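{- Let $(X,G)$ be one of the following pairs of a labeled affine Dynkin diagram $X$ and a finite group $G$ acting on its vertex set (the folded type $Y$ is recorded only for reference): (a) $X=\widetilde{A}_{2,2}$: vertex set $[4]$, underlying graph the $4$-cycle $1-2-4-3-1$, $G=\mathbb{Z}/2\mathbb{Z}=\langle\tau\rangle$ with $\tau=(1\,4)(2\,3)$ ($Y=\widetilde{A}_1$); (b) $X=\widetilde{A}_{n,n}$ ($n\ge 2$): vertex set $[2n]$, underlying graph the $2n$-cycle with edges $\{i,i+1\}$ for $1\le i\le n-1$, $\{n,2n\}$, $\{1,n+1\}$, $\{j,j+1\}$ for $n+1\le j\le 2n-1$; $G=\langle\tau\rangle\cong\mathbb{Z}/2\mathbb{Z}$ with $\tau(1)=1$, $\tau(2n)=2n$, $\tau(i)=n+i-1$ and $\tau(n+i-1)=i$ for $2\le i\le n$ ($Y=D_{n+1}^{(2)}$); (c) $X=\widetilde{D}_4$: vertex set $[5]$, edges $\{1,2\},\{1,3\},\{1,4\},\{1,5\}$; $G\cong(\mathbb{Z}/2\mathbb{Z})^2=\{\mathrm{id},(2\,3)(4\,5),(2\,4)(3\,5),(2\,5)(3\,4)\}$ ($Y=A_2^{(2)}$); (d) $X=\widetilde{D}_4$ as in (c), $G=\langle(3\,4\,5)\rangle\cong\mathbb{Z}/3\mathbb{Z}$ ($Y=D_4^{(3)}$); (e) $X=\widetilde{D}_n$ ($n\ge5$): vertex set $[n+1]$, edges $\{1,2\},\{1,3\},\{1,4\}$, $\{i,i+1\}$ for $4\le i\le n-2$, $\{n-1,n\},\{n-1,n+1\}$;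 $G=\langle(2\,3)(n\ \,n{+}1)\rangle\cong\mathbb{Z}/2\mathbb{Z}$ ($Y=\widetilde{C}_{n-2}$); (f) $X=\widetilde{D}_n$ ($n\ge5$) as in (e), $G=\langle(n\ \,n{+}1)\rangle\cong\mathbb{Z}/2\mathbb{Z}$ ($Y=A^{(2)}_{2(n-1)-1}$); (g) $X=\widetilde{D}_{2n}$ ($n\ge3$): vertex set $[2n+1]$, edges $\{1,2\},\{1,3\},\{1,4\}$, $\{i,i+1\}$ for $4\le i\le 2n-2$, $\{2n-1,2n\},\{2n-1,2n+1\}$; $G=\langle\sigma\rangle\cong\mathbb{Z}/2\mathbb{Z}$ where $\sigma$ is the involution with $\sigma(1)=2n-1$, $\sigma(2)=2n+1$, $\sigma(3)=2n$, $\sigma(i)=2n+2-i$ for $4\le i\le 2n-2$ ($Y=\widetilde{B}_n$); (h) $X=\widetilde{D}_{2n}$ ($n\ge3$) as in (g), $G=\langle\sigma,\rho\rangle\cong(\mathbb{Z}/2\mathbb{Z})^2$ with $\sigma$ as in (g) and $\rho=(2\,3)(2n\ \,2n{+}1)$ ($Y=A^{(2)}_{2n-2}$); (i) $X=\widetilde{E}_6$: vertex set $[7]$, edges $\{1,2\},\{1,4\},\{1,6\},\{2,3\},\{4,5\},\{6,7\}$; $G=\langle(2\,4\,6)(3\,5\,7)\rangle\cong\mathbb{Z}/3\mathbb{Z}$ ($Y=\widetilde{G}_2$); (j) $X=\widetilde{E}_6$ as in (i), $G=\langle(4\,6)(5\,7)\rangle\cong\mathbb{Z}/2\mathbb{Z}$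 ($Y=E_6^{(2)}$); (k) $X=\widetilde{E}_7$: vertex set $[8]$, edges $\{1,2\},\{1,3\},\{1,6\},\{3,4\},\{4,5\},\{6,7\},\{7,8\}$; $G=\langle(3\,6)(4\,7)(5\,8)\rangle\cong\mathbb{Z}/2\mathbb{Z}$ ($Y=\widetilde{F}_4$). Let $Q$ be a quiver of type $X$. If $Q$ is $G$-invariant, then $Q$ is $G$-admissible. In particular, for quivers of type $X$, $G$-invariance and $G$-admissibility are equivalent.
   Context: A quiver on $[N]=\{1,\dots,N\}$ is a finite directed multigraph with vertex set $[N]$ with no loops and no directed $2$-cycles. Its adjacency matrix $B=(b_{i,j})$ has $b_{i,j}=$ (number of arrows $i\to j$) $-$ (number of arrows $j\to i$). The mutation $\mu_k(Q)$ at $k\in[N]$ is the quiver with adjacency matrix $b'_{i,j}=-b_{i,j}$ if $k\in\{i,j\}$ and $b'_{i,j}=b_{i,j}+\frac{|b_{i,k}|b_{k,j}+b_{i,k}|b_{k,j}|}{2}$ otherwise. Quivers are mutation equivalent if one is obtained from the other by finitely many mutations; a quiver is acyclic if it has no directed cycle. For a labeled diagram $X$ on $[N]$ (a simple undirected graph with the given vertex labels), a quiver is of type $X$ if it is mutation equivalent to an acyclic quiver whose underlying undirected graph is $X$ (with the same labels); for $X=\widetilde{A}_{p,q}$ one additionally requires that this acyclic quiver on the cycle has exactly $p$ arrows oriented in one direction around the cycle and $q$ in the other. For a finite group $G$ acting on $[N]$: $Q$ is $G$-invariant if $b_{g(i),g(j)}=b_{i,j}$ for all $i,j\in[N]$ and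 $g\in G$; a $G$-invariant $Q$ is $G$-admissible if for all $i,i'$ in the same $G$-orbit, $b_{i,i'}=0$ and $b_{i,j}b_{i',j}\ge 0$ for all $j\in[N]$. -}

module Defs where

open import Data.Nat as ℕ using (ℕ; zero; suc; _∸_; _≡ᵇ_; _≤ᵇ_; _<?_)
import Data.Nat
open import Data.Integer as ℤ using (ℤ; +_; -_; ∣_∣)
open import Data.Integer.DivMod using (_/_)
open import Data.Fin as Fin using (Fin; toℕ; fromℕ<)
open import Data.Bool using (Bool; true; false; if_then_else_; _∨_)
open import Data.List using (List; []; _∷_; map; length; filter; _++_; upTo; zip)
open import Data.List.Membership.Propositional using (_∈_)
open import Data.Maybe using (Maybe; just; nothing)
open import Data.Product using (Σ; ∃; _×_; _,_)
open import Data.Sum using (_⊎_)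
open import Relation.Binary.PropositionalEquality using (_≡_)
open import Relation.Nullary using (¬_; does)

-- Quivers via adjacency matrices.  Vertices of [N] = {1,…,N} are
-- represented by Fin N; the vertex i : Fin N has label toℕ i + 1.

Matrix : ℕ → Set
Matrix N = Fin N → Fin N → ℤ

-- Adjacency matrices of quivers (no loops, no 2-cycles) on [N] are
-- exactly the skew-symmetric integer matrices.
Skew : ∀ {N} → Matrix N → Set
Skew {N} B = (i j : Fin N) → B j i ≡ - B i j

-- Mutation at k (the numerator is always even, so division is exact).
mutate : ∀ {N} → Fin N → Matrix N → Matrix N
mutate k B i j =
  if does (i Fin.≟ k) ∨ does (j Fin.≟ k)
  then - B i j
  else B i j ℤ.+ ((+ ∣ B i k ∣ ℤ.* B k j ℤ.+ B i k ℤ.* + ∣ B k j ∣) / (+ 2))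

mutateSeq : ∀ {N} → List (Fin N) → Matrix N → Matrix N
mutateSeq []       B = B
mutateSeq (k ∷ ks) B = mutateSeq ks (mutate k B)

MutationEquivalent : ∀ {N} → Matrix N → Matrix N → Set
MutationEquivalent {N} B B' =
  Σ (List (Fin N)) λ ks → (i j : Fin N) → mutateSeq ks B i j ≡ B' i j

-- Directed paths of length ≥ 1 (b_{i,j} > 0 means there is an arrow i → j).
data Path {N} (B : Matrix N) : Fin N → Fin N → Set where
  arrow : ∀ {i j} → + 0 ℤ.< B i j → Path B i j
  _∷_   : ∀ {i j k} → + 0 ℤ.< B i j → Path B j k → Path B i k

Acyclic : ∀ {N} → Matrix N → Set
Acyclic {N} B = (i : Fin N) → ¬ Path B i i

lab : ∀ {N} → Fin N → ℕ
lab i = suc (toℕ i)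

vert : (N : ℕ) → ℕ → Maybe (Fin N)
vert N zero = nothing
vert N (suc k) with k <? N
... | Relation.Nullary.yes p = just (fromℕ< p)
... | Relation.Nullary.no _  = nothing

-- a map on labels, acting on [N] (the fallback branch is never used for
-- the permutations below, which map [N] to [N])
act : ∀ {N} → (ℕ → ℕ) → Fin N → Fin N
act {N} g i with vert N (g (lab i))
... | just v  = v
... | nothing = i

entry : ∀ {N} → Matrix N → ℕ → ℕ → ℤ
entry {N} B u v with vert N u | vert N v
... | just i | just j = B i j
... | _      | _      = + 0

record Setting : Set₁ where
  field
    N     : ℕ
    Edge  : ℕ → ℕ → Set          -- edges {i,j}, listed in one orientation
    group : List (ℕ → ℕ)         -- all elements of G, acting on labels
    -- for X = Ã_{p,q}: the cycle (as a cyclic list of labels), p and q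
    cyc   : Maybe (List ℕ × ℕ × ℕ)

open Setting public

Adj : Setting → ℕ → ℕ → Set
Adj S i j = Edge S i j ⊎ Edge S j i

UnderlyingIs : (S : Setting) → Matrix (N S) → Set
UnderlyingIs S B = (i j : Fin (N S)) →
  (Adj S (lab i) (lab j) → ∣ B i j ∣ ≡ 1) × (¬ Adj S (lab i) (lab j) → B i j ≡ + 0)

cyclicPairs : List ℕ → List (ℕ × ℕ)
cyclicPairs []       = []
cyclicPairs (x ∷ xs) = zip (x ∷ xs) (xs ++ (x ∷ []))

forwardCount : ∀ {N} → Matrix N → List ℕ → ℕ
forwardCount B c = length (filter (λ { (u , v) → + 0 ℤ.<? entry B u v }) (cyclicPairs c))

backwardCount : ∀ {N} → Matrix N → List ℕ → ℕ
backwardCount B c = length (filter (λ { (u , v) → entry B u v ℤ.<? + 0 }) (cyclicPairs c))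

OrientationOK : (S : Setting) → Matrix (N S) → Set
OrientationOK S B with cyc S
... | nothing = Data.Unit.⊤ where import Data.Unit
... | just (c , p , q) =
  (forwardCount B c ≡ p × backwardCount B c ≡ q) ⊎
  (forwardCount B c ≡ q × backwardCount B c ≡ p)

OfType : (S : Setting) → Matrix (N S) → Set
OfType S B = Σ (Matrix (N S)) λ B' →
  Skew B' × Acyclic B' × UnderlyingIs S B' × OrientationOK S B' ×
  MutationEquivalent B B'

Invariant : (S : Setting) → Matrix (N S) → Set
Invariant S B = ∀ {g} → g ∈ group S → (i j : Fin (N S)) →
  B (act g i) (act g j) ≡ B i j

Admissible : (S : Setting) → Matrix (N S) → Set
Admissible S B = Invariant S B ×
  (∀ {g} → g ∈ group S → (i : Fin (N S)) →
     B i (act g i) ≡ + 0 × ((j : Fin (N S)) → + 0 ℤ.≤ B i j ℤ.* B (act g i) j))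

_==_ : ℕ → ℕ → Bool
_==_ = _≡ᵇ_
infix 4 _==_

swap : ℕ → ℕ → ℕ → ℕ
swap a b i = if i == a then b else if i == b then a else i

cyc3 : ℕ → ℕ → ℕ → ℕ → ℕ
cyc3 a b c i = if i == a then b else if i == b then c else if i == c then a else i

idL : ℕ → ℕ
idL i = i

_∘L_ : (ℕ → ℕ) → (ℕ → ℕ) → ℕ → ℕ
(f ∘L g) i = f (g i)

EdgeAnn : ℕ → ℕ → ℕ → Set
EdgeAnn n i j =
  (1 Data.Nat.≤ i × i Data.Nat.≤ n ∸ 1 × j ≡ suc i) ⊎
  (i ≡ n × j ≡ 2 Data.Nat.* n) ⊎
  (i ≡ 1 × j ≡ suc n) ⊎
  (suc n Data.Nat.≤ i × i Data.Nat.≤ 2 Data.Nat.* n ∸ 1 × j ≡ suc i)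

cycleAnn : ℕ → List ℕ
cycleAnn n = map suc (upTo n) ++ map (λ k → 2 Data.Nat.* n ∸ k) (upTo n)

EdgeList : List (ℕ × ℕ) → ℕ → ℕ → Set
EdgeList es i j = (i , j) ∈ es

EdgeD : ℕ → ℕ → ℕ → Set
EdgeD m i j =
  (i ≡ 1 × j ≡ 2) ⊎ (i ≡ 1 × j ≡ 3) ⊎ (i ≡ 1 × j ≡ 4) ⊎
  (4 Data.Nat.≤ i × i Data.Nat.≤ m ∸ 2 × j ≡ suc i) ⊎
  (i ≡ m ∸ 1 × j ≡ m) ⊎ (i ≡ m ∸ 1 × j ≡ suc m)

tauB : ℕ → ℕ → ℕ
tauB n i =
  if i ≤ᵇ 1 then i
  else if i ≤ᵇ n then n Data.Nat.+ i ∸ 1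
  else if i ≤ᵇ (2 Data.Nat.* n ∸ 1) then suc i ∸ n
  else i

sigmaG : ℕ → ℕ → ℕ
sigmaG n i =
  if i == 1 then 2 Data.Nat.* n ∸ 1
  else if i == 2 Data.Nat.* n ∸ 1 then 1
  else if i == 2 then suc (2 Data.Nat.* n)
  else if i == suc (2 Data.Nat.* n) then 2
  else if i == 3 then 2 Data.Nat.* n
  else if i == 2 Data.Nat.* n then 3
  else 2 Data.Nat.* n Data.Nat.+ 2 ∸ i

rhoH : ℕ → ℕ → ℕ
rhoH n = swap 2 3 ∘L swap (2 Data.Nat.* n) (suc (2 Data.Nat.* n))

settingA : Setting
settingA = record
  { N = 4
  ; Edge = EdgeList ((1 , 2) ∷ (2 , 4) ∷ (4 , 3) ∷ (3 , 1) ∷ [])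
  ; group = idL ∷ (swap 1 4 ∘L swap 2 3) ∷ []
  ; cyc = just ((1 ∷ 2 ∷ 4 ∷ 3 ∷ []) , 2 , 2) }

settingB : ℕ → Setting
settingB n = record
  { N = 2 Data.Nat.* n
  ; Edge = EdgeAnn n
  ; group = idL ∷ tauB n ∷ []
  ; cyc = just (cycleAnn n , n , n) }

EdgeD4 : ℕ → ℕ → Set
EdgeD4 = EdgeList ((1 , 2) ∷ (1 , 3) ∷ (1 , 4) ∷ (1 , 5) ∷ [])

settingC : Setting
settingC = record
  { N = 5 ; Edge = EdgeD4
  ; group = idL ∷ (swap 2 3 ∘L swap 4 5) ∷ (swap 2 4 ∘L swap 3 5)
                ∷ (swap 2 5 ∘L swap 3 4) ∷ []
  ; cyc = nothing }

settingD : Setting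
settingD = record
  { N = 5 ; Edge = EdgeD4
  ; group = idL ∷ cyc3 3 4 5 ∷ (cyc3 3 4 5 ∘L cyc3 3 4 5) ∷ []
  ; cyc = nothing }

settingE : ℕ → Setting
settingE n = record
  { N = suc n ; Edge = EdgeD n
  ; group = idL ∷ (swap 2 3 ∘L swap n (suc n)) ∷ []
  ; cyc = nothing }

settingF : ℕ → Setting
settingF n = record
  { N = suc n ; Edge = EdgeD n
  ; group = idL ∷ swap n (suc n) ∷ []
  ; cyc = nothing }

settingG : ℕ → Setting
settingG n = record
  { N = suc (2 Data.Nat.* n) ; Edge = EdgeD (2 Data.Nat.* n)
  ; group = idL ∷ sigmaG n ∷ []
  ; cyc = nothing }

settingH : ℕ → Setting
settingH n = record
  { N = suc (2 Data.Nat.* n) ; Edge = EdgeD (2 Data.Nat.* n)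
  ; group = idL ∷ sigmaG n ∷ rhoH n ∷ (sigmaG n ∘L rhoH n) ∷ []
  ; cyc = nothing }

EdgeE6 : ℕ → ℕ → Set
EdgeE6 = EdgeList ((1 , 2) ∷ (1 , 4) ∷ (1 , 6) ∷ (2 , 3) ∷ (4 , 5) ∷ (6 , 7) ∷ [])

gI : ℕ → ℕ
gI = cyc3 2 4 6 ∘L cyc3 3 5 7

settingI : Setting
settingI = record
  { N = 7 ; Edge = EdgeE6
  ; group = idL ∷ gI ∷ (gI ∘L gI) ∷ []
  ; cyc = nothing }

settingJ : Setting
settingJ = record
  { N = 7 ; Edge = EdgeE6
  ; group = idL ∷ (swap 4 6 ∘L swap 5 7) ∷ []
  ; cyc = nothing }

settingK : Setting
settingK = record
  { N = 8
  ; Edge = EdgeList ((1 , 2) ∷ (1 , 3) ∷ (1 , 6) ∷ (3 , 4) ∷ (4 , 5) ∷ (6 , 7) ∷ (7 , 8) ∷ [])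
  ; group = idL ∷ (swap 3 6 ∘L (swap 4 7 ∘L swap 5 8)) ∷ []
  ; cyc = nothing }

data Listed : Setting → Set₁ where
  case-a : Listed settingA
  case-b : ∀ n → 2 Data.Nat.≤ n → Listed (settingB n)
  case-c : Listed settingC
  case-d : Listed settingD
  case-e : ∀ n → 5 Data.Nat.≤ n → Listed (settingE n)
  case-f : ∀ n → 5 Data.Nat.≤ n → Listed (settingF n)
  case-g : ∀ n → 3 Data.Nat.≤ n → Listed (settingG n)
  case-h : ∀ n → 3 Data.Nat.≤ n → Listed (settingH n)
  case-i : Listed settingI
  case-j : Listed settingJ
  case-k : Listed settingK

{-# OPTIONS --safe #-}
-- Let A be the affine Cartan form of the diagram, with radical spanned by δ > 0, and let E be the Euler form of the acyclic
-- quiver, read off a level function on the vertices; on a cycle this function exists because both directions occur equally often.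
-- Every quiver B in the mutation class is B i j = G i j - G j i for the Gram matrix G i j = E (β i) (β j) of a family of roots
-- β i, each positive or negative, that satisfies sign conditions and spans δ = Σ d i β i; a mutation adds multiples of β k to
-- some members and negates β k. The sign conditions survive because reflecting at sources of the diagram transports the whole
-- family, and a potential argument shows that after finitely many such moves some member is simple, where they are visible.
--
-- The symmetrised Gram matrix is determined by B up to signs D i * D j, and only constant signs preserve it. An automorphism
-- g of B therefore lifts to a signed permutation of the roots, which must preserve the line spanned by d.
-- An involution: an oriented 4-cycle i → j → τ i → τ j → i forces D i * D (τ i) = -1 for every i, so the lift squares to -1,
-- which is impossible on a line. Order three: the lift can be normalised to have order three; a bad pair then contradicts
-- connectedness, semidefiniteness, or the vanishing of the determinant of the form on the invariant vectors.
module Submission where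

open import Data.Nat as ℕ using (ℕ; zero; suc)
open import Defs
import Data.Nat.Properties as ℕₚ
import Data.Nat.Induction as ℕᵢ
open import Induction.WellFounded using (Acc; acc)
open import Data.Integer using (ℤ; +_; -[1+_]; 0ℤ; 1ℤ; -1ℤ; _+_; _*_; -_; _-_; _≤_; _<_; ∣_∣; +≤+; +<+; -<+; _⊔_; nonNegative; positive; ≢-nonZero)
open import Data.Integer.Properties renaming (_≟_ to _≟ℤ_)
open import Data.Integer.Tactic.RingSolver using (solve-∀)
open import Data.Integer.DivMod using (_/_; _%_; a≡a%n+[a/n]*n; n%d<d)
open import Data.Fin using (Fin; zero; suc; _≟_; toℕ; fromℕ<; #_)
open import Data.Fin.Properties using (all?; any?; ¬∀⟶∃¬; toℕ-injective; toℕ-fromℕ<; toℕ<n; fromℕ<-toℕ)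
import Data.Bool
open import Data.Bool using (Bool; true; false; if_then_else_; _∧_; _∨_)
open import Data.List using (List; []; _∷_; _++_; allFin; length; filter; zip; applyUpTo)
open import Data.List.Properties using (map-upTo; ++-assoc)
open import Data.Maybe using (just; nothing)
open import Data.List.Membership.Propositional using (_∈_)
open import Data.List.Membership.Propositional.Properties using (∈-allFin)
open import Data.List.Relation.Unary.Any using (here; there)
import Data.Product.Properties
import Data.List.Relation.Unary.All as All
open All using (All)
import Data.List.Relation.Unary.AllPairs as AllPairs
open import Data.List.Relation.Unary.AllPairs using ([]; _∷_)
open import Data.List.Relation.Unary.Unique.Propositional using (Unique)
open import Data.List.Membership.DecPropositional ℕₚ._≟_ using (_∈?_)
open import Data.List.Membership.DecPropositional (Data.Product.Properties.≡-dec ℕₚ._≟_ ℕₚ._≟_) using () renaming (_∈?_ to _∈ᵖ?_)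
open import Data.Product using (Σ; ∃; _×_; _,_; proj₁; proj₂)
open import Data.Sum using (_⊎_; inj₁; inj₂; [_,_]′)
open import Data.Unit using (⊤; tt)
open import Data.Empty using (⊥; ⊥-elim)
open import Function using (_∘_)
open import Relation.Nullary using (¬_; Dec; yes; no; does)
open import Relation.Nullary.Decidable using (_×-dec_; _⊎-dec_; _→-dec_; ¬?; decidable-stable; dec-true; dec-false; from-yes)
open import Relation.Binary.PropositionalEquality
open import Relation.Binary.Definitions using (tri<; tri≈; tri>)
open import Algebra.Properties.CommutativeMonoid.Sum +-0-commutativeMonoid using (sum; sum-cong-≗; ∑-distrib-+; ∑-comm; sum-permute)
open import Data.Fin.Permutation using (permutation)
open import Algebra.Properties.Semiring.Sum +-*-semiring using (*-distribˡ-sum; *-distribʳ-sum)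

-- Two obstacles shape the reflection argument. A reflection at `s` transports the sign conditions
-- only while no member equals `neg (unit s)`. Such a member forces all others to vanish at `s`, so
-- the problem drops to the support without `s`, where strictly superharmonic weights drive every
-- positive root to a simple one. On the full affine support, however, the weight `δ` is only
-- harmonic, and the potential argument gives nothing for a root of defect `E lev δ β = 0`. The
-- member to follow must therefore have nonzero defect. This is why the relation `comb d β ≐ δ` is
-- carried through all mutations: with the sign conditions it yields a member of negative defect,
-- and the sign of that member decides whether the reflections use the Euler form or its transpose.
-- Later the same `d` serves as the kernel vector of the symmetrised Gram matrix. Everything stays
-- over the integers: division by `δ` becomes multiplication by `κ`, where `κ t * δ t` is the
-- constant `K`, and the half of the quadratic form is an Euler form with pairwise distinct levels.

-- Inequalities over the integers.

by-diff : ∀ {a b c} → 0ℤ ≤ c → c ≡ b - a → a ≤ b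
by-diff 0≤c refl = 0≤i-j⇒j≤i 0≤c

diff : ∀ {a b} → a ≤ b → 0ℤ ≤ b - a
diff = i≤j⇒0≤j-i

0≤+ : ∀ {a b} → 0ℤ ≤ a → 0ℤ ≤ b → 0ℤ ≤ a + b
0≤+ = +-mono-≤

0≤* : ∀ {a b} → 0ℤ ≤ a → 0ℤ ≤ b → 0ℤ ≤ a * b
0≤* {a} {b} p q = subst (_≤ a * b) (*-zeroʳ a) (*-monoˡ-≤-nonNeg a ⦃ nonNegative p ⦄ q)

0≤sq : ∀ a → 0ℤ ≤ a * a
0≤sq (+ n)    = subst (0ℤ ≤_) (pos-* n n) (+≤+ ℕ.z≤n)
0≤sq -[1+ n ] = +≤+ ℕ.z≤n

0≤neg : ∀ {a} → a ≤ 0ℤ → 0ℤ ≤ - a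
0≤neg = neg-mono-≤

neg≤0 : ∀ {a} → 0ℤ ≤ a → - a ≤ 0ℤ
neg≤0 = neg-mono-≤

1≤⇒≢0 : ∀ {a} → 1ℤ ≤ a → a ≢ 0ℤ
1≤⇒≢0 (+≤+ ()) refl

<⇒1+≤ : ∀ {a b} → a < b → 1ℤ + a ≤ b
<⇒1+≤ = i<j⇒suc[i]≤j

≰⇒1+≤ : ∀ {a b} → ¬ (a ≤ b) → 1ℤ + b ≤ a
≰⇒1+≤ p = <⇒1+≤ (≰⇒> p)

1≰0 : ¬ (1ℤ ≤ 0ℤ)
1≰0 (+≤+ ())

*≡0 : ∀ {a b} → a * b ≡ 0ℤ → a ≢ 0ℤ → b ≡ 0ℤ
*≡0 {a} {b} e a≢0 = *-cancelˡ-≡ a b 0ℤ ⦃ ≢-nonZero a≢0 ⦄ (trans e (sym (*-zeroʳ a)))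

sq≡0 : ∀ {a} → a * a ≡ 0ℤ → a ≡ 0ℤ
sq≡0 {+ zero} _ = refl

0≤-or-≤-1 : ∀ a → (0ℤ ≤ a) ⊎ (1ℤ ≤ - a)
0≤-or-≤-1 (+ n)    = inj₁ (+≤+ ℕ.z≤n)
0≤-or-≤-1 -[1+ n ] = inj₂ (+≤+ (ℕ.s≤s ℕ.z≤n))

≤0-or-1≤ : ∀ a → (a ≤ 0ℤ) ⊎ (1ℤ ≤ a)
≤0-or-1≤ a with 0≤-or-≤-1 (- a)
... | inj₁ p = inj₁ (subst (_≤ 0ℤ) (neg-involutive a) (neg≤0 p))
... | inj₂ p = inj₂ (subst (1ℤ ≤_) (neg-involutive a) p)

1≤⇒0≤ : ∀ {a} → 1ℤ ≤ a → 0ℤ ≤ a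
1≤⇒0≤ = ≤-trans (+≤+ ℕ.z≤n)

0<⇒1≤ : ∀ {a} → 0ℤ < a → 1ℤ ≤ a
0<⇒1≤ = <⇒1+≤

1≤* : ∀ {a b} → 1ℤ ≤ a → 1ℤ ≤ b → 1ℤ ≤ a * b
1≤* {a} {b} p q = by-diff (0≤+ (0≤* (diff p) (1≤⇒0≤ q)) (diff q)) (lem a b)
  where
  lem : ∀ a b → (a - 1ℤ) * b + (b - 1ℤ) ≡ a * b - 1ℤ
  lem = solve-∀

-- Finite sums of integer vectors.

V : ℕ → Set
V N = Fin N → ℤ

sum-0 : ∀ {n} (f : V n) → (∀ i → f i ≡ 0ℤ) → sum f ≡ 0ℤ
sum-0 {zero}  f p = refl
sum-0 {suc n} f p = cong₂ _+_ (p zero) (sum-0 (f ∘ suc) (p ∘ suc))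

sum-nonneg : ∀ {n} (f : V n) → (∀ i → 0ℤ ≤ f i) → 0ℤ ≤ sum f
sum-nonneg {zero}  f p = ≤-refl
sum-nonneg {suc n} f p = 0≤+ (p zero) (sum-nonneg (f ∘ suc) (p ∘ suc))

sum-mono : ∀ {n} (f g : V n) → (∀ i → f i ≤ g i) → sum f ≤ sum g
sum-mono {zero}  f g p = ≤-refl
sum-mono {suc n} f g p = +-mono-≤ (p zero) (sum-mono (f ∘ suc) (g ∘ suc) (p ∘ suc))

sum-nonpos : ∀ {n} (f : V n) → (∀ i → f i ≤ 0ℤ) → sum f ≤ 0ℤ
sum-nonpos {zero}  f p = ≤-refl
sum-nonpos {suc n} f p = +-mono-≤ (p zero) (sum-nonpos (f ∘ suc) (p ∘ suc))

sum-upper : ∀ {n} (f : V n) → (∀ i → 0ℤ ≤ f i) → ∀ i → f i ≤ sum f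
sum-upper f p zero    = by-diff (sum-nonneg (f ∘ suc) (p ∘ suc)) (lem (f zero) (sum (f ∘ suc)))
  where
  lem : ∀ a b → b ≡ a + b - a
  lem = solve-∀
sum-upper f p (suc i) = ≤-trans (sum-upper (f ∘ suc) (p ∘ suc) i) (by-diff (p zero) (lem (f zero) (sum (f ∘ suc))))
  where
  lem : ∀ a b → a ≡ a + b - b
  lem = solve-∀

sum-nonneg-0 : ∀ {n} (f : V n) → (∀ i → 0ℤ ≤ f i) → sum f ≡ 0ℤ → ∀ i → f i ≡ 0ℤ
sum-nonneg-0 f p e i = ≤-antisym (subst (f i ≤_) e (sum-upper f p i)) (p i)

sum-single : ∀ {n} (f : V n) (s : Fin n) → (∀ i → i ≢ s → f i ≡ 0ℤ) → sum f ≡ f s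
sum-single f zero    p = trans (cong (λ z → f zero + z) (sum-0 (f ∘ suc) (λ i → p (suc i) (λ ())))) (+-identityʳ _)
sum-single f (suc s) p = trans (cong₂ _+_ (p zero (λ ())) (sum-single (f ∘ suc) s (λ i i≢s → p (suc i) (λ { refl → i≢s refl })))) (+-identityˡ _)

sum-lin : ∀ {n} (a b : ℤ) (f g : V n) → sum (λ i → a * f i + b * g i) ≡ a * sum f + b * sum g
sum-lin a b f g = trans (∑-distrib-+ (λ i → a * f i) (λ i → b * g i))
  (sym (cong₂ _+_ (*-distribˡ-sum a f) (*-distribˡ-sum b g)))

sum-- : ∀ {n} (f g : V n) → sum (λ i → f i - g i) ≡ sum f - sum g
sum-- f g = trans (sum-cong-≗ (λ i → lem (f i) (g i))) (trans (sum-lin 1ℤ -1ℤ f g) (sym (lem (sum f) (sum g))))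
  where
  lem : ∀ a b → a - b ≡ 1ℤ * a + -1ℤ * b
  lem = solve-∀

-- Bilinear forms on integer vectors.

M : ℕ → Set
M N = Fin N → Fin N → ℤ

opaque
  form : ∀ {N} → M N → V N → V N → ℤ
  form A x y = sum λ t → sum λ u → x t * (A t u * y u)

  form-def : ∀ {N} (A : M N) (x y : V N) → form A x y ≡ sum λ t → sum λ u → x t * (A t u * y u)
  form-def A x y = refl

_≐_ : ∀ {N} → V N → V N → Set

x ≐ y = ∀ t → x t ≡ y t

opaque
  unfolding form

  form-cong : ∀ {N} (A : M N) {x x' y y' : V N} → x ≐ x' → y ≐ y' → form A x y ≡ form A x' y'
  form-cong A p q = sum-cong-≗ λ t → sum-cong-≗ λ u → cong₂ _*_ (p t) (cong (A t u *_) (q u))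

  form-congM : ∀ {N} (A A' : M N) (x y : V N) → (∀ t u → x t * (A t u * y u) ≡ x t * (A' t u * y u)) → form A x y ≡ form A' x y
  form-congM A A' x y p = sum-cong-≗ λ t → sum-cong-≗ λ u → p t u

  form-≡M : ∀ {N} {A A' : M N} → (∀ t u → A t u ≡ A' t u) → (x y : V N) → form A x y ≡ form A' x y
  form-≡M {A = A} {A'} p x y = form-congM A A' x y λ t u → cong (λ z → x t * (z * y u)) (p t u)

  form-linˡ : ∀ {N} (A : M N) (a b : ℤ) (x y z : V N) → form A (λ t → a * x t + b * y t) z ≡ a * form A x z + b * form A y z
  form-linˡ A a b x y z = trans
    (sum-cong-≗ λ t → trans (sum-cong-≗ λ u → lem a b (x t) (y t) (A t u * z u)) (sum-lin a b (λ u → x t * (A t u * z u)) (λ u → y t * (A t u * z u))))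
    (sum-lin a b (λ t → sum λ u → x t * (A t u * z u)) (λ t → sum λ u → y t * (A t u * z u)))
    where
    lem : ∀ a b x y w → (a * x + b * y) * w ≡ a * (x * w) + b * (y * w)
    lem = solve-∀

  form-T : ∀ {N} (A : M N) (x y : V N) → form A x y ≡ form (λ t u → A u t) y x
  form-T A x y = trans (∑-comm (λ t u → x t * (A t u * y u))) (sum-cong-≗ λ u → sum-cong-≗ λ t → lem (x t) (A t u) (y u))
    where
    lem : ∀ x a y → x * (a * y) ≡ y * (a * x)
    lem = solve-∀

  form-linʳ : ∀ {N} (A : M N) (a b : ℤ) (x y z : V N) → form A z (λ t → a * x t + b * y t) ≡ a * form A z x + b * form A z y
  form-linʳ A a b x y z = trans (form-T A z (λ t → a * x t + b * y t)) (trans (form-linˡ (λ t u → A u t) a b x y z)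
    (sym (cong₂ (λ p q → a * p + b * q) (form-T A z x) (form-T A z y))))

  form-+ : ∀ {N} (A A' : M N) (x y : V N) → form A x y + form A' x y ≡ form (λ t u → A t u + A' t u) x y
  form-+ A A' x y = sym (trans
    (sum-cong-≗ λ t → trans (sum-cong-≗ λ u → lem (x t) (A t u) (A' t u) (y u)) (∑-distrib-+ (λ u → x t * (A t u * y u)) (λ u → x t * (A' t u * y u))))
    (∑-distrib-+ (λ t → sum λ u → x t * (A t u * y u)) (λ t → sum λ u → x t * (A' t u * y u))))
    where
    lem : ∀ x a a' y → x * ((a + a') * y) ≡ x * (a * y) + x * (a' * y)
    lem = solve-∀

unit : ∀ {N} → Fin N → V N
unit s t with t ≟ s
... | yes _ = 1ℤ
... | no  _ = 0ℤ

unit-same : ∀ {N} (s : Fin N) → unit s s ≡ 1ℤ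
unit-same s with s ≟ s
... | yes _ = refl
... | no q  = ⊥-elim (q refl)

unit-other : ∀ {N} {s t : Fin N} → t ≢ s → unit s t ≡ 0ℤ
unit-other {s = s} {t} q with t ≟ s
... | yes p = ⊥-elim (q p)
... | no _  = refl

opaque
  unfolding form

  form-unitˡ : ∀ {N} (A : M N) (s : Fin N) (y : V N) → form A (unit s) y ≡ sum λ u → A s u * y u
  form-unitˡ A s y = trans
    (sum-single _ s (λ t t≢s → sum-0 _ (λ u → trans (cong (_* (A t u * y u)) (unit-other t≢s)) (*-zeroˡ (A t u * y u)))))
    (sum-cong-≗ λ u → trans (cong (_* (A s u * y u)) (unit-same s)) (*-identityˡ _))

  form-unitʳ : ∀ {N} (A : M N) (s : Fin N) (x : V N) → form A x (unit s) ≡ sum λ t → x t * A t s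
  form-unitʳ A s x = trans (form-T A x (unit s)) (trans (form-unitˡ (λ t u → A u t) s x) (sum-cong-≗ λ t → *-comm (A t s) (x t)))

comb : ∀ {n N} (d : V n) → (Fin n → V N) → V N
comb d β t = sum λ j → d j * β j t

form-combˡ : ∀ {N n} (A : M N) (d : V n) (β : Fin n → V N) (y : V N) → form A (comb d β) y ≡ sum λ j → d j * form A (β j) y
form-combˡ {N = N} {n = zero}  A d β y = trans (form-def A (comb d β) y) (sum-0 {N} _ λ t → sum-0 {N} _ λ u → refl)
form-combˡ {n = suc n} A d β y = trans
  (form-cong A {x' = λ t → d zero * β zero t + 1ℤ * comb (d ∘ suc) (β ∘ suc) t} (λ t → cong (λ z → d zero * β zero t + z) (sym (*-identityˡ _))) (λ _ → refl))
  (trans (form-linˡ A (d zero) 1ℤ (β zero) (comb (d ∘ suc) (β ∘ suc)) y)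
    (cong (λ z → d zero * form A (β zero) y + z) (trans (*-identityˡ _) (form-combˡ A (d ∘ suc) (β ∘ suc) y))))

form-combʳ : ∀ {n N} (A : M N) (d : V n) (β : Fin n → V N) (y : V N) → form A y (comb d β) ≡ sum λ j → d j * form A y (β j)
form-combʳ A d β y = trans (form-T A y (comb d β)) (trans (form-combˡ (λ t u → A u t) d β y) (sum-cong-≗ λ j → cong (d j *_) (sym (form-T A y (β j)))))

Pos Neg : ∀ {N} → V N → Set
Pos x = ∀ t → 0ℤ ≤ x t

Neg x = ∀ t → x t ≤ 0ℤ

-- Affine Cartan data and sign-coherent families.

-- The pair `κ`, `K` stands for the reciprocal of `δ` with denominators cleared. The field `conn`
-- gives, for each target `s`, a height that some neighbour always lowers, so properties can be
-- spread from `s` by well-founded induction.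
record Affine (N : ℕ) : Set where
  field
    A      : M N
    A-sym  : ∀ t u → A t u ≡ A u t
    A-diag : ∀ t → A t t ≡ + 2
    A-off  : ∀ {t u} → t ≢ u → A t u ≤ 0ℤ
    δ      : V N
    δ≥1    : ∀ t → 1ℤ ≤ δ t
    harm   : ∀ t → sum (λ u → A t u * δ u) ≡ 0ℤ
    κ      : V N
    κ≥1    : ∀ t → 1ℤ ≤ κ t
    K      : ℤ
    K≥1    : 1ℤ ≤ K
    κδ     : ∀ t → κ t * δ t ≡ K
    conn   : (s : Fin N) → Σ (Fin N → ℕ) λ h → ∀ t → t ≢ s → ∃ λ u → 1ℤ ≤ - A t u × h u ℕ.< h t
    o      : Fin N

Sub : ℕ → Set
Sub N = Fin N → Bool

Supp : ∀ {N} → Sub N → V N → Set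
Supp S x = ∀ t → S t ≡ false → x t ≡ 0ℤ

Sgn : ∀ {N} → Bool → V N → Set
Sgn true  = Pos
Sgn false = Neg

-- No condition is imposed when a negative member precedes a positive one, hence the vacuous g ≡ g.
OK : Bool → Bool → ℤ → Set
OK true  true  g = g ≤ 0ℤ
OK false false g = g ≤ 0ℤ
OK true  false g = g ≡ 0ℤ
OK false true  g = g ≡ g

_ᵀ : ∀ {N} → M N → M N

(G ᵀ) i j = G j i

-- `T` holds the indices still under consideration: the induction on supports removes members one at
-- a time.
record Coherent {N : ℕ} (G : M N) (β : Fin N → V N) (T : Sub N) : Set where
  field
    c   : Fin N → Bool
    col : ∀ i → T i ≡ true → Sgn (c i) (β i)
    ok  : ∀ i j → T i ≡ true → T j ≡ true → i ≢ j → OK (c i) (c j) (G i j)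

-- With unit diagonal entries this makes `G` unitriangular after reordering. It also excludes that
-- `G i j` and `G j i` are both nonzero, which is how `G - G ᵀ` determines `G + G ᵀ` up to signs.
Ord : ∀ {N} → M N → Sub N → Set
Ord {N} G T = Σ (Fin N → ℕ) λ ord → ∀ i j → T i ≡ true → T j ≡ true → i ≢ j → G i j ≢ 0ℤ → ord i ℕ.< ord j

opp : Bool → Bool
opp true  = false
opp false = true

OK-opp : ∀ a b {g} → OK a b g → OK (opp b) (opp a) g
OK-opp true  true  p = p
OK-opp true  false p = p
OK-opp false true  p = p
OK-opp false false p = p

OK-0 : ∀ a b {g} → g ≡ 0ℤ → OK a b g
OK-0 true  true  p = ≤-reflexive p
OK-0 false false p = ≤-reflexive p
OK-0 true  false p = p
OK-0 false true  p = refl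

upd : ∀ {N} → (Fin N → Bool) → Fin N → Bool → Fin N → Bool
upd c k b i with i ≟ k
... | yes _ = b
... | no _  = c i

rem : ∀ {N} → Sub N → Fin N → Sub N
rem T j i with i ≟ j
... | yes _ = false
... | no _  = T i

rem-sub : ∀ {N} (T : Sub N) {j i} → rem T j i ≡ true → T i ≡ true × i ≢ j
rem-sub T {j} {i} p with i ≟ j
... | no n = p , n

rem-in : ∀ {N} (T : Sub N) {j i} → T i ≡ true → i ≢ j → rem T j i ≡ true
rem-in T {j} {i} p n with i ≟ j
... | yes q = ⊥-elim (n q)
... | no _  = p

rem-self : ∀ {N} (T : Sub N) j → rem T j j ≡ false
rem-self T j with j ≟ j
... | yes _ = refl
... | no q  = ⊥-elim (q refl)

size : ∀ {N} → Sub N → ℤ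
size S = sum λ t → if S t then 1ℤ else 0ℤ

size-rem : ∀ {N} (S : Sub N) {s} → S s ≡ true → 1ℤ + size (rem S s) ≤ size S
size-rem {N} S {s} Ss = subst (_≤ size S) (trans (sum-lin 1ℤ 1ℤ (unit s) f) (trans (cong (λ z → 1ℤ * z + 1ℤ * sum f) sum-unit) (lem (sum f)))) (sum-mono _ _ term)
  where
  f : V N
  f t = if rem S s t then 1ℤ else 0ℤ
  lem : ∀ a → 1ℤ * 1ℤ + 1ℤ * a ≡ 1ℤ + a
  lem = solve-∀
  sum-unit : sum (unit s) ≡ 1ℤ
  sum-unit = trans (sum-single (unit s) s λ i n → unit-other n) (unit-same s)
  term : ∀ t → 1ℤ * unit s t + 1ℤ * f t ≤ (if S t then 1ℤ else 0ℤ)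
  term t with t ≟ s
  ... | yes refl rewrite Ss = ≤-refl
  ... | no _ with S t
  ...   | true  = ≤-refl
  ...   | false = ≤-refl

-- Arithmetic of quiver mutation.

-- Twice the error of the quotient is the remainder, a natural number below 2, so the error is zero.
/2-exact : ∀ x → (x * + 2) / + 2 ≡ x
/2-exact x = sym (i-j≡0⇒i≡j x q (zero-of (x - q) (trans (lem x q) (trans (cong (_- q * + 2) (a≡a%n+[a/n]*n (x * + 2) (+ 2))) (lem2 (+ ((x * + 2) % + 2)) (q * + 2)))) (n%d<d (x * + 2) (+ 2))))
  where
  q : ℤ
  q = (x * + 2) / + 2
  lem : ∀ x q → (x - q) * + 2 ≡ x * + 2 - q * + 2
  lem = solve-∀
  lem2 : ∀ r p → r + p - p ≡ r
  lem2 = solve-∀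
  zero-of : ∀ z {m} → z * + 2 ≡ + m → m ℕ.< 2 → z ≡ 0ℤ
  zero-of (+ zero) _ _ = refl
  zero-of (+ suc n) refl (ℕ.s≤s (ℕ.s≤s ()))

-- The halved sum of the mutation rule in a shape without division. Of the equivalent shapes this
-- one matches root mutation: for a positive `β k` the two coefficients are the multiplicities `r j`
-- and `r i`.
μ : ℤ → ℤ → ℤ
μ a b = (b ⊔ 0ℤ) * a + ((- a) ⊔ 0ℤ) * b

half-μ : ∀ a b → (+ ∣ a ∣ * b + a * + ∣ b ∣) / + 2 ≡ μ a b
half-μ a b = trans (cong (_/ + 2) (go (≤-total 0ℤ a) (≤-total 0ℤ b))) (/2-exact (μ a b))
  where
  abs-neg : ∀ {a} → a ≤ 0ℤ → + ∣ a ∣ ≡ - a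
  abs-neg {a} p = trans (cong +_ (sym (∣-i∣≡∣i∣ a))) (0≤i⇒+∣i∣≡i (0≤neg p))
  pp : ∀ a b → a * b + a * b ≡ (b * a + 0ℤ * b) * + 2
  pp = solve-∀
  pn : ∀ a b → a * b + a * - b ≡ (0ℤ * a + 0ℤ * b) * + 2
  pn = solve-∀
  np : ∀ a b → - a * b + a * b ≡ (b * a + - a * b) * + 2
  np = solve-∀
  nn : ∀ a b → - a * b + a * - b ≡ (0ℤ * a + - a * b) * + 2
  nn = solve-∀
  join : ∀ {x y u v z} → + ∣ a ∣ ≡ x → + ∣ b ∣ ≡ y → b ⊔ 0ℤ ≡ u → (- a) ⊔ 0ℤ ≡ v → x * b + a * y ≡ (u * a + v * b) * z → + ∣ a ∣ * b + a * + ∣ b ∣ ≡ μ a b * z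
  join refl refl refl refl h = h
  go : (0ℤ ≤ a ⊎ a ≤ 0ℤ) → (0ℤ ≤ b ⊎ b ≤ 0ℤ) → + ∣ a ∣ * b + a * + ∣ b ∣ ≡ μ a b * + 2
  go (inj₁ p) (inj₁ q) = join (0≤i⇒+∣i∣≡i p) (0≤i⇒+∣i∣≡i q) (i≥j⇒i⊔j≡i q) (i≤j⇒i⊔j≡j (neg≤0 p)) (pp a b)
  go (inj₁ p) (inj₂ q) = join (0≤i⇒+∣i∣≡i p) (abs-neg q) (i≤j⇒i⊔j≡j q) (i≤j⇒i⊔j≡j (neg≤0 p)) (pn a b)
  go (inj₂ p) (inj₁ q) = join (abs-neg p) (0≤i⇒+∣i∣≡i q) (i≥j⇒i⊔j≡i q) (i≥j⇒i⊔j≡i (0≤neg p)) (np a b)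
  go (inj₂ p) (inj₂ q) = join (abs-neg p) (abs-neg q) (i≤j⇒i⊔j≡j q) (i≥j⇒i⊔j≡i (0≤neg p)) (nn a b)

parts : ∀ a → (a ⊔ 0ℤ) - ((- a) ⊔ 0ℤ) ≡ a
parts a with ≤-total 0ℤ a
... | inj₁ p = trans (cong₂ _-_ (i≥j⇒i⊔j≡i p) (i≤j⇒i⊔j≡j (neg≤0 p))) (+-identityʳ a)
... | inj₂ p = trans (cong₂ _-_ (i≤j⇒i⊔j≡j p) (i≥j⇒i⊔j≡i (0≤neg p))) (trans (+-identityˡ _) (neg-involutive a))

-- Mutating twice at one vertex adds exactly this sum. It collapses to `a * b - b * a` because
-- positive part minus negative part is the number itself.
μ-inv : ∀ a b → μ a b + μ (- a) (- b) ≡ 0ℤ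
μ-inv a b = trans (cong (λ z → μ a b + (((- b) ⊔ 0ℤ) * - a + (z ⊔ 0ℤ) * - b)) (neg-involutive a))
  (trans (lem a b (a ⊔ 0ℤ) ((- a) ⊔ 0ℤ) (b ⊔ 0ℤ) ((- b) ⊔ 0ℤ)) (trans (cong₂ (λ x y → a * y - b * x) (parts a) (parts b)) (lem2 a b)))
  where
  lem : ∀ a b a⁺ a⁻ b⁺ b⁻ → b⁺ * a + a⁻ * b + (b⁻ * - a + a⁺ * - b) ≡ a * (b⁺ - b⁻) - b * (a⁺ - a⁻)
  lem = solve-∀
  lem2 : ∀ a b → a * b - b * a ≡ 0ℤ
  lem2 = solve-∀

μ-zeroʳ : ∀ a → μ a 0ℤ ≡ 0ℤ
μ-zeroʳ a = trans (cong₂ _+_ (*-zeroˡ a) (*-zeroʳ ((- a) ⊔ 0ℤ))) refl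

μ-zeroˡ : ∀ b → μ 0ℤ b ≡ 0ℤ
μ-zeroˡ b = trans (cong₂ _+_ (*-zeroʳ (b ⊔ 0ℤ)) (*-zeroˡ b)) refl

mutate-k : ∀ {N} (k : Fin N) B i j → (i ≡ k) ⊎ (j ≡ k) → mutate k B i j ≡ - B i j
mutate-k k B i j h with i ≟ k | j ≟ k
... | yes _ | _ = refl
... | no _ | yes _ = refl
mutate-k k B i j (inj₁ p) | no n | no _ = ⊥-elim (n p)
mutate-k k B i j (inj₂ p) | no _ | no n = ⊥-elim (n p)

mutate-o : ∀ {N} (k : Fin N) B {i j} → i ≢ k → j ≢ k → mutate k B i j ≡ B i j + μ (B i k) (B k j)
mutate-o k B {i} {j} n m with i ≟ k | j ≟ k
... | yes p | _ = ⊥-elim (n p)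
... | no _ | yes p = ⊥-elim (m p)
... | no _ | no _ = cong (λ z → B i j + z) (half-μ (B i k) (B k j))

mutate-cases : ∀ {N} (k i j : Fin N) → ((i ≡ k) ⊎ (j ≡ k)) ⊎ (i ≢ k × j ≢ k)
mutate-cases k i j with i ≟ k | j ≟ k
... | yes p | _ = inj₁ (inj₁ p)
... | no _ | yes p = inj₁ (inj₂ p)
... | no n | no m = inj₂ (n , m)

mutate-involutive : ∀ {N} (k : Fin N) B i j → mutate k (mutate k B) i j ≡ B i j
mutate-involutive k B i j with mutate-cases k i j
... | inj₁ h = trans (mutate-k k (mutate k B) i j h) (trans (cong -_ (mutate-k k B i j h)) (neg-involutive _))
... | inj₂ (n , m) = trans (mutate-o k (mutate k B) n m) (trans (cong₂ _+_ (mutate-o k B n m) (cong₂ μ (mutate-k k B i k (inj₂ refl)) (mutate-k k B k j (inj₁ refl))))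
        (trans (lem (B i j) (μ (B i k) (B k j)) (μ (- B i k) (- B k j))) (trans (cong (λ z → B i j + z) (μ-inv (B i k) (B k j))) (+-identityʳ _))))
  where
  lem : ∀ a b c → a + b + c ≡ a + (b + c)
  lem = solve-∀

mutate-neg : ∀ {N} (k : Fin N) B i j → mutate k (λ i j → - B i j) i j ≡ - mutate k B i j
mutate-neg k B i j with mutate-cases k i j
... | inj₁ h = trans (mutate-k k (λ i j → - B i j) i j h) (cong -_ (sym (mutate-k k B i j h)))
... | inj₂ (n , m) = trans (mutate-o k (λ i j → - B i j) n m) (trans (cong (λ z → - B i j + z) (neg-μ (B i k) (B k j))) (trans (sym (neg-distrib-+ (B i j) (μ (B i k) (B k j)))) (cong -_ (sym (mutate-o k B n m)))))
  where
  neg-μ : ∀ a b → μ (- a) (- b) ≡ - μ a b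
  neg-μ a b = trans (lem (μ a b) (μ (- a) (- b))) (trans (cong (_- μ a b) (μ-inv a b)) (+-identityˡ _))
    where
    lem : ∀ a b → b ≡ a + b - a
    lem = solve-∀

sgnz : ℤ → ℤ
sgnz (+ _)    = 1ℤ
sgnz -[1+ _ ] = -1ℤ

sgnz² : ∀ a → sgnz a * sgnz a ≡ 1ℤ
sgnz² (+ _)    = refl
sgnz² -[1+ _ ] = refl

sgnz-neg : ∀ a → a ≢ 0ℤ → sgnz (- a) ≡ - sgnz a
sgnz-neg (+ zero)  n = ⊥-elim (n refl)
sgnz-neg (+ suc _) n = refl
sgnz-neg -[1+ _ ]  n = refl

opposite? : ∀ a b → Dec (((1ℤ ≤ a) × (1ℤ ≤ - b)) ⊎ ((1ℤ ≤ - a) × (1ℤ ≤ b)))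
opposite? a b = ((1ℤ ≤? a) ×-dec (1ℤ ≤? - b)) ⊎-dec ((1ℤ ≤? - a) ×-dec (1ℤ ≤? b))

-- Orbits of order-three permutations and two finite checks.

module Orbit {N : ℕ} (g : Fin N → Fin N) where
  In : Fin N → Fin N → Set
  In i a = (i ≡ a) ⊎ (i ≡ g a) ⊎ (i ≡ g (g a))

  OneOrbit : Fin N → Fin N → Set
  OneOrbit f a = (g f ≡ f) × (∀ i → (g i ≡ i) ⊎ In i a)

  orb : V N → Fin N → ℤ
  orb h a = h a + (h (g a) + h (g (g a)))

  record TwoOrbits (f a x : Fin N) : Set where
    field
      fixed : g f ≡ f
      enum  : ∀ h → sum h ≡ h f + (orb h a + orb h x)
      a≢ga  : a ≢ g a
      x≢gx  : x ≢ g x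
      a∉x   : ¬ In a x
      cover : ∀ i → (i ≡ f) ⊎ In i a ⊎ In i x

succ₃ : Fin 3 → Fin 3
succ₃ zero = suc zero
succ₃ (suc zero) = suc (suc zero)
succ₃ (suc (suc zero)) = zero

-- The determinant of the matrix with rows (2, 3y₁, 3y₂), (y₁, s, m), (y₂, m, t). This is the
-- symmetrised form acting on vectors that are constant on one fixed vertex and two orbits of length
-- three; the factors 3 are orbit lengths.
determinant : ℤ → ℤ → ℤ → ℤ → ℤ → ℤ
determinant s t y₁ y₂ m = + 2 * (s * t - m * m) - + 3 * y₁ * (y₁ * t - m * y₂) + + 3 * y₂ * (y₁ * m - s * y₂)

-- The interval from `-b` to `b` as a finite type, so that statements about bounded integers are
-- settled by exhaustion.
centred : (b : ℕ) → Fin (suc (2 ℕ.* b)) → ℤ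
centred b k = + toℕ k - + b

bounded : (b : ℕ) → ∀ {z} → z ≤ + b → - z ≤ + b → ∃ λ k → z ≡ centred b k
bounded b {z} p q = go (z + + b) refl (by-diff (diff q) (lem z (+ b))) (≤-trans (+-monoˡ-≤ (+ b) p) (≤-reflexive (cong +_ (cong (b ℕ.+_) (sym (ℕₚ.+-identityʳ b))))))
  where
  lem : ∀ z b → b - - z ≡ (z + b) - 0ℤ
  lem = solve-∀
  lem2 : ∀ z b → z ≡ z + b - b
  lem2 = solve-∀
  go : ∀ w → z + + b ≡ w → 0ℤ ≤ w → w ≤ + (2 ℕ.* b) → ∃ λ k → z ≡ centred b k
  go (+ n) e _ (+≤+ le) = fromℕ< (ℕ.s≤s le) , trans (lem2 z (+ b)) (cong (_- + b) (trans e (cong +_ (sym (toℕ-fromℕ< (ℕ.s≤s le))))))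

-- The possible values of m² would be 8, 2, 12, 3.
cycle-determinant : ∀ (p : Fin 2) (y : Fin 5) (m : Fin 13) → determinant (+ 2 + + 2 * + suc (toℕ p)) (+ 2) 0ℤ (centred 2 y) (centred 6 m) ≢ 0ℤ
cycle-determinant = from-yes (all? λ (p : Fin 2) → all? λ (y : Fin 5) → all? λ (m : Fin 13) → ¬? (determinant (+ 2 + + 2 * + suc (toℕ p)) (+ 2) 0ℤ (centred 2 y) (centred 6 m) ≟ℤ 0ℤ))

Narrow : ℤ → Set
Narrow z = z ≤ + 3 × - z ≤ + 3

-- What is needed to contradict the sign rule for acyclic triangles: the fixed vertex meets both
-- orbits or neither, and the triangles through it have a nonnegative product of entries, whichever
-- of the two candidates from the first orbit is used.
Aligned : ℤ → ℤ → ℤ → ℤ → Set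
Aligned a₀ a₂ y₁ y₂ = (a₂ ≡ a₀) × 0ℤ ≤ y₁ * (y₂ * a₀) × (y₁ ≡ 0ℤ → y₂ ≡ 0ℤ) × (y₂ ≡ 0ℤ → y₁ ≡ 0ℤ)

-- An exhaustive search. The entries lie between -2 and 2 by semidefiniteness, and the three
-- `Narrow` conditions come from vectors that are not orbit-invariant, whose norm is therefore
-- strictly positive.
cross-determinant : ∀ (i j k : Fin 5) → let a₀ = centred 2 i ; a₁ = centred 2 j ; a₂ = centred 2 k in
  a₀ ≢ 0ℤ → a₂ ≢ 0ℤ → Narrow (+ 2 * a₀ - a₁ - a₂) → Narrow (+ 2 * a₁ - a₂ - a₀) → Narrow (+ 2 * a₂ - a₀ - a₁) →
  ∀ (u v : Fin 5) → determinant (+ 2) (+ 2) (centred 2 u) (centred 2 v) (a₀ + (a₁ + a₂)) ≡ 0ℤ → Aligned a₀ a₂ (centred 2 u) (centred 2 v)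
cross-determinant = from-yes (all? λ (i : Fin 5) → all? λ (j : Fin 5) → all? λ (k : Fin 5) → let a₀ = centred 2 i ; a₁ = centred 2 j ; a₂ = centred 2 k in
  ¬? (a₀ ≟ℤ 0ℤ) →-dec (¬? (a₂ ≟ℤ 0ℤ) →-dec (narrow? (+ 2 * a₀ - a₁ - a₂) →-dec (narrow? (+ 2 * a₁ - a₂ - a₀) →-dec (narrow? (+ 2 * a₂ - a₀ - a₁) →-dec
    (all? λ (u : Fin 5) → all? λ (v : Fin 5) → (determinant (+ 2) (+ 2) (centred 2 u) (centred 2 v) (a₀ + (a₁ + a₂)) ≟ℤ 0ℤ) →-dec aligned? a₀ a₂ (centred 2 u) (centred 2 v)))))))
  where
  narrow? : ∀ z → Dec (Narrow z)
  narrow? z = (z ≤? + 3) ×-dec (- z ≤? + 3)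
  aligned? : ∀ a₀ a₂ y₁ y₂ → Dec (Aligned a₀ a₂ y₁ y₂)
  aligned? a₀ a₂ y₁ y₂ = (a₂ ≟ℤ a₀) ×-dec ((0ℤ ≤? y₁ * (y₂ * a₀)) ×-dec (((y₁ ≟ℤ 0ℤ) →-dec (y₂ ≟ℤ 0ℤ)) ×-dec ((y₂ ≟ℤ 0ℤ) →-dec (y₁ ≟ℤ 0ℤ))))

reverse : Fin 3 → Fin 3
reverse zero = zero
reverse (suc zero) = suc (suc zero)
reverse (suc (suc zero)) = suc zero

reverse-succ₃ : ∀ k → reverse (succ₃ (succ₃ k)) ≡ succ₃ (reverse k)
reverse-succ₃ zero = refl
reverse-succ₃ (suc zero) = refl
reverse-succ₃ (suc (suc zero)) = refl

-- An arrow against the direction of rotation of `g` is an arrow along the rotation of `g²`, so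
-- results on forward arrows also cover backward ones once the orbit data is transferred to the
-- square.
module Squared {N : ℕ} (g : Fin N → Fin N) (ggg : ∀ i → g (g (g i)) ≡ i) where
  open Orbit g

  g² : Fin N → Fin N
  g² i = g (g i)

  module Sq = Orbit g²

  In⇒ : ∀ {i a} → In i a → Sq.In i a
  In⇒ (inj₁ p) = inj₁ p
  In⇒ {a = a} (inj₂ (inj₁ p)) = inj₂ (inj₂ (trans p (cong g (sym (ggg a)))))
  In⇒ (inj₂ (inj₂ p)) = inj₂ (inj₁ p)

  In⇐ : ∀ {i a} → Sq.In i a → In i a
  In⇐ (inj₁ p) = inj₁ p
  In⇐ {a = a} (inj₂ (inj₂ p)) = inj₂ (inj₁ (trans p (cong g (ggg a))))
  In⇐ (inj₂ (inj₁ p)) = inj₂ (inj₂ p)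

  one-orbit² : ∀ {f a} → OneOrbit f a → Sq.OneOrbit f a
  one-orbit² (e , cover) = trans (cong g e) e , λ i → [ (λ p → inj₁ (trans (cong g p) p)) , (λ p → inj₂ (In⇒ p)) ]′ (cover i)

  ≢-g² : ∀ {a} → a ≢ g a → a ≢ g² a
  ≢-g² {a} n p = n (trans (sym (ggg a)) (cong g (sym p)))

  two-orbits² : ∀ {f a x} → TwoOrbits f a x → Sq.TwoOrbits f a x
  two-orbits² {f} {a} {x} O = record
    { fixed = trans (cong g fixed) fixed ; enum = λ h → trans (enum h) (cong (λ z → h f + z) (cong₂ _+_ (orb² h a) (orb² h x)))
    ; a≢ga = ≢-g² a≢ga ; x≢gx = ≢-g² x≢gx ; a∉x = λ p → a∉x (In⇐ p)
    ; cover = λ i → [ inj₁ , [ (λ p → inj₂ (inj₁ (In⇒ p))) , (λ p → inj₂ (inj₂ (In⇒ p))) ]′ ]′ (cover i) }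
    where
    open TwoOrbits O
    orb² : ∀ h b → orb h b ≡ Sq.orb h b
    orb² h b = cong (λ z → h b + z) (trans (+-comm (h (g b)) (h (g² b))) (cong (λ z → h (g² b) + h z) (cong g (sym (ggg b)))))

  reverse-pos : {pos : Fin N → Fin 3} → (∀ i → (g i ≡ i × pos i ≡ zero) ⊎ (pos (g i) ≡ succ₃ (pos i))) →
                ∀ i → (g² i ≡ i × reverse (pos i) ≡ zero) ⊎ (reverse (pos (g² i)) ≡ succ₃ (reverse (pos i)))
  reverse-pos {pos} h i = go (h i) (h (g i))
    where
    go : (g i ≡ i × pos i ≡ zero) ⊎ (pos (g i) ≡ succ₃ (pos i)) → (g² i ≡ g i × pos (g i) ≡ zero) ⊎ (pos (g² i) ≡ succ₃ (pos (g i))) →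
         (g² i ≡ i × reverse (pos i) ≡ zero) ⊎ (reverse (pos (g² i)) ≡ succ₃ (reverse (pos i)))
    go (inj₁ (e , z)) _ = inj₁ (trans (cong g e) e , cong reverse z)
    go (inj₂ p) (inj₂ q) = inj₂ (trans (cong reverse (trans q (cong succ₃ p))) (reverse-succ₃ (pos i)))
    go (inj₂ p) (inj₁ (e , z)) = ⊥-elim (clash (pos i) (trans (sym p) z) (trans (sym p) (cong pos fix)))
      where
      fix : g i ≡ i
      fix = sym (trans (sym (ggg i)) (trans (cong g e) e))
      clash : ∀ k → succ₃ k ≡ zero → succ₃ k ≡ k → ⊥
      clash (suc (suc zero)) _ ()

-- The interface between root theory and the listed group actions.

Preserves Admits : ∀ {N} → Matrix N → (Fin N → Fin N) → Set
Preserves B g = ∀ i j → B (g i) (g j) ≡ B i j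

Admits B g = ∀ i → B i (g i) ≡ 0ℤ × (∀ j → 0ℤ ≤ B i j * B (g i) j)

-- Allows a permutation to be replaced by an explicit table that computes well.
good-≗ : ∀ {N} {B : Matrix N} {g g'} → (∀ i → g i ≡ g' i) → (Preserves B g' → Admits B g') → Preserves B g → Admits B g
good-≗ {B = B} {g} {g'} e h inv i = trans (cong (B i) (e i)) (proj₁ good) , λ j → subst (λ z → 0ℤ ≤ B i j * B z j) (sym (e i)) (proj₂ good j)
  where
  good : B i (g' i) ≡ 0ℤ × (∀ j → 0ℤ ≤ B i j * B (g' i) j)
  good = h (λ i j → trans (sym (cong₂ B (e i) (e j))) (inv i j)) i

record Foldable {N : ℕ} (B : Matrix N) : Set where
  field
    involution-good : ∀ τ → (∀ i → τ (τ i) ≡ i) → Preserves B τ → Admits B τ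
    one-orbit-good  : ∀ g → (∀ i → g (g (g i)) ≡ i) → Preserves B g → ∀ {f a} → Orbit.OneOrbit g f a → Admits B g
    two-orbit-good  : ∀ g → (∀ i → g (g (g i)) ≡ i) → Preserves B g → (pos : Fin N → Fin 3) → (∀ i → (g i ≡ i × pos i ≡ zero) ⊎ (pos (g i) ≡ succ₃ (pos i))) →
                      ∀ {f a x} → Orbit.TwoOrbits g f a x → Admits B g

-- Arrows of the acyclic quiver descend by exactly one level. This is stronger than acyclicity and
-- is what allows reflections to proceed level by level.
data Comparison {N : ℕ} (A : M N) (B₀ : Matrix N) (lev : V N) (t u : Fin N) : Set where
  unlinked : B₀ t u ≡ 0ℤ → A t u ≡ 0ℤ → Comparison A B₀ lev t u
  higher   : B₀ t u ≡ 1ℤ → A t u ≡ -1ℤ → lev t ≡ 1ℤ + lev u → Comparison A B₀ lev t u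
  deeper   : B₀ t u ≡ -1ℤ → A t u ≡ -1ℤ → lev u ≡ 1ℤ + lev t → Comparison A B₀ lev t u

module Theory {N : ℕ} (R : Affine N) where
  open Affine R

  -- Semidefiniteness of the affine form by a sum of squares.

  module Signed (ε : M N) (ε-diag : ∀ t → ε t t ≡ 1ℤ) (ε² : ∀ t u → ε t u * ε t u ≡ 1ℤ) (x : V N) where
    εA : M N
    εA t u = ε t u * A t u

    X : V N
    X t = κ t * x t

    gap : M N
    gap t u = (- A t u * (δ t * δ u)) * ((X t - ε t u * X u) * (X t - ε t u * X u))

    gap≥0 : ∀ t u → 0ℤ ≤ gap t u
    gap≥0 t u with t ≟ u
    ... | no t≢u = 0≤* (0≤* (0≤neg (A-off t≢u)) (0≤* (1≤⇒0≤ (δ≥1 t)) (1≤⇒0≤ (δ≥1 u)))) (0≤sq (X t - ε t u * X u))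
    ... | yes refl = ≤-reflexive (sym (trans (cong (λ z → (- A t t * (δ t * δ t)) * ((X t - z * X t) * (X t - z * X t))) (ε-diag t)) (lem (- A t t * (δ t * δ t)) (X t))))
      where
      lem : ∀ c y → c * ((y - 1ℤ * y) * (y - 1ℤ * y)) ≡ 0ℤ
      lem = solve-∀

    -- Completing squares with a positive harmonic function: the two pure-square parts vanish by
    -- `harm`, and in the mixed part the factors `κ` and `δ` combine to the constant `K * K`.
    sum-gap : sum (λ t → sum (gap t)) ≡ (+ 2 * (K * K)) * form εA x x
    sum-gap = begin
      sum (λ t → sum (gap t))
        ≡⟨ (sum-cong-≗ λ t → trans (sum-cong-≗ λ u → split t u) (trans (∑-distrib-+ (λ u → p t u + q t u) (r t)) (cong (_+ sum (r t)) (∑-distrib-+ (p t) (q t))))) ⟩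
      sum (λ t → sum (p t) + sum (q t) + sum (r t))
        ≡⟨ trans (∑-distrib-+ (λ t → sum (p t) + sum (q t)) (λ t → sum (r t))) (cong (_+ sum (λ t → sum (r t))) (∑-distrib-+ (λ t → sum (p t)) (λ t → sum (q t)))) ⟩
      sum (λ t → sum (p t)) + sum (λ t → sum (q t)) + sum (λ t → sum (r t))
        ≡⟨ cong₂ _+_ (cong₂ _+_ (sum-0 _ p0) (trans (∑-comm q) (sum-0 _ q0))) r-eq ⟩
      0ℤ + 0ℤ + (+ 2 * (K * K)) * form εA x x
        ≡⟨ trans (cong (_+ (+ 2 * (K * K)) * form εA x x) (+-identityˡ 0ℤ)) (+-identityˡ _) ⟩
      (+ 2 * (K * K)) * form εA x x ∎
      where
      open ≡-Reasoning
      p q r : M N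
      p t u = (- (δ t * (X t * X t))) * (A t u * δ u)
      q t u = (- (δ u * (X u * X u))) * (A u t * δ t)
      r t u = (+ 2 * (K * K)) * (x t * (εA t u * x u))
      lem : ∀ a d d' k k' x x' ε → - a * (d * d') * ((k * x - ε * (k' * x')) * (k * x - ε * (k' * x'))) ≡
            (- (d * ((k * x) * (k * x)))) * (a * d') + (- (d' * ((k' * x') * (k' * x')))) * (a * d) * (ε * ε) + (+ 2 * ((k * d) * (k' * d'))) * (x * ((ε * a) * x'))
      lem = solve-∀
      split : ∀ t u → gap t u ≡ p t u + q t u + r t u
      split t u = trans (lem (A t u) (δ t) (δ u) (κ t) (κ u) (x t) (x u) (ε t u))
        (cong₂ _+_ (cong (λ z → p t u + z) (trans (cong₂ (λ z w → (- (δ u * (X u * X u))) * (z * δ t) * w) (A-sym t u) (ε² t u)) (*-identityʳ _)))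
          (cong₂ (λ z w → (+ 2 * (z * w)) * (x t * (εA t u * x u))) (κδ t) (κδ u)))
      p0 : ∀ t → sum (p t) ≡ 0ℤ
      p0 t = trans (sym (*-distribˡ-sum (- (δ t * (X t * X t))) (λ u → A t u * δ u))) (trans (cong ((- (δ t * (X t * X t))) *_) (harm t)) (*-zeroʳ (- (δ t * (X t * X t)))))
      q0 : ∀ u → sum (λ t → q t u) ≡ 0ℤ
      q0 = p0
      r-eq : sum (λ t → sum (r t)) ≡ (+ 2 * (K * K)) * form εA x x
      r-eq = trans (sum-cong-≗ λ t → sym (*-distribˡ-sum (+ 2 * (K * K)) (λ u → x t * (εA t u * x u)))) (trans (sym (*-distribˡ-sum (+ 2 * (K * K)) (λ t → sum λ u → x t * (εA t u * x u)))) (cong ((+ 2 * (K * K)) *_) (sym (form-def εA x x))))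

    2K²≥1 : 1ℤ ≤ + 2 * (K * K)
    2K²≥1 = 1≤* {+ 2} (+≤+ (ℕ.s≤s ℕ.z≤n)) (1≤* K≥1 K≥1)

    psd : 0ℤ ≤ form εA x x
    psd = *-cancelˡ-≤-pos 0ℤ (form εA x x) (+ 2 * (K * K)) ⦃ positive (<-≤-trans (+<+ (ℕ.s≤s ℕ.z≤n)) 2K²≥1) ⦄
      (subst₂ _≤_ (sym (*-zeroʳ (+ 2 * (K * K)))) sum-gap (sum-nonneg _ λ t → sum-nonneg _ (gap≥0 t)))

    balanced : form εA x x ≡ 0ℤ → ∀ t u → 1ℤ ≤ - A t u → X t ≡ ε t u * X u
    balanced e t u a = i-j≡0⇒i≡j (X t) (ε t u * X u) (sq≡0 (*≡0 gap≡0 (1≤⇒≢0 (1≤* a (1≤* (δ≥1 t) (δ≥1 u))))))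
      where
      gap≡0 : gap t u ≡ 0ℤ
      gap≡0 = sum-nonneg-0 (gap t) (gap≥0 t)
        (sum-nonneg-0 _ (λ t → sum-nonneg _ (gap≥0 t)) (trans sum-gap (trans (cong ((+ 2 * (K * K)) *_) e) (*-zeroʳ (+ 2 * (K * K))))) t) u

  along : {P : Fin N → Set} (s : Fin N) → P s → (∀ t u → 1ℤ ≤ - A t u → P u → P t) → ∀ t → P t
  along {P} s ps step t = go t (ℕᵢ.<-wellFounded (proj₁ (conn s) t))
    where
    go : ∀ t → Acc ℕ._<_ (proj₁ (conn s) t) → P t
    go t (acc rs) with t ≟ s
    ... | yes refl = ps
    ... | no t≢s with proj₂ (conn s) t t≢s
    ...   | u , a , lt = step t u a (go u (rs lt))

  psd : ∀ x → 0ℤ ≤ form A x x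
  psd x = subst (0ℤ ≤_) (form-≡M (λ t u → *-identityˡ (A t u)) x x)
    (Signed.psd (λ _ _ → 1ℤ) (λ _ → refl) (λ _ _ → refl) x)

  -- The equality case of the sum of squares: the ratio of `x` to `δ` agrees across each edge and
  -- hence, the diagram being connected, everywhere.
  isotropic : ∀ x → form A x x ≡ 0ℤ → ∀ s t → κ t * x t ≡ κ s * x s
  isotropic x e s = along s refl λ t u a eq → trans (trans (Signed.balanced (λ _ _ → 1ℤ) (λ _ → refl) (λ _ _ → refl) x
      (trans (form-≡M (λ t u → *-identityˡ (A t u)) x x) e) t u a) (*-identityˡ _)) eq

  -- Euler forms attached to level functions.

  e : V N → M N
  e lev t u with t ≟ u | lev t <? lev u
  ... | yes _ | _     = 1ℤ
  ... | no _  | yes _ = A t u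
  ... | no _  | no _  = 0ℤ

  e-diag : ∀ lev t → e lev t t ≡ 1ℤ
  e-diag lev t with t ≟ t | lev t <? lev t
  ... | yes _ | _ = refl
  ... | no q  | _ = ⊥-elim (q refl)

  e-up : ∀ lev {t u} → lev t < lev u → e lev t u ≡ A t u
  e-up lev {t} {u} p with t ≟ u | lev t <? lev u
  ... | yes refl | _ = ⊥-elim (<-irrefl refl p)
  ... | no _  | yes _ = refl
  ... | no _  | no q  = ⊥-elim (q p)

  e-down : ∀ lev {t u} → t ≢ u → ¬ (lev t < lev u) → e lev t u ≡ 0ℤ
  e-down lev {t} {u} n p with t ≟ u | lev t <? lev u
  ... | yes q | _ = ⊥-elim (n q)
  ... | no _  | yes q = ⊥-elim (p q)
  ... | no _  | no _  = refl

  e-nonadj : ∀ lev {t u} → t ≢ u → A t u ≡ 0ℤ → e lev t u ≡ 0ℤ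
  e-nonadj lev {t} {u} n p with t ≟ u | lev t <? lev u
  ... | yes q | _ = ⊥-elim (n q)
  ... | no _  | yes _ = p
  ... | no _  | no _  = refl

  e-off : ∀ lev {t u} → t ≢ u → e lev t u ≤ 0ℤ
  e-off lev {t} {u} n with t ≟ u | lev t <? lev u
  ... | yes q | _ = ⊥-elim (n q)
  ... | no _  | yes _ = A-off n
  ... | no _  | no _  = ≤-refl

  e-sym : ∀ lev t u → (t ≡ u) ⊎ (A t u ≡ 0ℤ) ⊎ (lev t ≢ lev u) → e lev t u + e lev u t ≡ A t u
  e-sym lev t u = go (t ≟ u)
    where
    go : Dec (t ≡ u) → (t ≡ u) ⊎ (A t u ≡ 0ℤ) ⊎ (lev t ≢ lev u) → e lev t u + e lev u t ≡ A t u
    go (yes refl) _ = trans (cong₂ _+_ (e-diag lev t) (e-diag lev t)) (sym (A-diag t))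
    go (no n) (inj₁ p) = ⊥-elim (n p)
    go (no n) (inj₂ (inj₁ p)) = trans (cong₂ _+_ (e-nonadj lev n p) (e-nonadj lev (n ∘ sym) (trans (A-sym u t) p))) (sym p)
    go (no n) (inj₂ (inj₂ p)) with <-cmp (lev t) (lev u)
    ... | tri< a _ c = trans (cong₂ _+_ (e-up lev a) (e-down lev (n ∘ sym) c)) (+-identityʳ _)
    ... | tri≈ _ b _ = ⊥-elim (p b)
    ... | tri> a _ c = trans (cong₂ _+_ (e-down lev n a) (e-up lev c)) (trans (+-identityˡ _) (A-sym u t))

  E : V N → V N → V N → ℤ
  E lev = form (e lev)

  E-sym : ∀ lev x y → (∀ t u → (x t ≡ 0ℤ) ⊎ (y u ≡ 0ℤ) ⊎ (t ≡ u) ⊎ (A t u ≡ 0ℤ) ⊎ (lev t ≢ lev u)) → E lev x y + E lev y x ≡ form A x y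
  E-sym lev x y h = trans (cong (λ z → E lev x y + z) (form-T (e lev) y x)) (trans (form-+ (e lev) (λ t u → e lev u t) x y) (form-congM (λ t u → e lev t u + e lev u t) A x y eq))
    where
    eq : ∀ t u → x t * ((e lev t u + e lev u t) * y u) ≡ x t * (A t u * y u)
    eq t u with h t u
    ... | inj₁ p = trans (cong (_* ((e lev t u + e lev u t) * y u)) p) (sym (cong (_* (A t u * y u)) p))
    ... | inj₂ (inj₁ p) = cong (x t *_) (trans (cong ((e lev t u + e lev u t) *_) p) (trans (*-zeroʳ (e lev t u + e lev u t)) (sym (trans (cong (A t u *_) p) (*-zeroʳ (A t u))))))
    ... | inj₂ (inj₂ p) = cong (λ z → x t * (z * y u)) (e-sym lev t u p)

  -- Integrality of the quadratic form and signs of roots.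

  -- With all levels distinct, every off-diagonal entry falls on one side, so this Euler form
  -- symmetrises to `A` for any vectors. It shows that norms are even, which turns a norm that is
  -- merely nonzero into one of at least 2.
  index : V N
  index t = + toℕ t

  q : V N → ℤ
  q x = E index x x

  2q : ∀ x → form A x x ≡ + 2 * q x
  2q x = trans (sym (E-sym index x x sep)) (lem (q x))
    where
    lem : ∀ a → a + a ≡ + 2 * a
    lem = solve-∀
    sep : ∀ t u → (x t ≡ 0ℤ) ⊎ (x u ≡ 0ℤ) ⊎ (t ≡ u) ⊎ (A t u ≡ 0ℤ) ⊎ (index t ≢ index u)
    sep t u with t ≟ u
    ... | yes p = inj₂ (inj₂ (inj₁ p))
    ... | no n = inj₂ (inj₂ (inj₂ (inj₂ (λ eq → n (toℕ-injective (+-injective eq))))))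

  q≥0 : ∀ x → 0ℤ ≤ q x
  q≥0 x = *-cancelˡ-≤-pos 0ℤ (q x) (+ 2) (subst (0ℤ ≤_) (2q x) (psd x))

  -- Each half of a vector of mixed sign vanishes somewhere, so it is not isotropic and contributes norm at least 2.
  q≥1 : ∀ x s t → x s ≡ 0ℤ → 1ℤ ≤ x t → 1ℤ ≤ q x
  q≥1 x s t xs xt with ≤0-or-1≤ (q x)
  ... | inj₂ p = p
  ... | inj₁ p = ⊥-elim (1≤⇒≢0 (1≤* (κ≥1 t) xt) (trans (isotropic x iso s t) (trans (cong (κ s *_) xs) (*-zeroʳ (κ s)))))
    where
    iso : form A x x ≡ 0ℤ
    iso = trans (2q x) (cong (+ 2 *_) (≤-antisym p (q≥0 x)))

  root-sign : ∀ x → form A x x ≡ + 2 → Pos x ⊎ Neg x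
  root-sign x root with all? (λ t → 0ℤ ≤? x t) | all? (λ t → x t ≤? 0ℤ)
  ... | yes p | _ = inj₁ p
  ... | no _  | yes p = inj₂ p
  ... | no ¬p | no ¬n with ¬∀⟶∃¬ N _ (λ t → 0ℤ ≤? x t) ¬p | ¬∀⟶∃¬ N _ (λ t → x t ≤? 0ℤ) ¬n
  ...   | s , xs | t , xt = ⊥-elim (contra (q≥1 x⁺ s t x⁺s≡0 x⁺t≥1) (q≥1 x⁻ t s x⁻t≡0 x⁻s≥1))
    where
    x⁺ x⁻ : V N
    x⁺ t = x t ⊔ 0ℤ
    x⁻ t = (- x t) ⊔ 0ℤ
    xs≤0 : x s ≤ 0ℤ
    xs≤0 = <⇒≤ (≰⇒> xs)
    xt≥0 : 0ℤ ≤ x t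
    xt≥0 = <⇒≤ (≰⇒> xt)
    x⁺s≡0 : x⁺ s ≡ 0ℤ
    x⁺s≡0 = i≤j⇒i⊔j≡j xs≤0
    x⁻t≡0 : x⁻ t ≡ 0ℤ
    x⁻t≡0 = i≤j⇒i⊔j≡j (neg≤0 xt≥0)
    x⁺t≥1 : 1ℤ ≤ x⁺ t
    x⁺t≥1 = subst (1ℤ ≤_) (sym (i≥j⇒i⊔j≡i xt≥0)) (≰⇒1+≤ xt)
    x⁻s≥1 : 1ℤ ≤ x⁻ s
    x⁻s≥1 = subst (1ℤ ≤_) (sym (i≥j⇒i⊔j≡i (0≤neg xs≤0))) (0<⇒1≤ (neg-mono-< (≰⇒> xs)))
    halves : ∀ a → a ≡ 1ℤ * (a ⊔ 0ℤ) + -1ℤ * ((- a) ⊔ 0ℤ)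
    halves a with ≤-total 0ℤ a
    ... | inj₁ p = trans (lem a) (sym (cong₂ (λ u v → 1ℤ * u + -1ℤ * v) (i≥j⇒i⊔j≡i p) (i≤j⇒i⊔j≡j (neg≤0 p))))
      where
      lem : ∀ a → a ≡ 1ℤ * a + -1ℤ * 0ℤ
      lem = solve-∀
    ... | inj₂ p = trans (lem a) (sym (cong₂ (λ u v → 1ℤ * u + -1ℤ * v) (i≤j⇒i⊔j≡j p) (i≥j⇒i⊔j≡i (0≤neg p))))
      where
      lem : ∀ a → a ≡ 1ℤ * 0ℤ + -1ℤ * (- a)
      lem = solve-∀
    disjoint : ∀ a → (a ⊔ 0ℤ) * (+ 2 * ((- a) ⊔ 0ℤ)) ≡ 0ℤ
    disjoint a with ≤-total 0ℤ a
    ... | inj₁ p = trans (cong (λ v → (a ⊔ 0ℤ) * (+ 2 * v)) (i≤j⇒i⊔j≡j (neg≤0 p))) (*-zeroʳ (a ⊔ 0ℤ))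
    ... | inj₂ p = cong (λ v → v * (+ 2 * ((- a) ⊔ 0ℤ))) (i≤j⇒i⊔j≡j p)
    -- The two halves have disjoint supports, so the positive diagonal of `A` contributes nothing.
    cross : form A x⁺ x⁻ ≤ 0ℤ
    cross = subst (_≤ 0ℤ) (sym (form-def A x⁺ x⁻)) (sum-nonpos _ λ t → sum-nonpos _ (term t))
      where
      term : ∀ t u → x⁺ t * (A t u * x⁻ u) ≤ 0ℤ
      term t u with t ≟ u
      ... | yes refl = ≤-reflexive (trans (cong (λ z → x⁺ t * (z * x⁻ t)) (A-diag t)) (disjoint (x t)))
      ... | no n = subst (_≤ 0ℤ) (lem (x⁺ t) (A t u) (x⁻ u)) (neg≤0 (0≤* (0≤* (i≤j⊔i (x t) 0ℤ) (0≤neg (A-off n))) (i≤j⊔i (- x u) 0ℤ)))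
        where
        lem : ∀ a b c → - ((a * - b) * c) ≡ a * (b * c)
        lem = solve-∀
    expand : form A x x ≡ + 2 * q x⁺ + + 2 * q x⁻ - + 2 * form A x⁺ x⁻
    expand = begin
      form A x x ≡⟨ form-cong A (λ t → halves (x t)) (λ t → halves (x t)) ⟩
      form A y y ≡⟨ form-linˡ A 1ℤ -1ℤ x⁺ x⁻ y ⟩
      1ℤ * form A x⁺ y + -1ℤ * form A x⁻ y ≡⟨ cong₂ (λ u v → 1ℤ * u + -1ℤ * v) (form-linʳ A 1ℤ -1ℤ x⁺ x⁻ x⁺) (form-linʳ A 1ℤ -1ℤ x⁺ x⁻ x⁻) ⟩
      1ℤ * (1ℤ * form A x⁺ x⁺ + -1ℤ * form A x⁺ x⁻) + -1ℤ * (1ℤ * form A x⁻ x⁺ + -1ℤ * form A x⁻ x⁻)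
        ≡⟨ cong (λ v → 1ℤ * (1ℤ * form A x⁺ x⁺ + -1ℤ * form A x⁺ x⁻) + -1ℤ * (1ℤ * v + -1ℤ * form A x⁻ x⁻)) (trans (form-T A x⁻ x⁺) (form-≡M (λ t u → A-sym u t) x⁺ x⁻)) ⟩
      1ℤ * (1ℤ * form A x⁺ x⁺ + -1ℤ * form A x⁺ x⁻) + -1ℤ * (1ℤ * form A x⁺ x⁻ + -1ℤ * form A x⁻ x⁻)
        ≡⟨ lem (form A x⁺ x⁺) (form A x⁺ x⁻) (form A x⁻ x⁻) ⟩
      form A x⁺ x⁺ + form A x⁻ x⁻ - + 2 * form A x⁺ x⁻ ≡⟨ cong₂ (λ u v → u + v - + 2 * form A x⁺ x⁻) (2q x⁺) (2q x⁻) ⟩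
      + 2 * q x⁺ + + 2 * q x⁻ - + 2 * form A x⁺ x⁻ ∎
      where
      open ≡-Reasoning
      y : V N
      y t = 1ℤ * x⁺ t + -1ℤ * x⁻ t
      lem : ∀ a b c → 1ℤ * (1ℤ * a + -1ℤ * b) + -1ℤ * (1ℤ * b + -1ℤ * c) ≡ a + c - + 2 * b
      lem = solve-∀
    -- The norm of a root gives `1 = q x⁺ + q x⁻ - form A x⁺ x⁻`, whereas the right side is at least
    -- 2.
    contra : 1ℤ ≤ q x⁺ → 1ℤ ≤ q x⁻ → ⊥
    contra a b = 1≰0 (by-diff (0≤+ (0≤+ (diff a) (diff b)) (0≤neg cross)) (trans (lem (q x⁺) (q x⁻) (form A x⁺ x⁻)) (lem' (*-cancelˡ-≡ (+ 2) _ 1ℤ (trans (lem'' (q x⁺) (q x⁻) (form A x⁺ x⁻)) (trans (sym expand) root))))))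
      where
      lem : ∀ a b c → (a - 1ℤ) + (b - 1ℤ) + - c ≡ (a + b - c) - + 2
      lem = solve-∀
      lem' : ∀ {z} → z ≡ 1ℤ → z - + 2 ≡ 0ℤ - 1ℤ
      lem' refl = refl
      lem'' : ∀ a b c → + 2 * (a + b - c) ≡ + 2 * a + + 2 * b - + 2 * c
      lem'' = solve-∀

  -- Reflections at sources of a levelled diagram.

  Lvl : Sub N → V N → Set
  Lvl S lev = ∀ t u → S t ≡ true → S u ≡ true → t ≢ u → (A t u ≡ 0ℤ) ⊎ (lev u ≡ 1ℤ + lev t) ⊎ (lev t ≡ 1ℤ + lev u)

  Src : Sub N → V N → Fin N → Set
  Src S lev s = ∀ t → S t ≡ true → t ≢ s → (A s t ≡ 0ℤ) ⊎ (lev t ≡ 1ℤ + lev s)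

  -- A source lies one level below all its neighbours; raising it by two places it one level above
  -- them, so adjacent levels still differ by one.
  bump : Fin N → V N → V N
  bump s lev t with t ≟ s
  ... | yes _ = + 2 + lev t
  ... | no  _ = lev t

  bump-same : ∀ s lev → bump s lev s ≡ + 2 + lev s
  bump-same s lev with s ≟ s
  ... | yes _ = refl
  ... | no q  = ⊥-elim (q refl)

  bump-other : ∀ {s t} lev → t ≢ s → bump s lev t ≡ lev t
  bump-other {s} {t} lev n with t ≟ s
  ... | yes p = ⊥-elim (n p)
  ... | no _  = refl

  row : Fin N → V N → ℤ
  row s x = sum λ u → A s u * x u

  -- The simple reflection, kept in the shape `a * x + b * y` with a literal coefficient 1 so that
  -- the linearity lemmas of the form apply as they stand.
  rfl : Fin N → V N → V N
  rfl s x t = 1ℤ * x t + (- row s x) * unit s t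

  rfl-other : ∀ {s t} x → t ≢ s → rfl s x t ≡ x t
  rfl-other {s} {t} x n = trans (cong (λ z → 1ℤ * x t + (- row s x) * z) (unit-other n)) (lem (x t) (- row s x))
    where
    lem : ∀ a b → 1ℤ * a + b * 0ℤ ≡ a
    lem = solve-∀

  rfl-same : ∀ s x → rfl s x s ≡ x s - row s x
  rfl-same s x = trans (cong (λ z → 1ℤ * x s + (- row s x) * z) (unit-same s)) (lem (x s) (row s x))
    where
    lem : ∀ a b → 1ℤ * a + (- b) * 1ℤ ≡ a - b
    lem = solve-∀

  row-cong : ∀ s {x y} → x ≐ y → row s x ≡ row s y
  row-cong s p = sum-cong-≗ λ u → cong (A s u *_) (p u)

  row-lin : ∀ s a b x y → row s (λ t → a * x t + b * y t) ≡ a * row s x + b * row s y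
  row-lin s a b x y = trans (sum-cong-≗ λ u → lem (A s u) a b (x u) (y u)) (sum-lin a b (λ u → A s u * x u) (λ u → A s u * y u))
    where
    lem : ∀ w a b x y → w * (a * x + b * y) ≡ a * (w * x) + b * (w * y)
    lem = solve-∀

  rfl-cong : ∀ s {x y} → x ≐ y → rfl s x ≐ rfl s y
  rfl-cong s p t = cong₂ (λ a b → 1ℤ * a + (- b) * unit s t) (p t) (row-cong s p)

  rfl-lin : ∀ s a b x y → rfl s (λ t → a * x t + b * y t) ≐ (λ t → a * rfl s x t + b * rfl s y t)
  rfl-lin s a b x y t = trans (cong (λ z → 1ℤ * (a * x t + b * y t) + (- z) * unit s t) (row-lin s a b x y)) (lem a b (x t) (y t) (row s x) (row s y) (unit s t))
    where
    lem : ∀ a b x y p q u → 1ℤ * (a * x + b * y) + (- (a * p + b * q)) * u ≡ a * (1ℤ * x + (- p) * u) + b * (1ℤ * y + (- q) * u)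
    lem = solve-∀

  supp-rfl : ∀ {S s x} → S s ≡ true → Supp S x → Supp S (rfl s x)
  supp-rfl {S} {s} {x} Ss sx t St with t ≟ s
  ... | yes refl = ⊥-elim (case (trans (sym Ss) St))
    where
    case : true ≡ false → ⊥
    case ()
  ... | no n = trans (lem (x t) (- row s x)) (sx t St)
    where
    lem : ∀ a b → 1ℤ * a + b * 0ℤ ≡ a
    lem = solve-∀

  member : ∀ {S : Sub N} {x : V N} → Supp S x → ∀ t → (x t ≡ 0ℤ) ⊎ (S t ≡ true)
  member {S} sx t with S t in eq
  ... | true  = inj₂ refl
  ... | false = inj₁ (sx t eq)

  above : ∀ {S lev s} → Src S lev s → ∀ {t} → S t ≡ true → t ≢ s → (A s t ≡ 0ℤ) ⊎ (lev s < lev t)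
  above {lev = lev} {s} src {t} St n with src t St n
  ... | inj₁ p = inj₁ p
  ... | inj₂ p = inj₂ (subst (lev s <_) (sym p) (suc[i]≤j⇒i<j ≤-refl))

  below : ∀ {S lev s} → Src S lev s → ∀ {t} → S t ≡ true → t ≢ s → (A s t ≡ 0ℤ) ⊎ (lev t < + 2 + lev s)
  below {lev = lev} {s} src {t} St n with src t St n
  ... | inj₁ p = inj₁ p
  ... | inj₂ p = inj₂ (subst (_< + 2 + lev s) (sym p) (+-monoˡ-< (lev s) (+<+ (ℕ.s≤s (ℕ.s≤s ℕ.z≤n)))))

  e-cong : ∀ lev lev' t u → lev t ≡ lev' t → lev u ≡ lev' u → e lev t u ≡ e lev' t u
  e-cong lev lev' t u p q = go (t ≟ u) (lev t <? lev u)
    where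
    go : Dec (t ≡ u) → Dec (lev t < lev u) → e lev t u ≡ e lev' t u
    go (yes refl) _ = trans (e-diag lev t) (sym (e-diag lev' t))
    go (no n) (yes l) = trans (e-up lev l) (sym (e-up lev' (subst₂ _<_ p q l)))
    go (no n) (no l) = trans (e-down lev n l) (sym (e-down lev' n (λ l' → l (subst₂ _<_ (sym p) (sym q) l'))))

  E-cong : ∀ {lev lev'} → lev ≐ lev' → ∀ x y → E lev x y ≡ E lev' x y
  E-cong {lev} {lev'} p x y = form-≡M (λ t u → e-cong lev lev' t u (p t) (p u)) x y

  E-neg : ∀ lev x y → E (λ t → - lev t) x y ≡ E lev y x
  E-neg lev x y = trans (form-≡M eq x y) (sym (form-T (e lev) y x))
    where
    eq : ∀ t u → e (λ t → - lev t) t u ≡ e lev u t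
    eq t u = go (t ≟ u) (lev u <? lev t)
      where
      go : Dec (t ≡ u) → Dec (lev u < lev t) → e (λ t → - lev t) t u ≡ e lev u t
      go (yes refl) _ = trans (e-diag _ t) (sym (e-diag lev t))
      go (no n) (yes l) = trans (e-up _ (neg-mono-< l)) (trans (A-sym t u) (sym (e-up lev l)))
      go (no n) (no l) = trans (e-down _ n (λ l' → l (neg-cancel-< l'))) (sym (e-down lev (n ∘ sym) l))

  -- Raising a source by two reverses its arrows; on vectors supported in S this
  -- changes the Euler form only in the row and the column of s.
  E-bump : ∀ {S lev s} → Src S lev s → ∀ {x y} → Supp S x → Supp S y →
           E lev x y ≡ E (bump s lev) x y + (x s * row s y - row s x * y s)
  E-bump {S} {lev} {s} src {x} {y} sx sy = begin
    E lev x y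
      ≡⟨ form-congM (e lev) (λ t u → e (bump s lev) t u + (unit s t * A s u + - A t s * unit s u)) x y term ⟩
    form (λ t u → e (bump s lev) t u + (unit s t * A s u + - A t s * unit s u)) x y
      ≡⟨ sym (trans (cong (λ z → E (bump s lev) x y + z) (form-+ (λ t u → unit s t * A s u) (λ t u → - A t s * unit s u) x y)) (form-+ (e (bump s lev)) (λ t u → unit s t * A s u + - A t s * unit s u) x y)) ⟩
    E (bump s lev) x y + (form (λ t u → unit s t * A s u) x y + form (λ t u → - A t s * unit s u) x y)
      ≡⟨ cong (λ z → E (bump s lev) x y + z) (cong₂ _+_ rowpart colpart) ⟩
    E (bump s lev) x y + (x s * row s y - row s x * y s) ∎
    where
    open ≡-Reasoning
    rowpart : form (λ t u → unit s t * A s u) x y ≡ x s * row s y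
    rowpart = trans (form-def (λ t u → unit s t * A s u) x y) (trans (sum-single _ s (λ t n → sum-0 _ λ u → trans (cong (λ z → x t * (z * A s u * y u)) (unit-other n)) (lem0 (x t) (A s u) (y u))))
      (trans (sum-cong-≗ λ u → trans (cong (λ z → x s * (z * A s u * y u)) (unit-same s)) (lem1 (x s) (A s u) (y u))) (sym (*-distribˡ-sum (x s) (λ u → A s u * y u)))))
      where
      lem0 : ∀ x a y → x * (0ℤ * a * y) ≡ 0ℤ
      lem0 = solve-∀
      lem1 : ∀ x a y → x * (1ℤ * a * y) ≡ x * (a * y)
      lem1 = solve-∀
    colpart : form (λ t u → - A t s * unit s u) x y ≡ - (row s x * y s)
    colpart = trans (form-T (λ t u → - A t s * unit s u) x y) (trans (form-def (λ t u → - A u s * unit s t) y x) (trans (sum-single _ s (λ u n → sum-0 _ λ t → trans (cong (λ z → y u * (- A t s * z * x t)) (unit-other n)) (lem0 (y u) (A t s) (x t))))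
      (trans (sum-cong-≗ λ t → trans (cong₂ (λ z w → y s * (- w * z * x t)) (unit-same s) (A-sym t s)) (lem1 (y s) (A s t) (x t)))
        (trans (sym (*-distribˡ-sum (- y s) (λ t → A s t * x t))) (lem2 (y s) (row s x))))))
      where
      lem0 : ∀ y a x → y * (- a * 0ℤ * x) ≡ 0ℤ
      lem0 = solve-∀
      lem1 : ∀ y a x → y * (- a * 1ℤ * x) ≡ - y * (a * x)
      lem1 = solve-∀
      lem2 : ∀ y r → - y * r ≡ - (r * y)
      lem2 = solve-∀
    e-entry : ∀ t u → S t ≡ true → S u ≡ true → e lev t u ≡ e (bump s lev) t u + (unit s t * A s u + - A t s * unit s u)
    e-entry t u St Su = go (t ≟ s) (u ≟ s)
      where
      assemble : ∀ {l l' p q} → e lev t u ≡ l → e (bump s lev) t u ≡ l' → unit s t ≡ p → unit s u ≡ q → l ≡ l' + (p * A s u + - A t s * q) →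
                 e lev t u ≡ e (bump s lev) t u + (unit s t * A s u + - A t s * unit s u)
      assemble h₁ h₂ h₃ h₄ h = trans h₁ (trans h (sym (cong₂ _+_ h₂ (cong₂ (λ z w → z * A s u + - A t s * w) h₃ h₄))))
      lemss : ∀ a → 1ℤ ≡ 1ℤ + (1ℤ * a + - a * 1ℤ)
      lemss = solve-∀
      lemst : ∀ a b → a ≡ 0ℤ + (1ℤ * a + - b * 0ℤ)
      lemst = solve-∀
      lemts : ∀ a b → 0ℤ ≡ b + (0ℤ * a + - b * 1ℤ)
      lemts = solve-∀
      lemtu : ∀ l a b → l ≡ l + (0ℤ * a + - b * 0ℤ)
      lemtu = solve-∀
      go : Dec (t ≡ s) → Dec (u ≡ s) → e lev t u ≡ e (bump s lev) t u + (unit s t * A s u + - A t s * unit s u)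
      go (yes refl) (yes refl) = assemble (e-diag lev s) (e-diag (bump s lev) s) (unit-same s) (unit-same s) (lemss (A s s))
      go (yes refl) (no n) = assemble up dn (unit-same s) (unit-other n) (lemst (A s u) (A s s))
        where
        up : e lev s u ≡ A s u
        up with above src Su n
        ... | inj₁ p = trans (e-nonadj lev (n ∘ sym) p) (sym p)
        ... | inj₂ l = e-up lev l
        dn : e (bump s lev) s u ≡ 0ℤ
        dn with below src Su n
        ... | inj₁ p = e-nonadj (bump s lev) (n ∘ sym) p
        ... | inj₂ l = e-down (bump s lev) (n ∘ sym) λ l' → <-asym l (subst₂ _<_ (bump-same s lev) (bump-other lev n) l')
      go (no n) (yes refl) = assemble dn up (unit-other n) (unit-same s) (lemts (A s s) (A t s))
        where
        dn : e lev t s ≡ 0ℤ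
        dn with above src St n
        ... | inj₁ p = e-nonadj lev n (trans (A-sym t s) p)
        ... | inj₂ l = e-down lev n (<-asym l)
        up : e (bump s lev) t s ≡ A t s
        up with below src St n
        ... | inj₁ p = trans (e-nonadj (bump s lev) n (trans (A-sym t s) p)) (sym (trans (A-sym t s) p))
        ... | inj₂ l = e-up (bump s lev) (subst₂ _<_ (sym (bump-other lev n)) (sym (bump-same s lev)) l)
      go (no n) (no m) = assemble (e-cong lev (bump s lev) t u (sym (bump-other lev n)) (sym (bump-other lev m))) refl (unit-other n) (unit-other m) (lemtu (e (bump s lev) t u) (A s u) (A t s))
    term : ∀ t u → x t * (e lev t u * y u) ≡ x t * ((e (bump s lev) t u + (unit s t * A s u + - A t s * unit s u)) * y u)
    term t u with member {S} sx t | member {S} sy u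
    ... | inj₁ p | _ = trans (cong (_* (e lev t u * y u)) p) (sym (cong (_* ((e (bump s lev) t u + (unit s t * A s u + - A t s * unit s u)) * y u)) p))
    ... | inj₂ _ | inj₁ p = cong (x t *_) (trans (trans (cong (e lev t u *_) p) (*-zeroʳ (e lev t u))) (sym (trans (cong ((e (bump s lev) t u + (unit s t * A s u + - A t s * unit s u)) *_) p) (*-zeroʳ (e (bump s lev) t u + (unit s t * A s u + - A t s * unit s u))))))
    ... | inj₂ St | inj₂ Su = cong (λ z → x t * (z * y u)) (e-entry t u St Su)

  supp-unit : ∀ {S : Sub N} {s} → S s ≡ true → Supp S (unit s)
  supp-unit {S} {s} Ss t St = unit-other λ { refl → case (trans (sym Ss) St) }
    where
    case : true ≡ false → ⊥
    case ()

  -- No vertex of `S` adjacent to a source lies below it, so the column of `s` in the Euler matrix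
  -- has only its diagonal entry on `S`. This makes coordinates at `s` readable from Gram entries.
  E-source : ∀ {S lev s} → Src S lev s → ∀ {x} → Supp S x → E lev x (unit s) ≡ x s
  E-source {S} {lev} {s} src {x} sx = trans (form-unitʳ (e lev) s x) (trans (sum-single _ s other) (trans (cong (x s *_) (e-diag lev s)) (*-identityʳ (x s))))
    where
    other : ∀ t → t ≢ s → x t * e lev t s ≡ 0ℤ
    other t n with member {S} sx t
    ... | inj₁ p = cong (_* e lev t s) p
    ... | inj₂ St with above src St n
    ...   | inj₁ p = trans (cong (x t *_) (e-nonadj lev n (trans (A-sym t s) p))) (*-zeroʳ (x t))
    ...   | inj₂ l = trans (cong (x t *_) (e-down lev n (<-asym l))) (*-zeroʳ (x t))

  row-unit : ∀ s → row s (unit s) ≡ + 2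
  row-unit s = trans (sum-single _ s λ t n → trans (cong (A s t *_) (unit-other n)) (*-zeroʳ (A s t))) (trans (cong₂ _*_ (A-diag s) (unit-same s)) refl)

  -- The numerical form of Bernstein-Gelfand-Ponomarev reflection: the terms created by reflecting
  -- both arguments cancel the correction of `E-bump`. Gram matrices are thus unchanged while
  -- orientation and roots move together.
  E-rfl : ∀ {S lev s} → Src S lev s → S s ≡ true → ∀ {x y} → Supp S x → Supp S y → E (bump s lev) (rfl s x) (rfl s y) ≡ E lev x y
  E-rfl {S} {lev} {s} src Ss {x} {y} sx sy = begin
    E' (rfl s x) (rfl s y) ≡⟨ form-linˡ (e (bump s lev)) 1ℤ (- a) x γ (rfl s y) ⟩
    1ℤ * E' x (rfl s y) + - a * E' γ (rfl s y) ≡⟨ cong₂ (λ p q → 1ℤ * p + - a * q) (form-linʳ (e (bump s lev)) 1ℤ (- b) y γ x) (form-linʳ (e (bump s lev)) 1ℤ (- b) y γ γ) ⟩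
    1ℤ * (1ℤ * E' x y + - b * E' x γ) + - a * (1ℤ * E' γ y + - b * E' γ γ) ≡⟨ lem1 (E' x y) (E' x γ) (E' γ y) (E' γ γ) a b ⟩
    E' x y + (- b * E' x γ - a * E' γ y + a * b * E' γ γ) ≡⟨ cong (λ z → E' x y + z) (trans (cong₂ _+_ (cong₂ (λ p q → - b * p - a * q) xγ γy) (cong (a * b *_) γγ)) (lem2 a b (x s) (y s))) ⟩
    E' x y + (x s * b - a * y s) ≡⟨ sym (E-bump src sx sy) ⟩
    E lev x y ∎
    where
    open ≡-Reasoning
    E' = E (bump s lev)
    γ = unit s
    a = row s x
    b = row s y
    lem1 : ∀ p q r w a b → 1ℤ * (1ℤ * p + - b * q) + - a * (1ℤ * r + - b * w) ≡ p + (- b * q - a * r + a * b * w)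
    lem1 = solve-∀
    lem2 : ∀ a b xs ys → - b * (a - xs) - a * ys + a * b * 1ℤ ≡ xs * b - a * ys
    lem2 = solve-∀
    move : ∀ {p q r} → p ≡ q + r → q ≡ p - r
    move {p} {q} {r} refl = lem q r
      where
      lem : ∀ q r → q ≡ q + r - r
      lem = solve-∀
    γγ : E' γ γ ≡ 1ℤ
    γγ = trans (form-unitʳ (e (bump s lev)) s γ) (trans (sum-single _ s λ t n → trans (cong (_* e (bump s lev) t s) (unit-other n)) (*-zeroˡ (e (bump s lev) t s))) (trans (cong₂ _*_ (unit-same s) (e-diag (bump s lev) s)) refl))
    xγ : E' x γ ≡ a - x s
    xγ = trans (move (E-bump src sx (supp-unit {S} Ss))) (trans (cong₂ (λ p q → p - (x s * q - a * unit s s)) (E-source src sx) (row-unit s)) (trans (cong (λ z → x s - (x s * + 2 - a * z)) (unit-same s)) (lem (x s) a)))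
      where
      lem : ∀ x a → x - (x * + 2 - a * 1ℤ) ≡ a - x
      lem = solve-∀
    γy : E' γ y ≡ y s
    γy = trans (move (E-bump src (supp-unit {S} Ss) sy)) (trans (cong₂ (λ p q → p - (unit s s * b - q * y s)) γy0 (row-unit s)) (trans (cong (λ z → b - y s - (z * b - + 2 * y s)) (unit-same s)) (lem (y s) b)))
      where
      lem : ∀ y b → b - y - (1ℤ * b - + 2 * y) ≡ y
      lem = solve-∀
      sep : ∀ t u → (unit s t ≡ 0ℤ) ⊎ (y u ≡ 0ℤ) ⊎ (t ≡ u) ⊎ (A t u ≡ 0ℤ) ⊎ (lev t ≢ lev u)
      sep t u with t ≟ s
      ... | no n = inj₁ refl
      ... | yes refl with member {S} sy u
      ...   | inj₁ p = inj₂ (inj₁ p)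
      ...   | inj₂ Su with u ≟ s
      ...     | yes p = inj₂ (inj₂ (inj₁ (sym p)))
      ...     | no n with above src Su n
      ...       | inj₁ p = inj₂ (inj₂ (inj₂ (inj₁ p)))
      ...       | inj₂ l = inj₂ (inj₂ (inj₂ (inj₂ (<⇒≢ l))))
      γy0 : E lev γ y ≡ b - y s
      γy0 = trans (move' (E-sym lev γ y sep)) (cong₂ _-_ (form-unitˡ A s y) (E-source src sy))
        where
        move' : ∀ {p q r} → p + q ≡ r → p ≡ r - q
        move' {p} {q} refl = lem' p q
          where
          lem' : ∀ p q → p ≡ p + q - q
          lem' = solve-∀

  E-unitˡ-≤0 : ∀ lev {s x} → Pos x → x s ≡ 0ℤ → E lev (unit s) x ≤ 0ℤ
  E-unitˡ-≤0 lev {s} {x} px xs = subst (_≤ 0ℤ) (sym (form-unitˡ (e lev) s x)) (sum-nonpos _ term)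
    where
    lem : ∀ a b → - (- a * b) ≡ a * b
    lem = solve-∀
    term : ∀ u → e lev s u * x u ≤ 0ℤ
    term u = go (s ≟ u)
      where
      go : Dec (s ≡ u) → e lev s u * x u ≤ 0ℤ
      go (yes refl) = ≤-reflexive (trans (cong (e lev s s *_) xs) (*-zeroʳ (e lev s s)))
      go (no n) = subst (_≤ 0ℤ) (lem (e lev s u) (x u)) (neg≤0 (0≤* (0≤neg (e-off lev n)) (px u)))

  neg : V N → V N
  neg x t = - x t

  form-negˡ : (B : M N) (x y : V N) → form B (neg x) y ≡ - form B x y
  form-negˡ B x y = trans (form-cong B {x' = λ t → -1ℤ * x t + 0ℤ * x t} (λ t → lem (x t)) (λ _ → refl)) (trans (form-linˡ B -1ℤ 0ℤ x x y) (sym (lem (form B x y))))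
    where
    lem : ∀ a → - a ≡ -1ℤ * a + 0ℤ * a
    lem = solve-∀

  form-negʳ : (B : M N) (x y : V N) → form B x (neg y) ≡ - form B x y
  form-negʳ B x y = trans (form-T B x (neg y)) (trans (form-negˡ (λ t u → B u t) y x) (cong -_ (sym (form-T B x y))))

  form-neg-neg : (B : M N) (x y : V N) → form B (neg x) (neg y) ≡ form B x y
  form-neg-neg B x y = trans (form-negˡ B x (neg y)) (trans (cong -_ (form-negʳ B x y)) (neg-involutive _))

  pos-neg : ∀ {x : V N} → Neg x → Pos (neg x)
  pos-neg p t = 0≤neg (p t)

  neg-pos : ∀ {x : V N} → Pos x → Neg (neg x)
  neg-pos p t = neg≤0 (p t)

  E-unitˡ-≥0 : ∀ lev {s x} → Neg x → x s ≡ 0ℤ → 0ℤ ≤ E lev (unit s) x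
  E-unitˡ-≥0 lev {s} {x} nx xs = subst (0ℤ ≤_) (trans (cong -_ (form-negʳ (e lev) (unit s) x)) (neg-involutive _)) (0≤neg (E-unitˡ-≤0 lev (pos-neg nx) (cong -_ xs)))

  norm-rfl : ∀ s x → form A (rfl s x) (rfl s x) ≡ form A x x
  norm-rfl s x = begin
    form A (rfl s x) (rfl s x) ≡⟨ form-linˡ A 1ℤ (- a) x γ (rfl s x) ⟩
    1ℤ * form A x (rfl s x) + - a * form A γ (rfl s x) ≡⟨ cong₂ (λ p q → 1ℤ * p + - a * q) (form-linʳ A 1ℤ (- a) x γ x) (form-linʳ A 1ℤ (- a) x γ γ) ⟩
    1ℤ * (1ℤ * form A x x + - a * form A x γ) + - a * (1ℤ * form A γ x + - a * form A γ γ)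
      ≡⟨ cong₂ (λ p q → 1ℤ * (1ℤ * form A x x + - a * p) + - a * q) (trans (form-T A x γ) (trans (form-≡M (λ t u → A-sym u t) γ x) (form-unitˡ A s x))) (cong₂ (λ p q → 1ℤ * p + - a * q) (form-unitˡ A s x) (trans (form-unitˡ A s γ) (row-unit s))) ⟩
    1ℤ * (1ℤ * form A x x + - a * a) + - a * (1ℤ * a + - a * + 2) ≡⟨ lem (form A x x) a ⟩
    form A x x ∎
    where
    open ≡-Reasoning
    γ = unit s
    a = row s x
    lem : ∀ f a → 1ℤ * (1ℤ * f + - a * a) + - a * (1ℤ * a + - a * + 2) ≡ f
    lem = solve-∀

  norm-multiple : ∀ s x → (∀ t → t ≢ s → x t ≡ 0ℤ) → form A x x ≡ + 2 * (x s * x s)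
  norm-multiple s x h = trans (form-def A x x) (trans (sum-single _ s λ t n → sum-0 _ λ u → cong (_* (A t u * x u)) (h t n))
    (trans (sum-single _ s λ u n → trans (cong (λ z → x s * (A s u * z)) (h u n)) (lem0 (x s) (A s u))) (trans (cong (λ z → x s * (z * x s)) (A-diag s)) (lem (x s)))))
    where
    lem0 : ∀ a b → a * (b * 0ℤ) ≡ 0ℤ
    lem0 = solve-∀
    lem : ∀ a → a * (+ 2 * a) ≡ + 2 * (a * a)
    lem = solve-∀

  Root : V N → Set
  Root x = form A x x ≡ + 2

  sq≡1 : ∀ {a} → 0ℤ ≤ a → a * a ≡ 1ℤ → a ≡ 1ℤ
  sq≡1 {+ 1} _ _ = refl

  -- The reflection alters only the coordinate at `s`. If the result were negative, `x` would vanish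
  -- off `s`, and a positive root that is a multiple of `unit s` has coefficient 1.
  pos-rfl : ∀ s {x} → Root x → Pos x → ¬ (x ≐ unit s) → Pos (rfl s x)
  pos-rfl s {x} root px ne with root-sign (rfl s x) (trans (norm-rfl s x) root)
  ... | inj₁ p = p
  ... | inj₂ n = ⊥-elim (ne eq)
    where
    zero-off : ∀ t → t ≢ s → x t ≡ 0ℤ
    zero-off t t≢s = ≤-antisym (subst (_≤ 0ℤ) (rfl-other x t≢s) (n t)) (px t)
    xs≡1 : x s ≡ 1ℤ
    xs≡1 = sq≡1 (px s) (*-cancelˡ-≡ (+ 2) _ _ (trans (sym (norm-multiple s x zero-off)) root))
    eq : x ≐ unit s
    eq t with t ≟ s
    ... | yes refl = xs≡1
    ... | no t≢s = zero-off t t≢s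

  root-neg : ∀ {x} → Root x → Root (neg x)
  root-neg {x} r = trans (form-neg-neg A x x) r

  neg-rfl : ∀ s {x} → Root x → Neg x → ¬ (x ≐ neg (unit s)) → Neg (rfl s x)
  neg-rfl s {x} root nx ne t = subst (_≤ 0ℤ) (trans (cong -_ (lem t)) (neg-involutive _)) (neg≤0 (pos-rfl s (root-neg root) (pos-neg nx) (λ eq → ne λ t → trans (sym (neg-involutive (x t))) (cong -_ (eq t))) t))
    where
    lem0 : ∀ a → - a ≡ -1ℤ * a + 0ℤ * a
    lem0 = solve-∀
    lem : ∀ t → rfl s (neg x) t ≡ - rfl s x t
    lem t = trans (rfl-cong s (λ t → lem0 (x t)) t) (trans (rfl-lin s -1ℤ 0ℤ x x t) (sym (lem0 (rfl s x t))))

  pos∧neg : ∀ {x : V N} → Root x → Pos x → Neg x → ⊥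
  pos∧neg {x} root p n = case (trans (sym root) (trans (form-def A x x) (sum-0 _ λ t → sum-0 _ λ u → cong (_* (A t u * x u)) (≤-antisym (n t) (p t)))))
    where
    case : + 2 ≡ 0ℤ → ⊥
    case ()

  -- Schedules of source reflections.

  -- A finite certificate that some sequence of source reflections makes `Y` simple at a source.
  -- Later proofs recurse on it, so termination is established here once.
  data Reach (S : Sub N) : V N → V N → Set where
    here  : ∀ {lev Y} s → S s ≡ true → Src S lev s → Y ≐ unit s → Reach S lev Y
    there : ∀ {lev Y} s → S s ≡ true → Src S lev s → Reach S (bump s lev) (rfl s Y) → Reach S lev Y

  bump-cong : ∀ s {lev lev'} → lev ≐ lev' → bump s lev ≐ bump s lev'
  bump-cong s p t with t ≟ s
  ... | yes _ = cong (λ z → + 2 + z) (p t)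
  ... | no _  = p t

  src-cong : ∀ {S s lev lev'} → lev ≐ lev' → Src S lev s → Src S lev' s
  src-cong {s = s} p src t St n with src t St n
  ... | inj₁ q = inj₁ q
  ... | inj₂ q = inj₂ (trans (sym (p t)) (trans q (cong (λ z → 1ℤ + z) (p s))))

  reach-cong : ∀ {S lev lev' Y Y'} → lev ≐ lev' → Y ≐ Y' → Reach S lev Y → Reach S lev' Y'
  reach-cong p q (here s Ss src eq) = here s Ss (src-cong p src) (λ t → trans (sym (q t)) (eq t))
  reach-cong p q (there s Ss src r) = there s Ss (src-cong p src) (reach-cong (bump-cong s p) (rfl-cong s q) r)

  lvl-bump : ∀ {S lev s} → Lvl S lev → Src S lev s → Lvl S (bump s lev)
  lvl-bump {S} {lev} {s} lvl src t u St Su n = go (t ≟ s) (u ≟ s)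
    where
    lem : ∀ a → + 2 + a ≡ 1ℤ + (1ℤ + a)
    lem = solve-∀
    go : Dec (t ≡ s) → Dec (u ≡ s) → (A t u ≡ 0ℤ) ⊎ (bump s lev u ≡ 1ℤ + bump s lev t) ⊎ (bump s lev t ≡ 1ℤ + bump s lev u)
    go (yes refl) (yes refl) = ⊥-elim (n refl)
    go (yes refl) (no m) with src u Su m
    ... | inj₁ p = inj₁ p
    ... | inj₂ p = inj₂ (inj₂ (trans (bump-same s lev) (trans (lem (lev s)) (cong (λ z → 1ℤ + z) (trans (sym p) (sym (bump-other lev m)))))))
    go (no m) (yes refl) with src t St m
    ... | inj₁ p = inj₁ (trans (A-sym t s) p)
    ... | inj₂ p = inj₂ (inj₁ (trans (bump-same s lev) (trans (lem (lev s)) (cong (λ z → 1ℤ + z) (trans (sym p) (sym (bump-other lev m)))))))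
    go (no m) (no m') with lvl t u St Su n
    ... | inj₁ p = inj₁ p
    ... | inj₂ (inj₁ p) = inj₂ (inj₁ (trans (bump-other lev m') (trans p (cong (λ z → 1ℤ + z) (sym (bump-other lev m))))))
    ... | inj₂ (inj₂ p) = inj₂ (inj₂ (trans (bump-other lev m) (trans p (cong (λ z → 1ℤ + z) (sym (bump-other lev m'))))))

  lvl-sep : ∀ {S lev} → Lvl S lev → ∀ {x y} → Supp S x → Supp S y → E lev x y + E lev y x ≡ form A x y
  lvl-sep {S} {lev} lvl {x} {y} sx sy = E-sym lev x y sep
    where
    apart : ∀ {a b} → a ≡ 1ℤ + b → a ≢ b
    apart {b = b} p q = <-irrefl (sym (trans (sym p) q)) (suc[i]≤j⇒i<j {b} ≤-refl)
    sep : ∀ t u → (x t ≡ 0ℤ) ⊎ (y u ≡ 0ℤ) ⊎ (t ≡ u) ⊎ (A t u ≡ 0ℤ) ⊎ (lev t ≢ lev u)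
    sep t u with member {S} sx t | member {S} sy u | t ≟ u
    ... | inj₁ p | _ | _ = inj₁ p
    ... | inj₂ _ | inj₁ p | _ = inj₂ (inj₁ p)
    ... | inj₂ _ | inj₂ _ | yes p = inj₂ (inj₂ (inj₁ p))
    ... | inj₂ St | inj₂ Su | no n with lvl t u St Su n
    ...   | inj₁ p = inj₂ (inj₂ (inj₂ (inj₁ p)))
    ...   | inj₂ (inj₁ p) = inj₂ (inj₂ (inj₂ (inj₂ (apart p ∘ sym))))
    ...   | inj₂ (inj₂ p) = inj₂ (inj₂ (inj₂ (inj₂ (apart p))))

  root-of : ∀ {S lev} → Lvl S lev → ∀ {x} → Supp S x → E lev x x ≡ 1ℤ → Root x
  root-of lvl sx p = trans (sym (lvl-sep lvl sx sx)) (cong₂ _+_ p p)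

  module Schedule (S : Sub N) where
    record Good (lev Y : V N) : Set where
      field
        lvl  : Lvl S lev
        supp : Supp S Y
        root : Root Y
        pos  : Pos Y

    good-cong : ∀ {lev lev' Y Y'} → lev ≐ lev' → Y ≐ Y' → Good lev Y → Good lev' Y'
    good-cong {lev} {lev'} {Y} {Y'} p q g = record
      { lvl = lvl'
      ; supp = λ t St → trans (sym (q t)) (Good.supp g t St)
      ; root = trans (form-cong A (λ t → sym (q t)) (λ t → sym (q t))) (Good.root g)
      ; pos = λ t → subst (0ℤ ≤_) (q t) (Good.pos g t) }
      where
      lvl' : Lvl S lev'
      lvl' t u St Su n with Good.lvl g t u St Su n
      ... | inj₁ h = inj₁ h
      ... | inj₂ (inj₁ h) = inj₂ (inj₁ (trans (sym (p u)) (trans h (cong (λ z → 1ℤ + z) (p t)))))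
      ... | inj₂ (inj₂ h) = inj₂ (inj₂ (trans (sym (p t)) (trans h (cong (λ z → 1ℤ + z) (p u)))))

    good-step : ∀ {lev Y s} → S s ≡ true → Src S lev s → ¬ (Y ≐ unit s) → Good lev Y → Good (bump s lev) (rfl s Y)
    good-step {s = s} Ss src ne g = record
      { lvl = lvl-bump (Good.lvl g) src
      ; supp = supp-rfl Ss (Good.supp g)
      ; root = trans (norm-rfl s _) (Good.root g)
      ; pos = pos-rfl s (Good.root g) (Good.pos g) ne }

    Low : ℤ → V N → Set
    Low v lev = ∀ t → S t ≡ true → v ≤ lev t

    -- One sweep over the lowest level `v`. The set `D` records which vertices have been handled,
    -- and `levᴰ`, `Yᴰ` describe the state in closed form for every such set.
    module Round (lev : V N) (Y : V N) (v : ℤ) (lvl : Lvl S lev) (low : Low v lev) where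
      hit : Fin N → Bool
      hit t = S t ∧ does (lev t ≟ℤ v)

      hit⁻ : ∀ t → hit t ≡ true → S t ≡ true × lev t ≡ v
      hit⁻ t h with S t | lev t ≟ℤ v
      ... | true | yes p = refl , p

      hit⁺ : ∀ t → S t ≡ true → lev t ≡ v → hit t ≡ true
      hit⁺ t Ss p with S t | lev t ≟ℤ v
      ... | true | yes _ = refl
      ... | true | no q = ⊥-elim (q p)

      levᴰ Yᴰ : (Fin N → Bool) → V N
      levᴰ D t = if D t ∧ hit t then + 2 + lev t else lev t
      Yᴰ D t = if D t ∧ hit t then Y t - row t Y else Y t

      add : (Fin N → Bool) → Fin N → Fin N → Bool
      add D s t = D t ∨ does (t ≟ s)

      add-same : ∀ D s → add D s s ≡ true
      add-same D s with D s | s ≟ s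
      ... | true  | _ = refl
      ... | false | yes _ = refl
      ... | false | no q = ⊥-elim (q refl)

      add-other : ∀ D {s t} → t ≢ s → add D s t ≡ D t
      add-other D {s} {t} n with D t | t ≟ s
      ... | true  | _ = refl
      ... | false | yes p = ⊥-elim (n p)
      ... | false | no _ = refl

      bump-lev : ∀ D {s} → hit s ≡ true → D s ≡ false → bump s (levᴰ D) ≐ levᴰ (add D s)
      bump-lev D {s} hs Ds t = go (t ≟ s)
        where
        go : Dec (t ≡ s) → bump s (levᴰ D) t ≡ levᴰ (add D s) t
        go (yes refl) rewrite bump-same s (levᴰ D) | add-same D s | Ds | hs = refl
        go (no n) rewrite bump-other (levᴰ D) n | add-other D n = refl

      -- Vertices on one level are not adjacent, so reflections already performed in this sweep do
      -- not affect the row of the next vertex.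
      row-stable : ∀ D {s} → hit s ≡ true → D s ≡ false → row s (Yᴰ D) ≡ row s Y
      row-stable D {s} hs Ds = sum-cong-≗ term
        where
        term : ∀ u → A s u * Yᴰ D u ≡ A s u * Y u
        term u with D u in Du | hit u in hu
        ... | false | _     = refl
        ... | true  | false = refl
        ... | true  | true  = trans (cong (_* (Y u - row u Y)) A≡0) (sym (cong (_* Y u) A≡0))
          where
          s≢u : s ≢ u
          s≢u refl = case (trans (sym Ds) Du)
            where
            case : false ≡ true → ⊥
            case ()
          same : lev u ≡ lev s
          same = trans (proj₂ (hit⁻ u hu)) (sym (proj₂ (hit⁻ s hs)))
          apart : ∀ {a b} → a ≡ b → a ≢ 1ℤ + b
          apart {b = b} refl q = <-irrefl q (suc[i]≤j⇒i<j {b} ≤-refl)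
          A≡0 : A s u ≡ 0ℤ
          A≡0 with lvl s u (proj₁ (hit⁻ s hs)) (proj₁ (hit⁻ u hu)) s≢u
          ... | inj₁ p = p
          ... | inj₂ (inj₁ p) = ⊥-elim (apart same p)
          ... | inj₂ (inj₂ p) = ⊥-elim (apart (sym same) p)

      Yᴰ-new : ∀ D {s} → D s ≡ false → Yᴰ D s ≡ Y s
      Yᴰ-new D Ds rewrite Ds = refl

      levᴰ-new : ∀ D {s} → D s ≡ false → levᴰ D s ≡ lev s
      levᴰ-new D Ds rewrite Ds = refl

      rfl-Y : ∀ D {s} → hit s ≡ true → D s ≡ false → rfl s (Yᴰ D) ≐ Yᴰ (add D s)
      rfl-Y D {s} hs Ds t = go (t ≟ s)
        where
        hitval : Yᴰ (add D s) s ≡ Y s - row s Y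
        hitval rewrite add-same D s | hs = refl
        go : Dec (t ≡ s) → rfl s (Yᴰ D) t ≡ Yᴰ (add D s) t
        go (yes refl) = trans (rfl-same s (Yᴰ D)) (trans (cong₂ _-_ (Yᴰ-new D Ds) (row-stable D hs Ds)) (sym hitval))
        go (no n) = trans (rfl-other (Yᴰ D) n) (cong (λ b → if b ∧ hit t then Y t - row t Y else Y t) (sym (add-other D n)))

      src : ∀ D {s} → hit s ≡ true → D s ≡ false → Src S (levᴰ D) s
      src D {s} hs Ds t St n with lvl s t (proj₁ (hit⁻ s hs)) St (n ∘ sym)
      ... | inj₁ p = inj₁ p
      ... | inj₂ (inj₁ p) = inj₂ (trans unhit (trans p (cong (λ z → 1ℤ + z) (sym (levᴰ-new D Ds)))))
        where
        nh : hit t ≡ false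
        nh with hit t in ht
        ... | false = refl
        ... | true = ⊥-elim (<-irrefl (trans (trans (proj₂ (hit⁻ s hs)) (sym (proj₂ (hit⁻ t ht)))) p) (suc[i]≤j⇒i<j {lev s} ≤-refl))
        unhit : levᴰ D t ≡ lev t
        unhit rewrite nh with D t
        ... | true = refl
        ... | false = refl
      ... | inj₂ (inj₂ p) = ⊥-elim (<⇒≱ (suc[i]≤j⇒i<j {lev t} ≤-refl) (subst (_≤ lev t) (trans (sym (proj₂ (hit⁻ s hs))) p) (low t St)))

      skip-lev : ∀ D {s} → (D s ≡ true) ⊎ (hit s ≡ false) → levᴰ D ≐ levᴰ (add D s)
      skip-lev D {s} h t = go (t ≟ s) h
        where
        go : Dec (t ≡ s) → (D s ≡ true) ⊎ (hit s ≡ false) → levᴰ D t ≡ levᴰ (add D s) t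
        go (no n) _ rewrite add-other D n = refl
        go (yes refl) (inj₁ p) rewrite add-same D s | p = refl
        go (yes refl) (inj₂ p) rewrite add-same D s | p with D s
        ... | true = refl
        ... | false = refl

      skip-Y : ∀ D {s} → (D s ≡ true) ⊎ (hit s ≡ false) → Yᴰ D ≐ Yᴰ (add D s)
      skip-Y D {s} h t = go (t ≟ s) h
        where
        go : Dec (t ≡ s) → (D s ≡ true) ⊎ (hit s ≡ false) → Yᴰ D t ≡ Yᴰ (add D s) t
        go (no n) _ rewrite add-other D n = refl
        go (yes refl) (inj₁ p) rewrite add-same D s | p = refl
        go (yes refl) (inj₂ p) rewrite add-same D s | p with D s
        ... | true = refl
        ... | false = refl

      lev⁺ Y⁺ : V N
      lev⁺ t = if hit t then + 2 + lev t else lev t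
      Y⁺ t = if hit t then Y t - row t Y else Y t

      -- The sweep carries an extra invariant `I` and a continuation `next` for the state after the
      -- whole level, which leaves the choice of a decreasing quantity to the caller.
      module Run (I : V N → V N → Set)
                 (I-cong : ∀ {l l' Z Z'} → l ≐ l' → Z ≐ Z' → I l Z → I l' Z')
                 (I-step : ∀ {l Z s} → S s ≡ true → Src S l s → Good l Z → I l Z → I (bump s l) (rfl s Z))
                 (next : Good lev⁺ Y⁺ → I lev⁺ Y⁺ → Reach S lev⁺ Y⁺) where

        proc : ∀ l D → (∀ t → (D t ≡ true) ⊎ (t ∈ l)) → Good (levᴰ D) (Yᴰ D) → I (levᴰ D) (Yᴰ D) → Reach S (levᴰ D) (Yᴰ D)
        proc [] D cov g i = reach-cong (λ t → sym (eqL t)) (λ t → sym (eqY t)) (next (good-cong eqL eqY g) (I-cong eqL eqY i))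
          where
          all : ∀ t → D t ≡ true
          all t with cov t
          ... | inj₁ p = p
          ... | inj₂ ()
          eqL : levᴰ D ≐ lev⁺
          eqL t rewrite all t = refl
          eqY : Yᴰ D ≐ Y⁺
          eqY t rewrite all t = refl
        proc (s ∷ l) D cov g i with D s in Ds | hit s in hs
        ... | true  | _ = reach-cong (λ t → sym (skip-lev D (inj₁ Ds) t)) (λ t → sym (skip-Y D (inj₁ Ds) t))
                            (proc l (add D s) cov' (good-cong (skip-lev D (inj₁ Ds)) (skip-Y D (inj₁ Ds)) g) (I-cong (skip-lev D (inj₁ Ds)) (skip-Y D (inj₁ Ds)) i))
          where
          cov' : ∀ t → (add D s t ≡ true) ⊎ (t ∈ l)
          cov' t with cov t
          ... | inj₁ p = inj₁ (cong (_∨ does (t ≟ s)) p)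
          ... | inj₂ (here refl) = inj₁ (add-same D s)
          ... | inj₂ (there p) = inj₂ p
        ... | false | false = reach-cong (λ t → sym (skip-lev D (inj₂ hs) t)) (λ t → sym (skip-Y D (inj₂ hs) t))
                            (proc l (add D s) cov' (good-cong (skip-lev D (inj₂ hs)) (skip-Y D (inj₂ hs)) g) (I-cong (skip-lev D (inj₂ hs)) (skip-Y D (inj₂ hs)) i))
          where
          cov' : ∀ t → (add D s t ≡ true) ⊎ (t ∈ l)
          cov' t with cov t
          ... | inj₁ p = inj₁ (cong (_∨ does (t ≟ s)) p)
          ... | inj₂ (here refl) = inj₁ (add-same D s)
          ... | inj₂ (there p) = inj₂ p
        -- Stopping exactly here keeps the vector positive: the only positive root that a reflection
        -- at `s` makes negative is `unit s`.
        ... | false | true with all? (λ t → Yᴰ D t ≟ℤ unit s t)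
        ...   | yes eq = Reach.here s (proj₁ (hit⁻ s hs)) (src D hs Ds) eq
        ...   | no ne = Reach.there s (proj₁ (hit⁻ s hs)) (src D hs Ds)
                  (reach-cong (λ t → sym (bump-lev D hs Ds t)) (λ t → sym (rfl-Y D hs Ds t))
                    (proc l (add D s) cov' (good-cong (bump-lev D hs Ds) (rfl-Y D hs Ds) (good-step (proj₁ (hit⁻ s hs)) (src D hs Ds) ne g))
                      (I-cong (bump-lev D hs Ds) (rfl-Y D hs Ds) (I-step (proj₁ (hit⁻ s hs)) (src D hs Ds) g i))))
          where
          cov' : ∀ t → (add D s t ≡ true) ⊎ (t ∈ l)
          cov' t with cov t
          ... | inj₁ p = inj₁ (cong (_∨ does (t ≟ s)) p)
          ... | inj₂ (here refl) = inj₁ (add-same D s)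
          ... | inj₂ (there p) = inj₂ p

        round : Good lev Y → I lev Y → Reach S lev Y
        round = proc (allFin N) (λ _ → false) (λ t → inj₂ (∈-allFin t))

  -- The potential argument.

  -- The weight `w` is superharmonic on `S` with surplus at least `θ`. Once the levels are flat,
  -- sweeps alternate between two levels, and the weighted sizes of `Y` on successive levels form a
  -- single sequence, shifted by one per sweep.
  module Potential (S : Sub N) (w : V N) (w≥1 : ∀ t → 1ℤ ≤ w t)
                   (θ : ℤ) (θ≥0 : 0ℤ ≤ θ) (super : ∀ u → S u ≡ true → θ ≤ row u w) where
    open Schedule S

    Flat : ℤ → V N → Set
    Flat v lev = ∀ t → S t ≡ true → (lev t ≡ v) ⊎ (lev t ≡ 1ℤ + v)

    1+≢ : ∀ {v a} → a ≡ 1ℤ + v → a ≢ v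
    1+≢ {v} p q = <-irrefl (trans (sym q) p) (suc[i]≤j⇒i<j {v} ≤-refl)

    flat-low : ∀ {v lev} → Flat v lev → Low v lev
    flat-low {v} f t St with f t St
    ... | inj₁ p = ≤-reflexive (sym p)
    ... | inj₂ p = subst (v ≤_) (sym p) (i≤suc[i] v)

    lo : ℤ → V N → Fin N → Bool
    lo v lev t = does (lev t ≟ℤ v)

    lo-yes : ∀ {v lev t} → lev t ≡ v → lo v lev t ≡ true
    lo-yes {v} {lev} {t} p with lev t ≟ℤ v
    ... | yes _ = refl
    ... | no q = ⊥-elim (q p)

    lo-no : ∀ {v lev t} → lev t ≢ v → lo v lev t ≡ false
    lo-no {v} {lev} {t} p with lev t ≟ℤ v
    ... | yes q = ⊥-elim (p q)
    ... | no _ = refl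

    Wlo Whi yhi : ℤ → V N → V N → ℤ
    Wlo v lev Y = sum λ t → if lo v lev t then w t * Y t else 0ℤ
    Whi v lev Y = sum λ t → if lo v lev t then 0ℤ else w t * Y t
    yhi v lev Y = sum λ t → if lo v lev t then 0ℤ else Y t

    if-0≤ : ∀ b {x y : ℤ} → 0ℤ ≤ x → 0ℤ ≤ y → 0ℤ ≤ (if b then x else y)
    if-0≤ true  p q = p
    if-0≤ false p q = q

    wY≥0 : ∀ {Y : V N} → Pos Y → ∀ t → 0ℤ ≤ w t * Y t
    wY≥0 p t = 0≤* (1≤⇒0≤ (w≥1 t)) (p t)

    Wlo≥0 : ∀ v lev {Y} → Pos Y → 0ℤ ≤ Wlo v lev Y
    Wlo≥0 v lev p = sum-nonneg _ λ t → if-0≤ (lo v lev t) (wY≥0 p t) ≤-refl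

    Whi≥0 : ∀ v lev {Y} → Pos Y → 0ℤ ≤ Whi v lev Y
    Whi≥0 v lev p = sum-nonneg _ λ t → if-0≤ (lo v lev t) ≤-refl (wY≥0 p t)

    yhi≥0 : ∀ v lev {Y} → Pos Y → 0ℤ ≤ yhi v lev Y
    yhi≥0 v lev p = sum-nonneg _ λ t → if-0≤ (lo v lev t) ≤-refl (p t)

    module Step {lev Y : V N} {v : ℤ} (flat : Flat v lev) (good : Good lev Y) where
      open Round lev Y v (Good.lvl good) (flat-low flat)

      hit-lo : ∀ t → S t ≡ true → hit t ≡ lo v lev t
      hit-lo t St rewrite St = refl

      flat⁺ : Flat (1ℤ + v) lev⁺
      flat⁺ t St with hit t in ht | flat t St
      ... | true  | inj₁ p = inj₂ (trans (cong (λ z → + 2 + z) p) (lem v))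
        where
        lem : ∀ v → + 2 + v ≡ 1ℤ + (1ℤ + v)
        lem = solve-∀
      ... | true  | inj₂ p = ⊥-elim (1+≢ p (proj₂ (hit⁻ t ht)))
      ... | false | inj₁ p = ⊥-elim (case (trans (sym ht) (hit⁺ t St p)))
        where
        case : false ≡ true → ⊥
        case ()
      ... | false | inj₂ p = inj₁ p

      lo⁺ : ∀ t → S t ≡ true → lo (1ℤ + v) lev⁺ t ≡ (if hit t then false else true)
      lo⁺ t St with hit t in ht
      ... | true  = lo-no {1ℤ + v} {λ _ → + 2 + lev t} {t} λ p → 1+≢ {1ℤ + v} {+ 2 + lev t} (trans (cong (λ z → + 2 + z) (proj₂ (hit⁻ t ht))) (lem v)) p
        where
        lem : ∀ v → + 2 + v ≡ 1ℤ + (1ℤ + v)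
        lem = solve-∀
      ... | false with flat t St
      ...   | inj₁ p = ⊥-elim (case (trans (sym ht) (hit⁺ t St p)))
        where
        case : false ≡ true → ⊥
        case ()
      ...   | inj₂ p = lo-yes {1ℤ + v} {lev} {t} p

      outside : ∀ t → S t ≡ false → Y t ≡ 0ℤ × Y⁺ t ≡ 0ℤ
      outside t St = Good.supp good t St , trans y⁺ (Good.supp good t St)
        where
        y⁺ : Y⁺ t ≡ Y t
        y⁺ rewrite St = refl

      if-zero : ∀ b {x : ℤ} → x ≡ 0ℤ → (if b then x else 0ℤ) ≡ 0ℤ
      if-zero true p = p
      if-zero false p = refl

      if-zero' : ∀ b {x : ℤ} → x ≡ 0ℤ → (if b then 0ℤ else x) ≡ 0ℤ
      if-zero' true p = refl
      if-zero' false p = p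

      w*0 : ∀ t {y} → y ≡ 0ℤ → w t * y ≡ 0ℤ
      w*0 t p = trans (cong (w t *_) p) (*-zeroʳ (w t))

      Wlo⁺ : Wlo (1ℤ + v) lev⁺ Y⁺ ≡ Whi v lev Y
      Wlo⁺ = sum-cong-≗ λ t → go t (S t) refl
        where
        go : ∀ t b → S t ≡ b → (if lo (1ℤ + v) lev⁺ t then w t * Y⁺ t else 0ℤ) ≡ (if lo v lev t then 0ℤ else w t * Y t)
        go t false St = trans (if-zero (lo (1ℤ + v) lev⁺ t) (w*0 t (proj₂ (outside t St)))) (sym (if-zero' (lo v lev t) (w*0 t (proj₁ (outside t St)))))
        go t true St = select (hit t) (lo⁺ t St) (sym (hit-lo t St)) (w t)
          where
          select : ∀ h {a b} → a ≡ (if h then false else true) → b ≡ h → ∀ c {x y} → (if a then c * (if h then x else y) else 0ℤ) ≡ (if b then 0ℤ else c * y)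
          select true  refl refl c = refl
          select false refl refl c = refl

      wlo : V N
      wlo t = if hit t then w t else 0ℤ

      Whi⁺ : Whi (1ℤ + v) lev⁺ Y⁺ ≡ Wlo v lev Y - form A wlo Y
      Whi⁺ = trans (sum-cong-≗ λ t → go t (S t) refl) (trans (sum-- (λ t → if lo v lev t then w t * Y t else 0ℤ) (λ t → wlo t * row t Y))
               (cong (λ z → Wlo v lev Y - z) (sym (trans (form-def A wlo Y) (sum-cong-≗ λ t → sym (*-distribˡ-sum (wlo t) (λ u → A t u * Y u)))))))
        where
        lem : ∀ w y r → w * (y - r) ≡ w * y - w * r
        lem = solve-∀
        go : ∀ t b → S t ≡ b → (if lo (1ℤ + v) lev⁺ t then 0ℤ else w t * Y⁺ t) ≡ (if lo v lev t then w t * Y t else 0ℤ) - wlo t * row t Y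
        go t false St = trans (if-zero' (lo (1ℤ + v) lev⁺ t) (w*0 t (proj₂ (outside t St))))
          (sym (trans (cong (λ z → z - wlo t * row t Y) (if-zero (lo v lev t) (w*0 t (proj₁ (outside t St))))) (cong (λ z → 0ℤ - z * row t Y) wlo0)))
          where
          wlo0 : wlo t ≡ 0ℤ
          wlo0 rewrite St = refl
        go t true St = select (hit t) (lo⁺ t St) (sym (hit-lo t St)) (w t) (Y t) (row t Y)
          where
          select : ∀ h {a b} → a ≡ (if h then false else true) → b ≡ h → ∀ c y r →
                   (if a then 0ℤ else c * (if h then y - r else y)) ≡ (if b then c * y else 0ℤ) - (if h then c else 0ℤ) * r
          select true  refl refl c y r = lem c y r
          select false refl refl c y r = refl

      wlo≤w : ∀ t → 0ℤ ≤ w t - wlo t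
      wlo≤w t with hit t
      ... | true  = ≤-reflexive (sym (+-inverseʳ (w t)))
      ... | false = subst (0ℤ ≤_) (sym (+-identityʳ (w t))) (1≤⇒0≤ (w≥1 t))

      row-lo : ∀ u → hit u ≡ true → row u wlo ≡ + 2 * w u
      row-lo u hu = trans (sum-single _ u other) (cong₂ _*_ (A-diag u) wlo-u)
        where
        wlo-u : wlo u ≡ w u
        wlo-u rewrite hu = refl
        other : ∀ t → t ≢ u → A u t * wlo t ≡ 0ℤ
        other t n with hit t in ht
        ... | false = *-zeroʳ (A u t)
        ... | true with Good.lvl good u t (proj₁ (hit⁻ u hu)) (proj₁ (hit⁻ t ht)) (n ∘ sym)
        ...   | inj₁ p = cong (_* w t) p
        ...   | inj₂ (inj₁ p) = ⊥-elim (1+≢ p (trans (proj₂ (hit⁻ t ht)) (sym (proj₂ (hit⁻ u hu)))))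
        ...   | inj₂ (inj₂ p) = ⊥-elim (1+≢ p (trans (proj₂ (hit⁻ u hu)) (sym (proj₂ (hit⁻ t ht)))))

      row-hi : ∀ u → hit u ≡ false → S u ≡ true → θ - + 2 * w u ≤ row u wlo
      row-hi u hu Su = by-diff (0≤+ (diff (super u Su)) (diff rest)) (lem θ (row u w) (row u wlo) (w u))
        where
        lem : ∀ θ r r' w → (r - θ) + (+ 2 * w - (r - r')) ≡ r' - (θ - + 2 * w)
        lem = solve-∀
        wlo-u : wlo u ≡ 0ℤ
        wlo-u rewrite hu = refl
        bound : ∀ t → A u t * (w t - wlo t) ≤ (+ 2 * w u) * unit u t
        bound t with t ≟ u
        ... | yes refl = ≤-reflexive (trans (cong₂ (λ a b → a * (w t - b)) (A-diag t) wlo-u) (lem2 (w t)))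
          where
          lem2 : ∀ a → + 2 * (a - 0ℤ) ≡ + 2 * a * 1ℤ
          lem2 = solve-∀
        ... | no n = subst₂ _≤_ (lem2 (A u t) (w t - wlo t)) (sym (*-zeroʳ (+ 2 * w u))) (neg≤0 (0≤* (0≤neg (A-off (n ∘ sym))) (wlo≤w t)))
          where
          lem2 : ∀ a b → - (- a * b) ≡ a * b
          lem2 = solve-∀
        rest : row u w - row u wlo ≤ + 2 * w u
        rest = subst₂ _≤_ (trans (sum-cong-≗ λ t → lem2 (A u t) (w t) (wlo t)) (sum-- (λ t → A u t * w t) (λ t → A u t * wlo t)))
          (trans (sum-single _ u λ t n → trans (cong ((+ 2 * w u) *_) (unit-other n)) (*-zeroʳ (+ 2 * w u))) (trans (cong ((+ 2 * w u) *_) (unit-same u)) (*-identityʳ _)))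
          (sum-mono _ _ bound)
          where
          lem2 : ∀ a w w' → a * (w - w') ≡ a * w - a * w'
          lem2 = solve-∀

      -- Pairing `Y` with the rows of the low part of `w`. At a low vertex the row is exactly twice
      -- the weight, since equal levels are not adjacent. At a high vertex it is the row of all of
      -- `w` less the contribution of the high level, which is at most twice the weight.
      form-bound : + 2 * Wlo v lev Y - + 2 * Whi v lev Y + θ * yhi v lev Y ≤ form A wlo Y
      form-bound = subst₂ _≤_ eqˡ eqʳ (sum-mono _ _ λ u → term u (S u) refl)
        where
        f g h₀ : V N
        f u = if lo v lev u then w u * Y u else 0ℤ
        g u = if lo v lev u then 0ℤ else w u * Y u
        h₀ u = if lo v lev u then 0ℤ else Y u
        eqʳ : sum (λ u → Y u * row u wlo) ≡ form A wlo Y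
        eqʳ = sym (trans (form-T A wlo Y) (trans (form-≡M (λ t u → A-sym u t) Y wlo) (trans (form-def A Y wlo) (sum-cong-≗ λ u → sym (*-distribˡ-sum (Y u) (λ t → A u t * wlo t))))))
        lem : ∀ a b c d → + 2 * a + -[1+ 1 ] * b + d * c ≡ + 2 * a - + 2 * b + d * c
        lem = solve-∀
        eqˡ : sum (λ u → + 2 * f u + -[1+ 1 ] * g u + θ * h₀ u) ≡ + 2 * Wlo v lev Y - + 2 * Whi v lev Y + θ * yhi v lev Y
        eqˡ = trans (∑-distrib-+ (λ u → + 2 * f u + -[1+ 1 ] * g u) (λ u → θ * h₀ u))
          (trans (cong₂ _+_ (sum-lin (+ 2) -[1+ 1 ] f g) (sym (*-distribˡ-sum θ h₀))) (lem (sum f) (sum g) (sum h₀) θ))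
        term : ∀ u b → S u ≡ b → + 2 * f u + -[1+ 1 ] * g u + θ * h₀ u ≤ Y u * row u wlo
        term u false Su = ≤-reflexive (trans (cong₂ _+_ (cong₂ (λ a b → + 2 * a + -[1+ 1 ] * b) (if-zero (lo v lev u) (w*0 u Yu)) (if-zero' (lo v lev u) (w*0 u Yu))) (trans (cong (θ *_) (if-zero' (lo v lev u) Yu)) (*-zeroʳ θ)))
          (sym (cong (_* row u wlo) Yu)))
          where
          Yu = proj₁ (outside u Su)
        term u true Su = pick (hit u) (sym (hit-lo u Su)) (row-lo u) (λ hu → row-hi u hu Su) (Good.pos good u)
          where
          lem2 : ∀ w y θ → + 2 * (w * y) + -[1+ 1 ] * 0ℤ + θ * 0ℤ ≡ y * (+ 2 * w)
          lem2 = solve-∀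
          lem3 : ∀ w y θ → y * (θ - + 2 * w) ≡ + 2 * 0ℤ + -[1+ 1 ] * (w * y) + θ * y
          lem3 = solve-∀
          pick : ∀ h {b r c y} → b ≡ h → (h ≡ true → r ≡ + 2 * c) → (h ≡ false → θ - + 2 * c ≤ r) → 0ℤ ≤ y →
                 + 2 * (if b then c * y else 0ℤ) + -[1+ 1 ] * (if b then 0ℤ else c * y) + θ * (if b then 0ℤ else y) ≤ y * r
          pick true  {c = c} {y} refl h₁ _ _ = ≤-reflexive (trans (lem2 c y θ) (cong (y *_) (sym (h₁ refl))))
          pick false {r = r} {c} {y} refl _ h₂ p = subst (_≤ y * r) (lem3 c y θ) (*-monoˡ-≤-nonNeg y ⦃ nonNegative p ⦄ (h₂ refl))

      -- The level sums satisfy the discrete concavity W(m) + W(m+2) ≤ 2 W(m+1).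
      concave : Whi (1ℤ + v) lev⁺ Y⁺ ≤ + 2 * Whi v lev Y - Wlo v lev Y - θ * yhi v lev Y
      concave = by-diff (diff form-bound) (trans (lem (Wlo v lev Y) (Whi v lev Y) (θ * yhi v lev Y) (form A wlo Y)) (cong (λ z → + 2 * Whi v lev Y - Wlo v lev Y - θ * yhi v lev Y - z) (sym Whi⁺)))
        where
        lem : ∀ a b c f → f - (+ 2 * a - + 2 * b + c) ≡ + 2 * b - a - c - (a - f)
        lem = solve-∀

    module Phases (I : V N → V N → Set)
                  (I-cong : ∀ {l l' Z Z'} → l ≐ l' → Z ≐ Z' → I l Z → I l' Z')
                  (I-step : ∀ {l Z s} → S s ≡ true → Src S l s → Good l Z → I l Z → I (bump s l) (rfl s Z)) where

      -- Concavity preserves a drop, so the nonnegative low sum loses at least one per sweep and the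
      -- bound `n` shrinks with it. The case `zero` is contradictory: a simple root at a source must
      -- occur in an earlier sweep.
      falling : ∀ n {v lev Y} → Flat v lev → Good lev Y → I lev Y → 1ℤ + Whi v lev Y ≤ Wlo v lev Y → Wlo v lev Y ≤ + n → Reach S lev Y
      falling zero {v} {lev} flat g i d b = ⊥-elim (1≰0 (≤-trans (by-diff (Whi≥0 v lev (Good.pos g)) (lem (Whi v lev _))) (≤-trans d b)))
        where
        lem : ∀ a → a ≡ 1ℤ + a - 1ℤ
        lem = solve-∀
      falling (suc n) {v} {lev} {Y} flat g i d b = Round.Run.round lev Y v (Good.lvl g) (flat-low flat) I I-cong I-step next g i
        where
        open Step flat g
        open Round lev Y v (Good.lvl g) (flat-low flat)
        next : Good lev⁺ Y⁺ → I lev⁺ Y⁺ → Reach S lev⁺ Y⁺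
        next g⁺ i⁺ = falling n flat⁺ g⁺ i⁺
          (subst (1ℤ + Whi (1ℤ + v) lev⁺ Y⁺ ≤_) (sym Wlo⁺) (by-diff (0≤+ (0≤+ (diff concave) (diff d)) (0≤* θ≥0 (yhi≥0 v lev (Good.pos g)))) (lem1 (Whi (1ℤ + v) lev⁺ Y⁺) (Whi v lev Y) (Wlo v lev Y) (θ * yhi v lev Y))))
          (subst (_≤ + n) (sym Wlo⁺) (by-diff (0≤+ (diff d) (diff b)) (lem2 (Whi v lev Y) (Wlo v lev Y) (+ n))))
          where
          lem1 : ∀ h⁺ h l c → (+ 2 * h - l - c - h⁺) + (l - (1ℤ + h)) + c ≡ h - (1ℤ + h⁺)
          lem1 = solve-∀
          lem2 : ∀ h l n → (l - (1ℤ + h)) + (1ℤ + n - l) ≡ n - h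
          lem2 = solve-∀

      start-falling : ∀ {v lev Y} → Flat v lev → Good lev Y → I lev Y → 1ℤ + Whi v lev Y ≤ Wlo v lev Y → Reach S lev Y
      start-falling {v} {lev} {Y} flat g i d = falling ∣ Wlo v lev Y ∣ flat g i d (≤-reflexive (sym (0≤i⇒+∣i∣≡i (Wlo≥0 v lev (Good.pos g)))))

      -- With a positive surplus the increments of the sequence decrease by at least one per sweep,
      -- so after at most `n` sweeps the falling phase begins.
      rising : 1ℤ ≤ θ → ∀ n {v lev Y} → Flat v lev → Good lev Y → I lev Y → 1ℤ + Whi v lev Y ≤ Wlo v lev Y + + n → Reach S lev Y
      rising θ≥1 zero {v} {lev} {Y} flat g i b = start-falling flat g i (subst (1ℤ + Whi v lev Y ≤_) (+-identityʳ _) b)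
      rising θ≥1 (suc n) {v} {lev} {Y} flat g i b with ≤0-or-1≤ (Wlo v lev Y - Whi v lev Y)
      ... | inj₂ d = start-falling flat g i (by-diff (diff d) (lem (Wlo v lev Y) (Whi v lev Y)))
        where
        lem : ∀ l h → l - h - 1ℤ ≡ l - (1ℤ + h)
        lem = solve-∀
      ... | inj₁ d = Round.Run.round lev Y v (Good.lvl g) (flat-low flat) I I-cong I-step next g i
        where
        open Step flat g
        open Round lev Y v (Good.lvl g) (flat-low flat)
        -- If the high level carried nothing, its sum would be zero; as the low sum does not exceed
        -- it, `Y` would be zero.
        y≥1 : 1ℤ ≤ yhi v lev Y
        y≥1 with ≤0-or-1≤ (yhi v lev Y)
        ... | inj₂ p = p
        ... | inj₁ p = ⊥-elim (pos∧neg (Good.root g) (Good.pos g) λ t → ≤-reflexive (zero-at t))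
          where
          hi0 : ∀ t → (if lo v lev t then 0ℤ else Y t) ≡ 0ℤ
          hi0 = sum-nonneg-0 _ (λ t → if-0≤ (lo v lev t) ≤-refl (Good.pos g t)) (≤-antisym p (yhi≥0 v lev (Good.pos g)))
          Whi0 : Whi v lev Y ≡ 0ℤ
          Whi0 = sum-0 _ eq
            where
            eq : ∀ t → (if lo v lev t then 0ℤ else w t * Y t) ≡ 0ℤ
            eq t with lo v lev t | hi0 t
            ... | true  | _ = refl
            ... | false | q = w*0 t q
          lo0 : ∀ t → (if lo v lev t then w t * Y t else 0ℤ) ≡ 0ℤ
          lo0 = sum-nonneg-0 _ (λ t → if-0≤ (lo v lev t) (wY≥0 (Good.pos g) t) ≤-refl)
            (≤-antisym (subst (λ z → Wlo v lev Y ≤ z) Whi0 (by-diff (0≤neg d) (lem (Wlo v lev Y) (Whi v lev Y)))) (Wlo≥0 v lev (Good.pos g)))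
            where
            lem : ∀ l h → - (l - h) ≡ h - l
            lem = solve-∀
          zero-at : ∀ t → Y t ≡ 0ℤ
          zero-at t with lo v lev t | hi0 t | lo0 t
          ... | true  | _ | q = *≡0 q (1≤⇒≢0 (w≥1 t))
          ... | false | q | _ = q
        next : Good lev⁺ Y⁺ → I lev⁺ Y⁺ → Reach S lev⁺ Y⁺
        next g⁺ i⁺ = rising θ≥1 n flat⁺ g⁺ i⁺
          (subst (λ z → 1ℤ + Whi (1ℤ + v) lev⁺ Y⁺ ≤ z + + n) (sym Wlo⁺)
            (by-diff (0≤+ (0≤+ (diff concave) (diff b)) (diff (1≤* θ≥1 y≥1))) (lem1 (Whi (1ℤ + v) lev⁺ Y⁺) (Whi v lev Y) (Wlo v lev Y) (θ * yhi v lev Y) (+ n))))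
          where
          lem1 : ∀ h⁺ h l c n → (+ 2 * h - l - c - h⁺) + (l + (1ℤ + n) - (1ℤ + h)) + (c - 1ℤ) ≡ h + n - (1ℤ + h⁺)
          lem1 = solve-∀

      -- Each sweep lifts the minimum level by one without lifting the upper bound, so `n` counts
      -- how far the spread of levels exceeds one.
      flatten : ∀ n {v lev Y} → Low v lev → (∀ t → S t ≡ true → lev t ≤ 1ℤ + v + + n) → Good lev Y → I lev Y →
                (∀ {v lev Y} → Flat v lev → Good lev Y → I lev Y → Reach S lev Y) → Reach S lev Y
      flatten zero {v} {lev} low high g i fin = fin {v} flat g i
        where
        flat : Flat v lev
        flat t St with lev t ≟ℤ v
        ... | yes p = inj₁ p
        ... | no q = inj₂ (≤-antisym (subst (lev t ≤_) (+-identityʳ _) (high t St)) (<⇒1+≤ (≤∧≢⇒< (low t St) (q ∘ sym))))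
      flatten (suc n) {v} {lev} {Y} low high g i fin = Round.Run.round lev Y v (Good.lvl g) low I I-cong I-step next g i
        where
        open Round lev Y v (Good.lvl g) low
        low⁺ : Low (1ℤ + v) lev⁺
        low⁺ t St with hit t in ht
        ... | true = by-diff {c = 1ℤ} (+≤+ ℕ.z≤n) (trans (lem v) (cong (λ z → + 2 + z - (1ℤ + v)) (sym (proj₂ (hit⁻ t ht)))))
          where
          lem : ∀ v → 1ℤ ≡ + 2 + v - (1ℤ + v)
          lem = solve-∀
        ... | false = <⇒1+≤ (≤∧≢⇒< (low t St) λ p → case (trans (sym ht) (hit⁺ t St (sym p))))
          where
          case : false ≡ true → ⊥
          case ()
        high⁺ : ∀ t → S t ≡ true → lev⁺ t ≤ 1ℤ + (1ℤ + v) + + n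
        high⁺ t St with hit t in ht
        ... | true = by-diff {c = + n} (+≤+ ℕ.z≤n) (trans (lem v (+ n)) (cong (λ z → 1ℤ + (1ℤ + v) + + n - (+ 2 + z)) (sym (proj₂ (hit⁻ t ht)))))
          where
          lem : ∀ v n → n ≡ 1ℤ + (1ℤ + v) + n - (+ 2 + v)
          lem = solve-∀
        ... | false = subst (lev t ≤_) (lem v (+ n)) (high t St)
          where
          lem : ∀ v n → 1ℤ + v + (1ℤ + n) ≡ 1ℤ + (1ℤ + v) + n
          lem = solve-∀
        next : Good lev⁺ Y⁺ → I lev⁺ Y⁺ → Reach S lev⁺ Y⁺
        next g⁺ i⁺ = flatten n {1ℤ + v} low⁺ high⁺ g⁺ i⁺ fin

      from-anywhere : ∀ {lev Y} → Good lev Y → I lev Y → (∀ {v lev Y} → Flat v lev → Good lev Y → I lev Y → Reach S lev Y) → Reach S lev Y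
      from-anywhere {lev} g i fin = flatten (∣ L ∣ ℕ.+ ∣ L ∣) { - L} low high g i fin
        where
        L : ℤ
        L = sum λ t → + ∣ lev t ∣
        up : ∀ t → + ∣ lev t ∣ ≤ L
        up = sum-upper (λ t → + ∣ lev t ∣) λ t → +≤+ ℕ.z≤n
        L≡ : + ∣ L ∣ ≡ L
        L≡ = 0≤i⇒+∣i∣≡i (sum-nonneg (λ t → + ∣ lev t ∣) λ t → +≤+ ℕ.z≤n)
        abs-up : ∀ a → a ≤ + ∣ a ∣
        abs-up (+ n) = ≤-refl
        abs-up -[1+ n ] = Data.Integer.-≤+
        low : Low (- L) lev
        low t _ = subst (- L ≤_) (neg-involutive (lev t)) (neg-mono-≤ (≤-trans (subst (λ z → - lev t ≤ + z) (∣-i∣≡∣i∣ (lev t)) (abs-up (- lev t))) (up t)))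
        high : ∀ t → S t ≡ true → lev t ≤ 1ℤ + - L + + (∣ L ∣ ℕ.+ ∣ L ∣)
        high t _ = ≤-trans (≤-trans (abs-up (lev t)) (up t)) (by-diff {c = 1ℤ} (+≤+ ℕ.z≤n) (trans (lem L) (cong (λ z → 1ℤ + - L + z - L) (trans (cong₂ _+_ (sym L≡) (sym L≡)) (sym (pos-+ ∣ L ∣ ∣ L ∣))))))
          where
          lem : ∀ L → 1ℤ ≡ 1ℤ + - L + (L + L) - L
          lem = solve-∀

  -- δ is harmonic; subtracting a function that triples along a path towards s
  -- makes the weights strictly superharmonic away from s.
  module Strict (s : Fin N) where
    h : Fin N → ℕ
    h = proj₁ (conn s)

    H : ℕ
    H = ∣ sum (λ t → + h t) ∣

    h≤H : ∀ t → h t ℕ.≤ H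
    h≤H t = drop‿+≤+ (subst (+ h t ≤_) (sym (0≤i⇒+∣i∣≡i (sum-nonneg (λ t → + h t) λ _ → +≤+ ℕ.z≤n))) (sum-upper (λ t → + h t) (λ _ → +≤+ ℕ.z≤n) t))

    φ : V N
    φ t = + (3 ℕ.^ (H ℕ.∸ h t))

    -- `C` exceeds every value of `φ`, hence `η` is positive; the term with `δ` is harmonic and
    -- leaves the surplus untouched.
    C : ℤ
    C = 1ℤ + + (3 ℕ.^ H)

    η : V N
    η t = C * δ t + -1ℤ * φ t

    φ≥1 : ∀ t → 1ℤ ≤ φ t
    φ≥1 t = +≤+ (ℕₚ.m^n>0 3 (H ℕ.∸ h t))

    φ≤ : ∀ t → φ t ≤ + (3 ℕ.^ H)
    φ≤ t = +≤+ (ℕₚ.^-monoʳ-≤ 3 (ℕₚ.m∸n≤m H (h t)))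

    η≥1 : ∀ t → 1ℤ ≤ η t
    η≥1 t = by-diff (0≤+ (0≤* {C} (0≤+ {1ℤ} (+≤+ ℕ.z≤n) (+≤+ ℕ.z≤n)) (diff (δ≥1 t))) (diff (φ≤ t))) (lem (+ (3 ℕ.^ H)) (δ t) (φ t))
      where
      lem : ∀ c d f → (1ℤ + c) * (d - 1ℤ) + (c - f) ≡ (1ℤ + c) * d + -1ℤ * f - 1ℤ
      lem = solve-∀

    triple : ∀ {t u} → h u ℕ.< h t → + 3 * φ t ≤ φ u
    triple {t} {u} lt = subst (_≤ φ u) (pos-* 3 (3 ℕ.^ (H ℕ.∸ h t))) (+≤+ (ℕₚ.^-monoʳ-≤ 3 (ℕₚ.∸-monoʳ-< lt (h≤H t))))

    super : ∀ t → t ≢ s → 1ℤ ≤ row t η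
    super t t≢s with proj₂ (conn s) t t≢s
    ... | u , a , lt = subst (1ℤ ≤_) (sym (trans (row-lin t C -1ℤ δ φ) (trans (cong (λ z → C * z + -1ℤ * row t φ) (harm t)) (lem C (row t φ))))) (≤-trans (φ≥1 t) (by-diff (diff bound) (lem2 (row t φ) (φ t))))
      where
      lem : ∀ c r → c * 0ℤ + -1ℤ * r ≡ - r
      lem = solve-∀
      lem2 : ∀ r f → (- f) - r ≡ - r - f
      lem2 = solve-∀
      t≢u : t ≢ u
      t≢u refl = ℕₚ.<-irrefl refl lt
      term : ∀ x → A t x * φ x ≤ + 2 * φ t * unit t x + (- (+ 3 * φ t)) * unit u x
      term x = go (x ≟ t) (x ≟ u)
        where
        lem3 : ∀ f → + 2 * f ≡ + 2 * f * 1ℤ + (- (+ 3 * f)) * 0ℤ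
        lem3 = solve-∀
        lem4 : ∀ f → - (+ 3 * f) ≡ + 2 * f * 0ℤ + (- (+ 3 * f)) * 1ℤ
        lem4 = solve-∀
        lem5 : ∀ f → 0ℤ ≡ + 2 * f * 0ℤ + (- (+ 3 * f)) * 0ℤ
        lem5 = solve-∀
        lem6 : ∀ a f g → ((- a) - 1ℤ) * g + (g - + 3 * f) ≡ - (+ 3 * f) - a * g
        lem6 = solve-∀
        lem7 : ∀ a b → - (- a * b) ≡ a * b
        lem7 = solve-∀
        go : Dec (x ≡ t) → Dec (x ≡ u) → A t x * φ x ≤ + 2 * φ t * unit t x + (- (+ 3 * φ t)) * unit u x
        go (yes refl) _ = ≤-reflexive (trans (cong (_* φ t) (A-diag t)) (trans (lem3 (φ t)) (sym (cong₂ (λ a b → + 2 * φ t * a + (- (+ 3 * φ t)) * b) (unit-same t) (unit-other t≢u)))))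
        go (no n) (yes refl) = subst (A t x * φ x ≤_) (trans (lem4 (φ t)) (sym (cong₂ (λ a b → + 2 * φ t * a + (- (+ 3 * φ t)) * b) (unit-other n) (unit-same u))))
          (by-diff (0≤+ (0≤* (diff a) (1≤⇒0≤ (φ≥1 x))) (diff (triple lt))) (lem6 (A t x) (φ t) (φ x)))
        go (no n) (no m) = subst₂ _≤_ (lem7 (A t x) (φ x)) (trans (lem5 (φ t)) (sym (cong₂ (λ a b → + 2 * φ t * a + (- (+ 3 * φ t)) * b) (unit-other n) (unit-other m))))
          (neg≤0 (0≤* (0≤neg (A-off (n ∘ sym))) (1≤⇒0≤ (φ≥1 x))))
      sum-unit : ∀ y → sum (unit y) ≡ 1ℤ
      sum-unit y = trans (sum-single (unit y) y λ i n → unit-other n) (unit-same y)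
      lem8 : ∀ f → + 2 * f * 1ℤ + (- (+ 3 * f)) * 1ℤ ≡ - f
      lem8 = solve-∀
      bound : row t φ ≤ - φ t
      bound = subst (row t φ ≤_) (trans (sum-lin (+ 2 * φ t) (- (+ 3 * φ t)) (unit t) (unit u)) (trans (cong₂ (λ a b → + 2 * φ t * a + (- (+ 3 * φ t)) * b) (sum-unit t) (sum-unit u)) (lem8 (φ t))))
        (sum-mono _ _ term)

  -- Omitting one vertex leaves finite type. The strictly superharmonic weights of `Strict` then
  -- make every positive root supported there reach a simple one.
  reach-proper : ∀ {S s lev Y} → S s ≡ false → Schedule.Good S lev Y → Reach S lev Y
  reach-proper {S} {s} Ss good = from-anywhere good tt λ {v} {lev} {Y} flat g i →
      -- The fuel `Whi + 1` bounds the initial increment, because the low sum is nonnegative.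
      rising (+≤+ (ℕ.s≤s ℕ.z≤n)) (∣ Whi v lev Y ∣ ℕ.+ 1) flat g i (by-diff (Wlo≥0 v lev (Schedule.Good.pos g)) (lem v lev Y (Schedule.Good.pos g)))
    where
    super' : ∀ u → S u ≡ true → 1ℤ ≤ row u (Strict.η s)
    super' u Su = Strict.super s u λ { refl → case (trans (sym Ss) Su) }
      where
      case : false ≡ true → ⊥
      case ()
    open Potential S (Strict.η s) (Strict.η≥1 s) 1ℤ (+≤+ ℕ.z≤n) super'
    open Phases (λ _ _ → ⊤) (λ _ _ _ → tt) (λ _ _ _ _ → tt)
    lem : ∀ v lev Y → Pos Y → Wlo v lev Y ≡ Wlo v lev Y + + (∣ Whi v lev Y ∣ ℕ.+ 1) - (1ℤ + Whi v lev Y)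
    lem v lev Y p = trans (lem' (Wlo v lev Y) (Whi v lev Y)) (cong (λ z → Wlo v lev Y + z - (1ℤ + Whi v lev Y)) (sym (trans (pos-+ ∣ Whi v lev Y ∣ 1) (cong (_+ 1ℤ) (0≤i⇒+∣i∣≡i (Whi≥0 v lev p))))))
      where
      lem' : ∀ a h → a ≡ a + (h + 1ℤ) - (1ℤ + h)
      lem' = solve-∀

  full : Sub N
  full _ = true

  supp-full : ∀ {x : V N} → Supp full x
  supp-full t ()

  rfl-δ : ∀ s → rfl s δ ≐ δ
  rfl-δ s t = trans (cong (λ z → 1ℤ * δ t + (- z) * unit s t) (harm s)) (lem (δ t) (unit s t))
    where
    lem : ∀ d u → 1ℤ * d + (- 0ℤ) * u ≡ d
    lem = solve-∀

  -- The weight `δ` has surplus zero, so a drop can only be preserved and not created. Positive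
  -- defect is precisely such a drop, and it survives reflections because `δ` is fixed by them.
  reach-affine : ∀ {lev Y} → Schedule.Good full lev Y → 1ℤ ≤ E lev δ Y → Reach full lev Y
  reach-affine good ∂ = from-anywhere good ∂ λ {v} {lev} {Y} flat g i → start-falling flat g i (by-diff (diff (subst (1ℤ ≤_) (defect flat g) i)) (lem (Wlo v lev Y) (Whi v lev Y)))
    where
    open Potential full δ δ≥1 0ℤ ≤-refl (λ u _ → ≤-reflexive (sym (harm u)))
    lem : ∀ a b → a - b - 1ℤ ≡ a - (1ℤ + b)
    lem = solve-∀
    I : V N → V N → Set
    I lev Y = 1ℤ ≤ E lev δ Y
    I-cong : ∀ {l l' Z Z'} → l ≐ l' → Z ≐ Z' → I l Z → I l' Z'
    I-cong {l} {l'} {Z} {Z'} p q = subst (1ℤ ≤_) (trans (E-cong p δ Z) (form-cong (e l') (λ _ → refl) q))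
    I-step : ∀ {l Z s} → full s ≡ true → Src full l s → Schedule.Good full l Z → I l Z → I (bump s l) (rfl s Z)
    I-step {l} {Z} {s} Ss src g = subst (1ℤ ≤_) (sym (trans (form-cong (e (bump s l)) (λ t → sym (rfl-δ s t)) (λ _ → refl)) (E-rfl {full} src Ss supp-full supp-full)))
    open Phases I I-cong I-step
    -- On flat levels the column sums of the Euler matrix against `δ` are `δ u` at low vertices and,
    -- by harmonicity, `- δ u` at high ones.
    defect : ∀ {v lev Y} → Flat v lev → Schedule.Good full lev Y → E lev δ Y ≡ Wlo v lev Y - Whi v lev Y
    defect {v} {lev} {Y} flat g = trans (form-T (e lev) δ Y) (trans (form-def (λ t u → e lev u t) Y δ) (trans (sum-cong-≗ term) (sum-- (λ u → if lo v lev u then δ u * Y u else 0ℤ) (λ u → if lo v lev u then 0ℤ else δ u * Y u))))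
      where
      col : ∀ u → sum (λ t → Y u * (e lev t u * δ t)) ≡ Y u * sum (λ t → e lev t u * δ t)
      col u = sym (*-distribˡ-sum (Y u) (λ t → e lev t u * δ t))
      low-col : ∀ u → lev u ≡ v → sum (λ t → e lev t u * δ t) ≡ δ u
      low-col u p = trans (sum-single _ u λ t n → trans (cong (_* δ t) (e-down lev n λ l → <⇒≱ l (subst (_≤ lev t) (sym p) (flat-low flat t refl)))) (*-zeroˡ (δ t)))
        (trans (cong (_* δ u) (e-diag lev u)) (*-identityˡ (δ u)))
      high-col : ∀ u → lev u ≡ 1ℤ + v → sum (λ t → e lev t u * δ t) ≡ - δ u
      high-col u p = trans (sum-cong-≗ λ t → trans (cong (_* δ t) (e-entry t)) (lem2 (A u t) (unit u t) (δ t))) (trans (sum-- (λ t → A u t * δ t) (λ t → unit u t * δ t))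
        (trans (cong₂ _-_ (harm u) (trans (sum-single _ u λ t n → trans (cong (_* δ t) (unit-other n)) (*-zeroˡ (δ t))) (trans (cong (_* δ u) (unit-same u)) (*-identityˡ (δ u))))) (+-identityˡ (- δ u))))
        where
        lem2 : ∀ a b d → (a - b) * d ≡ a * d - b * d
        lem2 = solve-∀
        e-entry : ∀ t → e lev t u ≡ A u t - unit u t
        e-entry t = go (t ≟ u)
          where
          go : Dec (t ≡ u) → e lev t u ≡ A u t - unit u t
          go (yes refl) = trans (e-diag lev t) (sym (cong₂ _-_ (A-diag t) (unit-same t)))
          go (no n) = trans off (sym (trans (cong (λ z → A u t - z) (unit-other n)) (+-identityʳ _)))
            where
            off : e lev t u ≡ A u t
            off with flat t refl
            ... | inj₁ q = trans (e-up lev (subst₂ _<_ (sym q) (sym p) (suc[i]≤j⇒i<j {v} ≤-refl))) (A-sym t u)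
            ... | inj₂ q with Schedule.Good.lvl g t u refl refl n
            ...   | inj₁ z = trans (e-nonadj lev n z) (trans (sym z) (A-sym t u))
            ...   | inj₂ (inj₁ z) = ⊥-elim (1+≢ z (trans p (sym q)))
            ...   | inj₂ (inj₂ z) = ⊥-elim (1+≢ z (trans q (sym p)))
      term : ∀ u → sum (λ t → Y u * (e lev t u * δ t)) ≡ (if lo v lev u then δ u * Y u else 0ℤ) - (if lo v lev u then 0ℤ else δ u * Y u)
      term u with flat u refl
      ... | inj₁ p = trans (col u) (trans (cong (Y u *_) (low-col u p)) (pick (lo-yes {v} {lev} {u} p)))
        where
        lem3 : ∀ y d → y * d ≡ d * y - 0ℤ
        lem3 = solve-∀
        pick : ∀ {b} → b ≡ true → Y u * δ u ≡ (if b then δ u * Y u else 0ℤ) - (if b then 0ℤ else δ u * Y u)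
        pick refl = lem3 (Y u) (δ u)
      ... | inj₂ p = trans (col u) (trans (cong (Y u *_) (high-col u p)) (pick (lo-no {v} {lev} {u} (1+≢ p))))
        where
        lem3 : ∀ y d → y * - d ≡ 0ℤ - d * y
        lem3 = solve-∀
        pick : ∀ {b} → b ≡ false → Y u * - δ u ≡ (if b then δ u * Y u else 0ℤ) - (if b then 0ℤ else δ u * Y u)
        pick refl = lem3 (Y u) (δ u)

  -- Coherent families, duality and frames.

  Sgn-cong : ∀ b {x y : V N} → x ≐ y → Sgn b x → Sgn b y
  Sgn-cong true  p s t = subst (0ℤ ≤_) (p t) (s t)
  Sgn-cong false p s t = subst (_≤ 0ℤ) (p t) (s t)

  coh-cong : ∀ {G β β' T} → (∀ i → T i ≡ true → β i ≐ β' i) → Coherent G β T → Coherent G β' T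
  coh-cong p P = record { c = c ; col = λ i Ti → Sgn-cong (c i) (p i Ti) (col i Ti) ; ok = ok }
    where open Coherent P

  Sgn-opp : ∀ b {x : V N} → Sgn b x → Sgn (opp b) (neg x)
  Sgn-opp true  s = neg-pos s
  Sgn-opp false s = pos-neg s

  coh-dual : ∀ {G β T} → Coherent G β T → Coherent (G ᵀ) (λ i → neg (β i)) T
  coh-dual P = record { c = λ i → opp (c i) ; col = λ i Ti → Sgn-opp (c i) (col i Ti) ; ok = λ i j Ti Tj n → OK-opp (c j) (c i) (ok j i Tj Ti (n ∘ sym)) }
    where open Coherent P

  ord-bound : (ord : Fin N → ℕ) → Σ ℕ λ L → ∀ t → ord t ℕ.≤ L
  ord-bound ord = ∣ sum (λ t → + ord t) ∣ , λ t → drop‿+≤+ (subst (+ ord t ≤_) (sym (0≤i⇒+∣i∣≡i (sum-nonneg (λ t → + ord t) λ _ → +≤+ ℕ.z≤n))) (sum-upper (λ t → + ord t) (λ _ → +≤+ ℕ.z≤n) t))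

  ord-dual : ∀ {G : M N} {T : Sub N} → Ord G T → Ord (G ᵀ) T
  ord-dual {G} {T} (ord , h) = (λ i → proj₁ (ord-bound ord) ℕ.∸ ord i) , λ i j Ti Tj n g → ℕₚ.∸-monoʳ-< (h j i Tj Ti (n ∘ sym) g) (proj₂ (ord-bound ord) i)

  Link : V N → M N → (Fin N → V N) → Sub N → Set
  Link lev G β T = ∀ i j → T i ≡ true → T j ≡ true → E lev (β i) (β j) ≡ G i j

  link-dual : ∀ {lev G β T} → Link lev G β T → Link (neg lev) (G ᵀ) (λ i → neg (β i)) T
  link-dual {lev} {β = β} l i j Ti Tj = trans (form-neg-neg (e (neg lev)) (β i) (β j)) (trans (E-neg lev (β i) (β j)) (l j i Tj Ti))

  lvl-neg : ∀ {S lev} → Lvl S lev → Lvl S (neg lev)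
  lvl-neg lvl t u St Su n = go (lvl t u St Su n)
    where
    lem : ∀ a → - a ≡ 1ℤ + - (1ℤ + a)
    lem = solve-∀
    flip : ∀ {a b} → b ≡ 1ℤ + a → - a ≡ 1ℤ + - b
    flip {a} refl = lem a
    go : ∀ {a b c} → a ⊎ (b ≡ 1ℤ + c) ⊎ (c ≡ 1ℤ + b) → a ⊎ (- b ≡ 1ℤ + - c) ⊎ (- c ≡ 1ℤ + - b)
    go (inj₁ p) = inj₁ p
    go (inj₂ (inj₁ p)) = inj₂ (inj₂ (flip p))
    go (inj₂ (inj₂ p)) = inj₂ (inj₁ (flip p))

  -- Along the order, all earlier coordinates already vanish, so the column sum at `j` reduces to
  -- `x j` and the hypothesis reads that its square is zero.
  triangular : ∀ {G : M N} → (∀ i → G i i ≡ 1ℤ) → Ord G full → (x : V N) → (∀ j → x j * sum (λ i → x i * G i j) ≡ 0ℤ) → ∀ j → x j ≡ 0ℤ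
  triangular {G} diag (ord , h) x e j = go j (ℕᵢ.<-wellFounded (ord j))
    where
    go : ∀ j → Acc ℕ._<_ (ord j) → x j ≡ 0ℤ
    go j (acc rs) = sq≡0 (trans (cong (x j *_) (sym (trans (sum-single _ j other) (trans (cong (x j *_) (diag j)) (*-identityʳ (x j)))))) (e j))
      where
      other : ∀ i → i ≢ j → x i * G i j ≡ 0ℤ
      other i n with G i j ≟ℤ 0ℤ
      ... | yes p = trans (cong (x i *_) p) (*-zeroʳ (x i))
      ... | no p = cong (_* G i j) (go i (rs (h i j refl refl n p)))

  A-δ : ∀ x → form A δ x ≡ 0ℤ
  A-δ x = trans (form-T A δ x) (trans (form-≡M (λ t u → A-sym u t) x δ) (trans (form-def A x δ) (sum-0 _ λ t → trans (sym (*-distribˡ-sum (x t) (λ u → A t u * δ u))) (trans (cong (x t *_) (harm t)) (*-zeroʳ (x t))))))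

  E-δ : ∀ {lev} → Lvl full lev → ∀ x → E lev x δ ≡ - E lev δ x
  E-δ {lev} lvl x = move (trans (lvl-sep lvl {δ} {x} supp-full supp-full) (A-δ x))
    where
    lem : ∀ a b → b ≡ (a + b) - a
    lem = solve-∀
    move : ∀ {a b} → a + b ≡ 0ℤ → b ≡ - a
    move {a} {b} p = trans (lem a b) (trans (cong (_- a) p) (+-identityˡ (- a)))

  E-δδ : ∀ {lev} → Lvl full lev → E lev δ δ ≡ 0ℤ
  E-δδ {lev} lvl = half (trans (lvl-sep lvl {δ} {δ} supp-full supp-full) (A-δ δ))
    where
    lem : ∀ a → + 2 * a ≡ a + a
    lem = solve-∀
    half : ∀ {a} → a + a ≡ 0ℤ → a ≡ 0ℤ
    half {a} p = *≡0 {+ 2} (trans (lem a) p) λ ()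

  record Frame (lev : V N) (G : M N) (β : Fin N → V N) (d : V N) : Set where
    field
      lvl  : Lvl full lev
      diag : ∀ i → G i i ≡ 1ℤ
      link : Link lev G β full
      ord  : Ord G full
      coh  : Coherent G β full
      span : comb d β ≐ δ

  frame-dual : ∀ {lev G β d} → Frame lev G β d → Frame (neg lev) (G ᵀ) (λ i → neg (β i)) (neg d)
  frame-dual {β = β} {d} F = record
    { lvl = lvl-neg lvl ; diag = diag ; link = link-dual link ; ord = ord-dual ord ; coh = coh-dual coh
    ; span = λ t → trans (sum-cong-≗ λ j → lem (d j) (β j t)) (span t) }
    where
    open Frame F
    lem : ∀ a b → - a * - b ≡ a * b
    lem = solve-∀

  -- Existence of a member of negative defect.

  module Defect {lev : V N} {G : M N} {β : Fin N → V N} {d : V N} (F : Frame lev G β d) where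
    open Frame F
    open Coherent coh

    ∂ : V N
    ∂ i = E lev δ (β i)

    ∂-sum : ∀ j → ∂ j ≡ sum λ i → d i * G i j
    ∂-sum j = trans (form-cong (e lev) (λ t → sym (span t)) (λ _ → refl)) (trans (form-combˡ (e lev) d β (β j)) (sum-cong-≗ λ i → cong (d i *_) (link i j refl refl)))

    ∂-sum' : ∀ i → - ∂ i ≡ sum λ j → d j * G i j
    ∂-sum' i = trans (sym (E-δ lvl (β i))) (trans (form-cong (e lev) (λ _ → refl) (λ t → sym (span t))) (trans (form-combʳ (e lev) d β (β i)) (sum-cong-≗ λ j → cong (d j *_) (link i j refl refl))))

    total : sum (λ i → d i * ∂ i) ≡ 0ℤ
    total = trans (sym (form-combʳ (e lev) d β δ)) (trans (form-cong (e lev) (λ _ → refl) span) (E-δδ lvl))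

    E-comb : ∀ x → E lev (comb x β) (comb x β) ≡ sum λ i → sum λ j → x i * (x j * G i j)
    E-comb x = trans (form-combˡ (e lev) x β (comb x β)) (sum-cong-≗ λ i → trans (cong (x i *_) (trans (form-combʳ (e lev) x β (β i)) (sum-cong-≗ λ j → cong (x j *_) (link i j refl refl))))
      (*-distribˡ-sum (x i) (λ j → x j * G i j)))

    independent : ∀ x → (∀ t → comb x β t ≡ 0ℤ) → ∀ i → x i ≡ 0ℤ
    independent x z = triangular diag ord x λ j → trans (cong (x j *_) (trans (sum-cong-≗ λ i → cong (x i *_) (sym (link i j refl refl))) (trans (sym (form-combˡ (e lev) x β (β j))) (zero-form j)))) (*-zeroʳ (x j))
      where
      zero-form : ∀ j → E lev (comb x β) (β j) ≡ 0ℤ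
      zero-form j = trans (form-def (e lev) (comb x β) (β j)) (sum-0 _ λ t → sum-0 _ λ u → cong (_* (e lev t u * β j u)) (z t))

    -- An isotropic combination is a multiple of `δ`, which is itself `comb d β`; independence of
    -- the members lets the coefficients be compared. The factors `K` and `κ o` clear the
    -- denominator of the ratio.
    proportional : ∀ x → form A (comb x β) (comb x β) ≡ 0ℤ → ∀ i → K * x i ≡ (κ o * comb x β o) * d i
    proportional x iso i = i-j≡0⇒i≡j _ _ (trans (lem K (x i) C (d i)) (independent (λ i → K * x i + (- C) * d i) z i))
      where
      C : ℤ
      C = κ o * comb x β o
      lem : ∀ k x c d → k * x - c * d ≡ k * x + (- c) * d
      lem = solve-∀
      lem2 : ∀ k x c d b → (k * x + (- c) * d) * b ≡ k * (x * b) + (- c) * (d * b)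
      lem2 = solve-∀
      lem3 : ∀ q d v → (q * d) * v + (- (q * v)) * d ≡ 0ℤ
      lem3 = solve-∀
      z : ∀ t → comb (λ i → K * x i + (- C) * d i) β t ≡ 0ℤ
      z t = trans (sum-cong-≗ λ j → lem2 K (x j) C (d j) (β j t)) (trans (sum-lin K (- C) (λ j → x j * β j t) (λ j → d j * β j t))
        (trans (cong₂ (λ p q → K * p + (- C) * q) {x = comb x β t} refl (span t))
          (trans (cong₂ (λ p q → p * comb x β t + (- q) * δ t) (sym (κδ t)) (sym (isotropic (comb x β) iso o t))) (lem3 (κ t) (δ t) (comb x β t)))))

    d≢0 : ¬ (∀ i → d i ≡ 0ℤ)
    d≢0 z = 1≤⇒≢0 (δ≥1 o) (trans (sym (span o)) (sum-0 _ λ j → cong (_* β j o) (z j)))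

    -- The products sum to the defect of `δ`, which is zero. Nonnegative products would all vanish,
    -- and triangularity would then give `d = 0`.
    nonneg-zero : (∀ i → 0ℤ ≤ d i * ∂ i) → ⊥
    nonneg-zero p = d≢0 (triangular diag ord d λ j → trans (cong (d j *_) (sym (∂-sum j))) (sum-nonneg-0 _ p total j))

    a : V N
    a i = if c i then d i ⊔ 0ℤ else 0ℤ

    a-true : ∀ {i} → c i ≡ true → a i ≡ d i ⊔ 0ℤ
    a-true p rewrite p = refl

    a-false : ∀ {i} → c i ≡ false → a i ≡ 0ℤ
    a-false p rewrite p = refl

    a≥0 : ∀ i → 0ℤ ≤ a i
    a≥0 i with c i
    ... | true  = i≤j⊔i (d i) 0ℤ
    ... | false = ≤-refl

    va : V N
    va = comb a β

    va-pos : Pos va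
    va-pos t = sum-nonneg _ term
      where
      term : ∀ j → 0ℤ ≤ a j * β j t
      term j with c j | col j refl
      ... | true  | p = 0≤* (i≤j⊔i (d j) 0ℤ) (p t)
      ... | false | _ = ≤-refl

    module _ (∂≥0 : ∀ i → 0ℤ ≤ ∂ i) where
      -- a keeps the coefficients of d that are positive on positive members;
      -- by coherence the coefficients dropped only increase each pairing.
      dominated : ∀ i j → a i * (a j * G i j) ≤ a i * (d j * G i j)
      dominated i j = go (c i) refl (c j) refl (i ≟ j)
        where
        lem : ∀ x y g → (x - y) * (- g) ≡ y * g - x * g
        lem = solve-∀
        go : ∀ b → c i ≡ b → ∀ b' → c j ≡ b' → Dec (i ≡ j) → a i * (a j * G i j) ≤ a i * (d j * G i j)
        go false ci _ _ _ = ≤-reflexive (trans (cong (_* (a j * G i j)) (a-false ci)) (sym (cong (_* (d j * G i j)) (a-false ci))))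
        go true ci _ _ (yes refl) with ≤-total (d i) 0ℤ
        ... | inj₁ p = ≤-reflexive (trans (cong (_* (a i * G i i)) z) (sym (cong (_* (d i * G i i)) z)))
          where
          z : a i ≡ 0ℤ
          z = trans (a-true ci) (i≤j⇒i⊔j≡j p)
        ... | inj₂ p = ≤-reflexive (cong (λ z → a i * (z * G i i)) (trans (a-true ci) (i≥j⇒i⊔j≡i p)))
        go true ci b' cj (no n) = *-monoˡ-≤-nonNeg (a i) ⦃ nonNegative (a≥0 i) ⦄ (inner b' cj (subst₂ (λ b b' → OK b b' (G i j)) ci cj (ok i j refl refl n)))
          where
          inner : ∀ b' → c j ≡ b' → OK true b' (G i j) → a j * G i j ≤ d j * G i j
          inner true cj g = by-diff (0≤* (diff (subst (d j ≤_) (sym (a-true cj)) (i≤i⊔j (d j) 0ℤ))) (0≤neg g)) (lem (a j) (d j) (G i j))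
          inner false cj g = ≤-reflexive (trans (cong (a j *_) g) (trans (*-zeroʳ (a j)) (sym (trans (cong (d j *_) g) (*-zeroʳ (d j))))))

      E-va≤0 : E lev va va ≤ 0ℤ
      E-va≤0 = subst (_≤ 0ℤ) (sym (E-comb a)) (≤-trans (sum-mono _ _ λ i → sum-mono _ _ (dominated i)) (sum-nonpos _ term))
        where
        lem : ∀ x y → x * - y ≡ - (x * y)
        lem = solve-∀
        term : ∀ i → sum (λ j → a i * (d j * G i j)) ≤ 0ℤ
        term i = subst (_≤ 0ℤ) (sym (trans (sym (*-distribˡ-sum (a i) (λ j → d j * G i j))) (trans (cong (a i *_) (sym (∂-sum' i))) (lem (a i) (∂ i))))) (neg≤0 (0≤* (a≥0 i) (∂≥0 i)))

      iso : form A va va ≡ 0ℤ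
      iso = ≤-antisym (subst (_≤ 0ℤ) (lvl-sep lvl {va} {va} supp-full supp-full) (+-mono-≤ E-va≤0 E-va≤0)) (psd va)

      -- The vector `va` has nonpositive Euler norm, hence is isotropic, and its coefficients are a
      -- nonnegative multiple of `d`. A positive factor would make all of `d` nonnegative, against
      -- `nonneg-zero`; so the factor is zero and `a` vanishes.
      positives : ∀ i → c i ≡ true → d i ≤ 0ℤ
      positives i ci with ≤0-or-1≤ (κ o * va o)
      ... | inj₁ p = ≤-trans (i≤i⊔j (d i) 0ℤ) (≤-reflexive (trans (sym (a-true ci)) (*≡0 (trans (proportional a iso i) (trans (cong (_* d i) C≡0) (*-zeroˡ (d i)))) (1≤⇒≢0 K≥1))))
        where
        C≡0 : κ o * va o ≡ 0ℤ
        C≡0 = ≤-antisym p (0≤* (1≤⇒0≤ (κ≥1 o)) (va-pos o))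
      ... | inj₂ p = ⊥-elim (nonneg-zero λ i → 0≤* (d≥0 i) (∂≥0 i))
        where
        d≥0 : ∀ i → 0ℤ ≤ d i
        d≥0 i = *-cancelˡ-≤-pos 0ℤ (d i) (κ o * va o) ⦃ positive (<-≤-trans (+<+ (ℕ.s≤s ℕ.z≤n)) p) ⦄
          (subst₂ _≤_ (sym (*-zeroʳ (κ o * va o))) (proportional a iso i) (0≤* (1≤⇒0≤ K≥1) (a≥0 i)))

  -- Were all defects nonnegative, `positives` for the frame and for its dual would give `d` the
  -- sign opposite to each member, so the positive vector `comb d β`, namely `δ`, would have only
  -- nonpositive contributions.
  negative-defect : ∀ {lev G β d} → Frame lev G β d → ∃ λ i → 1ℤ ≤ - E lev δ (β i)
  negative-defect {lev} {G} {β} {d} F with all? (λ i → 0ℤ ≤? E lev δ (β i))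
  ... | no ¬p with ¬∀⟶∃¬ N _ (λ i → 0ℤ ≤? E lev δ (β i)) ¬p
  ...   | i , q = i , 0<⇒1≤ (neg-mono-< (≰⇒> q))
  negative-defect {lev} {G} {β} {d} F | yes ∂≥0 = ⊥-elim (1≰0 (≤-trans (δ≥1 o) (subst (_≤ 0ℤ) (span o) (sum-nonpos _ term))))
    where
    open Frame F
    open Coherent coh
    ∂ᵈ≥0 : ∀ i → 0ℤ ≤ E (neg lev) δ (neg (β i))
    ∂ᵈ≥0 i = subst (0ℤ ≤_) (sym (trans (form-negʳ (e (neg lev)) δ (β i)) (trans (cong -_ (trans (E-neg lev δ (β i)) (E-δ lvl (β i)))) (neg-involutive _)))) (∂≥0 i)
    term : ∀ j → d j * β j o ≤ 0ℤ
    term j with c j in cj | col j refl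
    ... | true | p = subst (_≤ 0ℤ) (lem (d j) (β j o)) (neg≤0 (0≤* (0≤neg (Defect.positives F ∂≥0 j cj)) (p o)))
      where
      lem : ∀ a b → - (- a * b) ≡ a * b
      lem = solve-∀
    ... | false | p = subst (_≤ 0ℤ) (lem (d j) (β j o)) (neg≤0 (0≤* (subst (0ℤ ≤_) (neg-involutive (d j)) (0≤neg (Defect.positives (frame-dual F) ∂ᵈ≥0 j (cong opp cj)))) (0≤neg (p o))))
      where
      lem : ∀ a b → - (a * - b) ≡ a * b
      lem = solve-∀

  -- Mutation of a family of roots.

  module Mutation (G : M N) (k : Fin N) (diag : ∀ i → G i i ≡ 1ℤ) where
    r : V N
    r i = (- G i k) ⊔ 0ℤ

    opaque
      sg ρ : V N
      sg i with i ≟ k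
      ... | yes _ = -1ℤ
      ... | no _  = 1ℤ
      ρ i with i ≟ k
      ... | yes _ = 0ℤ
      ... | no _  = r i

      sg-k : sg k ≡ -1ℤ
      sg-k with k ≟ k
      ... | yes _ = refl
      ... | no q = ⊥-elim (q refl)

      ρ-k : ρ k ≡ 0ℤ
      ρ-k with k ≟ k
      ... | yes _ = refl
      ... | no q = ⊥-elim (q refl)

      sg-o : ∀ {i} → i ≢ k → sg i ≡ 1ℤ
      sg-o {i} n with i ≟ k
      ... | yes q = ⊥-elim (n q)
      ... | no _ = refl

      ρ-o : ∀ {i} → i ≢ k → ρ i ≡ r i
      ρ-o {i} n with i ≟ k
      ... | yes q = ⊥-elim (n q)
      ... | no _ = refl

    r≥0 : ∀ i → 0ℤ ≤ r i
    r≥0 i = i≤j⊔i (- G i k) 0ℤ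

    r-neg : ∀ {i} → G i k ≤ 0ℤ → r i ≡ - G i k
    r-neg p = i≥j⇒i⊔j≡i (0≤neg p)

    r-pos : ∀ {i} → 0ℤ ≤ G i k → r i ≡ 0ℤ
    r-pos p = i≤j⇒i⊔j≡j (neg≤0 p)

    r≥1 : ∀ {i} → 1ℤ ≤ r i → r i ≡ - G i k
    r≥1 {i} p with ≤-total (G i k) 0ℤ
    ... | inj₁ q = r-neg q
    ... | inj₂ q = ⊥-elim (1≰0 (subst (1ℤ ≤_) (r-pos q) p))

    G' : M N
    G' i j = sg i * sg j * G i j + sg i * ρ j * G i k + ρ i * sg j * G k j + ρ i * ρ j * G k k

    -- The mutation rule of c-vectors at a positive member. Writing it with the scalars `sg` and `ρ`
    -- treats the index `k` and the others uniformly, so Gram entries transform by plain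
    -- bilinearity.
    mut : (Fin N → V N) → Fin N → V N
    mut β i t = sg i * β i t + ρ i * β k t

    mut-k : ∀ β t → mut β k t ≡ - β k t
    mut-k β t = trans (cong₂ (λ a b → a * β k t + b * β k t) sg-k ρ-k) (lem (β k t))
      where
      lem : ∀ a → -1ℤ * a + 0ℤ * a ≡ - a
      lem = solve-∀

    mut-o : ∀ β {i} → i ≢ k → ∀ t → mut β i t ≡ β i t + r i * β k t
    mut-o β {i} n t = trans (cong₂ (λ a b → a * β i t + b * β k t) (sg-o n) (ρ-o n)) (cong (_+ r i * β k t) (*-identityˡ (β i t)))

    mut-r0 : ∀ β {i} → i ≢ k → r i ≡ 0ℤ → mut β i ≐ β i
    mut-r0 β {i} n p t = trans (mut-o β n t) (trans (cong (λ z → β i t + z * β k t) p) (lem (β i t) (β k t)))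
      where
      lem : ∀ a b → a + 0ℤ * b ≡ a
      lem = solve-∀

    G'-oo : ∀ {i j} → i ≢ k → j ≢ k → G' i j ≡ G i j + r j * G i k + r i * G k j + r i * r j
    G'-oo {i} {j} n m = trans (cong₂ (λ p q → p * q * G i j + p * ρ j * G i k + ρ i * q * G k j + ρ i * ρ j * G k k) (sg-o n) (sg-o m))
      (trans (cong₂ (λ p q → 1ℤ * 1ℤ * G i j + 1ℤ * q * G i k + p * 1ℤ * G k j + p * q * G k k) (ρ-o n) (ρ-o m))
        (trans (cong (λ z → 1ℤ * 1ℤ * G i j + 1ℤ * r j * G i k + r i * 1ℤ * G k j + r i * r j * z) (diag k)) (lem (G i j) (G i k) (G k j) (r i) (r j))))
      where
      lem : ∀ a b c x y → 1ℤ * 1ℤ * a + 1ℤ * y * b + x * 1ℤ * c + x * y * 1ℤ ≡ a + y * b + x * c + x * y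
      lem = solve-∀

    G'-ok : ∀ {i} → i ≢ k → G' i k ≡ - G i k - r i
    G'-ok {i} n = trans (cong₂ (λ p q → p * q * G i k + p * ρ k * G i k + ρ i * q * G k k + ρ i * ρ k * G k k) (sg-o n) sg-k)
      (trans (cong₂ (λ p q → 1ℤ * -1ℤ * G i k + 1ℤ * q * G i k + p * -1ℤ * G k k + p * q * G k k) (ρ-o n) ρ-k)
        (trans (cong (λ z → 1ℤ * -1ℤ * G i k + 1ℤ * 0ℤ * G i k + r i * -1ℤ * z + r i * 0ℤ * z) (diag k)) (lem (G i k) (r i))))
      where
      lem : ∀ a x → 1ℤ * -1ℤ * a + 1ℤ * 0ℤ * a + x * -1ℤ * 1ℤ + x * 0ℤ * 1ℤ ≡ - a - x
      lem = solve-∀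

    G'-ko : ∀ {j} → j ≢ k → G' k j ≡ - G k j - r j
    G'-ko {j} n = trans (cong₂ (λ p q → p * q * G k j + p * ρ j * G k k + ρ k * q * G k j + ρ k * ρ j * G k k) sg-k (sg-o n))
      (trans (cong₂ (λ p q → -1ℤ * 1ℤ * G k j + -1ℤ * q * G k k + p * 1ℤ * G k j + p * q * G k k) ρ-k (ρ-o n))
        (trans (cong (λ z → -1ℤ * 1ℤ * G k j + -1ℤ * r j * z + 0ℤ * 1ℤ * G k j + 0ℤ * r j * z) (diag k)) (lem (G k j) (r j))))
      where
      lem : ∀ a x → -1ℤ * 1ℤ * a + -1ℤ * x * 1ℤ + 0ℤ * 1ℤ * a + 0ℤ * x * 1ℤ ≡ - a - x
      lem = solve-∀

    G'-kk : G' k k ≡ 1ℤ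
    G'-kk = trans (cong₂ (λ p q → p * p * G k k + p * q * G k k + q * p * G k k + q * q * G k k) sg-k ρ-k) (trans (cong (λ z → -1ℤ * -1ℤ * z + -1ℤ * 0ℤ * z + 0ℤ * -1ℤ * z + 0ℤ * 0ℤ * z) (diag k)) refl)

    -- When `β i` gains `r i` copies of `β k`, the change of its Euler norm is
    -- `r i * (G i k + G k i + r i)`. Since the order forbids both pairings at once, a positive
    -- `r i` equals `- G i k` with `G k i = 0`.
    G'-diag : ∀ {T} → Ord G T → T k ≡ true → ∀ i → T i ≡ true → G' i i ≡ 1ℤ
    G'-diag {T} (ord , h) Tk i Ti = go (i ≟ k)
      where
      lem0 : ∀ g a b → g + 0ℤ * a + 0ℤ * b + 0ℤ * 0ℤ ≡ g
      lem0 = solve-∀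
      lem1 : ∀ g a → g + - a * a + - a * 0ℤ + - a * - a ≡ g
      lem1 = solve-∀
      go : Dec (i ≡ k) → G' i i ≡ 1ℤ
      go (yes refl) = G'-kk
      go (no n) with ≤-total (G i k) 0ℤ
      ... | inj₂ p = trans (G'-oo n n) (trans (cong (λ z → G i i + z * G i k + z * G k i + z * z) (r-pos p)) (trans (lem0 (G i i) (G i k) (G k i)) (diag i)))
      ... | inj₁ p with G k i ≟ℤ 0ℤ | G i k ≟ℤ 0ℤ
      ...   | yes q | _ = trans (G'-oo n n) (trans (cong₂ (λ z w → G i i + z * G i k + z * w + z * z) (r-neg p) q) (trans (lem1 (G i i) (G i k)) (diag i)))
      ...   | no _ | yes q = trans (G'-oo n n) (trans (cong (λ z → G i i + z * G i k + z * G k i + z * z) (r-pos (≤-reflexive (sym q)))) (trans (lem0 (G i i) (G i k) (G k i)) (diag i)))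
      ...   | no q | no q' = ⊥-elim (ℕₚ.<-asym (h i k Ti Tk n q') (h k i Tk Ti (n ∘ sym) q))

    form-mut : (B : M N) (β : Fin N → V N) → ∀ i j → form B (mut β i) (mut β j) ≡
               sg i * sg j * form B (β i) (β j) + sg i * ρ j * form B (β i) (β k) + ρ i * sg j * form B (β k) (β j) + ρ i * ρ j * form B (β k) (β k)
    form-mut B β i j = trans (form-linˡ B (sg i) (ρ i) (β i) (β k) (mut β j)) (trans (cong₂ (λ p q → sg i * p + ρ i * q) (form-linʳ B (sg j) (ρ j) (β j) (β k) (β i)) (form-linʳ B (sg j) (ρ j) (β j) (β k) (β k)))
      (lem (sg i) (ρ i) (sg j) (ρ j) (form B (β i) (β j)) (form B (β i) (β k)) (form B (β k) (β j)) (form B (β k) (β k))))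
      where
      lem : ∀ s p s' p' a b c d → s * (s' * a + p' * b) + p * (s' * c + p' * d) ≡ s * s' * a + s * p' * b + p * s' * c + p * p' * d
      lem = solve-∀

    link-mut : ∀ {lev β T} → T k ≡ true → Link lev G β T → Link lev G' (mut β) T
    link-mut {lev} {β} Tk l i j Ti Tj = trans (form-mut (e lev) β i j) (cong₂ _+_ (cong₂ _+_ (cong₂ _+_ (cong (sg i * sg j *_) (l i j Ti Tj)) (cong (sg i * ρ j *_) (l i k Ti Tk))) (cong (ρ i * sg j *_) (l k j Tk Tj))) (cong (ρ i * ρ j *_) (l k k Tk Tk)))

    link-mutᵀ : ∀ {lev β T} → T k ≡ true → Link lev (G ᵀ) β T → Link lev (G' ᵀ) (mut β) T
    link-mutᵀ {lev} {β} Tk l i j Ti Tj = trans (form-mut (e lev) β i j) (trans (cong₂ _+_ (cong₂ _+_ (cong₂ _+_ (cong (sg i * sg j *_) (l i j Ti Tj)) (cong (sg i * ρ j *_) (l i k Ti Tk))) (cong (ρ i * sg j *_) (l k j Tk Tj))) (cong (ρ i * ρ j *_) (l k k Tk Tk)))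
      (lem (sg i) (ρ i) (sg j) (ρ j) (G j i) (G k i) (G j k) (G k k)))
      where
      lem : ∀ s p s' p' a b c d → s * s' * a + s * p' * b + p * s' * c + p * p' * d ≡ s' * s * a + s' * p * c + p' * s * b + p' * p * d
      lem = solve-∀

    supp-mut : ∀ {S : Sub N} {β : Fin N → V N} → Supp S (β k) → ∀ i → Supp S (β i) → Supp S (mut β i)
    supp-mut {β = β} sk i si t St = trans (cong₂ (λ a b → sg i * a + ρ i * b) (si t St) (sk t St)) (lem (sg i) (ρ i))
      where
      lem : ∀ a b → a * 0ℤ + b * 0ℤ ≡ 0ℤ
      lem = solve-∀

    rfl-mut : ∀ s β i → mut (λ i → rfl s (β i)) i ≐ rfl s (mut β i)
    rfl-mut s β i t = sym (rfl-lin s (sg i) (ρ i) (β i) (β k) t)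

    sgn-unique : ∀ b b' {x : V N} → Root x → Sgn b x → Sgn b' x → b ≡ b'
    sgn-unique true  true  _ _ _ = refl
    sgn-unique false false _ _ _ = refl
    sgn-unique true  false r p q = ⊥-elim (pos∧neg r p q)
    sgn-unique false true  r p q = ⊥-elim (pos∧neg r q p)

    Res : Sub N → (Fin N → V N) → Set
    Res T β = Coherent G' (mut β) T × Ord G' T

    -- The matrix `g` is a parameter because the same facts are needed for `G`, for its transpose
    -- and for the mutated matrix.
    record Sys (S T : Sub N) (lev : V N) (g : M N) (β : Fin N → V N) : Set where
      field
        lvl  : Lvl S lev
        link : Link lev g β T
        supp : ∀ i → T i ≡ true → Supp S (β i)
        gdiag : ∀ i → T i ≡ true → g i i ≡ 1ℤ

      root : ∀ i → T i ≡ true → Root (β i)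
      root i Ti = root-of lvl (supp i Ti) (trans (link i i Ti Ti) (gdiag i Ti))

    E-from-source : ∀ {S lev s} → Lvl S lev → Src S lev s → S s ≡ true → ∀ {y} → Supp S y → E lev (unit s) y ≡ - rfl s y s
    E-from-source {S} {lev} {s} lvl src Ss {y} sy = trans (move (lvl-sep lvl (supp-unit {S} Ss) sy)) (trans (cong₂ _-_ (form-unitˡ A s y) (E-source src sy)) (trans (lem (row s y) (y s)) (cong -_ (sym (rfl-same s y)))))
      where
      lem : ∀ a b → a - b ≡ - (b - a)
      lem = solve-∀
      lem2 : ∀ p q → p ≡ p + q - q
      lem2 = solve-∀
      move : ∀ {p q r} → p + q ≡ r → p ≡ r - q
      move {p} {q} refl = lem2 p q

    rfl-unit : ∀ s {x} → x ≐ unit s → rfl s x ≐ neg (unit s)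
    rfl-unit s {x} p t = trans (cong₂ (λ a b → 1ℤ * a + (- b) * unit s t) (p t) (trans (row-cong s p) (row-unit s))) (lem (unit s t))
      where
      lem : ∀ u → 1ℤ * u + (- + 2) * u ≡ - u
      lem = solve-∀

    unit-pos : ∀ s → Pos (unit {N} s)
    unit-pos s t with t ≟ s
    ... | yes _ = +≤+ ℕ.z≤n
    ... | no _  = ≤-refl

    opaque
      _≐?_ : (x y : V N) → Dec (x ≐ y)
      x ≐? y = all? (λ t → x t ≟ℤ y t)

    -- Without `neg (unit s)` among the members, only a member equal to `unit s` changes sign under
    -- the reflection. Its Gram entries are coordinates at `s`, before or after reflection, and
    -- their signs supply what the new colours demand, in both directions.
    module Turn {S T lev g β} (sys : Sys S T lev g β) {s} (Ss : S s ≡ true) (src : Src S lev s)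
                (free : ∀ j → T j ≡ true → ¬ (β j ≐ neg (unit s))) where
      open Sys sys

      isγ : Fin N → Bool
      isγ i = does (β i ≐? unit s)

      src-val : ∀ {i j} → T i ≡ true → T j ≡ true → β j ≐ unit s → g i j ≡ β i s
      src-val {i} {j} Ti Tj p = trans (sym (link i j Ti Tj)) (trans (form-cong (e lev) (λ _ → refl) p) (E-source src (supp i Ti)))

      src-val' : ∀ {i j} → T i ≡ true → T j ≡ true → β i ≐ unit s → g i j ≡ - rfl s (β j) s
      src-val' {i} {j} Ti Tj p = trans (sym (link i j Ti Tj)) (trans (form-cong (e lev) p (λ _ → refl)) (E-from-source lvl src Ss (supp j Tj)))

      forward : Coherent g β T → Coherent g (λ i → rfl s (β i)) T
      forward P = record { c = c' ; col = col' ; ok = ok' }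
        where
        open Coherent P
        c' : Fin N → Bool
        c' i = if isγ i then false else c i
        c-γ : ∀ {i} → T i ≡ true → β i ≐ unit s → c i ≡ true
        c-γ {i} Ti p = sgn-unique (c i) true (root i Ti) (col i Ti) (λ t → subst (0ℤ ≤_) (sym (p t)) (unit-pos s t))
        col' : ∀ i → T i ≡ true → Sgn (c' i) (rfl s (β i))
        col' i Ti with β i ≐? unit s
        ... | yes p = λ t → subst (_≤ 0ℤ) (sym (rfl-unit s p t)) (neg≤0 (unit-pos s t))
        ... | no q with c i | col i Ti
        ...   | true  | pos = pos-rfl s (root i Ti) pos q
        ...   | false | ng  = neg-rfl s (root i Ti) ng (free i Ti)
        ok' : ∀ i j → T i ≡ true → T j ≡ true → i ≢ j → OK (c' i) (c' j) (g i j)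
        ok' i j Ti Tj n with β i ≐? unit s | β j ≐? unit s
        ... | yes p | yes q = subst₂ (λ a b → OK a b (g i j)) (c-γ Ti p) (c-γ Tj q) (ok i j Ti Tj n)
        ... | yes p | no q with c j in cj
        ...   | true  = refl
        ...   | false = ≤-reflexive (subst₂ (λ a b → OK a b (g i j)) (c-γ Ti p) cj (ok i j Ti Tj n))
        ok' i j Ti Tj n | no q | yes p with c i in ci | col i Ti
        ...   | true  | pos = ≤-antisym (subst₂ (λ a b → OK a b (g i j)) ci (c-γ Tj p) (ok i j Ti Tj n)) (subst (0ℤ ≤_) (sym (src-val Ti Tj p)) (pos s))
        ...   | false | ng  = subst (_≤ 0ℤ) (sym (src-val Ti Tj p)) (ng s)
        ok' i j Ti Tj n | no _ | no _ = ok i j Ti Tj n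

      backward : Coherent g (λ i → rfl s (β i)) T → Coherent g β T
      backward P = record { c = c' ; col = col' ; ok = ok' }
        where
        open Coherent P
        c' : Fin N → Bool
        c' i = if isγ i then true else c i
        rroot : ∀ i → T i ≡ true → Root (rfl s (β i))
        rroot i Ti = trans (norm-rfl s (β i)) (root i Ti)
        c-γ : ∀ {i} → T i ≡ true → β i ≐ unit s → c i ≡ false
        c-γ {i} Ti p = sgn-unique (c i) false (rroot i Ti) (col i Ti) (λ t → subst (_≤ 0ℤ) (sym (rfl-unit s p t)) (neg≤0 (unit-pos s t)))
        col' : ∀ i → T i ≡ true → Sgn (c' i) (β i)
        col' i Ti with β i ≐? unit s
        ... | yes p = λ t → subst (0ℤ ≤_) (sym (p t)) (unit-pos s t)
        ... | no q with root-sign (β i) (root i Ti)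
        ...   | inj₁ pos = subst (λ b → Sgn b (β i)) (sgn-unique true (c i) (rroot i Ti) (pos-rfl s (root i Ti) pos q) (col i Ti)) pos
        ...   | inj₂ ng  = subst (λ b → Sgn b (β i)) (sgn-unique false (c i) (rroot i Ti) (neg-rfl s (root i Ti) ng (free i Ti)) (col i Ti)) ng
        ok' : ∀ i j → T i ≡ true → T j ≡ true → i ≢ j → OK (c' i) (c' j) (g i j)
        ok' i j Ti Tj n with β i ≐? unit s | β j ≐? unit s
        ... | yes p | yes q = subst₂ (λ a b → OK a b (g i j)) (c-γ Ti p) (c-γ Tj q) (ok i j Ti Tj n)
        ... | yes p | no q with c j in cj | col j Tj
        ...   | true  | pos = subst (_≤ 0ℤ) (sym (src-val' Ti Tj p)) (neg≤0 (pos s))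
        ...   | false | ng  = ≤-antisym (subst₂ (λ a b → OK a b (g i j)) (c-γ Ti p) cj (ok i j Ti Tj n)) (subst (0ℤ ≤_) (sym (src-val' Ti Tj p)) (0≤neg (ng s)))
        ok' i j Ti Tj n | no q | yes p with c i in ci
        ...   | true  = ≤-reflexive (subst₂ (λ a b → OK a b (g i j)) ci (c-γ Tj p) (ok i j Ti Tj n))
        ...   | false = refl
        ok' i j Ti Tj n | no _ | no _ = ok i j Ti Tj n

      sys-rfl : Sys S T (bump s lev) g (λ i → rfl s (β i))
      sys-rfl = record
        { lvl = lvl-bump lvl src
        ; link = λ i j Ti Tj → trans (E-rfl src Ss (supp i Ti) (supp j Tj)) (link i j Ti Tj)
        ; supp = λ i Ti → supp-rfl Ss (supp i Ti)
        ; gdiag = gdiag }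

    -- Mutation at a simple member, and members that block a reflection.

    restrict : ∀ {g : M N} {β : Fin N → V N} {T : Sub N} {j} → Coherent g β T → Coherent g β (rem T j)
    restrict {T = T} P = record { c = c ; col = λ i Ti → col i (proj₁ (rem-sub T Ti)) ; ok = λ i j Ti Tj → ok i j (proj₁ (rem-sub T Ti)) (proj₁ (rem-sub T Tj)) }
      where open Coherent P

    ord-restrict : ∀ {g : M N} {T : Sub N} {j} → Ord g T → Ord g (rem T j)
    ord-restrict {T = T} (ord , h) = ord , λ i j Ti Tj → h i j (proj₁ (rem-sub T Ti)) (proj₁ (rem-sub T Tj))

    extend : ∀ {g : M N} {β : Fin N → V N} {T : Sub N} j b → Sgn b (β j) → (P : Coherent g β (rem T j)) →
             (∀ i → T i ≡ true → i ≢ j → OK (Coherent.c P i) b (g i j)) → (∀ i → T i ≡ true → i ≢ j → OK b (Coherent.c P i) (g j i)) → Coherent g β T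
    extend {g} {β} {T} j b sj P to from = record { c = upd c j b ; col = col' ; ok = ok' }
      where
      open Coherent P
      col' : ∀ i → T i ≡ true → Sgn (upd c j b i) (β i)
      col' i Ti with i ≟ j
      ... | yes refl = sj
      ... | no n = col i (rem-in T Ti n)
      ok' : ∀ i l → T i ≡ true → T l ≡ true → i ≢ l → OK (upd c j b i) (upd c j b l) (g i l)
      ok' i l Ti Tl n with i ≟ j | l ≟ j
      ... | yes refl | yes refl = ⊥-elim (n refl)
      ... | yes refl | no m = from l Tl m
      ... | no m | yes refl = to i Ti m
      ... | no m | no m' = ok i l (rem-in T Ti m) (rem-in T Tl m') n

    ord-first : ∀ {g : M N} {T : Sub N} j → (∀ i → T i ≡ true → i ≢ j → g i j ≡ 0ℤ) → Ord g (rem T j) → Ord g T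
    ord-first {g} {T} j z (ord , h) = ord' , h'
      where
      ord' : Fin N → ℕ
      ord' i with i ≟ j
      ... | yes _ = 0
      ... | no _ = suc (ord i)
      h' : ∀ i l → T i ≡ true → T l ≡ true → i ≢ l → g i l ≢ 0ℤ → ord' i ℕ.< ord' l
      h' i l Ti Tl n q with i ≟ j | l ≟ j
      ... | yes refl | yes refl = ⊥-elim (n refl)
      ... | yes refl | no m = ℕ.s≤s ℕ.z≤n
      ... | no m | yes refl = ⊥-elim (q (z i Ti m))
      ... | no m | no m' = ℕ.s≤s (h i l (rem-in T Ti m) (rem-in T Tl m') n q)

    ord-last : ∀ {g : M N} {T : Sub N} j → (∀ i → T i ≡ true → i ≢ j → g j i ≡ 0ℤ) → Ord g (rem T j) → Ord g T
    ord-last {g} {T} j z (ord , h) = ord' , h'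
      where
      ord' : Fin N → ℕ
      ord' i with i ≟ j
      ... | yes _ = suc (proj₁ (ord-bound ord))
      ... | no _ = ord i
      h' : ∀ i l → T i ≡ true → T l ≡ true → i ≢ l → g i l ≢ 0ℤ → ord' i ℕ.< ord' l
      h' i l Ti Tl n q with i ≟ j | l ≟ j
      ... | yes refl | yes refl = ⊥-elim (n refl)
      ... | yes refl | no m = ⊥-elim (q (z l Tl m))
      ... | no m | yes refl = ℕ.s≤s (proj₂ (ord-bound ord) i)
      ... | no m | no m' = h i l (rem-in T Ti m) (rem-in T Tl m') n q

    mut-k-neg : ∀ {β : Fin N → V N} → Pos (β k) → Neg (mut β k)
    mut-k-neg {β} p t = subst (_≤ 0ℤ) (sym (mut-k β t)) (neg≤0 (p t))

    -- Mutation at a member that is a source: no other member changes sign.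
    base-source : ∀ {S T lev β s} → Sys S T lev G β → T k ≡ true → Ord G T → Coherent G β T →
                  S s ≡ true → Src S lev s → β k ≐ unit s → Res T β
    base-source {S} {T} {lev} {β} {s} sys Tk (ord , h) P Ss src βk = record { c = upd c k false ; col = col' ; ok = ok' } , (ord' , h')
      where
      open Coherent P
      open Sys sys
      posk : Pos (β k)
      posk t = subst (0ℤ ≤_) (sym (βk t)) (unit-pos s t)
      ck : c k ≡ true
      ck = sgn-unique (c k) true (root k Tk) (col k Tk) posk
      Gik : ∀ i → T i ≡ true → G i k ≡ β i s
      Gik i Ti = trans (sym (link i k Ti Tk)) (trans (form-cong (e lev) (λ _ → refl) βk) (E-source src (supp i Ti)))
      Gik≤0 : ∀ i → T i ≡ true → i ≢ k → G i k ≤ 0ℤ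
      Gik≤0 i Ti n with c i in ci | col i Ti
      ... | true | _ = subst₂ (λ a b → OK a b (G i k)) ci ck (ok i k Ti Tk n)
      ... | false | ng = subst (_≤ 0ℤ) (sym (Gik i Ti)) (ng s)
      Gik≡0 : ∀ i → T i ≡ true → i ≢ k → c i ≡ true → G i k ≡ 0ℤ
      Gik≡0 i Ti n ci = ≤-antisym (Gik≤0 i Ti n) (subst (0ℤ ≤_) (sym (Gik i Ti)) (subst (λ b → Sgn b (β i)) ci (col i Ti) s))
      r≡ : ∀ i → T i ≡ true → i ≢ k → r i ≡ - G i k
      r≡ i Ti n = r-neg (Gik≤0 i Ti n)
      Gkj≡0 : ∀ j → T j ≡ true → j ≢ k → c j ≡ false → G k j ≡ 0ℤ
      Gkj≡0 j Tj n cj = subst₂ (λ a b → OK a b (G k j)) ck cj (ok k j Tk Tj (n ∘ sym))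
      G'oo : ∀ i j → T i ≡ true → T j ≡ true → i ≢ k → j ≢ k → G' i j ≡ G i j - G i k * G k j
      G'oo i j Ti Tj n m = trans (G'-oo n m) (trans (cong₂ (λ p q → G i j + q * G i k + p * G k j + p * q) (r≡ i Ti n) (r≡ j Tj m)) (lem (G i j) (G i k) (G k j) (G j k)))
        where
        lem : ∀ g a b c → g + - c * a + - a * b + - a * - c ≡ g - a * b
        lem = solve-∀
      G'ik≡0 : ∀ i → T i ≡ true → i ≢ k → G' i k ≡ 0ℤ
      G'ik≡0 i Ti n = trans (G'-ok n) (trans (cong (λ z → - G i k - z) (r≡ i Ti n)) (lem (G i k)))
        where
        lem : ∀ a → - a - - a ≡ 0ℤ
        lem = solve-∀
      col' : ∀ i → T i ≡ true → Sgn (upd c k false i) (mut β i)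
      col' i Ti with i ≟ k
      ... | yes refl = mut-k-neg {β} posk
      ... | no n with c i in ci | col i Ti
      ...   | true | pos = λ t → subst (0ℤ ≤_) (sym (mut-r0 β n (trans (r≡ i Ti n) (cong -_ (Gik≡0 i Ti n ci))) t)) (pos t)
      ...   | false | ng = λ t → subst (_≤ 0ℤ) (sym (trans (mut-o β n t) (cong₂ (λ p q → β i t + p * q) (trans (r≡ i Ti n) (cong -_ (Gik i Ti))) (βk t)))) (go t (t ≟ s))
        where
        lem1 : ∀ a → a + - a * 1ℤ ≡ 0ℤ
        lem1 = solve-∀
        lem2 : ∀ a b → a + - b * 0ℤ ≡ a
        lem2 = solve-∀
        go : ∀ t → Dec (t ≡ s) → β i t + - β i s * unit s t ≤ 0ℤ
        go t (yes refl) = ≤-reflexive (trans (cong (λ z → β i t + - β i t * z) (unit-same t)) (lem1 (β i t)))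
        go t (no q) = subst (_≤ 0ℤ) (sym (trans (cong (λ z → β i t + - β i s * z) (unit-other q)) (lem2 (β i t) (β i s)))) (ng t)
      unchanged : ∀ {g a b} → a ≡ 0ℤ ⊎ b ≡ 0ℤ → g - a * b ≡ g
      unchanged {g} {a} {b} (inj₁ p) = trans (cong (λ z → g - z * b) p) (lem g b)
        where
        lem : ∀ g b → g - 0ℤ * b ≡ g
        lem = solve-∀
      unchanged {g} {a} {b} (inj₂ p) = trans (cong (λ z → g - a * z) p) (lem g a)
        where
        lem : ∀ g b → g - b * 0ℤ ≡ g
        lem = solve-∀
      ok' : ∀ i j → T i ≡ true → T j ≡ true → i ≢ j → OK (upd c k false i) (upd c k false j) (G' i j)
      ok' i j Ti Tj n with i ≟ k | j ≟ k
      ... | yes refl | yes refl = ⊥-elim (n refl)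
      ... | no m | yes refl = OK-0 (c i) false (G'ik≡0 i Ti m)
      ... | yes refl | no m with c j in cj
      ...   | true = refl
      ...   | false = subst (_≤ 0ℤ) (sym (trans (G'-ko m) (trans (cong (λ z → - z - r j) (Gkj≡0 j Tj m cj)) (+-identityˡ (- r j))))) (neg≤0 (r≥0 j))
      ok' i j Ti Tj n | no m | no m' with c i in ci | c j in cj | ok i j Ti Tj n
      ...   | true  | b | w = subst (OK true b) (sym (trans (G'oo i j Ti Tj m m') (unchanged {G i j} {G i k} {G k j} (inj₁ (Gik≡0 i Ti m ci))))) w
      ...   | false | false | w = subst (OK false false) (sym (trans (G'oo i j Ti Tj m m') (unchanged {G i j} {G i k} {G k j} (inj₂ (Gkj≡0 j Tj m' cj))))) w
      ...   | false | true | w = refl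
      ord' : Fin N → ℕ
      ord' i with i ≟ k
      ... | yes _ = 0
      ... | no _ = suc (ord i)
      h' : ∀ i j → T i ≡ true → T j ≡ true → i ≢ j → G' i j ≢ 0ℤ → ord' i ℕ.< ord' j
      h' i j Ti Tj n q with i ≟ k | j ≟ k
      ... | yes refl | yes refl = ⊥-elim (n refl)
      ... | yes refl | no m = ℕ.s≤s ℕ.z≤n
      ... | no m | yes refl = ⊥-elim (q (G'ik≡0 i Ti m))
      ... | no m | no m' with G i j ≟ℤ 0ℤ
      ...   | no p = ℕ.s≤s (h i j Ti Tj n p)
      -- An entry that was zero becomes nonzero only through `k`, and then `i`, `k`, `j` already
      -- stand in this order.
      ...   | yes p = ℕ.s≤s (ℕₚ.<-trans (h i k Ti Tk m λ z → q (vanish (inj₁ z))) (h k j Tk Tj (m' ∘ sym) λ z → q (vanish (inj₂ z))))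
        where
        vanish : (G i k ≡ 0ℤ) ⊎ (G k j ≡ 0ℤ) → G' i j ≡ 0ℤ
        vanish z = trans (G'oo i j Ti Tj m m') (trans (unchanged {G i j} {G i k} {G k j} z) p)

    -- Mutation at a member that is a sink (a source for the transposed form).
    base-sink : ∀ {S T lev β s} → Sys S T lev (G ᵀ) β → T k ≡ true → Ord G T → Coherent G β T →
                S s ≡ true → Src S lev s → β k ≐ unit s → Res T β
    base-sink {S} {T} {lev} {β} {s} sys Tk (ord , h) P Ss src βk = record { c = upd c k false ; col = col' ; ok = ok' } , (ord' , h')
      where
      open Coherent P
      open Sys sys
      posk : Pos (β k)
      posk t = subst (0ℤ ≤_) (sym (βk t)) (unit-pos s t)
      ck : c k ≡ true
      ck = sgn-unique (c k) true (root k Tk) (col k Tk) posk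
      Gki : ∀ i → T i ≡ true → G k i ≡ β i s
      Gki i Ti = trans (sym (link i k Ti Tk)) (trans (form-cong (e lev) (λ _ → refl) βk) (E-source src (supp i Ti)))
      Gki≡0 : ∀ i → T i ≡ true → i ≢ k → G k i ≡ 0ℤ
      Gki≡0 i Ti n with c i in ci | col i Ti
      ... | true  | pos = ≤-antisym (subst₂ (λ a b → OK a b (G k i)) ck ci (ok k i Tk Ti (n ∘ sym))) (subst (0ℤ ≤_) (sym (Gki i Ti)) (pos s))
      ... | false | _ = subst₂ (λ a b → OK a b (G k i)) ck ci (ok k i Tk Ti (n ∘ sym))
      r-true : ∀ i → T i ≡ true → i ≢ k → c i ≡ true → r i ≡ - G i k
      r-true i Ti n ci = r-neg (subst₂ (λ a b → OK a b (G i k)) ci ck (ok i k Ti Tk n))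
      Gik≥0 : ∀ i → T i ≡ true → i ≢ k → c i ≡ false → 0ℤ ≤ G i k
      Gik≥0 i Ti n ci = subst (0ℤ ≤_) (trans (form-cong (e lev) (λ t → sym (βk t)) (λ _ → refl)) (link k i Tk Ti))
        (E-unitˡ-≥0 lev (subst (λ b → Sgn b (β i)) ci (col i Ti)) (trans (sym (Gki i Ti)) (Gki≡0 i Ti n)))
      r-false : ∀ i → T i ≡ true → i ≢ k → c i ≡ false → r i ≡ 0ℤ
      r-false i Ti n ci = r-pos (Gik≥0 i Ti n ci)
      G'oo : ∀ i j → T j ≡ true → i ≢ k → j ≢ k → G' i j ≡ G i j + r j * (G i k + r i)
      G'oo i j Tj n m = trans (G'-oo n m) (trans (cong (λ z → G i j + r j * G i k + r i * z + r i * r j) (Gki≡0 j Tj m)) (lem (G i j) (G i k) (r i) (r j)))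
        where
        lem : ∀ g a x y → g + y * a + x * 0ℤ + x * y ≡ g + y * (a + x)
        lem = solve-∀
      same-true : ∀ i j → T i ≡ true → T j ≡ true → i ≢ k → j ≢ k → c i ≡ true → G' i j ≡ G i j
      same-true i j Ti Tj n m ci = trans (G'oo i j Tj n m) (trans (cong (λ z → G i j + r j * (G i k + z)) (r-true i Ti n ci)) (lem (G i j) (G i k) (r j)))
        where
        lem : ∀ g a y → g + y * (a + - a) ≡ g
        lem = solve-∀
      same-false : ∀ i j → T j ≡ true → i ≢ k → j ≢ k → c j ≡ false → G' i j ≡ G i j
      same-false i j Tj n m cj = trans (G'oo i j Tj n m) (trans (cong (λ z → G i j + z * (G i k + r i)) (r-false j Tj m cj)) (lem (G i j) (G i k + r i)))
        where
        lem : ∀ g a → g + 0ℤ * a ≡ g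
        lem = solve-∀
      G'ik-true : ∀ i → T i ≡ true → i ≢ k → c i ≡ true → G' i k ≡ 0ℤ
      G'ik-true i Ti n ci = trans (G'-ok n) (trans (cong (λ z → - G i k - z) (r-true i Ti n ci)) (lem (G i k)))
        where
        lem : ∀ a → - a - - a ≡ 0ℤ
        lem = solve-∀
      G'ik-false : ∀ i → T i ≡ true → i ≢ k → c i ≡ false → G' i k ≤ 0ℤ
      G'ik-false i Ti n ci = subst (_≤ 0ℤ) (sym (trans (G'-ok n) (trans (cong (λ z → - G i k - z) (r-false i Ti n ci)) (+-identityʳ (- G i k))))) (neg≤0 (Gik≥0 i Ti n ci))
      G'kj-false : ∀ j → T j ≡ true → j ≢ k → c j ≡ false → G' k j ≡ 0ℤ
      G'kj-false j Tj n cj = trans (G'-ko n) (cong₂ (λ y z → - y - z) (Gki≡0 j Tj n) (r-false j Tj n cj))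
      col' : ∀ i → T i ≡ true → Sgn (upd c k false i) (mut β i)
      col' i Ti with i ≟ k
      ... | yes refl = mut-k-neg {β} posk
      ... | no n with c i in ci | col i Ti
      ...   | true | pos = λ t → subst (0ℤ ≤_) (sym (mut-o β n t)) (0≤+ (pos t) (0≤* (r≥0 i) (posk t)))
      ...   | false | ng = λ t → subst (_≤ 0ℤ) (sym (mut-r0 β n (r-false i Ti n ci) t)) (ng t)
      ok' : ∀ i j → T i ≡ true → T j ≡ true → i ≢ j → OK (upd c k false i) (upd c k false j) (G' i j)
      ok' i j Ti Tj n with i ≟ k | j ≟ k
      ... | yes refl | yes refl = ⊥-elim (n refl)
      ok' i j Ti Tj n | no m | yes refl with c i in ci
      ...   | true  = G'ik-true i Ti m ci
      ...   | false = G'ik-false i Ti m ci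
      ok' i j Ti Tj n | yes refl | no m with c j in cj
      ...   | true  = refl
      ...   | false = ≤-reflexive (G'kj-false j Tj m cj)
      ok' i j Ti Tj n | no m | no m' with c i in ci | c j in cj | ok i j Ti Tj n
      ...   | true  | b | w = subst (OK true b) (sym (same-true i j Ti Tj m m' ci)) w
      ...   | false | false | w = subst (OK false false) (sym (same-false i j Tj m m' cj)) w
      ...   | false | true | w = refl
      -- New order: negative members, then `k`, then positive members. The offset `L + 2` leaves
      -- room for `k` at `L + 1`; no entry from a positive member to `k` or to a negative member
      -- survives.
      L : ℕ
      L = proj₁ (ord-bound ord)
      rank : Bool → ℕ → ℕ
      rank true  n = suc (suc L) ℕ.+ n
      rank false n = n
      ord' : Fin N → ℕ
      ord' i with i ≟ k
      ... | yes _ = suc L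
      ... | no _ = rank (c i) (ord i)
      h' : ∀ i j → T i ≡ true → T j ≡ true → i ≢ j → G' i j ≢ 0ℤ → ord' i ℕ.< ord' j
      h' i j Ti Tj n q with i ≟ k | j ≟ k
      ... | yes refl | yes refl = ⊥-elim (n refl)
      h' i j Ti Tj n q | yes refl | no m with c j in cj
      ...   | true  = ℕₚ.m≤m+n (suc (suc L)) (ord j)
      ...   | false = ⊥-elim (q (G'kj-false j Tj m cj))
      h' i j Ti Tj n q | no m | yes refl with c i in ci
      ...   | true  = ⊥-elim (q (G'ik-true i Ti m ci))
      ...   | false = ℕ.s≤s (proj₂ (ord-bound ord) i)
      h' i j Ti Tj n q | no m | no m' with c i in ci | c j in cj | ok i j Ti Tj n
      ...   | true  | true  | _ = ℕₚ.+-monoʳ-< (suc (suc L)) (h i j Ti Tj n λ z → q (trans (same-true i j Ti Tj m m' ci) z))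
      ...   | true  | false | w = ⊥-elim (q (trans (same-true i j Ti Tj m m' ci) w))
      ...   | false | false | _ = h i j Ti Tj n λ z → q (trans (same-false i j Tj m m' cj) z)
      ...   | false | true  | _ = ℕₚ.≤-trans (ℕ.s≤s (proj₂ (ord-bound ord) i)) (ℕₚ.≤-trans (ℕₚ.n≤1+n (suc L)) (ℕₚ.m≤m+n (suc (suc L)) (ord j)))

    Rec : Sub N → Sub N → Set
    Rec S T = ∀ {s j lev β} → S s ≡ true → rem T j k ≡ true → Sys (rem S s) (rem T j) lev G β → Pos (β k) → Ord G (rem T j) → Coherent G β (rem T j) → Res (rem T j) β

    supp-rem : ∀ {S : Sub N} {s} {x : V N} → Supp S x → x s ≡ 0ℤ → Supp (rem S s) x
    supp-rem {S} {s} sx z t p with t ≟ s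
    ... | yes refl = z
    ... | no _ = sx t p

    mut-at : ∀ β i s → β i s ≡ 0ℤ → β k s ≡ 0ℤ → mut β i s ≡ 0ℤ
    mut-at β i s p q = trans (cong₂ (λ a b → sg i * a + ρ i * b) p q) (lem (sg i) (ρ i))
      where
      lem : ∀ a b → a * 0ℤ + b * 0ℤ ≡ 0ℤ
      lem = solve-∀

    -- If −γ_s is a member, all the others avoid s and the problem drops to S ∖ s.
    obstacle-source : ∀ {S T lev β s j} → Rec S T → Sys S T lev G β → T k ≡ true → Pos (β k) → Ord G T → Coherent G β T →
                      S s ≡ true → Src S lev s → T j ≡ true → β j ≐ neg (unit s) → Res T β
    obstacle-source {S} {T} {lev} {β} {s} {j} rec sys Tk posk od P Ss src Tj βj = extend j false sj P' to from , ord-first j G'ij≡0 (proj₂ sub)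
      where
      open Coherent P
      open Sys sys
      negj : Neg (β j)
      negj t = subst (_≤ 0ℤ) (sym (βj t)) (neg≤0 (unit-pos s t))
      cj : c j ≡ false
      cj = sgn-unique (c j) false (root j Tj) (col j Tj) negj
      k≢j : k ≢ j
      k≢j refl = pos∧neg (root k Tk) posk negj
      E-to : ∀ {x} → Supp S x → E lev x (β j) ≡ - x s
      E-to {x} sx = trans (form-cong (e lev) (λ _ → refl) βj) (trans (form-negʳ (e lev) x (unit s)) (cong -_ (E-source src sx)))
      off : ∀ i → T i ≡ true → i ≢ j → β i s ≡ 0ℤ
      off i Ti n with c i in ci | col i Ti | ok i j Ti Tj n
      ... | true  | pos | w = trans (sym (neg-involutive (β i s))) (cong -_ (trans (sym (E-to (supp i Ti))) (trans (link i j Ti Tj) (subst (λ b → OK true b (G i j)) cj w))))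
      ... | false | ng  | w = ≤-antisym (ng s) (subst (0ℤ ≤_) (trans (cong -_ (trans (sym (link i j Ti Tj)) (E-to (supp i Ti)))) (neg-involutive (β i s))) (0≤neg (subst (λ b → OK false b (G i j)) cj w)))
      sys' : Sys (rem S s) (rem T j) lev G β
      sys' = record
        { lvl = λ t u St Su → lvl t u (proj₁ (rem-sub S St)) (proj₁ (rem-sub S Su))
        ; link = λ i l Ti Tl → link i l (proj₁ (rem-sub T Ti)) (proj₁ (rem-sub T Tl))
        ; supp = λ i Ti → supp-rem {S} (supp i (proj₁ (rem-sub T Ti))) (off i (proj₁ (rem-sub T Ti)) (proj₂ (rem-sub T Ti)))
        ; gdiag = λ i Ti → gdiag i (proj₁ (rem-sub T Ti)) }
      sub : Res (rem T j) β
      sub = rec Ss (rem-in T Tk k≢j) sys' posk (ord-restrict od) (restrict P)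
      P' : Coherent G' (mut β) (rem T j)
      P' = proj₁ sub
      -- The pairing of the obstacle with `β k` has the sign for which mutation leaves the obstacle
      -- unchanged, so it can be put back after the recursion.
      rj : r j ≡ 0ℤ
      rj = r-pos (subst (0ℤ ≤_) (trans (sym (form-negˡ (e lev) (unit s) (β k))) (trans (form-cong (e lev) (λ t → sym (βj t)) (λ _ → refl)) (link j k Tj Tk))) (0≤neg (E-unitˡ-≤0 lev posk (off k Tk k≢j))))
      mutj : mut β j ≐ neg (unit s)
      mutj t = trans (mut-r0 β (k≢j ∘ sym) rj t) (βj t)
      sj : Neg (mut β j)
      sj t = subst (_≤ 0ℤ) (sym (mutj t)) (neg≤0 (unit-pos s t))
      link' : Link lev G' (mut β) T
      link' = link-mut Tk link
      mut-off : ∀ i → T i ≡ true → i ≢ j → mut β i s ≡ 0ℤ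
      mut-off i Ti n = mut-at β i s (off i Ti n) (off k Tk k≢j)
      G'ij≡0 : ∀ i → T i ≡ true → i ≢ j → G' i j ≡ 0ℤ
      G'ij≡0 i Ti n = trans (sym (link' i j Ti Tj)) (trans (form-cong (e lev) (λ _ → refl) mutj) (trans (form-negʳ (e lev) (mut β i) (unit s)) (cong -_ (trans (E-source src (supp-mut {S} {β} (supp k Tk) i (supp i Ti))) (mut-off i Ti n)))))
      to : ∀ i → T i ≡ true → i ≢ j → OK (Coherent.c P' i) false (G' i j)
      to i Ti n = OK-0 (Coherent.c P' i) false (G'ij≡0 i Ti n)
      from : ∀ i → T i ≡ true → i ≢ j → OK false (Coherent.c P' i) (G' j i)
      from i Ti n with Coherent.c P' i | Coherent.col P' i (rem-in T Ti n)
      ... | true  | _ = refl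
      ... | false | ng = subst (_≤ 0ℤ) (trans (sym (form-negˡ (e lev) (unit s) (mut β i))) (trans (form-cong (e lev) (λ t → sym (mutj t)) (λ _ → refl)) (link' j i Tj Ti))) (neg≤0 (E-unitˡ-≥0 lev ng (mut-off i Ti n)))

    -- For the transposed form the blocking member is `unit s` itself. Its pairings with the others
    -- are their coordinates at `s`, and coherence forces these to vanish; the member returns at the
    -- end of the order instead of the beginning.
    obstacle-sink : ∀ {S T lev β s j} → Rec S T → Sys S T lev (G ᵀ) β → T k ≡ true → Pos (β k) → Ord G T → Coherent G β T →
                    S s ≡ true → Src S lev s → T j ≡ true → k ≢ j → β j ≐ unit s → Res T β
    obstacle-sink {S} {T} {lev} {β} {s} {j} rec sys Tk posk od P Ss src Tj k≢j βj = extend j true sj P' to from , ord-last j G'ji≡0 (proj₂ sub)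
      where
      open Coherent P
      open Sys sys
      posj : Pos (β j)
      posj t = subst (0ℤ ≤_) (sym (βj t)) (unit-pos s t)
      cj : c j ≡ true
      cj = sgn-unique (c j) true (root j Tj) (col j Tj) posj
      E-to : ∀ {x} → Supp S x → E lev x (β j) ≡ x s
      E-to {x} sx = trans (form-cong (e lev) (λ _ → refl) βj) (E-source src sx)
      Gji : ∀ i → T i ≡ true → G j i ≡ β i s
      Gji i Ti = trans (sym (link i j Ti Tj)) (E-to (supp i Ti))
      off : ∀ i → T i ≡ true → i ≢ j → β i s ≡ 0ℤ
      off i Ti n with c i in ci | col i Ti | ok j i Tj Ti (n ∘ sym)
      ... | true  | pos | w = ≤-antisym (subst (_≤ 0ℤ) (Gji i Ti) (subst (λ b → OK b true (G j i)) cj w)) (pos s)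
      ... | false | ng  | w = trans (sym (Gji i Ti)) (subst (λ b → OK b false (G j i)) cj w)
      link⁻ : Link (neg lev) G β T
      link⁻ i l Ti Tl = trans (E-neg lev (β i) (β l)) (link l i Tl Ti)
      -- The recursion is stated for `G`; negating the levels turns the transposed form back.
      sys' : Sys (rem S s) (rem T j) (neg lev) G β
      sys' = record
        { lvl = lvl-neg λ t u St Su → lvl t u (proj₁ (rem-sub S St)) (proj₁ (rem-sub S Su))
        ; link = λ i l Ti Tl → link⁻ i l (proj₁ (rem-sub T Ti)) (proj₁ (rem-sub T Tl))
        ; supp = λ i Ti → supp-rem {S} (supp i (proj₁ (rem-sub T Ti))) (off i (proj₁ (rem-sub T Ti)) (proj₂ (rem-sub T Ti)))
        ; gdiag = λ i Ti → gdiag i (proj₁ (rem-sub T Ti)) }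
      sub : Res (rem T j) β
      sub = rec Ss (rem-in T Tk k≢j) sys' posk (ord-restrict od) (restrict P)
      P' : Coherent G' (mut β) (rem T j)
      P' = proj₁ sub
      rj : r j ≡ 0ℤ
      rj = r-pos (≤-reflexive (sym (trans (Gji k Tk) (off k Tk k≢j))))
      mutj : mut β j ≐ unit s
      mutj t = trans (mut-r0 β (k≢j ∘ sym) rj t) (βj t)
      sj : Pos (mut β j)
      sj t = subst (0ℤ ≤_) (sym (mutj t)) (unit-pos s t)
      link' : Link lev (G' ᵀ) (mut β) T
      link' = link-mutᵀ Tk link
      mut-off : ∀ i → T i ≡ true → i ≢ j → mut β i s ≡ 0ℤ
      mut-off i Ti n = mut-at β i s (off i Ti n) (off k Tk k≢j)
      G'ji≡0 : ∀ i → T i ≡ true → i ≢ j → G' j i ≡ 0ℤ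
      G'ji≡0 i Ti n = trans (sym (link' i j Ti Tj)) (trans (form-cong (e lev) (λ _ → refl) mutj) (trans (E-source src (supp-mut {S} {β} (supp k Tk) i (supp i Ti))) (mut-off i Ti n)))
      from : ∀ i → T i ≡ true → i ≢ j → OK true (Coherent.c P' i) (G' j i)
      from i Ti n = OK-0 true (Coherent.c P' i) (G'ji≡0 i Ti n)
      to : ∀ i → T i ≡ true → i ≢ j → OK (Coherent.c P' i) true (G' i j)
      to i Ti n with Coherent.c P' i | Coherent.col P' i (rem-in T Ti n)
      ... | false | _ = refl
      ... | true | pos = subst (_≤ 0ℤ) (trans (form-cong (e lev) (λ t → sym (mutj t)) (λ _ → refl)) (link' j i Tj Ti)) (E-unitˡ-≤0 lev pos (mut-off i Ti n))

    search : (T : Sub N) (β : Fin N → V N) (x : V N) → Dec (∃ λ j → T j ≡ true × β j ≐ x)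
    search T β x = any? λ j → (T j Data.Bool.≟ true) ×-dec (β j ≐? x)

    ≐-neg : ∀ {x y : V N} → x ≐ neg y → y ≐ neg x
    ≐-neg {x} {y} p t = trans (sym (neg-involutive (y t))) (cong -_ (sym (p t)))

    sys-mut : ∀ {S T lev β} → T k ≡ true → Ord G T → Sys S T lev G β → Sys S T lev G' (mut β)
    sys-mut {S} {T} {lev} {β} Tk od sys = record
      { lvl = lvl ; link = link-mut Tk link ; supp = λ i Ti → supp-mut {S} {β} (supp k Tk) i (supp i Ti) ; gdiag = λ i Ti → G'-diag od Tk i Ti }
      where open Sys sys

    sys-mutᵀ : ∀ {S T lev β} → T k ≡ true → Ord G T → Sys S T lev (G ᵀ) β → Sys S T lev (G' ᵀ) (mut β)
    sys-mutᵀ {S} {T} {lev} {β} Tk od sys = record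
      { lvl = lvl ; link = link-mutᵀ Tk link ; supp = λ i Ti → supp-mut {S} {β} (supp k Tk) i (supp i Ti) ; gdiag = λ i Ti → G'-diag od Tk i Ti }
      where open Sys sys

    neg-unit≱0 : ∀ {x : V N} {s} → x ≐ neg (unit s) → ¬ (0ℤ ≤ x s)
    neg-unit≱0 {x} {s} p q = case (subst (0ℤ ≤_) (trans (p s) (cong -_ (unit-same s))) q)
      where
      case : ¬ (0ℤ ≤ -1ℤ)
      case ()

    -- A new obstacle would need a positive `r j`. If `β j` is positive, adding copies of `β k`
    -- keeps it so. If it is negative, coherence gives `G k j = 0`, and pairing `β k` with the
    -- mutated member yields `r j` on one side and `- β k s` on the other.
    free-source : ∀ {S T lev β s} → Sys S T lev G β → T k ≡ true → Pos (β k) → Coherent G β T → Src S lev s →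
                  ¬ (β k ≐ unit s) → (∀ j → T j ≡ true → ¬ (β j ≐ neg (unit s))) → ∀ j → T j ≡ true → ¬ (mut β j ≐ neg (unit s))
    free-source {S} {T} {lev} {β} {s} sys Tk posk P src k≠ free j Tj eq = go (j ≟ k)
      where
      open Coherent P
      open Sys sys
      go : Dec (j ≡ k) → ⊥
      go (yes refl) = k≠ λ t → trans (sym (neg-involutive (β k t))) (trans (cong -_ (trans (sym (mut-k β t)) (eq t))) (neg-involutive (unit s t)))
      go (no n) with ≤0-or-1≤ (r j)
      ... | inj₁ p = free j Tj λ t → trans (sym (mut-r0 β n (≤-antisym p (r≥0 j)) t)) (eq t)
      ... | inj₂ p with c j in cj | col j Tj
      ...   | true  | pos = neg-unit≱0 eq (subst (0ℤ ≤_) (sym (mut-o β n s)) (0≤+ (pos s) (0≤* (r≥0 j) (posk s))))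
      ...   | false | _ = 1≰0 (≤-trans p (subst (_≤ 0ℤ) (sym r-val) (neg≤0 (posk s))))
        where
        ck : c k ≡ true
        ck = sgn-unique (c k) true (root k Tk) (col k Tk) posk
        r-val : r j ≡ - β k s
        r-val = begin
          r j ≡⟨ sym (lem (r j)) ⟩
          1ℤ * 0ℤ + r j * 1ℤ ≡⟨ sym (cong₂ (λ a b → 1ℤ * a + r j * b) (trans (link k j Tk Tj) (subst₂ (λ a b → OK a b (G k j)) ck cj (ok k j Tk Tj (n ∘ sym)))) (trans (link k k Tk Tk) (diag k))) ⟩
          1ℤ * E lev (β k) (β j) + r j * E lev (β k) (β k) ≡⟨ sym (form-linʳ (e lev) 1ℤ (r j) (β j) (β k) (β k)) ⟩
          E lev (β k) (λ t → 1ℤ * β j t + r j * β k t) ≡⟨ form-cong (e lev) (λ _ → refl) (λ t → trans (cong (_+ r j * β k t) (*-identityˡ (β j t))) (trans (sym (mut-o β n t)) (eq t))) ⟩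
          E lev (β k) (neg (unit s)) ≡⟨ trans (form-negʳ (e lev) (β k) (unit s)) (cong -_ (E-source src (supp k Tk))) ⟩
          - β k s ∎
          where
          open ≡-Reasoning
          lem : ∀ a → 1ℤ * 0ℤ + a * 1ℤ ≡ a
          lem = solve-∀

    -- If `unit s` arose by adding copies of `β k`, pairing with `β k` would show that `β k`
    -- vanishes at `s`. Then `β j` is positive there, hence everywhere, and off `s` the two cancel,
    -- leaving no room for the positive root `β k`.
    free-sink : ∀ {S T lev β s} → Sys S T lev (G ᵀ) β → T k ≡ true → Pos (β k) → Src S lev s →
                (∀ j → T j ≡ true → ¬ (β j ≐ unit s)) → ∀ j → T j ≡ true → ¬ (mut β j ≐ unit s)
    free-sink {S} {T} {lev} {β} {s} sys Tk posk src free j Tj eq = go (j ≟ k)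
      where
      open Sys sys
      go : Dec (j ≡ k) → ⊥
      go (yes refl) = neg-unit≱0 {β k} {s} (λ t → trans (sym (neg-involutive (β k t))) (cong -_ (trans (sym (mut-k β t)) (eq t)))) (posk s)
      go (no n) with ≤0-or-1≤ (r j)
      ... | inj₁ p = free j Tj λ t → trans (sym (mut-r0 β n (≤-antisym p (r≥0 j)) t)) (eq t)
      ... | inj₂ p = contra (root-sign (β j) (root j Tj))
        where
        βks : β k s ≡ 0ℤ
        βks = begin
          β k s ≡⟨ sym (E-source src (supp k Tk)) ⟩
          E lev (β k) (unit s) ≡⟨ form-cong (e lev) (λ _ → refl) (λ t → trans (sym (eq t)) (trans (mut-o β n t) (cong (_+ r j * β k t) (sym (*-identityˡ (β j t)))))) ⟩
          E lev (β k) (λ t → 1ℤ * β j t + r j * β k t) ≡⟨ form-linʳ (e lev) 1ℤ (r j) (β j) (β k) (β k) ⟩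
          1ℤ * E lev (β k) (β j) + r j * E lev (β k) (β k) ≡⟨ cong₂ (λ a b → 1ℤ * a + r j * b) (trans (link k j Tk Tj) (trans (sym (neg-involutive (G j k))) (cong -_ (sym (r≥1 p))))) (trans (link k k Tk Tk) (diag k)) ⟩
          1ℤ * - r j + r j * 1ℤ ≡⟨ lem (r j) ⟩
          0ℤ ∎
          where
          open ≡-Reasoning
          lem : ∀ a → 1ℤ * - a + a * 1ℤ ≡ 0ℤ
          lem = solve-∀
        βj : ∀ t → β j t + r j * β k t ≡ unit s t
        βj t = trans (sym (mut-o β n t)) (eq t)
        βjs : β j s ≡ 1ℤ
        βjs = trans (sym (trans (cong (λ z → β j s + r j * z) βks) (trans (cong (λ z → β j s + z) (*-zeroʳ (r j))) (+-identityʳ (β j s))))) (trans (βj s) (unit-same s))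
        contra : Pos (β j) ⊎ Neg (β j) → ⊥
        contra (inj₂ ng) = 1≰0 (subst (_≤ 0ℤ) βjs (ng s))
        contra (inj₁ pos) = pos∧neg (root k Tk) posk λ t → at t (t ≟ s)
          where
          at : ∀ t → Dec (t ≡ s) → β k t ≤ 0ℤ
          at t (yes refl) = ≤-reflexive βks
          at t (no m) = *-cancelˡ-≤-pos (β k t) 0ℤ (r j) ⦃ positive (<-≤-trans (+<+ (ℕ.s≤s ℕ.z≤n)) p) ⦄
            (by-diff (pos t) (trans (lem (β j t) (r j * β k t)) (cong₂ _-_ (trans (βj t) (trans (unit-other m) (sym (*-zeroʳ (r j))))) refl)))
            where
            lem : ∀ a b → a ≡ (a + b) - b
            lem = solve-∀

    dual-turn : ∀ {S T lev g β} → Sys S T lev (g ᵀ) β → Sys S T lev (g ᵀ) (λ i → neg (β i))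
    dual-turn {lev = lev} {β = β} sys = record { lvl = lvl ; link = λ i j Ti Tj → trans (form-neg-neg (e lev) (β i) (β j)) (link i j Ti Tj) ; supp = λ i Ti t St → cong -_ (supp i Ti t St) ; gdiag = gdiag }
      where open Sys sys

    rfl-neg : ∀ s x → rfl s (neg x) ≐ neg (rfl s x)
    rfl-neg s x t = trans (rfl-cong s (λ t → lem (x t)) t) (trans (rfl-lin s -1ℤ 0ℤ x x t) (sym (lem (rfl s x t))))
      where
      lem : ∀ a → - a ≡ -1ℤ * a + 0ℤ * a
      lem = solve-∀

    neg-neg : ∀ (x : V N) → neg (neg x) ≐ x
    neg-neg x t = neg-involutive (x t)

    forward-sink : ∀ {S T lev g β s} → Sys S T lev (g ᵀ) β → S s ≡ true → Src S lev s → (∀ j → T j ≡ true → ¬ (β j ≐ unit s)) →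
                   Coherent g β T → Coherent g (λ i → rfl s (β i)) T
    forward-sink {g = g} {β} {s} sys Ss src free P = coh-cong (λ i _ t → trans (cong -_ (rfl-neg s (β i) t)) (neg-involutive (rfl s (β i) t)))
      (coh-dual (Turn.forward (dual-turn {g = g} sys) Ss src (λ j Tj eq → free j Tj λ t → trans (sym (neg-involutive (β j t))) (trans (cong -_ (eq t)) (neg-involutive (unit s t)))) (coh-dual P)))

    backward-sink : ∀ {S T lev g β s} → Sys S T lev (g ᵀ) β → S s ≡ true → Src S lev s → (∀ j → T j ≡ true → ¬ (β j ≐ unit s)) →
                    Coherent g (λ i → rfl s (β i)) T → Coherent g β T
    backward-sink {g = g} {β} {s} sys Ss src free P = coh-cong (λ i _ → neg-neg (β i))
      (coh-dual (Turn.backward (dual-turn {g = g} sys) Ss src (λ j Tj eq → free j Tj λ t → trans (sym (neg-involutive (β j t))) (trans (cong -_ (eq t)) (neg-involutive (unit s t))))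
        (coh-cong (λ i _ t → sym (rfl-neg s (β i) t)) (coh-dual P))))

    -- Following a member until it becomes simple.

    -- Recursion on the schedule of a tracked root. It stops as soon as `β k` is simple at the
    -- current source or a member is blocking; the final step of the schedule guarantees one of
    -- these, because the tracked root is `β k` or the negative of a member.
    forward-loop : ∀ {S T lev β Y} → Reach S lev Y → (Y ≐ β k) ⊎ (∃ λ i → T i ≡ true × Y ≐ neg (β i)) → Rec S T →
                   Sys S T lev G β → T k ≡ true → Pos (β k) → Ord G T → Coherent G β T → Res T β
    forward-loop {S} {T} {lev} {β} {Y} reach tracked rec sys Tk posk od P = go reach
      where
      open Sys sys
      turn : ∀ s → S s ≡ true → Src S lev s → ¬ (β k ≐ unit s) → ¬ (∃ λ j → T j ≡ true × β j ≐ neg (unit s)) → Reach S (bump s lev) (rfl s Y) → Res T β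
      turn s Ss src k≠ no-obstacle r =
          -- Coherence of the old family goes forward through the reflection and coherence of the
          -- mutated family comes back. The two moves commute, since mutation depends only on the
          -- unchanged Gram matrix.
          Turn.backward (sys-mut Tk od sys) Ss src (free-source sys Tk posk P src k≠ free) (coh-cong (λ i _ → rfl-mut s β i) (proj₁ next)) , proj₂ next
        where
        free : ∀ j → T j ≡ true → ¬ (β j ≐ neg (unit s))
        free j Tj eq = no-obstacle (j , Tj , eq)
        tracked' : (rfl s Y ≐ rfl s (β k)) ⊎ (∃ λ i → T i ≡ true × rfl s Y ≐ neg (rfl s (β i)))
        tracked' = [ (λ p → inj₁ (rfl-cong s p)) , (λ { (i , Ti , p) → inj₂ (i , Ti , λ t → trans (rfl-cong s p t) (rfl-neg s (β i) t)) }) ]′ tracked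
        next : Res T (λ i → rfl s (β i))
        next = forward-loop r tracked' rec (Turn.sys-rfl sys Ss src free) Tk (pos-rfl s (root k Tk) posk k≠) od (Turn.forward sys Ss src free P)
      go : Reach S lev Y → Res T β
      go (Reach.here s Ss src eq) with β k ≐? unit s | search T β (neg (unit s))
      ... | yes p | _ = base-source sys Tk od P Ss src p
      ... | no _ | yes (j , Tj , p) = obstacle-source rec sys Tk posk od P Ss src Tj p
      ... | no p | no q = ⊥-elim ([ (λ z → p λ t → trans (sym (z t)) (eq t)) , (λ { (i , Ti , z) → q (i , Ti , ≐-neg λ t → trans (sym (eq t)) (z t)) }) ]′ tracked)
      go (Reach.there s Ss src r) with β k ≐? unit s | search T β (neg (unit s))
      ... | yes p | _ = base-source sys Tk od P Ss src p
      ... | no _ | yes (j , Tj , p) = obstacle-source rec sys Tk posk od P Ss src Tj p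
      ... | no p | no q = turn s Ss src p q r

    -- The same recursion for the transposed form. Here positive simple members stop it, so the
    -- tracked root is a member itself: `k`, which is then at a sink, or another index, which is an
    -- obstacle.
    backward-loop : ∀ {S T lev β Y} → Reach S lev Y → (∃ λ i → T i ≡ true × Y ≐ β i) → Rec S T →
                    Sys S T lev (G ᵀ) β → T k ≡ true → Pos (β k) → Ord G T → Coherent G β T → Res T β
    backward-loop {S} {T} {lev} {β} {Y} reach (i , Ti , z) rec sys Tk posk od P = go reach
      where
      open Sys sys
      stop : ∀ {s} → S s ≡ true → Src S lev s → (∃ λ j → T j ≡ true × β j ≐ unit s) → Res T β
      stop Ss src (j , Tj , p) = case (k ≟ j)
        where
        case : Dec (k ≡ j) → Res T β
        case (yes refl) = base-sink sys Tk od P Ss src p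
        case (no n) = obstacle-sink rec sys Tk posk od P Ss src Tj n p
      turn : ∀ s → S s ≡ true → Src S lev s → ¬ (∃ λ j → T j ≡ true × β j ≐ unit s) → Reach S (bump s lev) (rfl s Y) → Res T β
      turn s Ss src no-obstacle r =
          backward-sink {g = G'} (sys-mutᵀ Tk od sys) Ss src (free-sink sys Tk posk src free) (coh-cong (λ i _ → rfl-mut s β i) (proj₁ next)) , proj₂ next
        where
        free : ∀ j → T j ≡ true → ¬ (β j ≐ unit s)
        free j Tj eq = no-obstacle (j , Tj , eq)
        sys' : Sys S T (bump s lev) (G ᵀ) (λ i → rfl s (β i))
        sys' = record
          { lvl = lvl-bump lvl src
          ; link = λ i j Ti Tj → trans (E-rfl src Ss (supp i Ti) (supp j Tj)) (link i j Ti Tj)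
          ; supp = λ i Ti → supp-rfl Ss (supp i Ti)
          ; gdiag = gdiag }
        next : Res T (λ i → rfl s (β i))
        next = backward-loop r (i , Ti , rfl-cong s z) rec sys' Tk (pos-rfl s (root k Tk) posk (free k Tk)) od (forward-sink {g = G} sys Ss src free P)
      go : Reach S lev Y → Res T β
      go (Reach.here s Ss src eq) = stop Ss src (i , Ti , λ t → trans (sym (z t)) (eq t))
      go (Reach.there s Ss src r) with search T β (unit s)
      ... | yes p = stop Ss src p
      ... | no q = turn s Ss src q r

    -- On a proper support `β k` itself can be tracked. Each obstacle removes a vertex, so the size
    -- of the support bounds the recursion.
    proper : ∀ n {S T} → size S ≤ + n → (∃ λ s → S s ≡ false) → ∀ {lev β} → Sys S T lev G β → T k ≡ true → Pos (β k) → Ord G T → Coherent G β T → Res T β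
    proper n {S} {T} sz (s₀ , S₀) {lev} {β} sys Tk posk od P =
        forward-loop (reach-proper {S} {s₀} S₀ good) (inj₁ λ _ → refl) (rec n sz) sys Tk posk od P
      where
      open Sys sys
      good : Schedule.Good S lev (β k)
      good = record { lvl = lvl ; supp = supp k Tk ; root = root k Tk ; pos = posk }
      rec : ∀ n → size S ≤ + n → Rec S T
      rec zero sz {s} Ss = ⊥-elim (1≰0 (≤-trans (by-diff (sum-nonneg _ λ t → if-nonneg (rem S s t)) (lem (size (rem S s)))) (≤-trans (size-rem S Ss) sz)))
        where
        lem : ∀ a → a ≡ 1ℤ + a - 1ℤ
        lem = solve-∀
        if-nonneg : ∀ b → 0ℤ ≤ (if b then 1ℤ else 0ℤ)
        if-nonneg true = +≤+ ℕ.z≤n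
        if-nonneg false = ≤-refl
      rec (suc n) sz {s} {j} Ss Tk' sys' posk' od' P' = proper n (by-diff (0≤+ (diff (size-rem S Ss)) (diff sz)) (lem (size (rem S s)) (size S) (+ n))) (s , rem-self S s) sys' Tk' posk' od' P'
        where
        lem : ∀ a b n → (b - (1ℤ + a)) + (1ℤ + n - b) ≡ n - a
        lem = solve-∀

    -- On the full support a member of negative defect is tracked instead. If it is negative, its
    -- opposite is a positive root of positive defect; if it is positive, the reversed levels change
    -- the sign of the defect. An obstacle leads to a proper support.
    closed : ∀ {lev β d} → Frame lev G β d → Pos (β k) → Res full β
    closed {lev} {β} {d} F posk with negative-defect F
    ... | i , ∂i = go (c i) refl
      where
      open Frame F hiding (diag)
      open Coherent coh
      sys : Sys full full lev G β
      sys = record { lvl = lvl ; link = link ; supp = λ _ _ → supp-full ; gdiag = λ i _ → diag i }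
      rec : Rec full full
      rec {s} Ss Tk' sys' posk' od' P' = proper ∣ size (rem full s) ∣ (≤-reflexive (sym (0≤i⇒+∣i∣≡i (sum-nonneg _ λ t → if-nonneg (rem full s t))))) (s , rem-self full s) sys' Tk' posk' od' P'
        where
        if-nonneg : ∀ b → 0ℤ ≤ (if b then 1ℤ else 0ℤ)
        if-nonneg true = +≤+ ℕ.z≤n
        if-nonneg false = ≤-refl
      go : ∀ b → c i ≡ b → Res full β
      go false ci = forward-loop (reach-affine good (subst (1ℤ ≤_) (sym (form-negʳ (e lev) δ (β i))) ∂i)) (inj₂ (i , refl , λ _ → refl)) rec sys refl posk ord coh
        where
        good : Schedule.Good full lev (neg (β i))
        good = record { lvl = lvl ; supp = supp-full ; root = root-neg (Sys.root sys i refl) ; pos = pos-neg (subst (λ b → Sgn b (β i)) ci (col i refl)) }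
      go true ci = backward-loop (reach-affine good (subst (1ℤ ≤_) (sym (trans (E-neg lev δ (β i)) (E-δ lvl (β i)))) ∂i)) (i , refl , λ _ → refl) rec sysᵀ refl posk ord coh
        where
        sysᵀ : Sys full full (neg lev) (G ᵀ) β
        sysᵀ = record { lvl = lvl-neg lvl ; link = λ i j Ti Tj → trans (E-neg lev (β i) (β j)) (link j i Tj Ti) ; supp = λ _ _ → supp-full ; gdiag = λ i _ → diag i }
        good : Schedule.Good full (neg lev) (β i)
        good = record { lvl = lvl-neg lvl ; supp = supp-full ; root = Sys.root sys i refl ; pos = subst (λ b → Sgn b (β i)) ci (col i refl) }

    -- The coefficients of `δ` in the mutated family: the coefficient at `k` absorbs the copies of
    -- `β k` that the other members gained.
    d' : V N → V N
    d' d i = sg i * d i + unit k i * sum (λ j → ρ j * d j)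

    span-mut : ∀ {β d} → comb d β ≐ δ → comb (d' d) (mut β) ≐ δ
    span-mut {β} {d} span t = begin
      sum (λ i → (sg i * d i + unit k i * C) * (sg i * β i t + ρ i * b)) ≡⟨ sum-cong-≗ term ⟩
      sum (λ i → (d i * β i t + b * (ρ i * d i)) - unit k i * (C * b)) ≡⟨ sum-- (λ i → d i * β i t + b * (ρ i * d i)) (λ i → unit k i * (C * b)) ⟩
      sum (λ i → d i * β i t + b * (ρ i * d i)) - sum (λ i → unit k i * (C * b)) ≡⟨ cong₂ _-_ (trans (∑-distrib-+ (λ i → d i * β i t) (λ i → b * (ρ i * d i))) (cong (λ z → comb d β t + z) (sym (*-distribˡ-sum b (λ i → ρ i * d i))))) last ⟩
      comb d β t + b * C - C * b ≡⟨ lem (comb d β t) b C ⟩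
      comb d β t ≡⟨ span t ⟩
      δ t ∎
      where
      open ≡-Reasoning
      C b : ℤ
      C = sum (λ j → ρ j * d j)
      b = β k t
      lem : ∀ x b c → x + b * c - c * b ≡ x
      lem = solve-∀
      last : sum (λ i → unit k i * (C * b)) ≡ C * b
      last = trans (sum-single _ k λ i n → trans (cong (_* (C * b)) (unit-other n)) (*-zeroˡ (C * b))) (trans (cong (_* (C * b)) (unit-same k)) (*-identityˡ (C * b)))
      term : ∀ i → (sg i * d i + unit k i * C) * (sg i * β i t + ρ i * b) ≡ (d i * β i t + b * (ρ i * d i)) - unit k i * (C * b)
      term i = go (i ≟ k)
        where
        lemk : ∀ d c b → (-1ℤ * d + 1ℤ * c) * (-1ℤ * b + 0ℤ * b) ≡ (d * b + b * (0ℤ * d)) - 1ℤ * (c * b)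
        lemk = solve-∀
        lemo : ∀ d c x p b → (1ℤ * d + 0ℤ * c) * (1ℤ * x + p * b) ≡ (d * x + b * (p * d)) - 0ℤ * (c * b)
        lemo = solve-∀
        go : Dec (i ≡ k) → (sg i * d i + unit k i * C) * (sg i * β i t + ρ i * b) ≡ (d i * β i t + b * (ρ i * d i)) - unit k i * (C * b)
        go (yes refl) rewrite sg-k | ρ-k | unit-same k = lemk (d k) C b
        go (no n) rewrite sg-o n | unit-other n = lemo (d i) C (β i t) (ρ i) b

    frame-mut : ∀ {lev β d} → Frame lev G β d → Pos (β k) → Frame lev G' (mut β) (d' d)
    frame-mut {lev} {β} {d} F posk = record
      { lvl = Frame.lvl F ; diag = λ i → G'-diag (Frame.ord F) refl i refl ; link = link-mut refl (Frame.link F)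
      ; ord = proj₂ (closed F posk) ; coh = proj₁ (closed F posk) ; span = span-mut (Frame.span F) }

  -- Families realising a quiver, and mutation of their Gram matrices.

  record Fam (lev : V N) (B : Matrix N) : Set where
    field
      {G} : M N
      {β} : Fin N → V N
      {d} : V N
      frame : Frame lev G β d
      B≡    : ∀ i j → B i j ≡ G i j - G j i
    open Frame frame public

    gram : M N
    gram i j = G i j + G j i

    gram-sym : ∀ i j → gram i j ≡ gram j i
    gram-sym i j = +-comm (G i j) (G j i)

    gram-diag : ∀ i → gram i i ≡ + 2
    gram-diag i = cong₂ _+_ (diag i) (diag i)

    one-way : ∀ {i j} → i ≢ j → (G i j ≡ 0ℤ) ⊎ (G j i ≡ 0ℤ)
    one-way {i} {j} n with G i j ≟ℤ 0ℤ | G j i ≟ℤ 0ℤ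
    ... | yes p | _ = inj₁ p
    ... | no _ | yes p = inj₂ p
    ... | no p | no q = ⊥-elim (ℕₚ.<-asym (proj₂ ord i j refl refl n p) (proj₂ ord j i refl refl (n ∘ sym) q))

    -- At most one of `G i j` and `G j i` is nonzero, so the sum and the difference agree up to
    -- sign: `gram` is a quasi-Cartan companion of `B`.
    companion : ∀ {i j} → i ≢ j → (gram i j ≡ B i j) ⊎ (gram i j ≡ - B i j)
    companion {i} {j} n with one-way n
    ... | inj₁ p = inj₂ (trans (cong (_+ G j i) p) (sym (trans (cong -_ (trans (B≡ i j) (cong (_- G j i) p))) (lem (G j i)))))
      where
      lem : ∀ a → - (0ℤ - a) ≡ 0ℤ + a
      lem = solve-∀
    ... | inj₂ p = inj₁ (trans (cong (λ z → G i j + z) p) (sym (trans (B≡ i j) (cong (λ z → G i j - z) p))))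

    gram-form : ∀ i j → gram i j ≡ form A (β i) (β j)
    gram-form i j = trans (sym (cong₂ _+_ (link i j refl refl) (link j i refl refl))) (lvl-sep lvl supp-full supp-full)

    kernel : ∀ i → sum (λ j → d j * gram i j) ≡ 0ℤ
    kernel i = trans (sum-cong-≗ λ j → cong (d j *_) (gram-form i j)) (trans (sym (form-combʳ A d β (β i))) (trans (form-cong A (λ _ → refl) span)
      (trans (form-T A (β i) δ) (trans (form-≡M (λ t u → A-sym u t) δ (β i)) (A-δ (β i))))))

    skew : ∀ i j → B j i ≡ - B i j
    skew i j = trans (B≡ j i) (trans (lem (G j i) (G i j)) (cong -_ (sym (B≡ i j))))
      where
      lem : ∀ a b → a - b ≡ - (b - a)
      lem = solve-∀

  Opposite : ℤ → ℤ → Set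
  Opposite a b = (1ℤ ≤ a × 1ℤ ≤ - b) ⊎ (1ℤ ≤ - a × 1ℤ ≤ b)

  -- Apart from the one sign `ζ`, the new Gram matrix is computed from `B` and the old one alone,
  -- with no reference to the roots. Two families over the same quiver can therefore be compared
  -- along a whole mutation path.
  record Rel (k : Fin N) (B : Matrix N) (a a' : M N) : Set where
    field
      ζ     : ℤ
      ζ²    : ζ * ζ ≡ 1ℤ
      out   : ∀ {i} → i ≢ k → 1ℤ ≤ B k i → a' i k ≡ ζ * a i k
      inn   : ∀ {i} → i ≢ k → 1ℤ ≤ - B k i → a' i k ≡ - ζ * a i k
      cross : ∀ {i j} → i ≢ k → j ≢ k → Opposite (B k i) (B k j) → a' i j ≡ a i j - a i k * a k j
      keep  : ∀ {i j} → i ≢ k → j ≢ k → ¬ Opposite (B k i) (B k j) → a' i j ≡ a i j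

  fam-cong : ∀ {lev B B'} → (∀ i j → B i j ≡ B' i j) → Fam lev B → Fam lev B'
  fam-cong p F = record { frame = Fam.frame F ; B≡ = λ i j → trans (sym (p i j)) (Fam.B≡ F i j) }

  step-pos : ∀ {lev B} k (F : Fam lev B) → Pos (Fam.β F k) → Σ (Fam lev (mutate k B)) λ F' → Rel k B (Fam.gram F) (Fam.gram F')
  step-pos {lev} {B} k F posk = F' , record { ζ = 1ℤ ; ζ² = refl ; out = out ; inn = inn ; cross = cross ; keep = keep }
    where
    open Fam F
    open Coherent coh
    open Mutation G k diag using (r; r-neg; r-pos; G'; G'-oo; G'-ok; G'-ko; mut; sgn-unique)
    ck : c k ≡ true
    ck = sgn-unique (c k) true (trans (sym (gram-form k k)) (gram-diag k)) (col k refl) posk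
    Gki≤0 : ∀ {i} → i ≢ k → G k i ≤ 0ℤ
    Gki≤0 {i} n with c k | ck | c i | ok k i refl refl (n ∘ sym)
    ... | true | _ | true  | w = w
    ... | true | _ | false | w = ≤-reflexive w
    -- This ties the two mutations together: for a positive `β k`, coherence makes `G k i`
    -- nonpositive, so the copies added are counted by the arrows leaving `k`.
    r-B : ∀ {i} → i ≢ k → r i ≡ B k i ⊔ 0ℤ
    r-B {i} n with 0≤-or-≤-1 (G i k)
    ... | inj₁ p = trans (r-pos p) (sym (i≤j⇒i⊔j≡j (subst (_≤ 0ℤ) (sym (B≡ k i)) (by-diff (0≤+ p (0≤neg (Gki≤0 n))) (lem (G i k) (G k i))))))
      where
      lem : ∀ a b → a + - b ≡ 0ℤ - (b - a)
      lem = solve-∀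
    ... | inj₂ p = trans (r-neg neg-G) (trans (sym Bki) (sym (i≥j⇒i⊔j≡i (subst (0ℤ ≤_) (sym Bki) (1≤⇒0≤ p)))))
      where
      neg-G : G i k ≤ 0ℤ
      neg-G = subst (_≤ 0ℤ) (neg-involutive (G i k)) (neg≤0 (1≤⇒0≤ p))
      Gki≡0 : G k i ≡ 0ℤ
      Gki≡0 with one-way n
      ... | inj₁ z = ⊥-elim (1≤⇒≢0 p (cong -_ z))
      ... | inj₂ z = z
      Bki : B k i ≡ - G i k
      Bki = trans (B≡ k i) (trans (cong (_- G i k) Gki≡0) (+-identityˡ _))
    eq : ∀ i j → mutate k B i j ≡ G' i j - G' j i
    eq i j with mutate-cases k i j
    ... | inj₁ (inj₁ refl) = trans (mutate-k k B k j (inj₁ refl)) (go (j ≟ k))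
      where
      lem : ∀ a b x → - (a - b) ≡ (- a - x) - (- b - x)
      lem = solve-∀
      go : Dec (j ≡ k) → - B k j ≡ G' k j - G' j k
      go (yes refl) = trans (cong -_ (trans (B≡ k k) (+-inverseʳ (G k k)))) (sym (+-inverseʳ (G' k k)))
      go (no n) = trans (cong -_ (B≡ k j)) (trans (lem (G k j) (G j k) (r j)) (sym (cong₂ _-_ (G'-ko n) (G'-ok n))))
    ... | inj₁ (inj₂ refl) = trans (mutate-k k B i k (inj₂ refl)) (go (i ≟ k))
      where
      lem : ∀ a b x → - (a - b) ≡ (- a - x) - (- b - x)
      lem = solve-∀
      go : Dec (i ≡ k) → - B i k ≡ G' i k - G' k i
      go (yes refl) = trans (cong -_ (trans (B≡ k k) (+-inverseʳ (G k k)))) (sym (+-inverseʳ (G' k k)))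
      go (no n) = trans (cong -_ (B≡ i k)) (trans (lem (G i k) (G k i) (r i)) (sym (cong₂ _-_ (G'-ok n) (G'-ko n))))
    ... | inj₂ (n , m) = trans (mutate-o k B n m) (trans (cong₂ _+_ (B≡ i j) (cong₂ (λ x y → x * B i k + y * B k j) (sym (r-B m)) (sym (trans (r-B n) (cong (_⊔ 0ℤ) (skew i k))))))
        (trans (cong₂ (λ x y → (G i j - G j i) + (r j * x + r i * y)) (B≡ i k) (B≡ k j)) (trans (lem (G i j) (G j i) (G i k) (G k i) (G k j) (G j k) (r i) (r j)) (sym (cong₂ _-_ (G'-oo n m) (G'-oo m n))))))
      where
      lem : ∀ g g' a a' b b' x y → (g - g') + (y * (a - a') + x * (b - b')) ≡ (g + y * a + x * b + x * y) - (g' + x * b' + y * a' + y * x)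
      lem = solve-∀
    F' : Fam lev (mutate k B)
    F' = record { frame = Mutation.frame-mut G k diag frame posk ; B≡ = eq }
    r-out : ∀ {i} → i ≢ k → 1ℤ ≤ B k i → r i ≡ - gram i k × gram i k ≡ gram k i
    r-out {i} n p = trans r≡ (cong -_ (sym gr)) , gram-sym i k
      where
      r≡ : r i ≡ - - r i
      r≡ = sym (neg-involutive (r i))
      rB : r i ≡ B k i
      rB = trans (r-B n) (i≥j⇒i⊔j≡i (1≤⇒0≤ p))
      gr : gram i k ≡ - r i
      gr with one-way n
      ... | inj₁ z = ⊥-elim (1≰0 (≤-trans p (subst (_≤ 0ℤ) (sym (trans (B≡ k i) (trans (cong (λ y → G k i - y) z) (+-identityʳ _)))) (Gki≤0 n))))
      ... | inj₂ z = trans (cong (λ y → G i k + y) z) (trans (+-identityʳ _) (trans (sym (neg-involutive (G i k))) (cong -_ (sym (trans rB (trans (B≡ k i) (trans (cong (_- G i k) z) (+-identityˡ _))))))))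
    r-in : ∀ {i} → i ≢ k → B k i ≤ 0ℤ → r i ≡ 0ℤ
    r-in n p = trans (r-B n) (i≤j⇒i⊔j≡j p)
    A'ik : ∀ {i} → i ≢ k → Fam.gram F' i k ≡ - gram i k - + 2 * r i
    A'ik {i} n = trans (cong₂ _+_ (G'-ok n) (G'-ko n)) (lem (G i k) (G k i) (r i))
      where
      lem : ∀ a b x → (- a - x) + (- b - x) ≡ - (a + b) - + 2 * x
      lem = solve-∀
    A'ij : ∀ {i j} → i ≢ k → j ≢ k → Fam.gram F' i j ≡ gram i j + r j * gram i k + r i * gram k j + + 2 * (r i * r j)
    A'ij {i} {j} n m = trans (cong₂ _+_ (G'-oo n m) (G'-oo m n)) (lem (G i j) (G j i) (G i k) (G k i) (G k j) (G j k) (r i) (r j))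
      where
      lem : ∀ g g' a a' b b' x y → (g + y * a + x * b + x * y) + (g' + x * b' + y * a' + y * x) ≡ (g + g') + y * (a + a') + x * (b + b') + + 2 * (x * y)
      lem = solve-∀
    nonpos : ∀ {b} → 1ℤ ≤ - b → b ≤ 0ℤ
    nonpos {b} p = subst (_≤ 0ℤ) (neg-involutive b) (neg≤0 (1≤⇒0≤ p))
    out : ∀ {i} → i ≢ k → 1ℤ ≤ B k i → Fam.gram F' i k ≡ 1ℤ * gram i k
    out {i} n p = trans (A'ik n) (trans (cong (λ z → - gram i k - + 2 * z) (proj₁ (r-out n p))) (lem (gram i k)))
      where
      lem : ∀ a → - a - + 2 * - a ≡ 1ℤ * a
      lem = solve-∀
    inn : ∀ {i} → i ≢ k → 1ℤ ≤ - B k i → Fam.gram F' i k ≡ - 1ℤ * gram i k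
    inn {i} n p = trans (A'ik n) (trans (cong (λ z → - gram i k - + 2 * z) (r-in n (nonpos p))) (lem (gram i k)))
      where
      lem : ∀ a → - a - + 2 * 0ℤ ≡ - 1ℤ * a
      lem = solve-∀
    cross : ∀ {i j} → i ≢ k → j ≢ k → Opposite (B k i) (B k j) → Fam.gram F' i j ≡ gram i j - gram i k * gram k j
    cross {i} {j} n m (inj₁ (p , q)) = trans (A'ij n m) (trans (cong₂ (λ x y → gram i j + y * gram i k + x * gram k j + + 2 * (x * y)) (proj₁ (r-out n p)) (r-in m (nonpos q))) (lem (gram i j) (gram i k) (gram k j)))
      where
      lem : ∀ g a b → g + 0ℤ * a + - a * b + + 2 * (- a * 0ℤ) ≡ g - a * b
      lem = solve-∀
    cross {i} {j} n m (inj₂ (p , q)) = trans (A'ij n m) (trans (cong₂ (λ x y → gram i j + y * gram i k + x * gram k j + + 2 * (x * y)) (r-in n (nonpos p)) (trans (proj₁ (r-out m q)) (cong -_ (proj₂ (r-out m q))))) (lem (gram i j) (gram i k) (gram k j)))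
      where
      lem : ∀ g a b → g + - b * a + 0ℤ * b + + 2 * (0ℤ * - b) ≡ g - a * b
      lem = solve-∀
    gram-0 : ∀ {i} → i ≢ k → B k i ≡ 0ℤ → gram k i ≡ 0ℤ
    gram-0 {i} n z with companion (n ∘ sym)
    ... | inj₁ p = trans p z
    ... | inj₂ p = trans p (cong -_ z)
    keep : ∀ {i j} → i ≢ k → j ≢ k → ¬ Opposite (B k i) (B k j) → Fam.gram F' i j ≡ gram i j
    keep {i} {j} n m no-opp with ≤0-or-1≤ (B k i) | ≤0-or-1≤ (B k j)
    ... | inj₁ p | inj₁ q = trans (A'ij n m) (trans (cong₂ (λ x y → gram i j + y * gram i k + x * gram k j + + 2 * (x * y)) (r-in n p) (r-in m q)) (lem (gram i j) (gram i k) (gram k j)))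
      where
      lem : ∀ g a b → g + 0ℤ * a + 0ℤ * b + + 2 * (0ℤ * 0ℤ) ≡ g
      lem = solve-∀
    ... | inj₂ p | inj₂ q = trans (A'ij n m) (trans (cong₂ (λ x y → gram i j + y * gram i k + x * gram k j + + 2 * (x * y)) (proj₁ (r-out n p)) (trans (proj₁ (r-out m q)) (cong -_ (proj₂ (r-out m q))))) (lem (gram i j) (gram i k) (gram k j)))
      where
      lem : ∀ g a b → g + - b * a + - a * b + + 2 * (- a * - b) ≡ g
      lem = solve-∀
    ... | inj₂ p | inj₁ q = trans (A'ij n m) (trans (cong₂ (λ x y → gram i j + y * gram i k + r i * x + + 2 * (r i * y)) (gram-0 m Bkj) (r-in m q)) (lem (gram i j) (gram i k) (r i)))
      where
      lem : ∀ g a x → g + 0ℤ * a + x * 0ℤ + + 2 * (x * 0ℤ) ≡ g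
      lem = solve-∀
      Bkj : B k j ≡ 0ℤ
      Bkj with 0≤-or-≤-1 (B k j)
      ... | inj₁ z = ≤-antisym q z
      ... | inj₂ z = ⊥-elim (no-opp (inj₁ (p , z)))
    ... | inj₁ p | inj₂ q = trans (A'ij n m) (trans (cong₂ (λ x y → gram i j + r j * x + y * gram k j + + 2 * (y * r j)) (trans (gram-sym i k) (gram-0 n Bki)) (r-in n p)) (lem (gram i j) (gram k j) (r j)))
      where
      lem : ∀ g a x → g + x * 0ℤ + 0ℤ * a + + 2 * (0ℤ * x) ≡ g
      lem = solve-∀
      Bki : B k i ≡ 0ℤ
      Bki with 0≤-or-≤-1 (B k i)
      ... | inj₁ z = ≤-antisym p z
      ... | inj₂ z = ⊥-elim (no-opp (inj₂ (z , q)))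

  fam-dual : ∀ {lev B} → Fam lev B → Fam (neg lev) (λ i j → - B i j)
  fam-dual F = record { frame = frame-dual (Fam.frame F) ; B≡ = λ i j → trans (cong -_ (Fam.B≡ F i j)) (lem (Fam.G F i j) (Fam.G F j i)) }
    where
    lem : ∀ a b → - (a - b) ≡ b - a
    lem = solve-∀

  frame-lev : ∀ {lev lev' G β d} → lev ≐ lev' → Frame lev G β d → Frame lev' G β d
  frame-lev {lev} {lev'} {G} {β} p F = record
    { lvl = lvl' ; diag = diag ; link = λ i j Ti Tj → trans (sym (E-cong p (β i) (β j))) (link i j Ti Tj) ; ord = ord ; coh = coh ; span = span }
    where
    open Frame F
    lvl' : Lvl full lev'
    lvl' t u St Su n with lvl t u St Su n
    ... | inj₁ h = inj₁ h
    ... | inj₂ (inj₁ h) = inj₂ (inj₁ (trans (sym (p u)) (trans h (cong (λ z → 1ℤ + z) (p t)))))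
    ... | inj₂ (inj₂ h) = inj₂ (inj₂ (trans (sym (p t)) (trans h (cong (λ z → 1ℤ + z) (p u)))))

  fam-undual : ∀ {lev B} → Fam (neg lev) (λ i j → - B i j) → Fam lev B
  fam-undual {lev} {B} F = record { frame = frame-lev (λ t → neg-involutive (lev t)) (frame-dual (Fam.frame F)) ; B≡ = λ i j → trans (sym (neg-involutive (B i j))) (trans (cong -_ (Fam.B≡ F i j)) (lem (Fam.G F i j) (Fam.G F j i))) }
    where
    lem : ∀ a b → - (a - b) ≡ b - a
    lem = solve-∀

  opaque
    -- A negative `β k` is treated in the dual family, which realises the opposite quiver. There the
    -- member is positive; arrows out of and into `k` are exchanged, so `ζ` changes sign on the way
    -- back.
    step : ∀ {lev B} k (F : Fam lev B) → Σ (Fam lev (mutate k B)) λ F' → Rel k B (Fam.gram F) (Fam.gram F')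
    step {lev} {B} k F with root-sign (Fam.β F k) (trans (sym (Fam.gram-form F k k)) (Fam.gram-diag F k))
    ... | inj₁ pos = step-pos k F pos
    ... | inj₂ ng = fam-undual (fam-cong (mutate-neg k B) (proj₁ dual)) , record
        { ζ = - Rel.ζ rel
        ; ζ² = trans (lem (Rel.ζ rel)) (Rel.ζ² rel)
        ; out = λ {i} n p → trans (flip i k) (trans (Rel.inn rel n (subst (1ℤ ≤_) (sym (neg-involutive (B k i))) p)) (cong (- Rel.ζ rel *_) (+-comm (Fam.G F k i) (Fam.G F i k))))
        ; inn = λ {i} n p → trans (flip i k) (trans (Rel.out rel n p) (cong₂ _*_ (sym (neg-involutive (Rel.ζ rel))) (+-comm (Fam.G F k i) (Fam.G F i k))))
        ; cross = λ {i} {j} n m op → trans (flip i j) (trans (Rel.cross rel n m (opp-neg op)) (cong₂ _-_ (+-comm (Fam.G F j i) (Fam.G F i j)) (cong₂ _*_ (+-comm (Fam.G F k i) (Fam.G F i k)) (+-comm (Fam.G F j k) (Fam.G F k j)))))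
        ; keep = λ {i} {j} n m nop → trans (flip i j) (trans (Rel.keep rel n m (λ op → nop (opp-neg' op))) (+-comm (Fam.G F j i) (Fam.G F i j))) }
      where
      dual : Σ (Fam (neg lev) (mutate k (λ i j → - B i j))) λ F' → Rel k (λ i j → - B i j) (Fam.gram (fam-dual F)) (Fam.gram F')
      dual = step-pos k (fam-dual F) (pos-neg ng)
      rel : Rel k (λ i j → - B i j) (Fam.gram (fam-dual F)) (Fam.gram (proj₁ dual))
      rel = proj₂ dual
      lem : ∀ a → - a * - a ≡ a * a
      lem = solve-∀
      flip : ∀ i j → Fam.gram (fam-undual {lev} (fam-cong (mutate-neg k B) (proj₁ dual))) i j ≡ Fam.gram (proj₁ dual) i j
      flip i j = +-comm (Fam.G (proj₁ dual) j i) (Fam.G (proj₁ dual) i j)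
      opp-neg : ∀ {a b} → Opposite a b → Opposite (- a) (- b)
      opp-neg {a} {b} (inj₁ (p , q)) = inj₂ (subst (1ℤ ≤_) (sym (neg-involutive a)) p , q)
      opp-neg {a} {b} (inj₂ (p , q)) = inj₁ (p , subst (1ℤ ≤_) (sym (neg-involutive b)) q)
      opp-neg' : ∀ {a b} → Opposite (- a) (- b) → Opposite a b
      opp-neg' {a} {b} (inj₁ (p , q)) = inj₂ (p , subst (1ℤ ≤_) (neg-involutive b) q)
      opp-neg' {a} {b} (inj₂ (p , q)) = inj₁ (subst (1ℤ ≤_) (neg-involutive a) p , q)

  -- The Gram matrix is determined by the quiver up to signs.

  module Symmetry (lev : V N) (B₀ : Matrix N) (seed : ∀ {i j} → i ≢ j → (B₀ i j ≡ A i j) ⊎ (B₀ i j ≡ - A i j)) where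
    Signs : V N → Set
    Signs D = ∀ i → D i * D i ≡ 1ℤ

    -- Entrywise signs alone might have nontrivial monodromy around a cycle. The kernel vector `d`
    -- excludes this: it is balanced along every edge, vanishes nowhere by connectedness, and its
    -- signs are the required `D`.
    seed-gram : (F : Fam lev B₀) → Σ (V N) λ D → Signs D × (∀ i j → Fam.gram F i j ≡ D i * D j * A i j)
    seed-gram F = D , (λ i → sgnz² (X i)) , eq
      where
      open Fam F
      ε : M N
      ε i j with gram i j ≟ℤ A i j
      ... | yes _ = 1ℤ
      ... | no _ = -1ℤ
      ε² : ∀ i j → ε i j * ε i j ≡ 1ℤ
      ε² i j with gram i j ≟ℤ A i j
      ... | yes _ = refl
      ... | no _ = refl
      ε-diag : ∀ i → ε i i ≡ 1ℤ
      ε-diag i with gram i i ≟ℤ A i i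
      ... | yes _ = refl
      ... | no q = ⊥-elim (q (trans (gram-diag i) (sym (A-diag i))))
      εA≡ : ∀ i j → ε i j * A i j ≡ gram i j
      εA≡ i j with gram i j ≟ℤ A i j
      ... | yes p = trans (*-identityˡ (A i j)) (sym p)
      ... | no q = trans (lem (A i j)) (sym (other (i ≟ j)))
        where
        lem : ∀ a → -1ℤ * a ≡ - a
        lem = solve-∀
        other : Dec (i ≡ j) → gram i j ≡ - A i j
        other (yes refl) = ⊥-elim (q (trans (gram-diag i) (sym (A-diag i))))
        other (no n) with companion n | seed n
        ... | inj₁ p | inj₁ z = ⊥-elim (q (trans p z))
        ... | inj₁ p | inj₂ z = trans p z
        ... | inj₂ p | inj₁ z = trans p (cong -_ z)
        ... | inj₂ p | inj₂ z = ⊥-elim (q (trans p (trans (cong -_ z) (neg-involutive (A i j)))))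
      open Signed ε ε-diag ε² d using (X; balanced; εA)
      iso : form εA d d ≡ 0ℤ
      iso = trans (form-≡M εA≡ d d) (trans (form-def gram d d) (sum-0 _ λ i → trans (sum-cong-≗ λ j → cong (d i *_) (*-comm (gram i j) (d j))) (trans (sym (*-distribˡ-sum (d i) (λ j → d j * gram i j))) (trans (cong (d i *_) (kernel i)) (*-zeroʳ (d i))))))
      κ≢0 : ∀ t → κ t ≢ 0ℤ
      κ≢0 t = 1≤⇒≢0 (κ≥1 t)
      nonzero : ∃ λ s → X s ≢ 0ℤ
      nonzero with any? (λ s → ¬? (X s ≟ℤ 0ℤ))
      ... | yes p = p
      ... | no q = ⊥-elim (Defect.d≢0 frame λ i → *≡0 (decidable-stable (X i ≟ℤ 0ℤ) λ ne → q (i , ne)) (κ≢0 i))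
      ε*≢0 : ∀ t u {x} → x ≢ 0ℤ → ε t u * x ≢ 0ℤ
      ε*≢0 t u {x} ne z = ne (trans (sym (trans (sym (*-assoc (ε t u) (ε t u) x)) (trans (cong (_* x) (ε² t u)) (*-identityˡ x)))) (trans (cong (ε t u *_) z) (*-zeroʳ (ε t u))))
      X≢0 : ∀ t → X t ≢ 0ℤ
      X≢0 = along (proj₁ nonzero) (proj₂ nonzero) λ t u a ne z → ε*≢0 t u ne (trans (sym (balanced iso t u a)) z)
      D : V N
      D t = sgnz (X t)
      D-ε : ∀ t u → 1ℤ ≤ - A t u → D t ≡ ε t u * D u
      D-ε t u a = trans (cong sgnz (balanced iso t u a)) go
        where
        lem : ∀ x → -1ℤ * x ≡ - x
        lem = solve-∀
        go : sgnz (ε t u * X u) ≡ ε t u * D u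
        go with gram t u ≟ℤ A t u
        ... | yes _ = trans (cong sgnz (*-identityˡ (X u))) (sym (*-identityˡ (D u)))
        ... | no _ = trans (cong sgnz (lem (X u))) (trans (sgnz-neg (X u) (X≢0 u)) (sym (lem (D u))))
      eq : ∀ i j → gram i j ≡ D i * D j * A i j
      eq i j with i ≟ j
      ... | yes refl = trans (gram-diag i) (sym (trans (cong₂ _*_ (sgnz² (X i)) (A-diag i)) refl))
      ... | no n with ≤0-or-1≤ (- A i j)
      ...   | inj₁ p = trans (sym (εA≡ i j)) (trans (cong (ε i j *_) A0) (trans (*-zeroʳ (ε i j)) (sym (trans (cong (D i * D j *_) A0) (*-zeroʳ (D i * D j))))))
        where
        A0 : A i j ≡ 0ℤ
        A0 = ≤-antisym (A-off n) (subst (0ℤ ≤_) (neg-involutive (A i j)) (0≤neg p))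
      ...   | inj₂ p = trans (sym (εA≡ i j)) (cong (_* A i j) (sym (trans (cong (_* D j) (D-ε i j p)) (trans (*-assoc (ε i j) (D j) (D j)) (trans (cong (ε i j *_) (sgnz² (X j))) (*-identityʳ (ε i j)))))))

    gram-vanish : ∀ {B} (F : Fam lev B) {i j} → i ≢ j → B i j ≡ 0ℤ → Fam.gram F i j ≡ 0ℤ
    gram-vanish F n z with Fam.companion F n
    ... | inj₁ p = trans p z
    ... | inj₂ p = trans p (cong -_ z)

    trichotomy : ∀ a → (a ≡ 0ℤ) ⊎ (1ℤ ≤ a) ⊎ (1ℤ ≤ - a)
    trichotomy (+ zero)  = inj₁ refl
    trichotomy (+ suc n) = inj₂ (inj₁ (+≤+ (ℕ.s≤s ℕ.z≤n)))
    trichotomy -[1+ n ]  = inj₂ (inj₂ (+≤+ (ℕ.s≤s ℕ.z≤n)))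

    Equivalent : M N → M N → Set
    Equivalent a b = Σ (V N) λ D → Signs D × (∀ i j → b i j ≡ D i * D j * a i j)

    -- Both families are mutated along the path to the acyclic quiver, compared there, and the signs
    -- are pulled back through `Rel`. Products through `k` transform consistently because `D k`
    -- enters them squared.
    unique : ∀ ks {B} → (∀ i j → mutateSeq ks B i j ≡ B₀ i j) → (F₁ F₂ : Fam lev B) → Equivalent (Fam.gram F₁) (Fam.gram F₂)
    unique [] p F₁ F₂ = D , sq , eq
      where
      S₁ = seed-gram (fam-cong p F₁)
      S₂ = seed-gram (fam-cong p F₂)
      D₁ = proj₁ S₁
      D₂ = proj₁ S₂
      D : V N
      D i = D₁ i * D₂ i
      lem : ∀ a b → (a * b) * (a * b) ≡ (a * a) * (b * b)
      lem = solve-∀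
      sq : Signs D
      sq i = trans (lem (D₁ i) (D₂ i)) (cong₂ _*_ (proj₁ (proj₂ S₁) i) (proj₁ (proj₂ S₂) i))
      lem2 : ∀ a b x y z → (a * b) * (x * y) * (a * x * z) ≡ (a * a) * (x * x) * (b * y * z)
      lem2 = solve-∀
      eq : ∀ i j → Fam.gram F₂ i j ≡ D i * D j * Fam.gram F₁ i j
      eq i j = trans (proj₂ (proj₂ S₂) i j) (sym (trans (cong (D i * D j *_) (proj₂ (proj₂ S₁) i j)) (trans (lem2 (D₁ i) (D₂ i) (D₁ j) (D₂ j) (A i j))
        (trans (cong₂ (λ x y → x * y * (D₂ i * D₂ j * A i j)) (proj₁ (proj₂ S₁) i) (proj₁ (proj₂ S₁) j)) (*-identityˡ _)))))
    unique (k ∷ ks) {B} p F₁ F₂ = D , sq , eq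
      where
      F₁' = proj₁ (step k F₁)
      F₂' = proj₁ (step k F₂)
      module R₁ = Rel (proj₂ (step k F₁))
      module R₂ = Rel (proj₂ (step k F₂))
      IH = unique ks {mutate k B} p F₁' F₂'
      D' = proj₁ IH
      ζ = R₁.ζ * R₂.ζ
      lemζ : ∀ a b → (a * b) * (a * b) ≡ (a * a) * (b * b)
      lemζ = solve-∀
      ζ² : ζ * ζ ≡ 1ℤ
      ζ² = trans (lemζ R₁.ζ R₂.ζ) (cong₂ _*_ R₁.ζ² R₂.ζ²)
      -- Only the sign at `k` has to be corrected, by the product of the two signs `ζ`.
      opaque
        D : V N
        D i with i ≟ k
        ... | yes _ = ζ * D' i
        ... | no _ = D' i
        D-k : D k ≡ ζ * D' k
        D-k with k ≟ k
        ... | yes _ = refl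
        ... | no q = ⊥-elim (q refl)
        D-o : ∀ {i} → i ≢ k → D i ≡ D' i
        D-o {i} n with i ≟ k
        ... | yes q = ⊥-elim (n q)
        ... | no _ = refl
      sq : Signs D
      sq i = go (i ≟ k)
        where
        go : Dec (i ≡ k) → D i * D i ≡ 1ℤ
        go (yes refl) = trans (cong₂ _*_ D-k D-k) (trans (lemζ ζ (D' k)) (cong₂ _*_ ζ² (proj₁ (proj₂ IH) k)))
        go (no n) = trans (cong₂ _*_ (D-o n) (D-o n)) (proj₁ (proj₂ IH) i)
      g₁ = Fam.gram F₁
      g₂ = Fam.gram F₂
      cancel : ∀ z₁ z₂ δ {a₁ a₁' a₂ a₂'} → z₂ * z₂ ≡ 1ℤ → a₁' ≡ z₁ * a₁ → a₂' ≡ z₂ * a₂ → a₂' ≡ δ * a₁' → a₂ ≡ (z₁ * z₂) * δ * a₁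
      cancel z₁ z₂ δ {a₁} {a₁'} {a₂} {a₂'} zz p q h = trans (sym (trans (cong (_* a₂) zz) (*-identityˡ a₂))) (trans (*-assoc z₂ z₂ a₂) (trans (cong (z₂ *_) (trans (sym q) (trans h (cong (δ *_) p)))) (lem z₁ z₂ δ a₁)))
        where
        lem : ∀ z₁ z₂ δ a → z₂ * (δ * (z₁ * a)) ≡ (z₁ * z₂) * δ * a
        lem = solve-∀
      lem-nn : ∀ a b → - a * - b ≡ a * b
      lem-nn = solve-∀
      ik : ∀ {i} → i ≢ k → g₂ i k ≡ D i * D k * g₁ i k
      ik {i} n with trichotomy (B k i)
      ... | inj₁ z = trans (gram-vanish F₂ n z') (sym (trans (cong (D i * D k *_) (gram-vanish F₁ n z')) (*-zeroʳ (D i * D k))))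
        where
        z' : B i k ≡ 0ℤ
        z' = trans (Fam.skew F₁ k i) (cong -_ z)
      ... | inj₂ (inj₁ b) = trans (cancel R₁.ζ R₂.ζ (D' i * D' k) R₂.ζ² (R₁.out n b) (R₂.out n b) (proj₂ (proj₂ IH) i k)) (cong (_* g₁ i k) (trans (lem ζ (D' i) (D' k)) (sym (cong₂ _*_ (D-o n) D-k))))
        where
        lem : ∀ z a b → z * (a * b) ≡ a * (z * b)
        lem = solve-∀
      ... | inj₂ (inj₂ b) = trans (cancel (- R₁.ζ) (- R₂.ζ) (D' i * D' k) (trans (lem-nn R₂.ζ R₂.ζ) R₂.ζ²) (R₁.inn n b) (R₂.inn n b) (proj₂ (proj₂ IH) i k))
          (cong (_* g₁ i k) (trans (cong (_* (D' i * D' k)) (lem-nn R₁.ζ R₂.ζ)) (trans (lem ζ (D' i) (D' k)) (sym (cong₂ _*_ (D-o n) D-k)))))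
        where
        lem : ∀ z a b → z * (a * b) ≡ a * (z * b)
        lem = solve-∀
      ki : ∀ {i} → i ≢ k → g₂ k i ≡ D k * D i * g₁ k i
      ki {i} n = trans (Fam.gram-sym F₂ k i) (trans (ik n) (cong₂ _*_ (*-comm (D i) (D k)) (Fam.gram-sym F₁ i k)))
      eq : ∀ i j → g₂ i j ≡ D i * D j * g₁ i j
      eq i j = go (i ≟ k) (j ≟ k)
        where
        back : ∀ x y {a a'} → a' ≡ a - x * y → a ≡ a' + x * y
        back x y {a} refl = lem a (x * y)
          where
          lem : ∀ a b → a ≡ a - b + b
          lem = solve-∀
        mix : ∀ di dj dk a x y → di * dj * (a - x * y) + (di * dk * x) * (dk * dj * y) ≡ di * dj * a + di * dj * (x * y) * (dk * dk - 1ℤ)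
        mix = solve-∀
        fin : ∀ z w → z + w * (1ℤ - 1ℤ) ≡ z
        fin = solve-∀
        go : Dec (i ≡ k) → Dec (j ≡ k) → g₂ i j ≡ D i * D j * g₁ i j
        go (yes refl) (yes refl) = trans (Fam.gram-diag F₂ k) (sym (trans (cong₂ _*_ (sq k) (Fam.gram-diag F₁ k)) refl))
        go (no n) (yes refl) = ik n
        go (yes refl) (no n) = ki n
        go (no n) (no m) with opposite? (B k i) (B k j)
        ... | no q = trans (sym (R₂.keep n m q)) (trans (proj₂ (proj₂ IH) i j) (cong₂ _*_ (sym (cong₂ _*_ (D-o n) (D-o m))) (R₁.keep n m q)))
        ... | yes q = trans (back (g₂ i k) (g₂ k j) (R₂.cross n m q)) (trans (cong₂ _+_ (trans (proj₂ (proj₂ IH) i j) (cong₂ _*_ (sym (cong₂ _*_ (D-o n) (D-o m))) (R₁.cross n m q))) (cong₂ _*_ (ik n) (ki m)))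
                (trans (mix (D i) (D j) (D k) (g₁ i j) (g₁ i k) (g₁ k j)) (trans (cong (λ z → D i * D j * g₁ i j + D i * D j * (g₁ i k * g₁ k j) * (z - 1ℤ)) (sq k)) (fin (D i * D j * g₁ i j) (D i * D j * (g₁ i k * g₁ k j))))))

    -- Signs preserving a Gram matrix also preserve its mutations. At the acyclic quiver a nonzero
    -- entry on each edge of the connected diagram forces equal signs at its ends.
    connected : ∀ ks {B} → (∀ i j → mutateSeq ks B i j ≡ B₀ i j) → (F : Fam lev B) (Q : V N) → Signs Q → (∀ i j → Fam.gram F i j ≡ Q i * Q j * Fam.gram F i j) → ∀ s t → Q t ≡ Q s
    connected [] p F Q sq inv s = along s refl λ t u a h → trans (same t u a) h
      where
      S = seed-gram (fam-cong p F)
      D = proj₁ S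
      cancel : ∀ q {g} → g ≢ 0ℤ → g ≡ q * g → q ≡ 1ℤ
      cancel q {g} ne h = *-cancelʳ-≡ q 1ℤ g ⦃ ≢-nonZero ne ⦄ (trans (sym h) (sym (*-identityˡ g)))
      same : ∀ t u → 1ℤ ≤ - A t u → Q t ≡ Q u
      same t u a = trans (sym (trans (*-assoc (Q t) (Q u) (Q u)) (trans (cong (Q t *_) (sq u)) (*-identityʳ (Q t))))) (trans (cong (_* Q u) (cancel (Q t * Q u) ne (inv t u))) (*-identityˡ (Q u)))
        where
        ne : Fam.gram F t u ≢ 0ℤ
        ne z = 1≤⇒≢0 a (cong -_ (trans (sym (*-identityˡ (A t u))) (trans (cong (_* A t u) (sym (trans (lem (D t) (D u)) (cong₂ _*_ (proj₁ (proj₂ S) t) (proj₁ (proj₂ S) u))))) (trans (*-assoc (D t * D u) (D t * D u) (A t u)) (trans (cong (D t * D u *_) (trans (sym (proj₂ (proj₂ S) t u)) z)) (*-zeroʳ (D t * D u)))))))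
          where
          lem : ∀ a b → (a * b) * (a * b) ≡ (a * a) * (b * b)
          lem = solve-∀
    connected (k ∷ ks) {B} p F Q sq inv = connected ks {mutate k B} p F' Q sq inv'
      where
      F' = proj₁ (step k F)
      module R' = Rel (proj₂ (step k F))
      g = Fam.gram F
      g' = Fam.gram F'
      scale : ∀ z q {a a'} → a' ≡ z * a → a ≡ q * a → a' ≡ q * a'
      scale z q {a} {a'} p h = trans p (trans (cong (z *_) h) (trans (lem z q a) (cong (q *_) (sym p))))
        where
        lem : ∀ z q a → z * (q * a) ≡ q * (z * a)
        lem = solve-∀
      ik : ∀ {i} → i ≢ k → g' i k ≡ Q i * Q k * g' i k
      ik {i} n with trichotomy (B k i)
      ... | inj₁ z = trans v (sym (trans (cong (Q i * Q k *_) v) (*-zeroʳ (Q i * Q k))))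
        where
        v : g' i k ≡ 0ℤ
        v = gram-vanish F' n (trans (mutate-k k B i k (inj₂ refl)) (trans (cong -_ (trans (Fam.skew F k i) (cong -_ z))) refl))
      ... | inj₂ (inj₁ b) = scale R'.ζ (Q i * Q k) (R'.out n b) (inv i k)
      ... | inj₂ (inj₂ b) = scale (- R'.ζ) (Q i * Q k) (R'.inn n b) (inv i k)
      inv' : ∀ i j → g' i j ≡ Q i * Q j * g' i j
      inv' i j = go (i ≟ k) (j ≟ k)
        where
        mix : ∀ qi qj qk a x y → qi * qj * a - (qi * qk * x) * (qk * qj * y) ≡ qi * qj * (a - x * y) + qi * qj * (x * y) * (1ℤ - qk * qk)
        mix = solve-∀
        fin : ∀ z w → z + w * (1ℤ - 1ℤ) ≡ z
        fin = solve-∀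
        go : Dec (i ≡ k) → Dec (j ≡ k) → g' i j ≡ Q i * Q j * g' i j
        go (yes refl) (yes refl) = sym (trans (cong (_* g' k k) (sq k)) (*-identityˡ (g' k k)))
        go (no n) (yes refl) = ik n
        go (yes refl) (no n) = trans (Fam.gram-sym F' k j) (trans (ik n) (cong₂ _*_ (*-comm (Q j) (Q k)) (Fam.gram-sym F' j k)))
        go (no n) (no m) with opposite? (B k i) (B k j)
        ... | no q = trans (R'.keep n m q) (trans (inv i j) (cong (Q i * Q j *_) (sym (R'.keep n m q))))
        ... | yes q = trans (R'.cross n m q) (trans (cong₂ _-_ (inv i j) (cong₂ _*_ (inv i k) (inv k j)))
                (trans (mix (Q i) (Q j) (Q k) (g i j) (g i k) (g k j)) (trans (cong (λ z → Q i * Q j * (g i j - g i k * g k j) + Q i * Q j * (g i k * g k j) * (1ℤ - z)) (sq k))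
                  (trans (fin (Q i * Q j * (g i j - g i k * g k j)) (Q i * Q j * (g i k * g k j))) (cong (Q i * Q j *_) (sym (R'.cross n m q)))))))

    -- The given path leads to the acyclic quiver; since mutation is an involution it can be run
    -- backwards from there.
    fam-of : ∀ ks {B} → (∀ i j → mutateSeq ks B i j ≡ B₀ i j) → Fam lev B₀ → Fam lev B
    fam-of [] p F = fam-cong (λ i j → sym (p i j)) F
    fam-of (k ∷ ks) {B} p F = fam-cong (mutate-involutive k B) (proj₁ (step k (fam-of ks {mutate k B} p F)))

    -- Lifting quiver automorphisms to signed permutations.

    module Action (ks : List (Fin N)) (B : Matrix N) (path : ∀ i j → mutateSeq ks B i j ≡ B₀ i j) (F : Fam lev B) where
      open Fam F

      gram-≢0 : ∀ {i j} → i ≢ j → B i j ≢ 0ℤ → gram i j ≢ 0ℤ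
      gram-≢0 n ne z with companion n
      ... | inj₁ p = ne (trans (sym p) z)
      ... | inj₂ p = ne (trans (sym (neg-involutive _)) (cong -_ (trans (sym p) z)))

      B-diag : ∀ i → B i i ≡ 0ℤ
      B-diag i = trans (B≡ i i) (+-inverseʳ (G i i))

      B-≢ : ∀ {i j} → B i j ≢ 0ℤ → i ≢ j
      B-≢ ne refl = ne (B-diag _)

      1≤-≢ : ∀ {i j} → 1ℤ ≤ B i j → i ≢ j
      1≤-≢ p = B-≢ (1≤⇒≢0 p)

      flip-sign : ∀ {i j} → 1ℤ ≤ - B i j → 1ℤ ≤ B j i
      flip-sign {i} {j} p = subst (1ℤ ≤_) (sym (skew i j)) p

      flip-sign' : ∀ {i j} → 1ℤ ≤ B i j → 1ℤ ≤ - B j i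
      flip-sign' {i} {j} p = subst (1ℤ ≤_) (trans (sym (neg-involutive (B i j))) (cong -_ (sym (skew i j)))) p

      module Moved (g g⁻ : Fin N → Fin N) (gg⁻ : ∀ i → g (g⁻ i) ≡ i) (g⁻g : ∀ i → g⁻ (g i) ≡ i) (inv : ∀ i j → B (g i) (g j) ≡ B i j) where

        g-inj : ∀ {i j} → g i ≡ g j → i ≡ j
        g-inj {i} {j} p = trans (sym (g⁻g i)) (trans (cong g⁻ p) (g⁻g j))

        sum-g : (f : V N) → sum (λ i → f (g i)) ≡ sum f
        sum-g f = sym (sum-permute f (permutation g g⁻ gg⁻ g⁻g))

        relabelled : Fam lev B
        relabelled = record
          { G = λ i j → G (g i) (g j) ; β = λ i → β (g i) ; d = λ i → d (g i)
          ; frame = record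
            { lvl = lvl ; diag = λ i → diag (g i) ; link = λ i j _ _ → link (g i) (g j) refl refl
            ; ord = (λ i → proj₁ ord (g i)) , (λ i j _ _ n q → proj₂ ord (g i) (g j) refl refl (λ e → n (g-inj e)) q)
            ; coh = record { c = λ i → Coherent.c coh (g i) ; col = λ i _ → Coherent.col coh (g i) refl ; ok = λ i j _ _ n → Coherent.ok coh (g i) (g j) refl refl (λ e → n (g-inj e)) }
            ; span = λ t → trans (sum-g (λ j → d j * β j t)) (span t) }
          ; B≡ = λ i j → trans (sym (inv i j)) (B≡ (g i) (g j)) }

        -- Permuting the members by an automorphism gives another family over the same `B`, so
        -- uniqueness compares its Gram matrix with the original one.
        lift : Equivalent gram (λ i j → gram (g i) (g j))
        lift = unique ks path F relabelled

        -- The twisted coefficients again lie in the kernel of the Gram matrix, so their combination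
        -- is isotropic and hence proportional to `d`.
        twisted : (D : V N) → Signs D → (∀ i j → gram (g i) (g j) ≡ D i * D j * gram i j) → ∃ λ C → ∀ j → K * (D j * d (g j)) ≡ C * d j
        twisted D sq eq = κ o * comb x β o , Defect.proportional frame x iso
          where
          x : V N
          x j = D j * d (g j)
          row0 : ∀ i → sum (λ j → x j * gram i j) ≡ 0ℤ
          row0 i = trans (sum-cong-≗ term) (trans (sym (*-distribˡ-sum (D i) (λ j → d (g j) * gram (g i) (g j)))) (trans (cong (D i *_) (trans (sum-g (λ m → d m * gram (g i) m)) (kernel (g i)))) (*-zeroʳ (D i))))
            where
            lem : ∀ di dj e a → di * (e * (di * dj * a)) ≡ (di * di) * (dj * e * a)
            lem = solve-∀
            term : ∀ j → x j * gram i j ≡ D i * (d (g j) * gram (g i) (g j))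
            term j = sym (trans (cong (λ z → D i * (d (g j) * z)) (eq i j)) (trans (lem (D i) (D j) (d (g j)) (gram i j)) (trans (cong (_* (D j * d (g j) * gram i j)) (sq i)) (*-identityˡ _))))
          iso : form A (comb x β) (comb x β) ≡ 0ℤ
          iso = trans (form-combˡ A x β (comb x β)) (sum-0 _ λ i → trans (cong (x i *_) (trans (form-combʳ A x β (β i)) (trans (sum-cong-≗ λ j → cong (x j *_) (sym (gram-form i j))) (row0 i)))) (*-zeroʳ (x i)))

      d≢0 : ¬ (∀ i → d i ≡ 0ℤ)
      d≢0 = Defect.d≢0 frame

      ±1-cases : ∀ {a} → a * a ≡ 1ℤ → (a ≡ 1ℤ) ⊎ (a ≡ -1ℤ)
      ±1-cases {+ 1} _ = inj₁ refl
      ±1-cases { -[1+ 0 ]} _ = inj₂ refl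
      ±1-cases { -[1+ suc n ]} ()

      -- Involutions.

      module Involution (τ : Fin N → Fin N) (ττ : ∀ i → τ (τ i) ≡ i) (inv : ∀ i j → B (τ i) (τ j) ≡ B i j) where
        open Moved τ τ ττ ττ inv

        self : ∀ i → B i (τ i) ≡ 0ℤ
        self i = half (trans (cong (λ z → B i (τ i) + z) (trans (sym (inv i (τ i))) (trans (cong (B (τ i)) (ττ i)) (skew i (τ i))))) (+-inverseʳ (B i (τ i))))
          where
          lem : ∀ a → + 2 * a ≡ a + a
          lem = solve-∀
          half : ∀ {a} → a + a ≡ 0ℤ → a ≡ 0ℤ
          half {a} p = *≡0 {+ 2} (trans (lem a) p) λ ()

        -- An oriented 4-cycle i → j → τ i → τ j → i.
        bad : ∀ i j → 1ℤ ≤ B i j → 1ℤ ≤ - B (τ i) j → ⊥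
        bad i j p q = d≢0 λ m → *≡0 {K * K + C * C} (final m) (1≤⇒≢0 (by-diff (0≤+ (diff (1≤* K≥1 K≥1)) (0≤sq C)) (lemC K C)))
          where
          i' j' : Fin N
          i' = τ i
          j' = τ j
          Bij≥1 = p
          q' : 1ℤ ≤ B j i'
          q' = flip-sign q
          Bi'j' : B i' j' ≡ B i j
          Bi'j' = inv i j
          Bj'i : B j' i ≡ B j i'
          Bj'i = trans (cong (B j') (sym (ττ i))) (inv j i')
          i≢j : i ≢ j
          i≢j = 1≤-≢ p
          j≢i' : j ≢ i'
          j≢i' = 1≤-≢ q'
          i'≢j' : i' ≢ j'
          i'≢j' = B-≢ λ z → 1≤⇒≢0 p (trans (sym Bi'j') z)
          j'≢i : j' ≢ i
          j'≢i = B-≢ λ z → 1≤⇒≢0 q' (trans (sym Bj'i) z)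
          neg-pos-clash : ∀ {a} → 1ℤ ≤ a → 1ℤ ≤ - a → ⊥
          neg-pos-clash {a} u v = 1≰0 (≤-trans v (neg≤0 (1≤⇒0≤ u)))
          i≢i' : i ≢ i'
          i≢i' e = neg-pos-clash p (subst (λ z → 1ℤ ≤ - B z j) (sym e) q)
          j≢j' : j ≢ j'
          j≢j' e = neg-pos-clash p (subst (λ z → 1ℤ ≤ - z) (trans (cong (B i') e) Bi'j') q)
          S₁ = step j F
          F₁ = proj₁ S₁
          B₁ = mutate j B
          S₂ = step j' F₁
          F₂ = proj₁ S₂
          B₁ij' : B₁ i j' ≡ B i j'
          B₁ij' = trans (mutate-o j B i≢j (j≢j' ∘ sym)) (trans (cong (λ z → B i j' + μ (B i j) z) (self j)) (trans (cong (λ z → B i j' + z) (μ-zeroʳ (B i j))) (+-identityʳ _)))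
          Bj'j : B j' j ≡ 0ℤ
          Bj'j = trans (skew j j') (cong -_ (self j))
          B₁j'i' : B₁ j' i' ≡ B j' i'
          B₁j'i' = trans (mutate-o j B (j≢j' ∘ sym) (j≢i' ∘ sym)) (trans (cong (λ z → B j' i' + μ z (B j i')) Bj'j) (trans (cong (λ z → B j' i' + z) (μ-zeroˡ (B j i'))) (+-identityʳ _)))
          Bij' : B i j' ≡ - B j i'
          Bij' = trans (skew j' i) (cong -_ Bj'i)
          Bj'i' : B j' i' ≡ - B i j
          Bj'i' = trans (skew i' j') (cong -_ Bi'j')
          μ-pos : ∀ {a b} → 1ℤ ≤ a → 1ℤ ≤ b → μ a b ≡ b * a
          μ-pos {a} {b} u v = trans (cong₂ (λ x y → x * a + y * b) (i≥j⇒i⊔j≡i (1≤⇒0≤ v)) (i≤j⇒i⊔j≡j (neg≤0 (1≤⇒0≤ u)))) (+-identityʳ (b * a))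
          μ-neg : ∀ {a b} → 1ℤ ≤ a → 1ℤ ≤ b → μ (- a) (- b) ≡ - (b * a)
          μ-neg {a} {b} u v = trans (lem (μ a b) (μ (- a) (- b))) (trans (cong₂ _-_ (μ-inv a b) (μ-pos u v)) (+-identityˡ _))
            where
            lem : ∀ x y → y ≡ x + y - x
            lem = solve-∀
          -- Mutation at `j` creates arrows from `i` to `i'`, and mutation at `j'` creates equally
          -- many in the opposite direction.
          B₂ii' : mutate j' B₁ i i' ≡ 0ℤ
          B₂ii' = trans (mutate-o j' B₁ (j'≢i ∘ sym) i'≢j') (trans (cong₂ _+_ (trans (mutate-o j B i≢j (j≢i' ∘ sym)) (cong₂ _+_ (self i) (μ-pos p q')))
            (trans (cong₂ μ (trans B₁ij' Bij') (trans B₁j'i' Bj'i')) (μ-neg q' p))) (lem (B j i') (B i j)))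
            where
            lem : ∀ a b → 0ℤ + a * b + - (b * a) ≡ 0ℤ
            lem = solve-∀
          A₀ii' : gram i i' ≡ 0ℤ
          A₀ii' = gram-vanish F i≢i' (self i)
          A₁ii' : Fam.gram F₁ i i' ≡ 0ℤ - gram i j * gram j i'
          A₁ii' = trans (Rel.cross (proj₂ S₁) i≢j (j≢i' ∘ sym) (inj₂ (flip-sign' p , q'))) (cong (_- gram i j * gram j i') A₀ii')
          not-opp : ∀ {a b} → b ≡ 0ℤ → ¬ Opposite a b
          not-opp refl (inj₁ (_ , +≤+ ()))
          not-opp refl (inj₂ (_ , +≤+ ()))
          not-opp' : ∀ {a b} → a ≡ 0ℤ → ¬ Opposite a b
          not-opp' refl (inj₁ (+≤+ () , _))
          not-opp' refl (inj₂ (+≤+ () , _))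
          A₁ij' : Fam.gram F₁ i j' ≡ gram i j'
          A₁ij' = Rel.keep (proj₂ S₁) i≢j (j≢j' ∘ sym) (not-opp (self j))
          A₁j'i' : Fam.gram F₁ j' i' ≡ gram j' i'
          A₁j'i' = Rel.keep (proj₂ S₁) (j≢j' ∘ sym) (j≢i' ∘ sym) (not-opp' (self j))
          opp₂ : Opposite (B₁ j' i) (B₁ j' i')
          opp₂ = inj₁ (subst (1ℤ ≤_) (sym (trans (Fam.skew F₁ i j') (trans (cong -_ (trans B₁ij' Bij')) (neg-involutive _)))) q' , subst (1ℤ ≤_) (sym (trans (cong -_ (trans B₁j'i' Bj'i')) (neg-involutive _))) p)
          -- The Gram entry of `i` and `i'` must vanish before and after the two mutations, although
          -- each of them subtracts a product along one of the two paths.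
          relation : gram i j * gram j i' + gram i j' * gram j' i' ≡ 0ℤ
          relation = trans (lem (gram i j * gram j i') (gram i j' * gram j' i')) (cong -_ (trans (cong₂ (λ x y → x - y) (sym A₁ii') (sym (cong₂ _*_ A₁ij' A₁j'i'))) (trans (sym (Rel.cross (proj₂ S₂) (j'≢i ∘ sym) i'≢j' opp₂)) (gram-vanish F₂ i≢i' B₂ii'))))
            where
            lem : ∀ a b → a + b ≡ - ((0ℤ - a) - b)
            lem = solve-∀
          D : V N
          D = proj₁ lift
          sq : Signs D
          sq = proj₁ (proj₂ lift)
          lifted : ∀ a b → gram (τ a) (τ b) ≡ D a * D b * gram a b
          lifted = proj₂ (proj₂ lift)
          Q : V N
          Q a = D a * D (τ a)
          Q² : Signs Q
          Q² a = trans (lem (D a) (D (τ a))) (cong₂ _*_ (sq a) (sq (τ a)))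
            where
            lem : ∀ x y → (x * y) * (x * y) ≡ (x * x) * (y * y)
            lem = solve-∀
          Q-inv : ∀ a b → gram a b ≡ Q a * Q b * gram a b
          Q-inv a b = trans (sym (cong₂ gram (ττ a) (ττ b))) (trans (lifted (τ a) (τ b)) (trans (cong (D (τ a) * D (τ b) *_) (lifted a b)) (lem (D a) (D (τ a)) (D b) (D (τ b)) (gram a b))))
            where
            lem : ∀ x x' y y' z → x' * y' * (x * y * z) ≡ (x * x') * (y * y') * z
            lem = solve-∀
          -- By the lift, the second product in `relation` is `Q i` times the first, so `Q i = 1`
          -- would double a nonzero number instead of cancelling it.
          Qi : Q i ≡ -1ℤ
          Qi with ±1-cases (Q² i)
          ... | inj₂ z = z
          ... | inj₁ z = ⊥-elim (nz (*≡0 {+ 2} (trans (sym expr) relation) λ ()))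
            where
            nz : gram i j * gram j i' ≢ 0ℤ
            nz e = gram-≢0 j≢i' (1≤⇒≢0 q') (*≡0 e (gram-≢0 i≢j (1≤⇒≢0 p)))
            lem : ∀ x y di di' dj → x * y + (di' * dj * y) * (dj * di * x) ≡ x * y + (dj * dj) * (di * di') * (x * y)
            lem = solve-∀
            lem2 : ∀ w → w + 1ℤ * 1ℤ * w ≡ + 2 * w
            lem2 = solve-∀
            expr : gram i j * gram j i' + gram i j' * gram j' i' ≡ + 2 * (gram i j * gram j i')
            expr = trans (cong₂ (λ x y → gram i j * gram j i' + x * y)
                (trans (cong (λ z → gram z j') (sym (ττ i))) (trans (lifted i' j) (cong (D i' * D j *_) (gram-sym i' j))))
                (trans (lifted j i) (cong (D j * D i *_) (gram-sym j i))))
              (trans (lem (gram i j) (gram j i') (D i) (D i') (D j)) (trans (cong₂ (λ x y → gram i j * gram j i' + x * y * (gram i j * gram j i')) (sq j) z) (lem2 (gram i j * gram j i'))))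
          Q-all : ∀ a → Q a ≡ -1ℤ
          Q-all a = trans (connected ks path F Q Q² Q-inv i a) Qi
          T = twisted D sq lifted
          C : ℤ
          C = proj₁ T
          lemC : ∀ k c → (k * k - 1ℤ) + c * c ≡ (k * k + c * c) - 1ℤ
          lemC = solve-∀
          -- Applying the twist twice multiplies `d` by `C * C` on one side and by `K * K * Q m` on
          -- the other, and `Q m` is -1.
          final : ∀ m → (K * K + C * C) * d m ≡ 0ℤ
          final m = trans (lem K C (d m)) (trans (cong (λ z → K * K * d m + C * z) (sym (proj₂ T m))) (trans (lem2 K C (D m) (d (τ m)) (d m)) (trans (cong (λ z → K * K * d m + K * D m * z)
              (trans (sym (proj₂ T (τ m))) (cong (λ z → K * (D (τ m) * z)) (cong d (ττ m))))) (trans (lem3 K (D m) (D (τ m)) (d m)) (trans (cong (λ z → K * K * d m + K * K * z * d m) (Q-all m)) (lem4 K (d m)))))))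
            where
            lem : ∀ k c x → (k * k + c * c) * x ≡ k * k * x + c * (c * x)
            lem = solve-∀
            lem2 : ∀ k c s y x → k * k * x + c * (k * (s * y)) ≡ k * k * x + k * s * (c * y)
            lem2 = solve-∀
            lem3 : ∀ k s s' x → k * k * x + k * s * (k * (s' * x)) ≡ k * k * x + k * k * (s * s') * x
            lem3 = solve-∀
            lem4 : ∀ k x → k * k * x + k * k * -1ℤ * x ≡ 0ℤ
            lem4 = solve-∀

        coherent : ∀ i j → 0ℤ ≤ B i j * B (τ i) j
        coherent i j with trichotomy (B i j) | trichotomy (B (τ i) j)
        ... | inj₁ p | _ = ≤-reflexive (sym (cong (_* B (τ i) j) p))
        ... | inj₂ _ | inj₁ p = ≤-reflexive (sym (trans (cong (B i j *_) p) (*-zeroʳ (B i j))))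
        ... | inj₂ (inj₁ p) | inj₂ (inj₁ q) = 0≤* (1≤⇒0≤ p) (1≤⇒0≤ q)
        ... | inj₂ (inj₂ p) | inj₂ (inj₂ q) = subst (0ℤ ≤_) (lem (B i j) (B (τ i) j)) (0≤* (1≤⇒0≤ p) (1≤⇒0≤ q))
          where
          lem : ∀ a b → - a * - b ≡ a * b
          lem = solve-∀
        ... | inj₂ (inj₁ p) | inj₂ (inj₂ q) = ⊥-elim (bad i j p q)
        ... | inj₂ (inj₂ p) | inj₂ (inj₁ q) = ⊥-elim (bad (τ i) j q (subst (λ z → 1ℤ ≤ - B z j) (sym (ττ i)) p))

      -- Sign rules for triangles, norm bounds and connectedness.

      ± : ℤ → ℤ → Set
      ± x b = (x ≡ b) ⊎ (x ≡ - b)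

      μ-pos : ∀ {a b} → 1ℤ ≤ a → 1ℤ ≤ b → μ a b ≡ a * b
      μ-pos {a} {b} u v = trans (cong₂ (λ x y → x * a + y * b) (i≥j⇒i⊔j≡i (1≤⇒0≤ v)) (i≤j⇒i⊔j≡j (neg≤0 (1≤⇒0≤ u)))) (lem a b)
        where
        lem : ∀ a b → b * a + 0ℤ * b ≡ a * b
        lem = solve-∀

      -- The companion property read off after mutation at the middle vertex `k`, expressed in terms
      -- of the entries before it. All sign rules for triangles come from this one identity.
      compose : ∀ {i k j} → 1ℤ ≤ B i k → 1ℤ ≤ B k j → i ≢ j → ± (gram i j - gram i k * gram k j) (B i j + B i k * B k j)
      compose {i} {k} {j} p q n = subst₂ ± (Rel.cross (proj₂ S) (1≤-≢ p) (1≤-≢ q ∘ sym) (inj₂ (flip-sign' p , q)))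
          (trans (mutate-o k B (1≤-≢ p) (1≤-≢ q ∘ sym)) (cong (λ z → B i j + z) (μ-pos p q))) (Fam.companion (proj₁ S) n)
        where
        S = step k F

      ±-mul : ∀ {x y a b} → ± x a → ± y b → ± (x * y) (a * b)
      ±-mul (inj₁ refl) (inj₁ refl) = inj₁ refl
      ±-mul {x} {b = b} (inj₁ refl) (inj₂ refl) = inj₂ (lem x b)
        where
        lem : ∀ a b → a * - b ≡ - (a * b)
        lem = solve-∀
      ±-mul {y = y} {a = a} (inj₂ refl) (inj₁ refl) = inj₂ (lem a y)
        where
        lem : ∀ a b → - a * b ≡ - (a * b)
        lem = solve-∀
      ±-mul {a = a} {b} (inj₂ refl) (inj₂ refl) = inj₁ (lem a b)
        where
        lem : ∀ a b → - a * - b ≡ a * b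
        lem = solve-∀

      twice-≢0 : ∀ {a} → 1ℤ ≤ a → ∀ {z} → z ≡ 0ℤ → + 2 * a ≡ z → ⊥
      twice-≢0 {a} p e h = 1≤⇒≢0 p (*≡0 {+ 2} (trans h e) λ ())

      same-sign : ∀ {x y b c} → 1ℤ ≤ b → 1ℤ ≤ c → ± x b → ± y c → ± (x - y) (b + c) → ¬ (0ℤ ≤ x * y)
      same-sign {b = b} {c} p q (inj₁ refl) (inj₁ refl) (inj₁ h) _ = twice-≢0 q refl (trans (lem b c) (trans (cong (λ z → (b + c) - z) h) (lem2 b c)))
        where
        lem : ∀ b c → + 2 * c ≡ (b + c) - (b - c)
        lem = solve-∀
        lem2 : ∀ b c → (b + c) - (b + c) ≡ 0ℤ
        lem2 = solve-∀
      same-sign {b = b} {c} p q (inj₁ refl) (inj₁ refl) (inj₂ h) _ = twice-≢0 p refl (trans (lem b c) (trans (cong (λ z → (b + c) + z) h) (lem2 b c)))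
        where
        lem : ∀ b c → + 2 * b ≡ (b + c) + (b - c)
        lem = solve-∀
        lem2 : ∀ b c → (b + c) + - (b + c) ≡ 0ℤ
        lem2 = solve-∀
      same-sign {b = b} {c} p q (inj₂ refl) (inj₂ refl) (inj₁ h) _ = twice-≢0 p refl (trans (lem b c) (trans (cong (λ z → (b + c) - z) h) (lem2 b c)))
        where
        lem : ∀ b c → + 2 * b ≡ (b + c) - (- b - - c)
        lem = solve-∀
        lem2 : ∀ b c → (b + c) - (b + c) ≡ 0ℤ
        lem2 = solve-∀
      same-sign {b = b} {c} p q (inj₂ refl) (inj₂ refl) (inj₂ h) _ = twice-≢0 q refl (trans (lem b c) (trans (cong (λ z → (b + c) + z) h) (lem2 b c)))
        where
        lem : ∀ b c → + 2 * c ≡ (b + c) + (- b - - c)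
        lem = solve-∀
        lem2 : ∀ b c → (b + c) + - (b + c) ≡ 0ℤ
        lem2 = solve-∀
      same-sign {b = b} {c} p q (inj₁ refl) (inj₂ refl) _ h = 1≰0 (≤-trans (1≤* p q) (subst (_≤ 0ℤ) (lem b c) (neg≤0 h)))
        where
        lem : ∀ b c → - (b * - c) ≡ b * c
        lem = solve-∀
      same-sign {b = b} {c} p q (inj₂ refl) (inj₁ refl) _ h = 1≰0 (≤-trans (1≤* p q) (subst (_≤ 0ℤ) (lem b c) (neg≤0 h)))
        where
        lem : ∀ b c → - (- b * c) ≡ b * c
        lem = solve-∀

      -- With all three arrows compatible, the mutated quiver entry is the sum of two positive
      -- numbers. Its companion is a difference of the corresponding signed numbers, so these must
      -- have opposite signs.
      acyclic-triangle : ∀ {i k j} → 1ℤ ≤ B i k → 1ℤ ≤ B k j → 1ℤ ≤ B i j → ¬ (0ℤ ≤ gram i j * (gram i k * gram k j))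
      acyclic-triangle p q s = same-sign s (1≤* p q) (companion (1≤-≢ s)) (±-mul (companion (1≤-≢ p)) (companion (1≤-≢ q))) (compose p q (1≤-≢ s))

      pair-sum : ∀ {n} → V n → (Fin n → Fin N) → ℤ
      pair-sum c idx = sum λ r → c r * sum λ s → c s * gram (idx r) (idx s)

      pair-form : ∀ {n} (c : V n) idx → form A (comb c (λ r → β (idx r))) (comb c (λ r → β (idx r))) ≡ pair-sum c idx
      pair-form c idx = trans (form-combˡ A c (λ r → β (idx r)) (comb c (λ r → β (idx r)))) (sum-cong-≗ λ r → cong (c r *_) (trans (form-combʳ A c (λ r → β (idx r)) (β (idx r))) (sum-cong-≗ λ s → cong (c s *_) (sym (gram-form (idx r) (idx s))))))

      pair-sum≥0 : ∀ {n} (c : V n) idx → 0ℤ ≤ pair-sum c idx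
      pair-sum≥0 c idx = subst (0ℤ ≤_) (pair-form c idx) (psd (comb c (λ r → β (idx r))))

      coefficient : ∀ {n} → V n → (Fin n → Fin N) → V N
      coefficient c idx i = sum λ r → c r * unit (idx r) i

      comb-coefficient : ∀ {n} (c : V n) idx → comb (coefficient c idx) β ≐ comb c (λ r → β (idx r))
      comb-coefficient c idx t = trans (sum-cong-≗ λ i → *-distribʳ-sum (β i t) (λ r → c r * unit (idx r) i)) (trans (∑-comm (λ i r → c r * unit (idx r) i * β i t)) (sum-cong-≗ term))
        where
        term : ∀ r → sum (λ i → c r * unit (idx r) i * β i t) ≡ c r * β (idx r) t
        term r = trans (sum-single _ (idx r) λ i n → trans (cong (λ z → c r * z * β i t) (unit-other n)) (lem (c r) (β i t))) (trans (cong (λ z → c r * z * β (idx r) t) (unit-same (idx r))) (cong (_* β (idx r) t) (*-identityʳ (c r))))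
          where
          lem : ∀ a b → a * 0ℤ * b ≡ 0ℤ
          lem = solve-∀

      pair-isotropic : ∀ {n} (c : V n) idx → pair-sum c idx ≡ 0ℤ → ∃ λ C → ∀ i → K * coefficient c idx i ≡ C * d i
      pair-isotropic c idx z = κ o * comb (coefficient c idx) β o , Defect.proportional frame (coefficient c idx) (trans (form-cong A (comb-coefficient c idx) (comb-coefficient c idx)) (trans (pair-form c idx) z))

      -- The norm of `β i` minus `s` times `β j` is `4 - 2 * (s * gram i j)`, which is nonnegative.
      gram≤2 : ∀ i j s → s * s ≡ 1ℤ → s * gram i j ≤ + 2
      gram≤2 i j s ss = *-cancelˡ-≤-pos (s * gram i j) (+ 2) (+ 2) (by-diff (pair-sum≥0 c idx) eq)
        where
        c : V 2
        c zero = 1ℤ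
        c (suc zero) = - s
        idx : Fin 2 → Fin N
        idx zero = i
        idx (suc zero) = j
        lem : ∀ s a b → 1ℤ * (1ℤ * + 2 + (- s * a + 0ℤ)) + (- s * (1ℤ * a + (- s * + 2 + 0ℤ)) + 0ℤ) ≡ + 2 + + 2 * (s * s) - + 2 * (s * a) + 0ℤ * b
        lem = solve-∀
        lem2 : ∀ s a → + 2 + + 2 * 1ℤ - + 2 * (s * a) + 0ℤ * a ≡ + 2 * + 2 - + 2 * (s * a)
        lem2 = solve-∀
        eq : pair-sum c idx ≡ + 2 * + 2 - + 2 * (s * gram i j)
        eq = trans (cong₂ (λ p q → 1ℤ * (1ℤ * p + (- s * gram i j + 0ℤ)) + (- s * (1ℤ * gram j i + (- s * q + 0ℤ)) + 0ℤ)) (gram-diag i) (gram-diag j))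
          (trans (cong (λ p → 1ℤ * (1ℤ * + 2 + (- s * gram i j + 0ℤ)) + (- s * (1ℤ * p + (- s * + 2 + 0ℤ)) + 0ℤ)) (gram-sym j i)) (trans (lem s (gram i j) (gram i j)) (trans (cong (λ z → + 2 + + 2 * z - + 2 * (s * gram i j) + 0ℤ * gram i j) ss) (lem2 s (gram i j)))))

      -- If no arrows join `S` to its complement, changing signs on `S` alone preserves the Gram
      -- matrix, whereas such signs have to be constant. This is connectedness of the quiver itself,
      -- with no path in it constructed.
      separated : (S : Fin N → Bool) → (∀ i j → S i ≡ true → S j ≡ false → B i j ≡ 0ℤ) → ∀ s t → S s ≡ true → S t ≡ false → ⊥
      separated S z s t ps pt = clash (trans (sym (cong sign ps)) (trans (connected ks path F Q Q² Q-inv t s) (cong sign pt)))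
        where
        sign : Bool → ℤ
        sign true = -1ℤ
        sign false = 1ℤ
        clash : -1ℤ ≡ 1ℤ → ⊥
        clash ()
        Q : V N
        Q i = sign (S i)
        sign² : ∀ b → sign b * sign b ≡ 1ℤ
        sign² true = refl
        sign² false = refl
        Q² : Signs Q
        Q² i = sign² (S i)
        Q-inv : ∀ i j → gram i j ≡ Q i * Q j * gram i j
        Q-inv i j = go (S i) (S j) refl refl
          where
          opaque
            scale : ℤ → ℤ → ℤ
            scale q x = q * x
            scale-1 : ∀ x → x ≡ scale 1ℤ x
            scale-1 x = sym (*-identityˡ x)
            scale-0 : ∀ q {x} → x ≡ 0ℤ → x ≡ scale q x
            scale-0 q refl = sym (*-zeroʳ q)
            scale-def : ∀ {q x y} → y ≡ scale q x → y ≡ q * x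
            scale-def p = p
          apart : ∀ {x y} → S x ≡ true → S y ≡ false → x ≢ y
          apart p q refl with trans (sym p) q
          ... | ()
          go : ∀ b c → S i ≡ b → S j ≡ c → gram i j ≡ Q i * Q j * gram i j
          go true true p q = scale-def (subst (λ w → gram i j ≡ scale w (gram i j)) (sym (cong₂ (λ x y → sign x * sign y) p q)) (scale-1 (gram i j)))
          go false false p q = scale-def (subst (λ w → gram i j ≡ scale w (gram i j)) (sym (cong₂ (λ x y → sign x * sign y) p q)) (scale-1 (gram i j)))
          go true false p q = scale-def (scale-0 (Q i * Q j) (gram-vanish F (apart p q) (z i j p q)))
          go false true p q = scale-def (scale-0 (Q i * Q j) (trans (gram-sym i j) (gram-vanish F (apart q p) (z j i q p))))

      -- Automorphisms of order three: normalising the lift.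

      module Rotate (g : Fin N → Fin N) (ggg : ∀ i → g (g (g i)) ≡ i) (inv : ∀ i j → B (g i) (g j) ≡ B i j) where
        open Moved g (λ i → g (g i)) ggg ggg inv

        D₀ : V N
        D₀ = proj₁ lift

        -- The signs of the cube of the lift. Since the cube of `g` is the identity they preserve
        -- the Gram matrix, hence are constant.
        Q : V N
        Q i = D₀ i * D₀ (g i) * D₀ (g (g i))

        Q² : Signs Q
        Q² i = trans (lem (D₀ i) (D₀ (g i)) (D₀ (g (g i)))) (cong₂ _*_ (cong₂ _*_ (proj₁ (proj₂ lift) i) (proj₁ (proj₂ lift) (g i))) (proj₁ (proj₂ lift) (g (g i))))
          where
          lem : ∀ x y z → (x * y * z) * (x * y * z) ≡ (x * x) * (y * y) * (z * z)
          lem = solve-∀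

        Q-inv : ∀ i j → gram i j ≡ Q i * Q j * gram i j
        Q-inv i j = trans (sym (cong₂ gram (ggg i) (ggg j))) (trans (proj₂ (proj₂ lift) (g (g i)) (g (g j))) (trans (cong (D₀ (g (g i)) * D₀ (g (g j)) *_) (trans (proj₂ (proj₂ lift) (g i) (g j)) (cong (D₀ (g i) * D₀ (g j) *_) (proj₂ (proj₂ lift) i j))))
            (lem (D₀ i) (D₀ (g i)) (D₀ (g (g i))) (D₀ j) (D₀ (g j)) (D₀ (g (g j))) (gram i j))))
          where
          lem : ∀ x x' x'' y y' y'' z → x'' * y'' * (x' * y' * (x * y * z)) ≡ (x * x' * x'') * (y * y' * y'') * z
          lem = solve-∀

        q₀ : ℤ
        q₀ = Q o

        Q≡q : ∀ i → Q i ≡ q₀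
        Q≡q i = connected ks path F Q Q² Q-inv o i

        -- Rescaling by the constant `q₀` multiplies the cube by `q₀` three times, so its value
        -- becomes an even power of `q₀`, that is 1.
        opaque
          D : V N
          D i = q₀ * D₀ i

          sq : Signs D
          sq i = trans (lem q₀ (D₀ i)) (cong₂ _*_ (Q² o) (proj₁ (proj₂ lift) i))
            where
            lem : ∀ x y → (x * y) * (x * y) ≡ (x * x) * (y * y)
            lem = solve-∀

          lifted : ∀ i j → gram (g i) (g j) ≡ D i * D j * gram i j
          lifted i j = trans (proj₂ (proj₂ lift) i j) (sym (trans (lem q₀ (D₀ i) (D₀ j) (gram i j)) (trans (cong (_* (D₀ i * D₀ j * gram i j)) (Q² o)) (*-identityˡ _))))
            where
            lem : ∀ x a b z → (x * a) * (x * b) * z ≡ (x * x) * (a * b * z)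
            lem = solve-∀

          cube : ∀ i → D i * D (g i) * D (g (g i)) ≡ 1ℤ
          cube i = trans (lem q₀ (D₀ i) (D₀ (g i)) (D₀ (g (g i)))) (trans (cong (λ z → (q₀ * q₀) * (q₀ * z)) (Q≡q i)) (cong₂ _*_ (Q² o) (Q² o)))
            where
            lem : ∀ x a b c → (x * a) * (x * b) * (x * c) ≡ (x * x) * (x * (a * b * c))
            lem = solve-∀

        product : ∀ i → D i * D (g i) ≡ D (g (g i))
        product i = trans (sym (*-identityʳ _)) (trans (cong (D i * D (g i) *_) (sym (sq (g (g i))))) (trans (lem (D i) (D (g i)) (D (g (g i)))) (trans (cong (_* D (g (g i))) (cube i)) (*-identityˡ _))))
          where
          lem : ∀ a b c → a * b * (c * c) ≡ (a * b * c) * c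
          lem = solve-∀

        fixed-D : ∀ {f} → g f ≡ f → D f ≡ 1ℤ
        fixed-D {f} e = trans (sym (trans (cong (_* D f) (sq f)) (*-identityˡ (D f)))) (trans (sym (cong₂ (λ x y → D f * x * y) (cong D e) (cong D (trans (cong g e) e)))) (cube f))

        C : ℤ
        C = proj₁ (twisted D sq lifted)

        Kd : ∀ j → K * d (g j) ≡ C * (D j * d j)
        Kd j = trans (sym (*-identityˡ _)) (trans (cong (_* (K * d (g j))) (sym (sq j))) (trans (lem (D j) K (d (g j))) (trans (cong (D j *_) (proj₂ (twisted D sq lifted) j)) (lem2 (D j) C (d j)))))
          where
          lem : ∀ s k x → s * s * (k * x) ≡ s * (k * (s * x))
          lem = solve-∀
          lem2 : ∀ s c x → s * (c * x) ≡ c * (s * x)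
          lem2 = solve-∀

        cubes : ∀ j → (K * K * K - C * C * C) * d j ≡ 0ℤ
        cubes j = trans (lem0 K C (d j)) (trans (cong (λ z → K * K * z - C * C * C * d j) (trans (cong (λ z → K * d z) (sym (ggg j))) (Kd (g (g j)))))
            (trans (lem1 K C (D (g (g j))) (d (g (g j))) (d j)) (trans (cong (λ z → K * C * D (g (g j)) * z - C * C * C * d j) (Kd (g j))) (trans (lem2 K C (D (g (g j))) (D (g j)) (d (g j)) (d j))
              (trans (cong (λ z → C * C * D (g (g j)) * D (g j) * z - C * C * C * d j) (Kd j)) (trans (lem3 C (D j) (D (g j)) (D (g (g j))) (d j)) (trans (cong (λ z → C * C * C * z * d j - C * C * C * d j) (cube j)) (lem4 C (d j)))))))))
          where
          lem0 : ∀ k c x → (k * k * k - c * c * c) * x ≡ k * k * (k * x) - c * c * c * x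
          lem0 = solve-∀
          lem1 : ∀ k c s y x → k * k * (c * (s * y)) - c * c * c * x ≡ k * c * s * (k * y) - c * c * c * x
          lem1 = solve-∀
          lem2 : ∀ k c s s' y x → k * c * s * (c * (s' * y)) - c * c * c * x ≡ c * c * s * s' * (k * y) - c * c * c * x
          lem2 = solve-∀
          lem3 : ∀ c s s' s'' x → c * c * s'' * s' * (c * (s * x)) - c * c * c * x ≡ c * c * c * (s * s' * s'') * x - c * c * c * x
          lem3 = solve-∀
          lem4 : ∀ c x → c * c * c * 1ℤ * x - c * c * c * x ≡ 0ℤ
          lem4 = solve-∀

        -- Going once around an orbit gives equality of the cubes. The other factor of the
        -- difference is a definite quadratic form in `K` and `C`: four times it is `3 * K * K` plus
        -- the square of `2 * C + K`.
        C≡K : C ≡ K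
        C≡K with any? (λ j → ¬? (d j ≟ℤ 0ℤ))
        ... | no none = ⊥-elim (d≢0 λ i → decidable-stable (d i ≟ℤ 0ℤ) λ ne → none (i , ne))
        ... | yes (j , ne) = sym (i-j≡0⇒i≡j K C (*≡0 {K * K + K * C + C * C} (trans (lem K C) (*≡0 {d j} (trans (*-comm (d j) _) (cubes j)) ne)) λ z → 1≤⇒≢0 pos (trans (cong (+ 4 *_) z) refl)))
          where
          lem : ∀ k c → (k * k + k * c + c * c) * (k - c) ≡ k * k * k - c * c * c
          lem = solve-∀
          lem2 : ∀ k c → (k * k - 1ℤ) * + 3 + + 2 + (+ 2 * c + k) * (+ 2 * c + k) ≡ + 4 * (k * k + k * c + c * c) - 1ℤ
          lem2 = solve-∀
          pos : 1ℤ ≤ + 4 * (K * K + K * C + C * C)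
          pos = by-diff (0≤+ (0≤+ (0≤* (diff (1≤* K≥1 K≥1)) (+≤+ ℕ.z≤n)) (+≤+ ℕ.z≤n)) (0≤sq (+ 2 * C + K))) (lem2 K C)

        d-g : ∀ j → d (g j) ≡ D j * d j
        d-g j = *-cancelˡ-≡ K _ _ ⦃ ≢-nonZero (1≤⇒≢0 K≥1) ⦄ (trans (Kd j) (cong (_* (D j * d j)) C≡K))

        -- Mutation at `g a` shows that the product of Gram entries around an oriented triangle is
        -- positive. As the three entries differ by the signs `D`, which multiply to 1 along the
        -- orbit, this fixes the sign of each.
        three-cycle : ∀ a → 1ℤ ≤ B a (g a) → gram a (g a) ≡ D a * B a (g a)
        three-cycle a p = go (companion a≢c) (±-mul (companion (1≤-≢ p)) (subst (± (gram b c)) Bbc (companion (1≤-≢ p')))) (subst (± (gram a c - gram a b * gram b c)) B' (compose p p' a≢c))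
          where
          b c : Fin N
          b = g a
          c = g (g a)
          P : ℤ
          P = B a b
          Bbc : B b c ≡ P
          Bbc = inv a b
          p' : 1ℤ ≤ B b c
          p' = subst (1ℤ ≤_) (sym Bbc) p
          Bca : B c a ≡ P
          Bca = trans (cong (B c) (sym (ggg a))) (trans (inv b c) Bbc)
          Bac : B a c ≡ - P
          Bac = trans (skew c a) (cong -_ Bca)
          a≢c : a ≢ c
          a≢c e = 1≤-≢ (subst (1ℤ ≤_) (sym Bca) p) (sym e)
          B' : B a c + P * B b c ≡ P * P - P
          B' = trans (cong₂ (λ x y → x + P * y) Bac Bbc) (lem P)
            where
            lem : ∀ p → - p + p * p ≡ p * p - p
            lem = solve-∀
          gbc : gram b c ≡ D a * D b * gram a b
          gbc = lifted a b
          gac : gram a c ≡ D a * D c * gram a b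
          gac = trans (gram-sym a c) (trans (cong (gram c) (sym (ggg a))) (trans (lifted b c) (trans (cong (D b * D c *_) gbc) (trans (lem (D a) (D b) (D c) (gram a b)) (trans (cong (_* (D a * D c * gram a b)) (sq b)) (*-identityˡ _))))))
            where
            lem : ∀ x y z w → y * z * (x * y * w) ≡ y * y * (x * z * w)
            lem = solve-∀
          g² : gram a b * gram a b ≡ P * P
          g² with companion (1≤-≢ p)
          ... | inj₁ e = cong₂ _*_ e e
          ... | inj₂ e = trans (cong₂ _*_ e e) (lem P)
            where
            lem : ∀ p → - p * - p ≡ p * p
            lem = solve-∀
          y-val : gram a b * gram b c ≡ D a * D b * (P * P)
          y-val = trans (cong (gram a b *_) gbc) (trans (lem (D a) (D b) (gram a b)) (cong (D a * D b *_) g²))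
            where
            lem : ∀ x y w → w * (x * y * w) ≡ x * y * (w * w)
            lem = solve-∀
          P²≥1 : 1ℤ ≤ P * P
          P²≥1 = 1≤* p p
          finish : gram a c ≡ D a * D b * P → gram a b ≡ D a * P
          finish e = trans (sym (*-identityˡ _)) (trans (cong (_* gram a b) (sym (cong₂ _*_ (sq a) (sq c)))) (trans (lem1 (D a) (D c) (gram a b)) (trans (cong (D a * D c *_) (trans (sym gac) e)) (trans (lem2 (D a) (D b) (D c) P) (trans (cong (λ z → z * (D b * D c) * P) (sq a)) (trans (cong (_* P) (*-identityˡ (D b * D c))) (cong (_* P) (trans (product b) (cong D (ggg a))))))))))
            where
            lem1 : ∀ x z w → (x * x) * (z * z) * w ≡ x * z * (x * z * w)
            lem1 = solve-∀
            lem2 : ∀ x y z p → x * z * (x * y * p) ≡ (x * x) * (y * z) * p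
            lem2 = solve-∀
          unscale : ∀ {s t} → s * (P * P) ≡ t * (P * P) → s ≡ t
          unscale {s} {t} h = *-cancelʳ-≡ s t (P * P) ⦃ ≢-nonZero (1≤⇒≢0 P²≥1) ⦄ h
          clash₁ : ∀ {z} → + 2 * P ≡ z → z ≡ 0ℤ → ⊥
          clash₁ h e = twice-≢0 p e h
          clash₂ : ∀ {z} → + 2 * (P * P) ≡ z → z ≡ 0ℤ → ⊥
          clash₂ h e = twice-≢0 P²≥1 e h
          go : ± (gram a c) (B a c) → ± (gram a b * gram b c) (P * P) → ± (gram a c - gram a b * gram b c) (P * P - P) → gram a b ≡ D a * P
          go (inj₂ x) (inj₁ y) _ = finish (trans x (trans (cong -_ Bac) (trans (neg-involutive P) (sym (trans (cong (_* P) (unscale {D a * D b} {1ℤ} (trans (sym y-val) (trans y (sym (*-identityˡ (P * P))))))) (*-identityˡ P))))))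
          go (inj₁ x) (inj₂ y) _ = finish (trans x (trans Bac (sym (trans (cong (_* P) (unscale {D a * D b} { -1ℤ} (trans (sym y-val) (trans y (lem (P * P)))))) (sym (lem P))))))
            where
            lem : ∀ p → - p ≡ -1ℤ * p
            lem = solve-∀
          go (inj₁ x) (inj₁ y) (inj₁ h) = ⊥-elim (clash₂ (lem P) (trans (cong (λ z → (P * P - P) - z) (trans (sym (cong₂ _-_ (trans x Bac) y)) h)) (+-inverseʳ (P * P - P))))
            where
            lem : ∀ p → + 2 * (p * p) ≡ (p * p - p) - (- p - p * p)
            lem = solve-∀
          go (inj₁ x) (inj₁ y) (inj₂ h) = ⊥-elim (clash₁ (lem P) (trans (cong (λ z → - (P * P - P) - z) (trans (sym (cong₂ _-_ (trans x Bac) y)) h)) (+-inverseʳ (- (P * P - P)))))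
            where
            lem : ∀ p → + 2 * p ≡ - (p * p - p) - (- p - p * p)
            lem = solve-∀
          go (inj₂ x) (inj₂ y) (inj₁ h) = ⊥-elim (clash₁ (lem P) (trans (cong (_- (P * P - P)) (trans (sym (cong₂ _-_ (trans x (trans (cong -_ Bac) (neg-involutive P))) y)) h)) (+-inverseʳ (P * P - P))))
            where
            lem : ∀ p → + 2 * p ≡ (p - - (p * p)) - (p * p - p)
            lem = solve-∀
          go (inj₂ x) (inj₂ y) (inj₂ h) = ⊥-elim (clash₂ (lem P) (trans (cong (_- - (P * P - P)) (trans (sym (cong₂ _-_ (trans x (trans (cong -_ Bac) (neg-involutive P))) y)) h)) (+-inverseʳ (- (P * P - P)))))
            where
            lem : ∀ p → + 2 * (p * p) ≡ (p - - (p * p)) - - (p * p - p)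
            lem = solve-∀

        -- Let `P` be the number of arrows along the cycle and `c` the number joining `f` to `a`.
        -- Comparing quiver and companion after one mutation equates `c * (1 - P)` and `c * (1 + P)`
        -- up to sign, impossible for positive `c` and `P`.
        fixed-zero : ∀ {f a} → g f ≡ f → 1ℤ ≤ B a (g a) → B f a ≡ 0ℤ
        fixed-zero {f} {a} e p = go (trichotomy (B f a))
          where
          b : Fin N
          b = g a
          P : ℤ
          P = B a b
          Bfb : B f b ≡ B f a
          Bfb = trans (cong (λ z → B z b) (sym e)) (inv f a)
          gfb : gram f b ≡ D a * gram f a
          gfb = trans (cong (λ z → gram z b) (sym e)) (trans (lifted f a) (cong (_* gram f a) (trans (cong (_* D a) (fixed-D e)) (*-identityˡ (D a)))))
          scaled : ∀ {s g c} → s * s ≡ 1ℤ → 1ℤ ≤ c → ± g c → ± (s * g * (1ℤ - P)) (c + c * P) → ⊥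
          scaled {s} {g} {c} ss c≥1 gc h = impossible (±-mul (±-mul (±1-cases' {s} ss) gc) (inj₁ {B = 1ℤ - P ≡ - (1ℤ - P)} refl)) h
            where
            ±1-cases' : ∀ {s} → s * s ≡ 1ℤ → ± s 1ℤ
            ±1-cases' = ±1-cases
            lem1 : ∀ c p → + 2 * (c * p) ≡ (c + c * p) - 1ℤ * c * (1ℤ - p)
            lem1 = solve-∀
            lem2 : ∀ c p → + 2 * c ≡ 1ℤ * c * (1ℤ - p) - - (c + c * p)
            lem2 = solve-∀
            lem3 : ∀ c p → + 2 * c ≡ (c + c * p) - - (1ℤ * c * (1ℤ - p))
            lem3 = solve-∀
            lem4 : ∀ c p → + 2 * (c * p) ≡ - (1ℤ * c * (1ℤ - p)) - - (c + c * p)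
            lem4 = solve-∀
            impossible : ∀ {x} → ± x (1ℤ * c * (1ℤ - P)) → ± x (c + c * P) → ⊥
            impossible (inj₁ u) (inj₁ v) = twice-≢0 (1≤* c≥1 p) (i≡j⇒i-j≡0 (trans (sym v) u)) (lem1 c P)
            impossible (inj₁ u) (inj₂ v) = twice-≢0 c≥1 (i≡j⇒i-j≡0 (trans (sym u) v)) (lem2 c P)
            impossible (inj₂ u) (inj₁ v) = twice-≢0 c≥1 (i≡j⇒i-j≡0 (trans (sym v) u)) (lem3 c P)
            impossible (inj₂ u) (inj₂ v) = twice-≢0 (1≤* c≥1 p) (i≡j⇒i-j≡0 (trans (sym u) v)) (lem4 c P)
          go : (B f a ≡ 0ℤ) ⊎ (1ℤ ≤ B f a) ⊎ (1ℤ ≤ - B f a) → B f a ≡ 0ℤ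
          go (inj₁ z) = z
          go (inj₂ (inj₁ h)) = ⊥-elim (scaled {D a} {gram f a} {B f a} (sq a) h (companion (1≤-≢ h)) (subst₂ ± (trans (cong₂ (λ x y → x - gram f a * y) gfb (three-cycle a p)) (lem (D a) (gram f a) P)) (cong (_+ B f a * P) Bfb) (compose h p (1≤-≢ (subst (1ℤ ≤_) (sym Bfb) h)))))
            where
            lem : ∀ s g p → s * g - g * (s * p) ≡ s * g * (1ℤ - p)
            lem = solve-∀
          go (inj₂ (inj₂ h)) = ⊥-elim (scaled {1ℤ} {gram a f} {B a f} refl h' (companion (1≤-≢ h')) (subst₂ ± (trans (cong₂ (λ x y → gram a f - x * y) (three-cycle a p) (trans (gram-sym b f) (trans gfb (cong (D a *_) (gram-sym f a))))) (trans (lem (D a) (gram a f) P) (trans (cong (λ z → gram a f - z * (P * gram a f)) (sq a)) (lem' (gram a f) P))))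
              (trans (cong (λ x → B a f + P * x) Bbf) (cong (λ z → B a f + z) (*-comm P (B a f)))) (compose p (subst (1ℤ ≤_) (sym Bbf) h') (1≤-≢ h'))))
            where
            h' : 1ℤ ≤ B a f
            h' = flip-sign h
            Bbf : B b f ≡ B a f
            Bbf = trans (skew f b) (trans (cong -_ Bfb) (sym (skew f a)))
            lem : ∀ s g p → g - (s * p) * (s * g) ≡ g - (s * s) * (p * g)
            lem = solve-∀
            lem' : ∀ g p → g - 1ℤ * (p * g) ≡ 1ℤ * g * (1ℤ - p)
            lem' = solve-∀

      -- Orbit bookkeeping and the case of a single nontrivial orbit.

      module Orbits (g : Fin N → Fin N) (ggg : ∀ i → g (g (g i)) ≡ i) (inv : Preserves B g) where
        open Rotate g ggg inv
        open Orbit g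

        g² : Fin N → Fin N
        g² i = g (g i)

        ggg² : ∀ i → g² (g² (g² i)) ≡ i
        ggg² i = trans (cong (λ z → g (g (g z))) (ggg i)) (ggg i)

        inv² : ∀ i j → B (g² i) (g² j) ≡ B i j
        inv² i j = trans (inv (g i) (g j)) (inv i j)

        In-sym : ∀ {i a} → In i a → In a i
        In-sym (inj₁ p) = inj₁ (sym p)
        In-sym (inj₂ (inj₁ refl)) = inj₂ (inj₂ (sym (ggg _)))
        In-sym (inj₂ (inj₂ refl)) = inj₂ (inj₁ (sym (ggg _)))

        In-g : ∀ {i a} → In i a → In (g i) a
        In-g (inj₁ p) = inj₂ (inj₁ (cong g p))
        In-g (inj₂ (inj₁ p)) = inj₂ (inj₂ (cong g p))
        In-g (inj₂ (inj₂ p)) = inj₁ (trans (cong g p) (ggg _))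

        In-trans : ∀ {i j k} → In i j → In j k → In i k
        In-trans (inj₁ refl) q = q
        In-trans (inj₂ (inj₁ refl)) q = In-g q
        In-trans (inj₂ (inj₂ refl)) q = In-g (In-g q)

        fixed-B : ∀ {f i a} → g f ≡ f → In i a → B f i ≡ B f a
        fixed-B {f} e = go
          where
          once : ∀ a → B f (g a) ≡ B f a
          once a = trans (cong (λ z → B z (g a)) (sym e)) (inv f a)
          go : ∀ {i a} → In i a → B f i ≡ B f a
          go (inj₁ refl) = refl
          go (inj₂ (inj₁ refl)) = once _
          go (inj₂ (inj₂ refl)) = trans (once _) (once _)

        back : ∀ {x} → 1ℤ ≤ - B x (g x) → 1ℤ ≤ B (g x) (g² (g x))
        back {x} h = subst (1ℤ ≤_) (cong (B (g x)) (sym (ggg x))) (flip-sign h)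

        fixed-cycle : ∀ {f x} → g f ≡ f → B x (g x) ≢ 0ℤ → B f x ≡ 0ℤ
        fixed-cycle {f} {x} e ne = go (trichotomy (B x (g x)))
          where
          go : (B x (g x) ≡ 0ℤ) ⊎ (1ℤ ≤ B x (g x)) ⊎ (1ℤ ≤ - B x (g x)) → B f x ≡ 0ℤ
          go (inj₁ z) = ⊥-elim (ne z)
          go (inj₂ (inj₁ h)) = fixed-zero e h
          go (inj₂ (inj₂ h)) = trans (sym (fixed-B e (inj₂ (inj₁ refl)))) (Rotate.fixed-zero g² ggg² inv² (trans (cong g e) e) (back h))

        no-loops : (∀ a → ¬ (1ℤ ≤ B a (g a))) → (∀ a → ¬ (1ℤ ≤ B a (g² a))) → ∀ a → B a (g a) ≡ 0ℤ
        no-loops n₁ n₂ a with trichotomy (B a (g a))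
        ... | inj₁ z = z
        ... | inj₂ (inj₁ h) = ⊥-elim (n₁ a h)
        ... | inj₂ (inj₂ h) = ⊥-elim (n₂ (g a) (back h))

        -- A fixed endpoint turns the product into a square, and inside one orbit it vanishes. What
        -- remains are pairs from two distinct nontrivial orbits.
        coherent-if : (∀ a → B a (g a) ≡ 0ℤ) → ∀ i j → (g i ≡ i) ⊎ (g j ≡ j) ⊎ In j i ⊎ (¬ Opposite (B i j) (B (g i) j)) → 0ℤ ≤ B i j * B (g i) j
        coherent-if z i j (inj₁ e) = subst (λ w → 0ℤ ≤ B i j * B w j) (sym e) (0≤sq (B i j))
        coherent-if z i j (inj₂ (inj₁ e)) = subst (λ w → 0ℤ ≤ B i j * w) (trans (sym (inv i j)) (cong (B (g i)) e)) (0≤sq (B i j))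
        coherent-if z i j (inj₂ (inj₂ (inj₁ p))) = ≤-reflexive (sym (cong (_* B (g i) j) (vanish p)))
          where
          vanish : In j i → B i j ≡ 0ℤ
          vanish (inj₁ refl) = B-diag i
          vanish (inj₂ (inj₁ refl)) = z i
          vanish (inj₂ (inj₂ refl)) = trans (skew (g² i) i) (cong -_ (trans (cong (B (g² i)) (sym (ggg i))) (z (g² i))))
        coherent-if z i j (inj₂ (inj₂ (inj₂ n))) with trichotomy (B i j) | trichotomy (B (g i) j)
        ... | inj₁ p | _ = ≤-reflexive (sym (cong (_* B (g i) j) p))
        ... | inj₂ _ | inj₁ p = ≤-reflexive (sym (trans (cong (B i j *_) p) (*-zeroʳ (B i j))))
        ... | inj₂ (inj₁ p) | inj₂ (inj₁ q) = 0≤* (1≤⇒0≤ p) (1≤⇒0≤ q)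
        ... | inj₂ (inj₂ p) | inj₂ (inj₂ q) = subst (0ℤ ≤_) (lem (B i j) (B (g i) j)) (0≤* (1≤⇒0≤ p) (1≤⇒0≤ q))
          where
          lem : ∀ a b → - a * - b ≡ a * b
          lem = solve-∀
        ... | inj₂ (inj₁ p) | inj₂ (inj₂ q) = ⊥-elim (n (inj₁ (p , q)))
        ... | inj₂ (inj₂ p) | inj₂ (inj₁ q) = ⊥-elim (n (inj₂ (p , q)))

        -- A cycle on the only nontrivial orbit would have no arrows to any fixed vertex,
        -- contradicting connectedness.
        one-orbit-no-cycle : ∀ {f a} → OneOrbit f a → ∀ b → ¬ (1ℤ ≤ B b (g b))
        one-orbit-no-cycle {f} {a} (e , cover) b h = separated (λ i → does (g i ≟ i)) vanish f b (dec-true (g f ≟ f) e) (dec-false (g b ≟ b) moved)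
          where
          moved : g b ≢ b
          moved p = 1≤-≢ h (sym p)
          same : ∀ j → g j ≢ j → In j b
          same j n = go (cover j) (cover b)
            where
            go : (g j ≡ j) ⊎ In j a → (g b ≡ b) ⊎ In b a → In j b
            go (inj₁ p) _ = ⊥-elim (n p)
            go (inj₂ p) (inj₁ q) = ⊥-elim (moved q)
            go (inj₂ p) (inj₂ q) = In-trans p (In-sym q)
          vanish : ∀ i j → does (g i ≟ i) ≡ true → does (g j ≟ j) ≡ false → B i j ≡ 0ℤ
          vanish i j p q with g i ≟ i | g j ≟ j
          ... | yes u | no v = trans (fixed-B u (same j v)) (fixed-zero u h)

        orb-In : ∀ h {i a} → In i a → orb h i ≡ orb h a
        orb-In h (inj₁ refl) = refl
        orb-In h {a = a} (inj₂ (inj₁ refl)) = trans (cong (λ z → h (g a) + (h (g² a) + h z)) (ggg a)) (lem (h a) (h (g a)) (h (g² a)))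
          where
          lem : ∀ x y z → y + (z + x) ≡ x + (y + z)
          lem = solve-∀
        orb-In h {a = a} (inj₂ (inj₂ refl)) = trans (cong₂ (λ z w → h (g² a) + (h z + h w)) (ggg a) (cong g (ggg a))) (lem (h a) (h (g a)) (h (g² a)))
          where
          lem : ∀ x y z → z + (x + y) ≡ x + (y + z)
          lem = solve-∀

        exchange : ∀ {f a x} → TwoOrbits f a x → TwoOrbits f x a
        exchange {f} {a} {x} O = record
          { fixed = fixed ; enum = λ h → trans (enum h) (cong (λ z → h f + z) (+-comm (orb h a) (orb h x))) ; a≢ga = x≢gx ; x≢gx = a≢ga
          ; a∉x = λ p → a∉x (In-sym p) ; cover = λ i → [ inj₁ , [ (λ p → inj₂ (inj₂ p)) , (λ p → inj₂ (inj₁ p)) ]′ ]′ (cover i) }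
          where open TwoOrbits O

        In-≢g : ∀ {i a} → In i a → a ≢ g a → i ≢ g i
        In-≢g (inj₁ refl) n = n
        In-≢g (inj₂ (inj₁ refl)) n p = n (trans (sym (ggg _)) (trans (cong (λ z → g (g z)) p) (cong g (ggg _))))
        In-≢g (inj₂ (inj₂ refl)) n p = n (trans (sym (ggg _)) (trans (cong g p) (cong g (ggg _))))

        rebase : ∀ {f a x b} → TwoOrbits f a x → In b a → TwoOrbits f b x
        rebase {f} {a} {x} {b} O p = record
          { fixed = fixed ; enum = λ h → trans (enum h) (cong (λ z → h f + (z + orb h x)) (sym (orb-In h p))) ; a≢ga = In-≢g p a≢ga ; x≢gx = x≢gx
          ; a∉x = λ q → a∉x (In-trans (In-sym p) q) ; cover = λ i → [ inj₁ , [ (λ q → inj₂ (inj₁ (In-trans q (In-sym p)))) , (λ q → inj₂ (inj₂ q)) ]′ ]′ (cover i) }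
          where open TwoOrbits O

        -- Order three with one fixed vertex and two orbits.

        module TwoOrbitFolding (pos : Fin N → Fin 3) (pos-g : ∀ i → (g i ≡ i × pos i ≡ zero) ⊎ (pos (g i) ≡ succ₃ (pos i))) where
          open Moved g (λ i → g (g i)) ggg ggg inv using (g-inj)

          -- A gauge trivialising the cocycle D: it exists because D multiplies to 1 along every orbit.
          gauge : Fin 3 → Fin N → ℤ
          gauge zero i = 1ℤ
          gauge (suc zero) i = D (g² i)
          gauge (suc (suc zero)) i = D i

          σ : V N
          σ i = gauge (pos i) i

          σ² : Signs σ
          σ² i = go (pos i)
            where
            go : ∀ k → gauge k i * gauge k i ≡ 1ℤ
            go zero = refl
            go (suc zero) = sq (g² i)
            go (suc (suc zero)) = sq i

          σ-g : ∀ i → σ (g i) ≡ D i * σ i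
          σ-g i = go (pos-g i)
            where
            shift : ∀ k → gauge (succ₃ k) (g i) ≡ D i * gauge k i
            shift zero = trans (cong D (ggg i)) (sym (*-identityʳ (D i)))
            shift (suc zero) = sym (trans (*-comm (D i) (D (g² i))) (trans (cong (λ z → D (g² i) * D z) (sym (ggg i))) (trans (product (g² i)) (cong (λ z → D (g z)) (ggg i)))))
            shift (suc (suc zero)) = sym (sq i)
            go : (g i ≡ i × pos i ≡ zero) ⊎ (pos (g i) ≡ succ₃ (pos i)) → σ (g i) ≡ D i * σ i
            go (inj₁ (e , _)) = trans (cong σ e) (sym (trans (cong (_* σ i) (fixed-D e)) (*-identityˡ (σ i))))
            go (inj₂ p) = trans (cong (λ k → gauge k (g i)) p) (shift (pos i))

          opaque
            -- In the gauge `σ` the signed permutation becomes an honest one: `Γ` and the kernel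
            -- vector `d̂` are both invariant under `g`.
            Γ : M N
            Γ i j = σ i * σ j * gram i j

            Γ-sym : ∀ i j → Γ i j ≡ Γ j i
            Γ-sym i j = cong₂ _*_ (*-comm (σ i) (σ j)) (gram-sym i j)

            Γ-diag : ∀ i → Γ i i ≡ + 2
            Γ-diag i = trans (cong₂ _*_ (σ² i) (gram-diag i)) refl

            Γ-g : ∀ i j → Γ (g i) (g j) ≡ Γ i j
            Γ-g i j = trans (cong₂ _*_ (cong₂ _*_ (σ-g i) (σ-g j)) (lifted i j)) (trans (lem (D i) (D j) (σ i) (σ j) (gram i j)) (trans (cong₂ (λ x y → x * y * (σ i * σ j * gram i j)) (sq i) (sq j)) (*-identityˡ _)))
              where
              lem : ∀ a b x y z → (a * x) * (b * y) * (a * b * z) ≡ (a * a) * (b * b) * (x * y * z)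
              lem = solve-∀

            Γ-vanish : ∀ {i j} → i ≢ j → B i j ≡ 0ℤ → Γ i j ≡ 0ℤ
            Γ-vanish {i} {j} n z = trans (cong (σ i * σ j *_) (gram-vanish F n z)) (*-zeroʳ (σ i * σ j))

            gram-Γ : ∀ i j → gram i j ≡ σ i * σ j * Γ i j
            gram-Γ i j = sym (trans (lem (σ i) (σ j) (gram i j)) (trans (cong₂ (λ x y → x * y * gram i j) (σ² i) (σ² j)) (*-identityˡ _)))
              where
              lem : ∀ x y z → x * y * (x * y * z) ≡ (x * x) * (y * y) * z
              lem = solve-∀

            Γ≤2 : ∀ i j → Γ i j ≤ + 2
            Γ≤2 i j = gram≤2 i j (σ i * σ j) (trans (lem (σ i) (σ j)) (cong₂ _*_ (σ² i) (σ² j)))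
              where
              lem : ∀ x y → (x * y) * (x * y) ≡ (x * x) * (y * y)
              lem = solve-∀

            -Γ≤2 : ∀ i j → - Γ i j ≤ + 2
            -Γ≤2 i j = subst (_≤ + 2) (lem0 (σ i) (σ j) (gram i j)) (gram≤2 i j (- (σ i * σ j)) (trans (lem (σ i) (σ j)) (cong₂ _*_ (σ² i) (σ² j))))
              where
              lem0 : ∀ x y z → - (x * y) * z ≡ - (x * y * z)
              lem0 = solve-∀
              lem : ∀ x y → - (x * y) * - (x * y) ≡ (x * x) * (y * y)
              lem = solve-∀

            -- Each vertex of a triangle occurs twice in the product, so the gauge cancels.
            Γ-triangle : ∀ i j k → gram i k * (gram i j * gram j k) ≡ Γ i k * (Γ i j * Γ j k)
            Γ-triangle i j k = sym (trans (lem (σ i) (σ j) (σ k) (gram i k) (gram i j) (gram j k)) (trans (cong₂ (λ x y → x * y * (gram i k * (gram i j * gram j k))) (cong₂ _*_ (σ² i) (σ² j)) (σ² k)) (*-identityˡ _)))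
              where
              lem : ∀ x y z a b c → (x * z * a) * ((x * y * b) * (y * z * c)) ≡ (x * x) * (y * y) * (z * z) * (a * (b * c))
              lem = solve-∀

            Γ-cycle : ∀ a → 1ℤ ≤ B a (g a) → Γ a (g a) ≡ B a (g a)
            Γ-cycle a p = trans (cong₂ (λ x y → σ a * x * y) (σ-g a) (three-cycle a p)) (trans (lem (σ a) (D a) (B a (g a))) (trans (cong₂ (λ x y → x * y * B a (g a)) (σ² a) (sq a)) (*-identityˡ _)))
              where
              lem : ∀ s t b → s * (t * s) * (t * b) ≡ (s * s) * (t * t) * b
              lem = solve-∀

            d̂ : V N
            d̂ i = σ i * d i

            d̂-g : ∀ i → d̂ (g i) ≡ d̂ i
            d̂-g i = trans (cong₂ _*_ (σ-g i) (d-g i)) (trans (lem (D i) (σ i) (d i)) (trans (cong (_* (σ i * d i)) (sq i)) (*-identityˡ _)))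
              where
              lem : ∀ a x y → (a * x) * (a * y) ≡ a * a * (x * y)
              lem = solve-∀

            d̂≢0 : ¬ (∀ i → d̂ i ≡ 0ℤ)
            d̂≢0 z = d≢0 λ i → trans (sym (trans (lem (σ i) (d i)) (trans (cong (_* d i) (σ² i)) (*-identityˡ (d i))))) (trans (cong (σ i *_) (z i)) (*-zeroʳ (σ i)))
              where
              lem : ∀ x y → x * (x * y) ≡ x * x * y
              lem = solve-∀

            Γ-kernel : ∀ i → sum (λ j → d̂ j * Γ i j) ≡ 0ℤ
            Γ-kernel i = trans (sum-cong-≗ term) (trans (sym (*-distribˡ-sum (σ i) (λ j → d j * gram i j))) (trans (cong (σ i *_) (kernel i)) (*-zeroʳ (σ i))))
              where
              lem : ∀ x y e a → y * e * (x * y * a) ≡ y * y * (x * (e * a))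
              lem = solve-∀
              term : ∀ j → d̂ j * Γ i j ≡ σ i * (d j * gram i j)
              term j = trans (lem (σ i) (σ j) (d j) (gram i j)) (trans (cong (_* (σ i * (d j * gram i j))) (σ² j)) (*-identityˡ _))

            Γ-pair : ∀ {n} (c : V n) (idx : Fin n → Fin N) → pair-sum (λ r → c r * σ (idx r)) idx ≡ sum λ r → c r * sum λ s → c s * Γ (idx r) (idx s)
            Γ-pair c idx = sum-cong-≗ λ r → trans (lem (c r) (σ (idx r)) (sum (λ s → c s * σ (idx s) * gram (idx r) (idx s)))) (cong (c r *_) (trans (*-distribˡ-sum (σ (idx r)) (λ s → c s * σ (idx s) * gram (idx r) (idx s))) (sum-cong-≗ λ s → lem2 (σ (idx r)) (c s) (σ (idx s)) (gram (idx r) (idx s)))))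
              where
              lem : ∀ a b c → a * b * c ≡ a * (b * c)
              lem = solve-∀
              lem2 : ∀ x c y z → x * (c * y * z) ≡ c * (x * y * z)
              lem2 = solve-∀

            Γ-isotropic : ∀ {n} (c : V n) (idx : Fin n → Fin N) → (sum λ r → c r * sum λ s → c s * Γ (idx r) (idx s)) ≡ 0ℤ → ∃ λ C → ∀ i → K * coefficient c idx i ≡ C * d̂ i
            Γ-isotropic c idx z = proj₁ P , λ i → trans (lem0 K (σ i) (coefficient c idx i) (σ² i)) (trans (cong (λ w → σ i * (K * w)) (sym (twist i))) (trans (cong (σ i *_) (proj₂ P i)) (lem1 (σ i) (proj₁ P) (d i))))
              where
              P : ∃ λ C → ∀ i → K * coefficient (λ r → c r * σ (idx r)) idx i ≡ C * d i
              P = pair-isotropic (λ r → c r * σ (idx r)) idx (trans (Γ-pair c idx) z)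
              lem1 : ∀ s c x → s * (c * x) ≡ c * (s * x)
              lem1 = solve-∀
              lem00 : ∀ k s x → s * (k * (s * x)) ≡ s * s * (k * x)
              lem00 = solve-∀
              lem0 : ∀ k s x → s * s ≡ 1ℤ → k * x ≡ s * (k * (s * x))
              lem0 k s x e = sym (trans (lem00 k s x) (trans (cong (_* (k * x)) e) (*-identityˡ (k * x))))
              twist : ∀ i → coefficient (λ r → c r * σ (idx r)) idx i ≡ σ i * coefficient c idx i
              twist i = trans (sum-cong-≗ term) (sym (*-distribˡ-sum (σ i) (λ r → c r * unit (idx r) i)))
                where
                lem2 : ∀ c s u → c * s * u ≡ s * (c * u)
                lem2 = solve-∀
                lem3 : ∀ c s t → c * s * 0ℤ ≡ t * (c * 0ℤ)
                lem3 = solve-∀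
                term : ∀ r → c r * σ (idx r) * unit (idx r) i ≡ σ i * (c r * unit (idx r) i)
                term r = go (i ≟ idx r)
                  where
                  go : Dec (i ≡ idx r) → c r * σ (idx r) * unit (idx r) i ≡ σ i * (c r * unit (idx r) i)
                  go (yes refl) = lem2 (c r) (σ (idx r)) (unit (idx r) (idx r))
                  go (no n) = trans (cong (c r * σ (idx r) *_) (unit-other n)) (trans (lem3 (c r) (σ (idx r)) (σ i)) (cong (λ w → σ i * (c r * w)) (sym (unit-other n))))

            Γ-sum≥0 : ∀ {n} (c : V n) (idx : Fin n → Fin N) → 0ℤ ≤ sum λ r → c r * sum λ s → c s * Γ (idx r) (idx s)
            Γ-sum≥0 c idx = subst (0ℤ ≤_) (Γ-pair c idx) (pair-sum≥0 (λ r → c r * σ (idx r)) idx)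

          Γ-g² : ∀ i j → Γ (g² i) (g² j) ≡ Γ i j
          Γ-g² i j = trans (Γ-g (g i) (g j)) (Γ-g i j)

          Γ-fixed : ∀ {f} → g f ≡ f → ∀ a → Γ f (g a) ≡ Γ f a
          Γ-fixed {f} e a = trans (cong (λ z → Γ z (g a)) (sym e)) (Γ-g f a)

          -- g carries (g a , x) to (g² a , g x) and then to (a , g² x).
          Γ-1 : ∀ a x → Γ (g a) x ≡ Γ a (g² x)
          Γ-1 a x = trans (sym (Γ-g² (g a) x)) (cong (λ z → Γ z (g² x)) (ggg a))

          Γ-2 : ∀ a x → Γ (g² a) x ≡ Γ a (g x)
          Γ-2 a x = trans (sym (Γ-g (g² a) x)) (cong (λ z → Γ z (g x)) (ggg a))

          -- Invariance collapses the kernel equations to three, in the values of `d̂` on the fixed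
          -- vertex and on the two orbits. As `d̂` is nonzero, the folded matrix is singular.
          module Pair {f a x : Fin N} (O : TwoOrbits f a x) where
            open TwoOrbits O

            y₁ y₂ m a₀ a₁ a₂ s t : ℤ
            y₁ = Γ f a
            y₂ = Γ f x
            a₀ = Γ a x
            a₁ = Γ a (g x)
            a₂ = Γ a (g² x)
            m = a₀ + (a₁ + a₂)
            s = + 2 + + 2 * Γ a (g a)
            t = + 2 + + 2 * Γ x (g x)

            kernel-row : ∀ i → d̂ f * Γ i f + (d̂ a * orb (Γ i) a + d̂ x * orb (Γ i) x) ≡ 0ℤ
            kernel-row i = trans (sym (trans (enum (λ j → d̂ j * Γ i j)) (cong (λ z → d̂ f * Γ i f + z) (cong₂ _+_ (block a) (block x))))) (Γ-kernel i)
              where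
              lem : ∀ e p q r → e * p + (e * q + e * r) ≡ e * (p + (q + r))
              lem = solve-∀
              block : ∀ b → orb (λ j → d̂ j * Γ i j) b ≡ d̂ b * orb (Γ i) b
              block b = trans (cong₂ (λ u v → d̂ b * Γ i b + (u * Γ i (g b) + v * Γ i (g² b))) (d̂-g b) (trans (d̂-g (g b)) (d̂-g b))) (lem (d̂ b) (Γ i b) (Γ i (g b)) (Γ i (g² b)))

            orb-fixed : ∀ b → orb (Γ f) b ≡ + 3 * Γ f b
            orb-fixed b = trans (cong₂ (λ u v → Γ f b + (u + v)) (Γ-fixed fixed b) (trans (Γ-fixed fixed (g b)) (Γ-fixed fixed b))) (lem (Γ f b))
              where
              lem : ∀ z → z + (z + z) ≡ + 3 * z
              lem = solve-∀

            orb-self : ∀ b → orb (Γ b) b ≡ + 2 + + 2 * Γ b (g b)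
            orb-self b = trans (cong₂ (λ u v → u + (Γ b (g b) + v)) (Γ-diag b) (trans (sym (Γ-1 b b)) (Γ-sym (g b) b))) (lem (Γ b (g b)))
              where
              lem : ∀ z → + 2 + (z + z) ≡ + 2 + + 2 * z
              lem = solve-∀

            orb-cross : orb (Γ x) a ≡ m
            orb-cross = trans (cong₂ _+_ (Γ-sym x a) (cong₂ _+_ (trans (Γ-sym x (g a)) (Γ-1 a x)) (trans (Γ-sym x (g² a)) (Γ-2 a x)))) (cong (λ z → a₀ + z) (+-comm a₂ a₁))

            row-f : d̂ f * + 2 + (d̂ a * (+ 3 * y₁) + d̂ x * (+ 3 * y₂)) ≡ 0ℤ
            row-f = trans (sym (cong₂ _+_ (cong (d̂ f *_) (Γ-diag f)) (cong₂ _+_ (cong (d̂ a *_) (orb-fixed a)) (cong (d̂ x *_) (orb-fixed x))))) (kernel-row f)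

            row-a : d̂ f * y₁ + (d̂ a * s + d̂ x * m) ≡ 0ℤ
            row-a = trans (cong₂ _+_ (cong (d̂ f *_) (Γ-sym f a)) (cong (_+ d̂ x * m) (cong (d̂ a *_) (sym (orb-self a))))) (kernel-row a)

            row-x : d̂ f * y₂ + (d̂ a * m + d̂ x * t) ≡ 0ℤ
            row-x = trans (cong₂ _+_ (cong (d̂ f *_) (Γ-sym f x)) (cong₂ _+_ (cong (d̂ a *_) (sym orb-cross)) (cong (d̂ x *_) (sym (orb-self x))))) (kernel-row x)

            det≡0 : determinant s t y₁ y₂ m ≡ 0ℤ
            det≡0 = decidable-stable (determinant s t y₁ y₂ m ≟ℤ 0ℤ) λ ne → d̂≢0 (zeros (*≡0 df ne) (*≡0 da ne) (*≡0 dx ne))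
              where
              -- Cramer's rule: the coefficients are the rows of the adjugate applied to the three
              -- kernel equations.
              lemf : ∀ s t y₁ y₂ m e f g → (+ 2 * (s * t - m * m) - + 3 * y₁ * (y₁ * t - m * y₂) + + 3 * y₂ * (y₁ * m - s * y₂)) * e ≡
                 (s * t - m * m) * (e * + 2 + (f * (+ 3 * y₁) + g * (+ 3 * y₂))) + (+ 3 * y₂ * m - + 3 * y₁ * t) * (e * y₁ + (f * s + g * m)) + (+ 3 * y₁ * m - + 3 * y₂ * s) * (e * y₂ + (f * m + g * t))
              lemf = solve-∀
              lema : ∀ s t y₁ y₂ m e f g → (+ 2 * (s * t - m * m) - + 3 * y₁ * (y₁ * t - m * y₂) + + 3 * y₂ * (y₁ * m - s * y₂)) * f ≡
                 (m * y₂ - y₁ * t) * (e * + 2 + (f * (+ 3 * y₁) + g * (+ 3 * y₂))) + (+ 2 * t - + 3 * y₂ * y₂) * (e * y₁ + (f * s + g * m)) + (+ 3 * y₁ * y₂ - + 2 * m) * (e * y₂ + (f * m + g * t))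
              lema = solve-∀
              lemx : ∀ s t y₁ y₂ m e f g → (+ 2 * (s * t - m * m) - + 3 * y₁ * (y₁ * t - m * y₂) + + 3 * y₂ * (y₁ * m - s * y₂)) * g ≡
                 (y₁ * m - s * y₂) * (e * + 2 + (f * (+ 3 * y₁) + g * (+ 3 * y₂))) + (+ 3 * y₁ * y₂ - + 2 * m) * (e * y₁ + (f * s + g * m)) + (+ 2 * s - + 3 * y₁ * y₁) * (e * y₂ + (f * m + g * t))
              lemx = solve-∀
              kill : ∀ p q r {u v w} → u ≡ 0ℤ → v ≡ 0ℤ → w ≡ 0ℤ → p * u + q * v + r * w ≡ 0ℤ
              kill p q r refl refl refl = cong₂ _+_ (cong₂ _+_ (*-zeroʳ p) (*-zeroʳ q)) (*-zeroʳ r)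
              df : determinant s t y₁ y₂ m * d̂ f ≡ 0ℤ
              df = trans (lemf s t y₁ y₂ m (d̂ f) (d̂ a) (d̂ x)) (kill (s * t - m * m) (+ 3 * y₂ * m - + 3 * y₁ * t) (+ 3 * y₁ * m - + 3 * y₂ * s) row-f row-a row-x)
              da : determinant s t y₁ y₂ m * d̂ a ≡ 0ℤ
              da = trans (lema s t y₁ y₂ m (d̂ f) (d̂ a) (d̂ x)) (kill (m * y₂ - y₁ * t) (+ 2 * t - + 3 * y₂ * y₂) (+ 3 * y₁ * y₂ - + 2 * m) row-f row-a row-x)
              dx : determinant s t y₁ y₂ m * d̂ x ≡ 0ℤ
              dx = trans (lemx s t y₁ y₂ m (d̂ f) (d̂ a) (d̂ x)) (kill (y₁ * m - s * y₂) (+ 3 * y₁ * y₂ - + 2 * m) (+ 2 * s - + 3 * y₁ * y₁) row-f row-a row-x)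
              zeros : d̂ f ≡ 0ℤ → d̂ a ≡ 0ℤ → d̂ x ≡ 0ℤ → ∀ i → d̂ i ≡ 0ℤ
              zeros p q r i = go (cover i)
                where
                spread : ∀ {b} → In i b → d̂ b ≡ 0ℤ → d̂ i ≡ 0ℤ
                spread (inj₁ refl) z = z
                spread (inj₂ (inj₁ refl)) z = trans (d̂-g _) z
                spread (inj₂ (inj₂ refl)) z = trans (d̂-g _) (trans (d̂-g _) z)
                go : (i ≡ f) ⊎ In i a ⊎ In i x → d̂ i ≡ 0ℤ
                go (inj₁ refl) = p
                go (inj₂ (inj₁ u)) = spread u q
                go (inj₂ (inj₂ u)) = spread u r

            f≢a : f ≢ a
            f≢a p = a≢ga (trans (sym p) (trans (sym fixed) (cong g p)))

            f≢x : f ≢ x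
            f≢x p = x≢gx (trans (sym p) (trans (sym fixed) (cong g p)))

            isolated : B f a ≡ 0ℤ → B f x ≡ 0ℤ → ⊥
            isolated p q = separated (λ i → does (i ≟ f)) vanish f a (dec-true (f ≟ f) refl) (dec-false (a ≟ f) (f≢a ∘ sym))
              where
              vanish : ∀ i j → does (i ≟ f) ≡ true → does (j ≟ f) ≡ false → B i j ≡ 0ℤ
              vanish i j u v with i ≟ f | j ≟ f
              ... | yes refl | no n = [ (λ e → ⊥-elim (n e)) , [ (λ e → trans (fixed-B fixed e) p) , (λ e → trans (fixed-B fixed e) q) ]′ ]′ (cover j)

            m≤6 : m ≤ + 6
            m≤6 = +-mono-≤ (Γ≤2 a x) (+-mono-≤ (Γ≤2 a (g x)) (Γ≤2 a (g² x)))

            -m≤6 : - m ≤ + 6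
            -m≤6 = subst (_≤ + 6) (lem a₀ a₁ a₂) (+-mono-≤ (-Γ≤2 a x) (+-mono-≤ (-Γ≤2 a (g x)) (-Γ≤2 a (g² x))))
              where
              lem : ∀ p q r → - p + (- q + - r) ≡ - (p + (q + r))
              lem = solve-∀

            -- A cycle on the orbit of `a` disconnects it from `f`. A second cycle on the orbit of
            -- `x` would isolate `f`; otherwise `t = 2` and `y₁ = 0`, and singularity fails for all
            -- entries within the semidefinite bounds.
            no-cycle : ¬ (1ℤ ≤ B a (g a))
            no-cycle h = go (B x (g x) ≟ℤ 0ℤ)
              where
              B0 : B f a ≡ 0ℤ
              B0 = fixed-zero fixed h
              P : ℤ
              P = Γ a (g a)
              one-two : ∀ {z} → 1ℤ ≤ z → z ≤ + 2 → ∃ λ (k : Fin 2) → z ≡ + suc (toℕ k)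
              one-two {+ 1} _ _ = zero , refl
              one-two {+ 2} _ _ = suc zero , refl
              one-two {+ suc (suc (suc n))} _ (+≤+ (ℕ.s≤s (ℕ.s≤s ())))
              one-two {+ 0} (+≤+ ()) _
              go : Dec (B x (g x) ≡ 0ℤ) → ⊥
              go (no ne) = isolated B0 (fixed-cycle fixed ne)
              go (yes z) = final (one-two (subst (1ℤ ≤_) (sym (Γ-cycle a h)) h) (Γ≤2 a (g a))) (bounded 2 (Γ≤2 f x) (-Γ≤2 f x)) (bounded 6 m≤6 -m≤6)
                where
                final : (∃ λ (k : Fin 2) → P ≡ + suc (toℕ k)) → (∃ λ k → y₂ ≡ centred 2 k) → (∃ λ k → m ≡ centred 6 k) → ⊥
                final (p , ep) (y , ey) (k , ek) = cycle-determinant p y k (trans (sym eq) det≡0)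
                  where
                  eq : determinant s t y₁ y₂ m ≡ determinant (+ 2 + + 2 * + suc (toℕ p)) (+ 2) 0ℤ (centred 2 y) (centred 6 k)
                  eq = trans (cong₂ (λ u v → determinant (+ 2 + + 2 * u) (+ 2 + + 2 * v) y₁ y₂ m) ep (Γ-vanish x≢gx z))
                    (trans (cong (λ u → determinant (+ 2 + + 2 * + suc (toℕ p)) (+ 2) u y₂ m) (Γ-vanish f≢a B0)) (cong₂ (determinant (+ 2 + + 2 * + suc (toℕ p)) (+ 2) 0ℤ) ey ek))

            x∉a : ¬ In x a
            x∉a p = a∉x (In-sym p)

            module _ (Γa : Γ a (g a) ≡ 0ℤ) (Γx : Γ x (g x) ≡ 0ℤ) where

              -- The vector used is `a - g a + e * (x - g x)`, whose norm in the gauge is twice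
              -- `4 + e * (2 * a₀ - a₁ - a₂)`. Strict positivity of this even norm yields the bound
              -- 3 in place of 4.
              narrow-half : ∀ e → e * e ≡ 1ℤ → - (e * (+ 2 * a₀ - a₁ - a₂)) ≤ + 3
              narrow-half e ee = by-diff (diff (positive-part (*-cancelˡ-≤-pos 0ℤ w (+ 2) (subst (0ℤ ≤_) value (Γ-sum≥0 c idx))) nonzero)) (lem (e * (+ 2 * a₀ - a₁ - a₂)))
                where
                w : ℤ
                w = e * (+ 2 * a₀ - a₁ - a₂) + + 4
                positive-part : ∀ {z} → 0ℤ ≤ z → z ≢ 0ℤ → 1ℤ ≤ z
                positive-part {+ zero} _ n = ⊥-elim (n refl)
                positive-part {+ suc n} _ _ = +≤+ (ℕ.s≤s ℕ.z≤n)
                lem : ∀ z → (z + + 4) - 1ℤ ≡ + 3 - - z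
                lem = solve-∀
                c : V 4
                c zero = 1ℤ
                c (suc zero) = -1ℤ
                c (suc (suc zero)) = e
                c (suc (suc (suc zero))) = - e
                idx : Fin 4 → Fin N
                idx zero = a
                idx (suc zero) = g a
                idx (suc (suc zero)) = x
                idx (suc (suc (suc zero))) = g x
                sum₄ : ∀ {p q r s p' q' r' s'} → p ≡ p' → q ≡ q' → r ≡ r' → s ≡ s' → 1ℤ * p + (-1ℤ * q + (e * r + (- e * s + 0ℤ))) ≡ 1ℤ * p' + (-1ℤ * q' + (e * r' + (- e * s' + 0ℤ)))
                sum₄ refl refl refl refl = refl
                Γga-a : Γ (g a) a ≡ 0ℤ
                Γga-a = trans (Γ-sym (g a) a) Γa
                expand : ∀ e p q r → 1ℤ * (1ℤ * + 2 + (-1ℤ * 0ℤ + (e * p + (- e * q + 0ℤ)))) + (-1ℤ * (1ℤ * 0ℤ + (-1ℤ * + 2 + (e * r + (- e * p + 0ℤ)))) + (e * (1ℤ * p + (-1ℤ * r + (e * + 2 + (- e * 0ℤ + 0ℤ)))) + (- e * (1ℤ * q + (-1ℤ * p + (e * 0ℤ + (- e * + 2 + 0ℤ)))) + 0ℤ)))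
                   ≡ + 2 * (e * (+ 2 * p - q - r) + + 4) + + 4 * (e * e - 1ℤ)
                expand = solve-∀
                tidy : ∀ z → z + + 4 * (1ℤ - 1ℤ) ≡ z
                tidy = solve-∀
                value : (sum λ r → c r * sum λ s → c s * Γ (idx r) (idx s)) ≡ + 2 * w
                value = trans (sum₄ (sum₄ (Γ-diag a) Γa refl refl) (sum₄ Γga-a (Γ-diag (g a)) (Γ-1 a x) (Γ-g a x)) (sum₄ (Γ-sym x a) (trans (Γ-sym x (g a)) (Γ-1 a x)) (Γ-diag x) Γx)
                    (sum₄ (Γ-sym (g x) a) (trans (Γ-g x a) (Γ-sym x a)) (trans (Γ-sym (g x) x) Γx) (Γ-diag (g x))))
                  (trans (expand e a₀ a₁ a₂) (trans (cong (λ z → + 2 * w + + 4 * (z - 1ℤ)) ee) (tidy (+ 2 * w))))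
                -- An isotropic vector is proportional to the invariant `d̂`, but here the
                -- coefficients at `a` and `g a` are 1 and -1.
                nonzero : w ≢ 0ℤ
                nonzero z = clash (*-cancelˡ-≡ K 1ℤ -1ℤ ⦃ ≢-nonZero (1≤⇒≢0 K≥1) ⦄ (trans (cong (K *_) (sym at-a)) (trans (proj₂ I a) (trans (cong (proj₁ I *_) (sym (d̂-g a))) (trans (sym (proj₂ I (g a))) (cong (K *_) at-ga))))))
                  where
                  I : ∃ λ C → ∀ i → K * coefficient c idx i ≡ C * d̂ i
                  I = Γ-isotropic c idx (trans value (cong (+ 2 *_) z))
                  clash : 1ℤ ≢ -1ℤ
                  clash ()
                  eva : ∀ e → 1ℤ * 1ℤ + (-1ℤ * 0ℤ + (e * 0ℤ + (- e * 0ℤ + 0ℤ))) ≡ 1ℤ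
                  eva = solve-∀
                  evga : ∀ e → 1ℤ * 0ℤ + (-1ℤ * 1ℤ + (e * 0ℤ + (- e * 0ℤ + 0ℤ))) ≡ -1ℤ
                  evga = solve-∀
                  at-a : coefficient c idx a ≡ 1ℤ
                  at-a = trans (sum₄ (unit-same a) (unit-other a≢ga) (unit-other (λ p → a∉x (inj₁ p))) (unit-other (λ p → a∉x (inj₂ (inj₁ p))))) (eva e)
                  at-ga : coefficient c idx (g a) ≡ -1ℤ
                  at-ga = trans (sum₄ (unit-other (a≢ga ∘ sym)) (unit-same (g a)) (unit-other (λ p → x∉a (inj₂ (inj₁ (sym p))))) (unit-other (λ p → a∉x (inj₁ (g-inj p))))) (evga e)

              narrow : Narrow (+ 2 * a₀ - a₁ - a₂)
              narrow = subst (_≤ + 3) (lem₁ (+ 2 * a₀ - a₁ - a₂)) (narrow-half -1ℤ refl) , subst (_≤ + 3) (lem₂ (+ 2 * a₀ - a₁ - a₂)) (narrow-half 1ℤ refl)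
                where
                lem₁ : ∀ z → - (-1ℤ * z) ≡ z
                lem₁ = solve-∀
                lem₂ : ∀ z → - (1ℤ * z) ≡ - z
                lem₂ = solve-∀

          not-opposite : (∀ b → B b (g b) ≡ 0ℤ) → ∀ {f a x} → TwoOrbits f a x → ¬ Opposite (B a x) (B (g a) x)
          not-opposite z {f} {a} {x} O opp = conclude (bounded 2 (Γ≤2 a x) (-Γ≤2 a x)) (bounded 2 (Γ≤2 a (g x)) (-Γ≤2 a (g x))) (bounded 2 (Γ≤2 a (g² x)) (-Γ≤2 a (g² x))) (bounded 2 (Γ≤2 f a) (-Γ≤2 f a)) (bounded 2 (Γ≤2 f x) (-Γ≤2 f x))
            where
            open TwoOrbits O
            open Pair O
            shifted : ∀ {b} → In b x → TwoOrbits f a b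
            shifted p = exchange (rebase (exchange O) p)
            Γ0 : ∀ {b} → b ≢ g b → Γ b (g b) ≡ 0ℤ
            Γ0 {b} n = Γ-vanish n (z b)
            In₁ : In (g x) x
            In₁ = inj₂ (inj₁ refl)
            In₂ : In (g² x) x
            In₂ = inj₂ (inj₂ refl)
            -- Replacing `x` by `g x` and by `g² x` permutes `a₀`, `a₁`, `a₂` cyclically, so one
            -- bound gives all three.
            Z₀ : Narrow (+ 2 * a₀ - a₁ - a₂)
            Z₀ = narrow (Γ0 a≢ga) (Γ0 x≢gx)
            Z₁ : Narrow (+ 2 * a₁ - a₂ - a₀)
            Z₁ = subst (λ w → Narrow (+ 2 * a₁ - a₂ - Γ a w)) (ggg x) (Pair.narrow (shifted In₁) (Γ0 a≢ga) (Γ0 (In-≢g In₁ x≢gx)))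
            Z₂ : Narrow (+ 2 * a₂ - a₀ - a₁)
            Z₂ = subst₂ (λ w w' → Narrow (+ 2 * a₂ - Γ a w - Γ a w')) (ggg x) (cong g (ggg x)) (Pair.narrow (shifted In₂) (Γ0 a≢ga) (Γ0 (In-≢g In₂ x≢gx)))
            det : determinant (+ 2) (+ 2) y₁ y₂ m ≡ 0ℤ
            det = trans (sym (cong₂ (λ u v → determinant (+ 2 + + 2 * u) (+ 2 + + 2 * v) y₁ y₂ m) (Γ0 a≢ga) (Γ0 x≢gx))) det≡0
            Γ-≢0 : ∀ {i j} → B i j ≢ 0ℤ → Γ i j ≢ 0ℤ
            Γ-≢0 {i} {j} ne e = gram-≢0 (B-≢ ne) ne (trans (gram-Γ i j) (trans (cong (σ i * σ j *_) e) (*-zeroʳ (σ i * σ j))))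
            neg≢0 : ∀ {b} → 1ℤ ≤ - b → b ≢ 0ℤ
            neg≢0 p refl = 1≰0 p
            ends : Opposite (B a x) (B (g a) x) → (B a x ≢ 0ℤ) × (B (g a) x ≢ 0ℤ)
            ends (inj₁ (p , q)) = 1≤⇒≢0 p , neg≢0 q
            ends (inj₂ (p , q)) = neg≢0 p , 1≤⇒≢0 q
            Bfga : B f (g a) ≡ B f a
            Bfga = fixed-B fixed (inj₂ (inj₁ refl))
            -- A bad pair gives a neighbour of `x` on the orbit of `a` for either direction.
            -- `towards` and `away` name the one whose arrow enters or leaves `x`; seen from `f` the
            -- two are alike.
            towards : ∃ λ n → 1ℤ ≤ B n x × B f n ≡ B f a × Γ f n ≡ y₁ × ((Γ n x ≡ a₀) ⊎ (Γ n x ≡ a₂))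
            towards = go opp
              where
              go : Opposite (B a x) (B (g a) x) → ∃ λ n → 1ℤ ≤ B n x × B f n ≡ B f a × Γ f n ≡ y₁ × ((Γ n x ≡ a₀) ⊎ (Γ n x ≡ a₂))
              go (inj₁ (p , q)) = a , p , refl , refl , inj₁ refl
              go (inj₂ (p , q)) = g a , q , Bfga , Γ-fixed fixed a , inj₂ (Γ-1 a x)
            away : ∃ λ n → 1ℤ ≤ B x n × B f n ≡ B f a × Γ f n ≡ y₁ × ((Γ n x ≡ a₀) ⊎ (Γ n x ≡ a₂))
            away = go opp
              where
              go : Opposite (B a x) (B (g a) x) → ∃ λ n → 1ℤ ≤ B x n × B f n ≡ B f a × Γ f n ≡ y₁ × ((Γ n x ≡ a₀) ⊎ (Γ n x ≡ a₂))
              go (inj₁ (p , q)) = g a , flip-sign q , Bfga , Γ-fixed fixed a , inj₂ (Γ-1 a x)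
              go (inj₂ (p , q)) = a , flip-sign p , refl , refl , inj₁ refl
            -- Whatever the orientation at `f`, one of the two choices of `n` makes the triangle of
            -- `f`, `n` and `x` acyclic, while alignment makes its product nonnegative.
            triangle : Aligned a₀ a₂ y₁ y₂ → ⊥
            triangle (e , pos₃ , y₁→ , y₂→) = go (trichotomy (B f a)) (trichotomy (B f x))
              where
              third : ∀ {n} → (Γ n x ≡ a₀) ⊎ (Γ n x ≡ a₂) → Γ n x ≡ a₀
              third (inj₁ p) = p
              third (inj₂ p) = trans p e
              product₃ : ∀ {n} → Γ f n ≡ y₁ → (Γ n x ≡ a₀) ⊎ (Γ n x ≡ a₂) → 0ℤ ≤ Γ f n * (Γ f x * Γ n x)
              product₃ p q = subst₂ (λ u v → 0ℤ ≤ u * (y₂ * v)) (sym p) (sym (third q)) pos₃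
              ordered : ∀ {i k j} → 1ℤ ≤ B i k → 1ℤ ≤ B k j → 1ℤ ≤ B i j → 0ℤ ≤ Γ i j * (Γ i k * Γ k j) → ⊥
              ordered {i} {k} {j} p q r h = acyclic-triangle p q r (subst (0ℤ ≤_) (sym (Γ-triangle i k j)) h)
              reorder₁ : ∀ a b c → a * (b * c) ≡ b * (a * c)
              reorder₁ = solve-∀
              reorder₂ : ∀ a b c → a * (b * c) ≡ c * (b * a)
              reorder₂ = solve-∀
              reorder₃ : ∀ a b c → a * (b * c) ≡ c * (a * b)
              reorder₃ = solve-∀
              reorder₄ : ∀ a b c → a * (b * c) ≡ a * (c * b)
              reorder₄ = solve-∀
              go : (B f a ≡ 0ℤ) ⊎ (1ℤ ≤ B f a) ⊎ (1ℤ ≤ - B f a) → (B f x ≡ 0ℤ) ⊎ (1ℤ ≤ B f x) ⊎ (1ℤ ≤ - B f x) → ⊥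
              go (inj₁ p) (inj₁ q) = isolated p q
              go (inj₁ p) (inj₂ (inj₁ q)) = Γ-≢0 (1≤⇒≢0 q) (y₁→ (Γ-vanish f≢a p))
              go (inj₁ p) (inj₂ (inj₂ q)) = Γ-≢0 (neg≢0 q) (y₁→ (Γ-vanish f≢a p))
              go (inj₂ (inj₁ p)) (inj₁ q) = Γ-≢0 (1≤⇒≢0 p) (y₂→ (Γ-vanish f≢x q))
              go (inj₂ (inj₂ p)) (inj₁ q) = Γ-≢0 (neg≢0 p) (y₂→ (Γ-vanish f≢x q))
              go (inj₂ (inj₁ p)) (inj₂ (inj₁ q)) with towards
              ... | n , h , e₁ , e₂ , e₃ = ordered (subst (1ℤ ≤_) (sym e₁) p) h q (subst (0ℤ ≤_) (reorder₁ (Γ f n) (Γ f x) (Γ n x)) (product₃ e₂ e₃))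
              go (inj₂ (inj₁ p)) (inj₂ (inj₂ q)) with away
              ... | n , h , e₁ , e₂ , e₃ = ordered (flip-sign q) (subst (1ℤ ≤_) (sym e₁) p) h
                      (subst (0ℤ ≤_) (trans (reorder₂ (Γ f n) (Γ f x) (Γ n x)) (cong₂ (λ u v → u * (v * Γ f n)) (Γ-sym n x) (Γ-sym f x))) (product₃ e₂ e₃))
              go (inj₂ (inj₂ p)) (inj₂ (inj₁ q)) with towards
              ... | n , h , e₁ , e₂ , e₃ = ordered (flip-sign (subst (λ w → 1ℤ ≤ - w) (sym e₁) p)) q h
                      (subst (0ℤ ≤_) (trans (reorder₃ (Γ f n) (Γ f x) (Γ n x)) (cong (λ u → Γ n x * (u * Γ f x)) (Γ-sym f n))) (product₃ e₂ e₃))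
              go (inj₂ (inj₂ p)) (inj₂ (inj₂ q)) with towards
              ... | n , h , e₁ , e₂ , e₃ = ordered h (flip-sign q) (flip-sign (subst (λ w → 1ℤ ≤ - w) (sym e₁) p))
                      (subst (0ℤ ≤_) (trans (reorder₄ (Γ f n) (Γ f x) (Γ n x)) (cong₂ (λ u v → u * (Γ n x * v)) (Γ-sym f n) (Γ-sym f x))) (product₃ e₂ e₃))
            conclude : (∃ λ k → a₀ ≡ centred 2 k) → (∃ λ k → a₁ ≡ centred 2 k) → (∃ λ k → a₂ ≡ centred 2 k) → (∃ λ k → y₁ ≡ centred 2 k) → (∃ λ k → y₂ ≡ centred 2 k) → ⊥
            conclude (i , ei) (j , ej) (k , ek) (u , eu) (v , ev) = triangle (subst₂ (λ p q → Aligned p q y₁ y₂) (sym ei) (sym ek) (subst₂ (Aligned (centred 2 i) (centred 2 k)) (sym eu) (sym ev) aligned))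
              where
              transport : (P : ℤ → ℤ → ℤ → Set) → P a₀ a₁ a₂ → P (centred 2 i) (centred 2 j) (centred 2 k)
              transport P h = subst (P (centred 2 i) (centred 2 j)) ek (subst₂ (λ p q → P p q a₂) ei ej h)
              aligned : Aligned (centred 2 i) (centred 2 k) (centred 2 u) (centred 2 v)
              aligned = cross-determinant i j k (λ h → Γ-≢0 (proj₁ (ends opp)) (trans ei h)) (λ h → Γ-≢0 (proj₂ (ends opp)) (trans (Γ-1 a x) (trans ek h)))
                (transport (λ p q r → Narrow (+ 2 * p - q - r)) Z₀) (transport (λ p q r → Narrow (+ 2 * q - r - p)) Z₁) (transport (λ p q r → Narrow (+ 2 * r - p - q)) Z₂)
                u v (transport (λ p q r → determinant (+ 2) (+ 2) (centred 2 u) (centred 2 v) (p + (q + r)) ≡ 0ℤ) (trans (sym (cong₂ (λ p q → determinant (+ 2) (+ 2) p q m) eu ev)) det))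

      involution-good : ∀ τ → (∀ i → τ (τ i) ≡ i) → Preserves B τ → Admits B τ
      involution-good τ ττ inv i = self i , coherent i
        where open Involution τ ττ inv

      one-orbit-good : ∀ g ggg inv {f a} → Orbit.OneOrbit g f a → Admits B g
      one-orbit-good g ggg inv {f} {a} O i = loops i , λ j → coherent-if loops i j (class j)
        where
        open Orbit g
        open Orbits g ggg inv
        open Squared g ggg using (one-orbit²)
        loops : ∀ b → B b (g b) ≡ 0ℤ
        loops = no-loops (one-orbit-no-cycle O) (Orbits.one-orbit-no-cycle g² ggg² inv² (one-orbit² O))
        class : ∀ j → (g i ≡ i) ⊎ (g j ≡ j) ⊎ In j i ⊎ (¬ Opposite (B i j) (B (g i) j))
        class j = go (proj₂ O i) (proj₂ O j)
          where
          go : (g i ≡ i) ⊎ In i a → (g j ≡ j) ⊎ In j a → (g i ≡ i) ⊎ (g j ≡ j) ⊎ In j i ⊎ (¬ Opposite (B i j) (B (g i) j))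
          go (inj₁ p) _ = inj₁ p
          go (inj₂ p) (inj₁ q) = inj₂ (inj₁ q)
          go (inj₂ p) (inj₂ q) = inj₂ (inj₂ (inj₁ (In-trans q (In-sym p))))

      two-orbit-no-cycle : ∀ g ggg inv pos pos-g {f a x} → Orbit.TwoOrbits g f a x → ∀ b → ¬ (1ℤ ≤ B b (g b))
      two-orbit-no-cycle g ggg inv pos pos-g {f} O b h = [ (λ { refl → 1≤⇒≢0 h (trans (cong (B b) fixed) (B-diag b)) }) , [ (λ p → Pair.no-cycle (rebase O p) h) , (λ p → Pair.no-cycle (rebase (exchange O) p) h) ]′ ]′ (cover b)
        where
        open Orbit g
        open Orbits g ggg inv
        open TwoOrbitFolding pos pos-g
        open TwoOrbits O

      two-orbit-good : ∀ g ggg inv pos pos-g {f a x} → Orbit.TwoOrbits g f a x → Admits B g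
      two-orbit-good g ggg inv pos pos-g {f} {a} {x} O i = loops i , λ j → coherent-if loops i j (class j)
        where
        open Orbit g
        open Orbits g ggg inv
        open Squared g ggg using (two-orbits²; reverse-pos)
        open TwoOrbitFolding pos pos-g
        open TwoOrbits O
        loops : ∀ b → B b (g b) ≡ 0ℤ
        loops = no-loops (two-orbit-no-cycle g ggg inv pos pos-g O) (two-orbit-no-cycle g² ggg² inv² (λ i → reverse (pos i)) (reverse-pos pos-g) (two-orbits² O))
        class : ∀ j → (g i ≡ i) ⊎ (g j ≡ j) ⊎ In j i ⊎ (¬ Opposite (B i j) (B (g i) j))
        class j = go (cover i) (cover j)
          where
          go : (i ≡ f) ⊎ In i a ⊎ In i x → (j ≡ f) ⊎ In j a ⊎ In j x → (g i ≡ i) ⊎ (g j ≡ j) ⊎ In j i ⊎ (¬ Opposite (B i j) (B (g i) j))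
          go (inj₁ refl) _ = inj₁ fixed
          go (inj₂ _) (inj₁ refl) = inj₂ (inj₁ fixed)
          go (inj₂ (inj₁ p)) (inj₂ (inj₁ q)) = inj₂ (inj₂ (inj₁ (In-trans q (In-sym p))))
          go (inj₂ (inj₂ p)) (inj₂ (inj₂ q)) = inj₂ (inj₂ (inj₁ (In-trans q (In-sym p))))
          go (inj₂ (inj₁ p)) (inj₂ (inj₂ q)) = inj₂ (inj₂ (inj₂ (not-opposite loops (exchange (rebase (exchange (rebase O p)) q)))))
          go (inj₂ (inj₂ p)) (inj₂ (inj₁ q)) = inj₂ (inj₂ (inj₂ (not-opposite loops (rebase (exchange (rebase O q)) p))))

      foldable : Foldable B
      foldable = record { involution-good = involution-good ; one-orbit-good = one-orbit-good ; two-orbit-good = two-orbit-good }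

  -- The initial family of simple roots.

  module Initial (lev : V N) (B₀ : Matrix N) (compare : ∀ {t u} → t ≢ u → Comparison A B₀ lev t u) (B₀-diag : ∀ t → B₀ t t ≡ 0ℤ) where
    1+-< : ∀ {a b} → a ≡ 1ℤ + b → b < a
    1+-< {b = b} refl = suc[i]≤j⇒i<j ≤-refl

    ord₀ : Fin N → ℕ
    ord₀ t = ∣ lev t + sum (λ u → + ∣ lev u ∣) ∣

    ord₀-val : ∀ t → + ord₀ t ≡ lev t + sum (λ u → + ∣ lev u ∣)
    ord₀-val t = 0≤i⇒+∣i∣≡i (by-diff (0≤+ (0≤abs (lev t)) (diff (sum-upper (λ u → + ∣ lev u ∣) (λ _ → +≤+ ℕ.z≤n) t))) (lem (lev t) (+ ∣ lev t ∣) (sum (λ u → + ∣ lev u ∣))))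
      where
      lem : ∀ a b s → (a + b) + (s - b) ≡ a + s - 0ℤ
      lem = solve-∀
      0≤abs : ∀ z → 0ℤ ≤ z + + ∣ z ∣
      0≤abs (+ n) = +≤+ ℕ.z≤n
      0≤abs -[1+ n ] = ≤-reflexive (sym (+-inverseˡ (+ suc n)))

    frame₀ : Frame lev (e lev) unit δ
    frame₀ = record
      { lvl = lvl₀ ; diag = e-diag lev ; link = λ i j _ _ → link₀ i j ; ord = ord₀ , λ i j _ _ n g → rise i j n g
      ; coh = record { c = λ _ → true ; col = λ i _ t → unit≥0 i t ; ok = λ i j _ _ n → e-off lev n } ; span = span₀ }
      where
      lvl₀ : Lvl full lev
      lvl₀ t u _ _ n with compare n
      ... | unlinked _ a = inj₁ a
      ... | higher _ _ l = inj₂ (inj₂ l)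
      ... | deeper _ _ l = inj₂ (inj₁ l)
      link₀ : ∀ i j → E lev (unit i) (unit j) ≡ e lev i j
      link₀ i j = trans (form-unitˡ (e lev) i (unit j)) (trans (sum-single _ j λ u n → trans (cong (e lev i u *_) (unit-other n)) (*-zeroʳ (e lev i u))) (trans (cong (e lev i j *_) (unit-same j)) (*-identityʳ _)))
      rise : ∀ i j → i ≢ j → e lev i j ≢ 0ℤ → ord₀ i ℕ.< ord₀ j
      rise i j n g = go (lev i <? lev j)
        where
        go : Dec (lev i < lev j) → ord₀ i ℕ.< ord₀ j
        go (no p) = ⊥-elim (g (e-down lev n p))
        go (yes p) = drop‿+<+ (subst₂ _<_ (sym (ord₀-val i)) (sym (ord₀-val j)) (+-monoˡ-< (sum (λ u → + ∣ lev u ∣)) p))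
      unit≥0 : ∀ i t → 0ℤ ≤ unit i t
      unit≥0 i t with t ≟ i
      ... | yes _ = +≤+ ℕ.z≤n
      ... | no _ = ≤-refl
      span₀ : ∀ t → sum (λ j → δ j * unit j t) ≡ δ t
      span₀ t = trans (sum-single _ t λ j n → trans (cong (δ j *_) (unit-other (n ∘ sym))) (*-zeroʳ (δ j))) (trans (cong (δ t *_) (unit-same t)) (*-identityʳ _))

    fam₀ : Fam lev B₀
    fam₀ = record { frame = frame₀ ; B≡ = λ i j → B₀≡ i j (i ≟ j) }
      where
      B₀≡ : ∀ i j → Dec (i ≡ j) → B₀ i j ≡ e lev i j - e lev j i
      B₀≡ i j (yes refl) = trans (B₀-diag i) (sym (+-inverseʳ (e lev i i)))
      B₀≡ i j (no n) with compare n
      ... | unlinked b a = trans b (sym (cong₂ _-_ (e-nonadj lev n a) (e-nonadj lev (n ∘ sym) (trans (A-sym j i) a))))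
      ... | higher b a l = trans b (sym (cong₂ _-_ (e-down lev n (<-asym (1+-< l))) (trans (e-up lev (1+-< l)) (trans (A-sym j i) a))))
      ... | deeper b a l = trans b (sym (cong₂ _-_ (trans (e-up lev (1+-< l)) a) (e-down lev (n ∘ sym) (<-asym (1+-< l)))))

    seed : ∀ {i j} → i ≢ j → (B₀ i j ≡ A i j) ⊎ (B₀ i j ≡ - A i j)
    seed n with compare n
    ... | unlinked b a = inj₁ (trans b (sym a))
    ... | higher b a _ = inj₂ (trans b (cong -_ (sym a)))
    ... | deeper b a _ = inj₁ (trans b (sym a))

    foldable : ∀ ks B → (∀ i j → mutateSeq ks B i j ≡ B₀ i j) → Foldable B
    foldable ks B path = Symmetry.Action.foldable lev B₀ seed ks B path (Symmetry.fam-of lev B₀ seed ks path fam₀)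

-- From labelled diagrams to affine data and levels.

total : (ℕ → ℤ) → List ℕ → ℤ
total φ []      = 0ℤ
total φ (i ∷ L) = φ i + total φ L

lab-injective : ∀ {N} {t u : Fin N} → lab t ≡ lab u → t ≡ u
lab-injective p = toℕ-injective (ℕₚ.suc-injective p)

vertex : ∀ {N i} → 1 ℕ.≤ i → i ℕ.≤ N → Fin N
vertex {i = suc i} _ p = fromℕ< p

lab-vertex : ∀ {N i} (p : 1 ℕ.≤ i) (q : i ℕ.≤ N) → lab (vertex p q) ≡ i
lab-vertex {i = suc i} _ q = cong suc (toℕ-fromℕ< q)

lab≤ : ∀ {N} (t : Fin N) → lab t ℕ.≤ N
lab≤ = toℕ<n

-- Reduces harmonicity, a sum over all vertices, to a sum over the short list of neighbours. The
-- function is cleared at one listed vertex at a time.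
sum-labels : ∀ {N} (φ : ℕ → ℤ) (L : List ℕ) → Unique L → (∀ {j} → j ∈ L → 1 ℕ.≤ j × j ℕ.≤ N) → (f : V N) →
             (∀ u → lab u ∈ L → f u ≡ φ (lab u)) → (∀ u → ¬ (lab u ∈ L) → f u ≡ 0ℤ) → sum f ≡ total φ L
sum-labels φ [] _ _ f _ h = sum-0 f λ u → h u λ ()
sum-labels {N} φ (i ∷ L) (i∉L ∷ uniq) range f on off = trans split (cong₂ _+_ (trans (on v (here v≡i)) (cong φ v≡i)) (sum-labels φ L uniq (range ∘ there) f' on' off'))
  where
  v : Fin N
  v = vertex (proj₁ (range (here refl))) (proj₂ (range (here refl)))
  v≡i : lab v ≡ i
  v≡i = lab-vertex (proj₁ (range (here refl))) (proj₂ (range (here refl)))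
  f' : V N
  f' u with u ≟ v
  ... | yes _ = 0ℤ
  ... | no _  = f u
  f'-v : f' v ≡ 0ℤ
  f'-v with v ≟ v
  ... | yes _ = refl
  ... | no n  = ⊥-elim (n refl)
  f'-o : ∀ {u} → u ≢ v → f' u ≡ f u
  f'-o {u} n with u ≟ v
  ... | yes p = ⊥-elim (n p)
  ... | no _  = refl
  v∉L : ¬ (i ∈ L)
  v∉L p = All.lookup i∉L p refl
  on' : ∀ u → lab u ∈ L → f' u ≡ φ (lab u)
  on' u p = trans (f'-o λ e → v∉L (subst (_∈ L) (trans (cong lab e) v≡i) p)) (on u (there p))
  off' : ∀ u → ¬ (lab u ∈ L) → f' u ≡ 0ℤ
  off' u p = go (u ≟ v)
    where
    go : Dec (u ≡ v) → f' u ≡ 0ℤ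
    go (yes e) = trans (cong f' e) f'-v
    go (no n) = trans (f'-o n) (off u λ { (here e) → n (lab-injective (trans e (sym v≡i))) ; (there q) → p q })
  split : sum f ≡ f v + sum f'
  split = trans (sum-cong-≗ pointwise) (trans (∑-distrib-+ (λ u → f v * unit v u) f') (cong (_+ sum f') (trans (sum-single (λ u → f v * unit v u) v (λ u n → trans (cong (f v *_) (unit-other n)) (*-zeroʳ (f v)))) (trans (cong (f v *_) (unit-same v)) (*-identityʳ (f v))))))
    where
    pointwise : ∀ u → f u ≡ f v * unit v u + f' u
    pointwise u = go (u ≟ v)
      where
      go : Dec (u ≡ v) → f u ≡ f v * unit v u + f' u
      go (yes refl) = sym (trans (cong₂ (λ x y → f v * x + y) (unit-same v) f'-v) (trans (+-identityʳ _) (*-identityʳ (f v))))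
      go (no n) = sym (trans (cong₂ (λ x y → f v * x + y) (unit-other n) (f'-o n)) (trans (cong (_+ f u) (*-zeroʳ (f v))) (+-identityˡ (f u))))

-- X marks the edges outside the spanning tree formed by the edges to the parents.
record Row (N : ℕ) (Adj X : ℕ → ℕ → Set) (δ : ℕ → ℤ) (i : ℕ) : Set where
  field
    nb       : List ℕ
    unique   : Unique nb
    range    : ∀ {j} → j ∈ nb → 1 ℕ.≤ j × j ℕ.≤ N
    sound    : ∀ {j} → j ∈ nb → Adj i j
    complete : ∀ {j} → Adj i j → j ∈ nb
    harmonic : total δ nb ≡ + 2 * δ i
    parent   : (i ≡ 1) ⊎ (∃ λ p → p ∈ nb × p ℕ.< i × (∀ {j} → j ∈ nb → j ℕ.< i → (j ≡ p) ⊎ X i j))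

module Diagram {N : ℕ} {Adj X : ℕ → ℕ → Set} (Adj-sym : ∀ {i j} → Adj i j → Adj j i) {δ κ : ℕ → ℤ}
               (δ≥1 : ∀ i → 1ℤ ≤ δ i) (κ≥1 : ∀ i → 1ℤ ≤ κ i) (κδ : ∀ i → κ i * δ i ≡ + 12)
               (rows : (t : Fin N) → Row N Adj X δ (lab t)) (o : Fin N) (o≡1 : lab o ≡ 1)
               (B₀ : Matrix N) (skew₀ : ∀ i j → B₀ j i ≡ - B₀ i j)
               (under : ∀ i j → (Adj (lab i) (lab j) → ∣ B₀ i j ∣ ≡ 1) × (¬ Adj (lab i) (lab j) → B₀ i j ≡ 0ℤ)) where

  edge? : ∀ (t u : Fin N) → Dec (lab u ∈ Row.nb (rows t))
  edge? t u = lab u ∈? Row.nb (rows t)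

  B₀-edge : ∀ {t u} → lab u ∈ Row.nb (rows t) → ∣ B₀ t u ∣ ≡ 1
  B₀-edge {t} {u} p = proj₁ (under t u) (Row.sound (rows t) p)

  B₀-none : ∀ {t u} → ¬ (lab u ∈ Row.nb (rows t)) → B₀ t u ≡ 0ℤ
  B₀-none {t} {u} p = proj₂ (under t u) λ a → p (Row.complete (rows t) a)

  B₀-diag : ∀ t → B₀ t t ≡ 0ℤ
  B₀-diag t = *≡0 {+ 2} (trans (lem (B₀ t t)) (trans (cong (λ z → B₀ t t + z) (skew₀ t t)) (+-inverseʳ (B₀ t t)))) λ ()
    where
    lem : ∀ a → + 2 * a ≡ a + a
    lem = solve-∀

  unit-entry : ∀ {z} → ∣ z ∣ ≡ 1 → (z ≡ 1ℤ) ⊎ (z ≡ -1ℤ)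
  unit-entry {+ 1} refl = inj₁ refl
  unit-entry { -[1+ 0 ]} refl = inj₂ refl

  entries : ∀ t u → (B₀ t u ≡ 0ℤ) ⊎ (B₀ t u ≡ 1ℤ) ⊎ (B₀ t u ≡ -1ℤ)
  entries t u with edge? t u
  ... | yes p = inj₂ (unit-entry (B₀-edge p))
  ... | no p = inj₁ (B₀-none p)

  A₀ : M N
  A₀ t u with t ≟ u
  ... | yes _ = + 2
  ... | no _  = - + ∣ B₀ t u ∣

  A₀-diag : ∀ t → A₀ t t ≡ + 2
  A₀-diag t with t ≟ t
  ... | yes _ = refl
  ... | no n  = ⊥-elim (n refl)

  A₀-other : ∀ {t u} → t ≢ u → A₀ t u ≡ - + ∣ B₀ t u ∣
  A₀-other {t} {u} n with t ≟ u
  ... | yes p = ⊥-elim (n p)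
  ... | no _  = refl

  A₀-sym : ∀ t u → A₀ t u ≡ A₀ u t
  A₀-sym t u = go (t ≟ u)
    where
    go : Dec (t ≡ u) → A₀ t u ≡ A₀ u t
    go (yes refl) = refl
    go (no n) = trans (A₀-other n) (trans (cong (λ z → - + z) (trans (sym (∣-i∣≡∣i∣ (B₀ t u))) (cong ∣_∣ (sym (skew₀ t u))))) (sym (A₀-other (n ∘ sym))))

  A₀-edge : ∀ {t u} → t ≢ u → lab u ∈ Row.nb (rows t) → A₀ t u ≡ -1ℤ
  A₀-edge n p = trans (A₀-other n) (cong (λ z → - + z) (B₀-edge p))

  A₀-harm : ∀ t → sum (λ u → A₀ t u * δ (lab u)) ≡ 0ℤ
  A₀-harm t = trans (sum-cong-≗ pointwise) (trans (sum-- (λ u → (+ 2 * δ (lab t)) * unit t u) (λ u → + ∣ B₀ t u ∣ * δ (lab u)))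
      (trans (cong₂ _-_ (trans (sum-single _ t (λ u n → trans (cong ((+ 2 * δ (lab t)) *_) (unit-other n)) (*-zeroʳ (+ 2 * δ (lab t))))) (trans (cong ((+ 2 * δ (lab t)) *_) (unit-same t)) (*-identityʳ (+ 2 * δ (lab t)))))
        (trans (sum-labels δ (Row.nb (rows t)) (Row.unique (rows t)) (Row.range (rows t)) (λ u → + ∣ B₀ t u ∣ * δ (lab u)) on off) (Row.harmonic (rows t)))) (+-inverseʳ (+ 2 * δ (lab t)))))
    where
    on : ∀ u → lab u ∈ Row.nb (rows t) → + ∣ B₀ t u ∣ * δ (lab u) ≡ δ (lab u)
    on u p = trans (cong (λ z → + z * δ (lab u)) (B₀-edge p)) (*-identityˡ _)
    off : ∀ u → ¬ (lab u ∈ Row.nb (rows t)) → + ∣ B₀ t u ∣ * δ (lab u) ≡ 0ℤ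
    off u p = cong (λ z → + ∣ z ∣ * δ (lab u)) (B₀-none p)
    pointwise : ∀ u → A₀ t u * δ (lab u) ≡ (+ 2 * δ (lab t)) * unit t u - + ∣ B₀ t u ∣ * δ (lab u)
    pointwise u = go (t ≟ u)
      where
      lem₁ : ∀ a → + 2 * a ≡ + 2 * a * 1ℤ - 0ℤ * a
      lem₁ = solve-∀
      lem₂ : ∀ a b c → - a * b ≡ c * 0ℤ - a * b
      lem₂ = solve-∀
      go : Dec (t ≡ u) → A₀ t u * δ (lab u) ≡ (+ 2 * δ (lab t)) * unit t u - + ∣ B₀ t u ∣ * δ (lab u)
      go (yes refl) = trans (cong (_* δ (lab t)) (A₀-diag t)) (trans (lem₁ (δ (lab t))) (cong₂ (λ x y → + 2 * δ (lab t) * x - + ∣ y ∣ * δ (lab t)) (sym (unit-same t)) (sym (B₀-diag t))))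
      go (no n) = trans (cong (_* δ (lab u)) (A₀-other n)) (trans (lem₂ (+ ∣ B₀ t u ∣) (δ (lab u)) (+ 2 * δ (lab t))) (cong (λ x → (+ 2 * δ (lab t)) * x - + ∣ B₀ t u ∣ * δ (lab u)) (sym (unit-other (n ∘ sym)))))

  record Parent (t : Fin N) : Set where
    field
      par   : Fin N
      edge  : lab par ∈ Row.nb (rows t)
      below : toℕ par ℕ.< toℕ t
      only  : ∀ {u} → lab u ∈ Row.nb (rows t) → toℕ u ℕ.< toℕ t → (u ≡ par) ⊎ X (lab t) (lab u)

  parent? : ∀ t → (t ≡ o) ⊎ Parent t
  parent? t with Row.parent (rows t)
  ... | inj₁ e = inj₁ (lab-injective (trans e (sym o≡1)))
  ... | inj₂ (p , p∈ , p<t , only) = inj₂ record { par = v ; edge = subst (_∈ Row.nb (rows t)) (sym v≡) p∈ ; below = ℕₚ.≤-pred (subst (ℕ._< lab t) (sym v≡) p<t)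
      ; only = λ q lt → [ (λ e → inj₁ (lab-injective (trans e (sym v≡)))) , inj₂ ]′ (only q (ℕ.s≤s lt)) }
    where
    r = Row.range (rows t) p∈
    v : Fin N
    v = vertex (proj₁ r) (proj₂ r)
    v≡ : lab v ≡ p
    v≡ = lab-vertex (proj₁ r) (proj₂ r)

  parentOf : ∀ {t} → (t ≡ o) ⊎ Parent t → Fin N
  parentOf {t} (inj₁ _) = t
  parentOf (inj₂ P) = Parent.par P

  par : Fin N → Fin N
  par t = parentOf (parent? t)

  adjacent : ∀ {t u} → lab u ∈ Row.nb (rows t) → 1ℤ ≤ - A₀ t u
  adjacent {t} {u} p = ≤-reflexive (sym (cong -_ (A₀-edge (λ e → absurd (trans (sym (B₀-edge p)) (cong ∣_∣ (trans (cong (B₀ t) (sym e)) (B₀-diag t))))) p)))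
    where
    absurd : 1 ≢ 0
    absurd ()

  -- The height for s is the height for the parent of s, raised by one and reset to 0 at s.
  connected₀ : (s : Fin N) → Acc ℕ._<_ (toℕ s) → Σ (Fin N → ℕ) λ h → ∀ t → t ≢ s → ∃ λ u → 1ℤ ≤ - A₀ t u × h u ℕ.< h t
  connected₀ s (acc rs) = go (parent? s)
    where
    go : (s ≡ o) ⊎ Parent s → Σ (Fin N → ℕ) λ h → ∀ t → t ≢ s → ∃ λ u → 1ℤ ≤ - A₀ t u × h u ℕ.< h t
    go (inj₁ refl) = toℕ , λ t n → [ (λ e → ⊥-elim (n e)) , (λ P → Parent.par P , adjacent (Parent.edge P) , Parent.below P) ]′ (parent? t)
    go (inj₂ P) = h , descend
      where
      IH = connected₀ (Parent.par P) (rs (Parent.below P))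
      h : Fin N → ℕ
      h t with t ≟ s
      ... | yes _ = 0
      ... | no _ = suc (proj₁ IH t)
      h-s : h s ≡ 0
      h-s with s ≟ s
      ... | yes _ = refl
      ... | no n = ⊥-elim (n refl)
      h-o : ∀ {t} → t ≢ s → h t ≡ suc (proj₁ IH t)
      h-o {t} n with t ≟ s
      ... | yes p = ⊥-elim (n p)
      ... | no _ = refl
      descend : ∀ t → t ≢ s → ∃ λ u → 1ℤ ≤ - A₀ t u × h u ℕ.< h t
      descend t n = step (t ≟ Parent.par P)
        where
        to-s : ∀ {u} → u ≡ s → h u ℕ.< h t
        to-s refl = subst₂ ℕ._<_ (sym h-s) (sym (h-o n)) (ℕ.s≤s ℕ.z≤n)
        step : Dec (t ≡ Parent.par P) → ∃ λ u → 1ℤ ≤ - A₀ t u × h u ℕ.< h t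
        step (yes refl) = s , subst (λ z → 1ℤ ≤ - z) (A₀-sym s t) (adjacent (Parent.edge P)) , to-s refl
        step (no m) with proj₂ IH t m
        ... | u , a , lt = u , a , lower (u ≟ s)
          where
          lower : Dec (u ≡ s) → h u ℕ.< h t
          lower (yes e) = to-s e
          lower (no k) = subst₂ ℕ._<_ (sym (h-o k)) (sym (h-o n)) (ℕ.s≤s lt)

  R₀ : Affine N
  R₀ = record
    { A = A₀ ; A-sym = A₀-sym ; A-diag = A₀-diag ; A-off = λ {t} {u} n → subst (_≤ 0ℤ) (sym (A₀-other n)) (neg≤0 (+≤+ ℕ.z≤n))
    ; δ = λ t → δ (lab t) ; δ≥1 = λ t → δ≥1 (lab t) ; harm = A₀-harm ; κ = λ t → κ (lab t) ; κ≥1 = λ t → κ≥1 (lab t)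
    -- 12 is the least common multiple of the marks 1, 2, 3, 4 that occur in the diagrams.
    ; K = + 12 ; K≥1 = +≤+ (ℕ.s≤s ℕ.z≤n) ; κδ = λ t → κδ (lab t) ; conn = λ s → connected₀ s (ℕᵢ.<-wellFounded (toℕ s)) ; o = o }

  -- Adds the arrows met in `k` steps towards the root. The root is its own parent and has no loop,
  -- so extra steps add nothing.
  level-within : ℕ → Fin N → ℤ
  level-within zero t = 0ℤ
  level-within (suc k) t = level-within k (par t) + B₀ t (par t)

  level-stable : ∀ k t → toℕ t ℕ.≤ k → level-within (suc k) t ≡ level-within k t
  level-stable k t le = go (parent? t) refl
    where
    go : (P : (t ≡ o) ⊎ Parent t) → parent? t ≡ P → level-within (suc k) t ≡ level-within k t
    go (inj₁ e) eq = trans (cong₂ _+_ (cong (level-within k) fix) (trans (cong (B₀ t) fix) (B₀-diag t))) (+-identityʳ _)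
      where
      fix : par t ≡ t
      fix = cong parentOf eq
    go (inj₂ P) eq = below k le
      where
      par≡ : par t ≡ Parent.par P
      par≡ = cong parentOf eq
      below : ∀ k → toℕ t ℕ.≤ k → level-within (suc k) t ≡ level-within k t
      below zero le' = ⊥-elim (ℕₚ.n≮0 (ℕₚ.<-≤-trans (Parent.below P) le'))
      below (suc k') le' = cong (_+ B₀ t (par t)) (level-stable k' (par t) (ℕₚ.≤-pred (ℕₚ.≤-trans (subst (λ z → toℕ z ℕ.< toℕ t) (sym par≡) (Parent.below P)) le')))

  opaque
    lev : V N
    lev = level-within N

    lev-parent : ∀ t → lev t ≡ lev (par t) + B₀ t (par t)
    lev-parent t = sym (level-stable N t (ℕₚ.<⇒≤ (toℕ<n t)))

  edge-sym : ∀ {t u} → lab u ∈ Row.nb (rows t) → lab t ∈ Row.nb (rows u)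
  edge-sym {t} {u} p = Row.complete (rows u) (Adj-sym (Row.sound (rows t) p))

  Level : Fin N → Fin N → Set
  Level t u = lev t ≡ lev u + B₀ t u

  level-sym : ∀ {t u} → Level t u → Level u t
  level-sym {t} {u} p = trans (lem (lev u) (B₀ t u)) (cong₂ _+_ (sym p) (sym (skew₀ t u)))
    where
    lem : ∀ a b → a ≡ a + b + - b
    lem = solve-∀

  tree-level : ∀ {t u} → lab u ∈ Row.nb (rows t) → toℕ u ℕ.< toℕ t → Level t u ⊎ X (lab t) (lab u)
  tree-level {t} {u} p lt = go (parent? t) refl
    where
    go : (P : (t ≡ o) ⊎ Parent t) → parent? t ≡ P → Level t u ⊎ X (lab t) (lab u)
    go (inj₁ e) _ = ⊥-elim (ℕₚ.n≮0 (subst (toℕ u ℕ.<_) (trans (cong toℕ e) (ℕₚ.suc-injective o≡1)) lt))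
    go (inj₂ P) eq = [ (λ e → inj₁ (subst (Level t) (trans (cong parentOf eq) (sym e)) (lev-parent t))) , inj₂ ]′ (Parent.only P p lt)

  -- The levels are right along the spanning tree by construction; only edges outside it call for an
  -- argument, and a tree has none.
  module Levelled (exceptional : ∀ t u → X (lab t) (lab u) → Level t u) where
    level : ∀ {t u} → lab u ∈ Row.nb (rows t) → Level t u
    level {t} {u} p with ℕₚ.<-cmp (toℕ u) (toℕ t)
    ... | tri< lt _ _ = [ (λ q → q) , exceptional t u ]′ (tree-level p lt)
    ... | tri> _ _ lt = level-sym ([ (λ q → q) , exceptional u t ]′ (tree-level (edge-sym p) lt))
    ... | tri≈ _ e _ = ⊥-elim (absurd (trans (sym (B₀-edge p)) (cong ∣_∣ (trans (cong (B₀ t) (toℕ-injective e)) (B₀-diag t)))))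
      where
      absurd : 1 ≢ 0
      absurd ()

    compare : ∀ {t u} → t ≢ u → Comparison A₀ B₀ lev t u
    compare {t} {u} n = go (edge? t u)
      where
      go : Dec (lab u ∈ Row.nb (rows t)) → Comparison A₀ B₀ lev t u
      go (no p) = unlinked (B₀-none p) (trans (A₀-other n) (cong (λ z → - + ∣ z ∣) (B₀-none p)))
      go (yes p) = [ (λ z → higher z (A₀-edge n p) (trans (level p) (trans (cong (λ y → lev u + y) z) (+-comm (lev u) 1ℤ))))
                   , (λ z → deeper z (A₀-edge n p) (trans (level-sym (level p)) (trans (cong (λ y → lev t + y) (trans (skew₀ t u) (cong -_ z))) (+-comm (lev t) 1ℤ)))) ]′ (unit-entry (B₀-edge p))

    foldable : ∀ ks B → (∀ i j → mutateSeq ks B i j ≡ B₀ i j) → Foldable B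
    foldable = Theory.Initial.foldable R₀ lev B₀ compare B₀-diag

-- Marks, and decidable checks for the small diagrams.

data Weight : Set where
  one two three four : Weight

mark comark : Weight → ℤ
mark one   = + 1
mark two   = + 2
mark three = + 3
mark four  = + 4

comark one   = + 12
comark two   = + 6
comark three = + 4
comark four  = + 3

mark≥1 : ∀ w → 1ℤ ≤ mark w
mark≥1 one   = +≤+ (ℕ.s≤s ℕ.z≤n)
mark≥1 two   = +≤+ (ℕ.s≤s ℕ.z≤n)
mark≥1 three = +≤+ (ℕ.s≤s ℕ.z≤n)
mark≥1 four  = +≤+ (ℕ.s≤s ℕ.z≤n)

comark≥1 : ∀ w → 1ℤ ≤ comark w
comark≥1 one   = +≤+ (ℕ.s≤s ℕ.z≤n)
comark≥1 two   = +≤+ (ℕ.s≤s ℕ.z≤n)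
comark≥1 three = +≤+ (ℕ.s≤s ℕ.z≤n)
comark≥1 four  = +≤+ (ℕ.s≤s ℕ.z≤n)

comark-mark : ∀ w → comark w * mark w ≡ + 12
comark-mark one   = refl
comark-mark two   = refl
comark-mark three = refl
comark-mark four  = refl

Symmetric : (ℕ → ℕ → Set) → ℕ → ℕ → Set
Symmetric E i j = E i j ⊎ E j i

NoEdge : ℕ → ℕ → Set
NoEdge i j = ⊥

-- Labels start at 1.
nth : List Weight → ℕ → Weight
nth []       _             = one
nth (w ∷ ws) (suc (suc i)) = nth ws (suc i)
nth (w ∷ ws) _             = w

neighbours : List (ℕ × ℕ) → ℕ → List ℕ
neighbours []             i = []
neighbours ((a , b) ∷ es) i =
  if does (a ℕₚ.≟ i) then b ∷ neighbours es i else if does (b ℕₚ.≟ i) then a ∷ neighbours es i else neighbours es i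

-- Picks the parent in the spanning tree. The default 0 is no label, so `Check` rejects it except at
-- the root.
first-below : List ℕ → ℕ → ℕ
first-below []       i = 0
first-below (j ∷ js) i = if does (j ℕₚ.<? i) then j else first-below js i

-- All requirements on a vertex are decidable, so for a fixed diagram the rows are obtained by
-- evaluation.
module Finite (N : ℕ) (es : List (ℕ × ℕ)) (ws : List Weight) where
  nbs : ℕ → List ℕ
  nbs = neighbours es

  δ : ℕ → ℤ
  δ i = mark (nth ws i)

  pl : ℕ → ℕ
  pl i = first-below (nbs i) i

  Check : ℕ → Set
  Check i = Unique (nbs i) × All (λ j → (1 ℕ.≤ j × j ℕ.≤ N) × ((i , j) ∈ es ⊎ (j , i) ∈ es) × (j ℕ.< i → j ≡ pl i)) (nbs i) ×
            All (λ e → (proj₁ e ≡ i → proj₂ e ∈ nbs i) × (proj₂ e ≡ i → proj₁ e ∈ nbs i)) es ×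
            (total δ (nbs i) ≡ + 2 * δ i) × ((i ≡ 1) ⊎ (pl i ∈ nbs i × pl i ℕ.< i))

  check? : ∀ i → Dec (Check i)
  check? i = AllPairs.allPairs? (λ x y → ¬? (x ℕₚ.≟ y)) (nbs i)
    ×-dec (All.all? (λ j → ((1 ℕₚ.≤? j) ×-dec (j ℕₚ.≤? N)) ×-dec ((((i , j) ∈ᵖ? es) ⊎-dec ((j , i) ∈ᵖ? es)) ×-dec ((j ℕₚ.<? i) →-dec (j ℕₚ.≟ pl i)))) (nbs i)
    ×-dec (All.all? (λ e → ((proj₁ e ℕₚ.≟ i) →-dec (proj₂ e ∈? nbs i)) ×-dec ((proj₂ e ℕₚ.≟ i) →-dec (proj₁ e ∈? nbs i))) es
    ×-dec ((total δ (nbs i) ≟ℤ + 2 * δ i)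
    ×-dec ((i ℕₚ.≟ 1) ⊎-dec ((pl i ∈? nbs i) ×-dec (pl i ℕₚ.<? i))))))

  row : ∀ {i} → Check i → Row N (Symmetric (EdgeList es)) NoEdge δ i
  row {i} (u , all-nb , all-es , h , p) = record
    { nb = nbs i ; unique = u ; range = λ q → proj₁ (All.lookup all-nb q) ; sound = λ q → proj₁ (proj₂ (All.lookup all-nb q))
    ; complete = [ (λ q → proj₁ (All.lookup all-es q) refl) , (λ q → proj₂ (All.lookup all-es q) refl) ]′
    ; harmonic = h ; parent = parent p }
    where
    parent : (i ≡ 1) ⊎ (pl i ∈ nbs i × pl i ℕ.< i) → (i ≡ 1) ⊎ (∃ λ p → p ∈ nbs i × p ℕ.< i × (∀ {j} → j ∈ nbs i → j ℕ.< i → (j ≡ p) ⊎ ⊥))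
    parent (inj₁ e) = inj₁ e
    parent (inj₂ (m , lt)) = inj₂ (pl i , m , lt , λ q lt' → inj₁ (proj₂ (proj₂ (All.lookup all-nb q)) lt'))

-- The diagrams of type D.

module DTilde (k : ℕ) where
  m : ℕ
  m = 5 ℕ.+ k

  leaf : ℕ → Bool
  leaf i = (i == 2) ∨ (i == 3) ∨ (i == m) ∨ (i == suc m)

  weight : ℕ → Weight
  weight i = if leaf i then one else two

  δ : ℕ → ℤ
  δ i = mark (weight i)

  R : ℕ → Set
  R = Row (suc m) (Symmetric (EdgeD m)) NoEdge δ

  ==-refl : ∀ i → (i == i) ≡ true
  ==-refl zero    = refl
  ==-refl (suc i) = ==-refl i

  ==-< : ∀ {i j} → i ℕ.< j → (i == j) ≡ false
  ==-< {zero}  {suc j} _ = refl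
  ==-< {suc i} {suc j} (ℕ.s≤s p) = ==-< p

  δ-spine : ∀ p → p ℕ.≤ k → δ (4 ℕ.+ p) ≡ + 2
  δ-spine p le = cong₂ (λ x y → mark (if x ∨ y then one else two)) (==-< (ℕ.s≤s le)) (==-< (ℕₚ.m≤n⇒m≤1+n (ℕ.s≤s le)))

  δ-m : δ m ≡ + 1
  δ-m = cong (λ x → mark (if x ∨ (k == suc k) then one else two)) (==-refl k)

  δ-sm : δ (suc m) ≡ + 1
  δ-sm = trans (cong (λ y → mark (if (suc k == k) ∨ y then one else two)) (==-refl k)) (cong (λ x → mark (if x then one else two)) (∨-true (suc k == k)))
    where
    ∨-true : ∀ b → (b ∨ true) ≡ true
    ∨-true true  = refl
    ∨-true false = refl

  -- The spine consists of 1, 4, 5, and so on: the labels 2 and 3 are leaves, so the predecessor of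
  -- 4 is 1.
  prev : ℕ → ℕ
  prev zero    = 1
  prev (suc p) = 4 ℕ.+ p

  prev< : ∀ p → prev p ℕ.< 4 ℕ.+ p
  prev< zero    = ℕ.s≤s (ℕ.s≤s ℕ.z≤n)
  prev< (suc p) = ℕₚ.≤-refl

  1≤prev : ∀ p → 1 ℕ.≤ prev p
  1≤prev zero    = ℕ.s≤s ℕ.z≤n
  1≤prev (suc p) = ℕ.s≤s ℕ.z≤n

  δ-prev : ∀ p → p ℕ.≤ k → δ (prev p) ≡ + 2
  δ-prev zero    _  = refl
  δ-prev (suc p) le = δ-spine p (ℕₚ.<⇒≤ le)

  sound-prev : ∀ p → p ℕ.≤ k → Symmetric (EdgeD m) (4 ℕ.+ p) (prev p)
  sound-prev zero    _  = inj₂ (inj₂ (inj₂ (inj₁ (refl , refl))))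
  sound-prev (suc p) le = inj₂ (inj₂ (inj₂ (inj₂ (inj₁ (ℕ.s≤s (ℕ.s≤s (ℕ.s≤s (ℕ.s≤s ℕ.z≤n))) , ℕ.s≤s (ℕ.s≤s (ℕ.s≤s le)) , refl)))))

  below-prev : ∀ p {j} → p ℕ.≤ k → EdgeD m j (4 ℕ.+ p) → j ≡ prev p
  below-prev p le (inj₁ (refl , ()))
  below-prev p le (inj₂ (inj₁ (refl , ())))
  below-prev zero le (inj₂ (inj₂ (inj₁ (refl , refl)))) = refl
  below-prev (suc p) le (inj₂ (inj₂ (inj₁ (refl , ()))))
  below-prev zero le (inj₂ (inj₂ (inj₂ (inj₁ (ℕ.s≤s (ℕ.s≤s (ℕ.s≤s ())) , _ , refl)))))
  below-prev (suc p) le (inj₂ (inj₂ (inj₂ (inj₁ (_ , _ , refl))))) = refl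
  below-prev p le (inj₂ (inj₂ (inj₂ (inj₂ (inj₁ (refl , refl)))))) = ⊥-elim (ℕₚ.1+n≰n le)
  below-prev p le (inj₂ (inj₂ (inj₂ (inj₂ (inj₂ (refl , refl)))))) = ⊥-elim (ℕₚ.1+n≰n (ℕₚ.<⇒≤ le))

  spine-mid : ∀ p → p ℕ.< k → R (4 ℕ.+ p)
  spine-mid p lt = record
    { nb = prev p ∷ (5 ℕ.+ p) ∷ []
    ; unique = (ℕₚ.<⇒≢ (ℕₚ.<-trans (prev< p) ℕₚ.≤-refl) All.∷ All.[]) ∷ (All.[] ∷ [])
    ; range = λ { (here refl) → 1≤prev p , ℕₚ.≤-trans (ℕₚ.<⇒≤ (prev< p)) (ℕ.s≤s (ℕ.s≤s (ℕ.s≤s (ℕ.s≤s (ℕₚ.≤-trans (ℕₚ.<⇒≤ lt) (ℕₚ.m≤n+m k 2)))))) ; (there (here refl)) → ℕ.s≤s ℕ.z≤n , ℕ.s≤s (ℕ.s≤s (ℕ.s≤s (ℕ.s≤s (ℕ.s≤s (ℕₚ.≤-trans (ℕₚ.<⇒≤ lt) (ℕₚ.n≤1+n k)))))) }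
    ; sound = λ { (here refl) → sound-prev p (ℕₚ.<⇒≤ lt) ; (there (here refl)) → inj₁ (inj₂ (inj₂ (inj₂ (inj₁ (ℕ.s≤s (ℕ.s≤s (ℕ.s≤s (ℕ.s≤s ℕ.z≤n))) , ℕ.s≤s (ℕ.s≤s (ℕ.s≤s lt)) , refl))))) }
    ; complete = [ (λ e → there (here (above-mid e))) , (λ e → here (below-prev p (ℕₚ.<⇒≤ lt) e)) ]′
    ; harmonic = trans (cong₂ (λ x y → x + (y + 0ℤ)) (δ-prev p (ℕₚ.<⇒≤ lt)) (δ-spine (suc p) lt)) (sym (cong (+ 2 *_) (δ-spine p (ℕₚ.<⇒≤ lt))))
    ; parent = inj₂ (prev p , here refl , prev< p , λ { (here refl) _ → inj₁ refl ; (there (here refl)) lt' → ⊥-elim (ℕₚ.<-asym lt' ℕₚ.≤-refl) }) }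
    where
    above-mid : ∀ {j} → EdgeD m (4 ℕ.+ p) j → j ≡ 5 ℕ.+ p
    above-mid (inj₁ (() , _))
    above-mid (inj₂ (inj₁ (() , _)))
    above-mid (inj₂ (inj₂ (inj₁ (() , _))))
    above-mid (inj₂ (inj₂ (inj₂ (inj₁ (_ , _ , e))))) = e
    above-mid (inj₂ (inj₂ (inj₂ (inj₂ (inj₁ (refl , _)))))) = ⊥-elim (ℕₚ.<-irrefl refl lt)
    above-mid (inj₂ (inj₂ (inj₂ (inj₂ (inj₂ (refl , _)))))) = ⊥-elim (ℕₚ.<-irrefl refl lt)

  spine-end : R (4 ℕ.+ k)
  spine-end = record
    { nb = prev k ∷ m ∷ suc m ∷ []
    ; unique = (ℕₚ.<⇒≢ (ℕₚ.<-trans (prev< k) ℕₚ.≤-refl) All.∷ ℕₚ.<⇒≢ (ℕₚ.<-trans (prev< k) (ℕₚ.n≤1+n m)) All.∷ All.[]) ∷ ((ℕₚ.<⇒≢ ℕₚ.≤-refl All.∷ All.[]) ∷ (All.[] ∷ []))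
    ; range = λ { (here refl) → 1≤prev k , ℕₚ.≤-trans (ℕₚ.<⇒≤ (prev< k)) (ℕₚ.m≤n+m (4 ℕ.+ k) 2) ; (there (here refl)) → ℕ.s≤s ℕ.z≤n , ℕₚ.n≤1+n m ; (there (there (here refl))) → ℕ.s≤s ℕ.z≤n , ℕₚ.≤-refl }
    ; sound = λ { (here refl) → sound-prev k ℕₚ.≤-refl ; (there (here refl)) → inj₁ (inj₂ (inj₂ (inj₂ (inj₂ (inj₁ (refl , refl)))))) ; (there (there (here refl))) → inj₁ (inj₂ (inj₂ (inj₂ (inj₂ (inj₂ (refl , refl)))))) }
    ; complete = [ above-end , (λ e → here (below-prev k ℕₚ.≤-refl e)) ]′
    ; harmonic = trans (cong₂ _+_ (δ-prev k ℕₚ.≤-refl) (cong₂ (λ x y → x + (y + 0ℤ)) δ-m δ-sm)) (sym (cong (+ 2 *_) (δ-spine k ℕₚ.≤-refl)))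
    ; parent = inj₂ (prev k , here refl , prev< k , λ { (here refl) _ → inj₁ refl ; (there (here refl)) lt → ⊥-elim (ℕₚ.<-asym lt ℕₚ.≤-refl) ; (there (there (here refl))) lt → ⊥-elim (ℕₚ.<-asym lt (ℕₚ.n≤1+n m)) }) }
    where
    above-end : ∀ {j} → EdgeD m (4 ℕ.+ k) j → j ∈ (prev k ∷ m ∷ suc m ∷ [])
    above-end (inj₁ (() , _))
    above-end (inj₂ (inj₁ (() , _)))
    above-end (inj₂ (inj₂ (inj₁ (() , _))))
    above-end (inj₂ (inj₂ (inj₂ (inj₁ (_ , le , _))))) = ⊥-elim (ℕₚ.1+n≰n le)
    above-end (inj₂ (inj₂ (inj₂ (inj₂ (inj₁ (_ , e)))))) = there (here e)
    above-end (inj₂ (inj₂ (inj₂ (inj₂ (inj₂ (_ , e)))))) = there (there (here e))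

  root : R 1
  root = record
    { nb = 2 ∷ 3 ∷ 4 ∷ []
    ; unique = ((λ ()) All.∷ (λ ()) All.∷ All.[]) ∷ (((λ ()) All.∷ All.[]) ∷ (All.[] ∷ []))
    ; range = λ { (here refl) → ℕ.s≤s ℕ.z≤n , ℕ.s≤s (ℕ.s≤s ℕ.z≤n) ; (there (here refl)) → ℕ.s≤s ℕ.z≤n , ℕ.s≤s (ℕ.s≤s (ℕ.s≤s ℕ.z≤n)) ; (there (there (here refl))) → ℕ.s≤s ℕ.z≤n , ℕ.s≤s (ℕ.s≤s (ℕ.s≤s (ℕ.s≤s ℕ.z≤n))) }
    ; sound = λ { (here refl) → inj₁ (inj₁ (refl , refl)) ; (there (here refl)) → inj₁ (inj₂ (inj₁ (refl , refl))) ; (there (there (here refl))) → inj₁ (inj₂ (inj₂ (inj₁ (refl , refl)))) }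
    ; complete = [ forth , back ]′
    ; harmonic = refl ; parent = inj₁ refl }
    where
    forth : ∀ {j} → EdgeD m 1 j → j ∈ (2 ∷ 3 ∷ 4 ∷ [])
    forth (inj₁ (_ , e)) = here e
    forth (inj₂ (inj₁ (_ , e))) = there (here e)
    forth (inj₂ (inj₂ (inj₁ (_ , e)))) = there (there (here e))
    forth (inj₂ (inj₂ (inj₂ (inj₁ (ℕ.s≤s () , _)))))
    forth (inj₂ (inj₂ (inj₂ (inj₂ (inj₁ (() , _))))))
    forth (inj₂ (inj₂ (inj₂ (inj₂ (inj₂ (() , _))))))
    back : ∀ {j} → EdgeD m j 1 → j ∈ (2 ∷ 3 ∷ 4 ∷ [])
    back (inj₁ (_ , ()))
    back (inj₂ (inj₁ (_ , ())))
    back (inj₂ (inj₂ (inj₁ (_ , ()))))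
    back (inj₂ (inj₂ (inj₂ (inj₁ (() , _ , refl)))))
    back (inj₂ (inj₂ (inj₂ (inj₂ (inj₁ (_ , ()))))))
    back (inj₂ (inj₂ (inj₂ (inj₂ (inj₂ (_ , ()))))))

  leaf-row : ∀ i p → 1 ℕ.≤ p → p ℕ.< i → i ℕ.≤ suc m → δ p ≡ + 2 → δ i ≡ + 1 → EdgeD m p i → (∀ {j} → EdgeD m i j → ⊥) → (∀ {j} → EdgeD m j i → j ≡ p) → R i
  leaf-row i p 1≤p p<i i≤ δp δi e no-out only = record
    { nb = p ∷ [] ; unique = All.[] ∷ [] ; range = λ { (here refl) → 1≤p , ℕₚ.≤-trans (ℕₚ.<⇒≤ p<i) i≤ } ; sound = λ { (here refl) → inj₂ e }
    ; complete = [ (λ h → ⊥-elim (no-out h)) , (λ h → here (only h)) ]′ ; harmonic = trans (cong (_+ 0ℤ) δp) (sym (cong (+ 2 *_) δi))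
    ; parent = inj₂ (p , here refl , p<i , λ { (here refl) _ → inj₁ refl }) }

  leaf-2 : R 2
  leaf-2 = leaf-row 2 1 (ℕ.s≤s ℕ.z≤n) (ℕ.s≤s (ℕ.s≤s ℕ.z≤n)) (ℕ.s≤s (ℕ.s≤s ℕ.z≤n)) refl refl (inj₁ (refl , refl)) out only
    where
    out : ∀ {j} → EdgeD m 2 j → ⊥
    out (inj₂ (inj₂ (inj₂ (inj₁ (ℕ.s≤s (ℕ.s≤s ()) , _)))))
    out (inj₂ (inj₂ (inj₂ (inj₂ (inj₁ (() , _))))))
    only : ∀ {j} → EdgeD m j 2 → j ≡ 1
    only (inj₁ (e , _)) = e
    only (inj₂ (inj₂ (inj₂ (inj₁ (ℕ.s≤s () , _ , refl)))))
    only (inj₂ (inj₂ (inj₂ (inj₂ (inj₁ (_ , ()))))))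
    only (inj₂ (inj₂ (inj₂ (inj₂ (inj₂ (_ , ()))))))

  leaf-3 : R 3
  leaf-3 = leaf-row 3 1 (ℕ.s≤s ℕ.z≤n) (ℕ.s≤s (ℕ.s≤s ℕ.z≤n)) (ℕ.s≤s (ℕ.s≤s (ℕ.s≤s ℕ.z≤n))) refl refl (inj₂ (inj₁ (refl , refl))) out only
    where
    out : ∀ {j} → EdgeD m 3 j → ⊥
    out (inj₂ (inj₂ (inj₂ (inj₁ (ℕ.s≤s (ℕ.s≤s (ℕ.s≤s ())) , _)))))
    out (inj₂ (inj₂ (inj₂ (inj₂ (inj₁ (() , _))))))
    only : ∀ {j} → EdgeD m j 3 → j ≡ 1
    only (inj₂ (inj₁ (e , _))) = e
    only (inj₂ (inj₂ (inj₂ (inj₁ (ℕ.s≤s (ℕ.s≤s ()) , _ , refl)))))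
    only (inj₂ (inj₂ (inj₂ (inj₂ (inj₁ (_ , ()))))))
    only (inj₂ (inj₂ (inj₂ (inj₂ (inj₂ (_ , ()))))))

  leaf-m : R m
  leaf-m = leaf-row m (4 ℕ.+ k) (ℕ.s≤s ℕ.z≤n) ℕₚ.≤-refl (ℕₚ.n≤1+n m) (δ-spine k ℕₚ.≤-refl) δ-m (inj₂ (inj₂ (inj₂ (inj₂ (inj₁ (refl , refl)))))) out only
    where
    out : ∀ {j} → EdgeD m m j → ⊥
    out (inj₂ (inj₂ (inj₂ (inj₁ (_ , le , _))))) = ℕₚ.1+n≰n (ℕₚ.<⇒≤ le)
    out (inj₂ (inj₂ (inj₂ (inj₂ (inj₁ (e , _)))))) = ℕₚ.1+n≢n e
    out (inj₂ (inj₂ (inj₂ (inj₂ (inj₂ (e , _)))))) = ℕₚ.1+n≢n e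
    only : ∀ {j} → EdgeD m j m → j ≡ 4 ℕ.+ k
    only (inj₂ (inj₂ (inj₂ (inj₁ (_ , le , refl))))) = ⊥-elim (ℕₚ.1+n≰n le)
    only (inj₂ (inj₂ (inj₂ (inj₂ (inj₁ (e , _)))))) = e
    only (inj₂ (inj₂ (inj₂ (inj₂ (inj₂ (e , _)))))) = e

  leaf-sm : R (suc m)
  leaf-sm = leaf-row (suc m) (4 ℕ.+ k) (ℕ.s≤s ℕ.z≤n) (ℕₚ.n≤1+n m) ℕₚ.≤-refl (δ-spine k ℕₚ.≤-refl) δ-sm (inj₂ (inj₂ (inj₂ (inj₂ (inj₂ (refl , refl)))))) out only
    where
    out : ∀ {j} → EdgeD m (suc m) j → ⊥
    out (inj₂ (inj₂ (inj₂ (inj₁ (_ , le , _))))) = ℕₚ.1+n≰n (ℕₚ.<⇒≤ (ℕₚ.<⇒≤ le))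
    out (inj₂ (inj₂ (inj₂ (inj₂ (inj₁ (e , _)))))) = ℕₚ.1+n≰n (ℕₚ.≤-trans (ℕₚ.n≤1+n _) (ℕₚ.≤-reflexive e))
    out (inj₂ (inj₂ (inj₂ (inj₂ (inj₂ (e , _)))))) = ℕₚ.1+n≰n (ℕₚ.≤-trans (ℕₚ.n≤1+n _) (ℕₚ.≤-reflexive e))
    only : ∀ {j} → EdgeD m j (suc m) → j ≡ 4 ℕ.+ k
    only (inj₂ (inj₂ (inj₂ (inj₁ (_ , le , refl))))) = ⊥-elim (ℕₚ.1+n≰n (ℕₚ.<⇒≤ le))
    only (inj₂ (inj₂ (inj₂ (inj₂ (inj₁ (e , _)))))) = e
    only (inj₂ (inj₂ (inj₂ (inj₂ (inj₂ (e , _)))))) = e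

  row : ∀ i → 1 ℕ.≤ i → i ℕ.≤ suc m → R i
  row 1 _ _ = root
  row 2 _ _ = leaf-2
  row 3 _ _ = leaf-3
  row (suc (suc (suc (suc p)))) _ (ℕ.s≤s (ℕ.s≤s (ℕ.s≤s (ℕ.s≤s le)))) with ℕₚ.<-cmp p k
  ... | tri< lt _ _ = spine-mid p lt
  ... | tri≈ _ refl _ = spine-end
  ... | tri> _ _ gt with ℕₚ.m≤n⇒m<n∨m≡n gt
  ...   | inj₂ refl = leaf-m
  ...   | inj₁ gt' with ℕₚ.≤-antisym le gt'
  ...     | refl = leaf-sm

-- The cycles of type A.

module ATilde (k : ℕ) where
  n ℓ : ℕ
  n = 2 ℕ.+ k
  ℓ = suc k

  -- The two paths 1, …, n and n + 1, …, 2n that make up the cycle.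
  base : Bool → ℕ
  base false = 1
  base true  = suc n

  label : Bool → ℕ → ℕ
  label b p = p ℕ.+ base b

  2n≡ : label true ℓ ≡ 2 ℕ.* n
  2n≡ = trans (ℕₚ.+-suc ℓ n) (cong (n ℕ.+_) (sym (ℕₚ.+-identityʳ n)))

  n≡ : label false ℓ ≡ n
  n≡ = ℕₚ.+-comm ℓ 1

  1≤base : ∀ b → 1 ℕ.≤ base b
  1≤base false = ℕ.s≤s ℕ.z≤n
  1≤base true  = ℕ.s≤s ℕ.z≤n

  1≤label : ∀ b p → 1 ℕ.≤ label b p
  1≤label b p = ℕₚ.≤-trans (1≤base b) (ℕₚ.m≤n+m (base b) p)

  label≤ : ∀ b {p} → p ℕ.≤ ℓ → label b p ℕ.≤ 2 ℕ.* n
  label≤ true {p} le = subst (label true p ℕ.≤_) 2n≡ (ℕₚ.+-monoˡ-≤ (suc n) le)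
  label≤ false le = ℕₚ.≤-trans (ℕₚ.+-monoˡ-≤ 1 le) (subst (ℕ._≤ 2 ℕ.* n) (sym n≡) (ℕₚ.m≤m+n n (n ℕ.+ 0)))

  false<true : ∀ {p} p' → p ℕ.≤ ℓ → label false p ℕ.< label true p'
  false<true {p} p' le = ℕₚ.<-≤-trans (ℕ.s≤s (subst (label false p ℕ.≤_) n≡ (ℕₚ.+-monoˡ-≤ 1 le))) (ℕₚ.m≤n+m (suc n) p')

  label-inj : ∀ b b' {p p'} → p ℕ.≤ ℓ → p' ℕ.≤ ℓ → label b p ≡ label b' p' → (b ≡ b') × (p ≡ p')
  label-inj false false _ _ e = refl , ℕₚ.+-cancelʳ-≡ 1 _ _ e
  label-inj true  true  _ _ e = refl , ℕₚ.+-cancelʳ-≡ (suc n) _ _ e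
  label-inj false true {p' = p'} le _ e = ⊥-elim (ℕₚ.<-irrefl e (false<true p' le))
  label-inj true false {p} _ le e = ⊥-elim (ℕₚ.<-irrefl (sym e) (false<true p le))

  data Link (i j : ℕ) : Set where
    along  : ∀ b p → p ℕ.< ℓ → i ≡ label b p → j ≡ suc (label b p) → Link i j
    bottom : i ≡ 1 → j ≡ suc n → Link i j
    top    : i ≡ label false ℓ → j ≡ label true ℓ → Link i j

  link : ∀ {i j} → EdgeAnn n i j → Link i j
  link {suc p} (inj₁ (_ , le , e)) = along false p le (ℕₚ.+-comm 1 p) (trans e (cong suc (ℕₚ.+-comm 1 p)))
  link (inj₂ (inj₁ (p , q))) = top (trans p (sym n≡)) (trans q (sym 2n≡))
  link (inj₂ (inj₂ (inj₁ (p , q)))) = bottom p q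
  link {i} (inj₂ (inj₂ (inj₂ (lo , hi , e)))) = along true (i ℕ.∸ suc n) (ℕₚ.+-cancelʳ-< (suc n) _ _ (subst₂ ℕ._<_ eq (sym 2n≡) (ℕ.s≤s hi))) eq (trans e (cong suc eq))
    where
    eq : i ≡ label true (i ℕ.∸ suc n)
    eq = sym (ℕₚ.m∸n+n≡m lo)

  unlink : ∀ {i j} → Link i j → EdgeAnn n i j
  unlink (along false p lt refl refl) = inj₁ (1≤label false p , subst (ℕ._≤ ℓ) (ℕₚ.+-comm 1 p) lt , refl)
  unlink (along true p lt refl refl) = inj₂ (inj₂ (inj₂ (ℕₚ.m≤n+m (suc n) p , ℕₚ.≤-pred (subst (label true p ℕ.<_) 2n≡ (ℕₚ.+-monoˡ-< (suc n) lt)) , refl)))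
  unlink (bottom p q) = inj₂ (inj₂ (inj₁ (p , q)))
  unlink (top p q) = inj₂ (inj₁ (trans p n≡ , trans q 2n≡))

  -- The edge that closes the cycle, seen from its larger end `2n`; without it the two paths joined
  -- at the bottom form a spanning tree.
  X : ℕ → ℕ → Set
  X i j = (i ≡ label true ℓ) × (j ≡ label false ℓ)

  δ : ℕ → ℤ
  δ _ = mark one

  R : ℕ → Set
  R = Row (2 ℕ.* n) (Symmetric (EdgeAnn n)) X δ

  not : Bool → Bool
  not true  = false
  not false = true

  prev : Bool → ℕ → ℕ
  prev b zero    = base (not b)
  prev b (suc p) = label b p

  next-to : ∀ b p → Dec (p ℕ.< ℓ) → ℕ
  next-to b p (yes _) = label b (suc p)
  next-to b p (no _)  = label (not b) ℓ

  last : ∀ {p} → p ℕ.≤ ℓ → ¬ (p ℕ.< ℓ) → p ≡ ℓ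
  last le nlt = ℕₚ.≤-antisym le (ℕₚ.≮⇒≥ nlt)

  module At (b : Bool) (p : ℕ) (le : p ℕ.≤ ℓ) (d : Dec (p ℕ.< ℓ)) where
    nx : ℕ
    nx = next-to b p d

    prev-range : ∀ p → p ℕ.≤ ℓ → 1 ℕ.≤ prev b p × prev b p ℕ.≤ 2 ℕ.* n
    prev-range zero    _  = 1≤base (not b) , label≤ (not b) {0} ℕ.z≤n
    prev-range (suc p) le = 1≤label b p , label≤ b (ℕₚ.<⇒≤ le)

    next-range : (d : Dec (p ℕ.< ℓ)) → 1 ℕ.≤ next-to b p d × next-to b p d ℕ.≤ 2 ℕ.* n
    next-range (yes lt) = 1≤label b (suc p) , label≤ b lt
    next-range (no _)   = 1≤label (not b) ℓ , label≤ (not b) ℕₚ.≤-refl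

    prev≢next : ∀ p (le : p ℕ.≤ ℓ) (d : Dec (p ℕ.< ℓ)) → prev b p ≢ next-to b p d
    prev≢next zero _ (yes lt) e = flip b (proj₁ (label-inj (not b) b {0} {1} ℕ.z≤n lt e))
      where
      flip : ∀ b → not b ≢ b
      flip true ()
      flip false ()
    prev≢next zero _ (no h) _ = h (ℕ.s≤s ℕ.z≤n)
    prev≢next (suc p) le (yes lt) e = ℕₚ.<-irrefl (proj₂ (label-inj b b (ℕₚ.<⇒≤ le) lt e)) (ℕₚ.m≤n⇒m≤1+n ℕₚ.≤-refl)
    prev≢next (suc p) le (no _) e = flip b (proj₁ (label-inj b (not b) (ℕₚ.<⇒≤ le) ℕₚ.≤-refl e))
      where
      flip : ∀ b → b ≢ not b
      flip true ()
      flip false ()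

    sound-prev : ∀ b p → p ℕ.≤ ℓ → Symmetric (EdgeAnn n) (label b p) (prev b p)
    sound-prev false zero    _  = inj₁ (unlink (bottom refl refl))
    sound-prev true  zero    _  = inj₂ (unlink (bottom refl refl))
    sound-prev b     (suc p) le = inj₂ (unlink (along b p le refl refl))

    sound-next : ∀ b (d : Dec (p ℕ.< ℓ)) → Symmetric (EdgeAnn n) (label b p) (next-to b p d)
    sound-next b     (yes lt) = inj₁ (unlink (along b p lt refl refl))
    sound-next false (no h)   = inj₁ (unlink (top (cong (label false) (last le h)) refl))
    sound-next true  (no h)   = inj₂ (unlink (top refl (cong (label true) (last le h))))

    forth : ∀ {j} (d : Dec (p ℕ.< ℓ)) → Link (label b p) j → (j ≡ prev b p) ⊎ (j ≡ next-to b p d)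
    forth (yes lt) (along b' p' lt' e f) with label-inj b b' le (ℕₚ.<⇒≤ lt') e
    ... | refl , refl = inj₂ f
    forth (no h) (along b' p' lt' e f) with label-inj b b' le (ℕₚ.<⇒≤ lt') e
    ... | refl , refl = ⊥-elim (h lt')
    forth d (bottom e f) with label-inj b false {p} {0} le ℕ.z≤n e
    ... | refl , refl = inj₁ f
    forth d (top e f) with label-inj b false le ℕₚ.≤-refl e
    forth (yes lt) (top e f) | refl , refl = ⊥-elim (ℕₚ.<-irrefl refl lt)
    forth (no h) (top e f) | refl , refl = inj₂ f

    back : ∀ {j} (d : Dec (p ℕ.< ℓ)) → Link j (label b p) → (j ≡ prev b p) ⊎ (j ≡ next-to b p d)
    back d (along b' p' lt' e f) with label-inj b b' le lt' f
    ... | refl , refl = inj₁ e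
    back d (bottom e f) with label-inj b true {p} {0} le ℕ.z≤n f
    ... | refl , refl = inj₁ e
    back d (top e f) with label-inj b true le ℕₚ.≤-refl f
    back (yes lt) (top e f) | refl , refl = ⊥-elim (ℕₚ.<-irrefl refl lt)
    back (no h) (top e f) | refl , refl = inj₂ e

    listed : ∀ {j} → (j ≡ prev b p) ⊎ (j ≡ nx) → j ∈ (prev b p ∷ nx ∷ [])
    listed (inj₁ e) = here e
    listed (inj₂ e) = there (here e)

    Below : Bool → ℕ → ℕ → Set
    Below b p j = j ℕ.< label b p → (j ≡ prev b p) ⊎ X (label b p) j

    next-below : ∀ b (d : Dec (p ℕ.< ℓ)) → Below b p (next-to b p d)
    next-below b (yes lt) h = ⊥-elim (ℕₚ.<-asym h ℕₚ.≤-refl)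
    next-below false (no _) h = ⊥-elim (ℕₚ.<-asym h (false<true ℓ le))
    next-below true (no h) _ = inj₂ (cong (label true) (last le h) , refl)

    prev<label : ∀ b p → (b ≡ true) ⊎ (1 ℕ.≤ p) → prev b p ℕ.< label b p
    prev<label true zero _ = ℕ.s≤s (ℕ.s≤s ℕ.z≤n)
    prev<label b (suc p) _ = ℕₚ.≤-refl
    prev<label false zero (inj₁ ())
    prev<label false zero (inj₂ ())

    parent-or : ∀ b p → (label b p ≡ 1) ⊎ (b ≡ true) ⊎ (1 ℕ.≤ p)
    parent-or false zero = inj₁ refl
    parent-or true p = inj₂ (inj₁ refl)
    parent-or false (suc p) = inj₂ (inj₂ (ℕ.s≤s ℕ.z≤n))

    row : R (label b p)
    row = record
      { nb = prev b p ∷ nx ∷ [] ; unique = (prev≢next p le d All.∷ All.[]) ∷ (All.[] ∷ [])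
      ; range = λ { (here refl) → prev-range p le ; (there (here refl)) → next-range d }
      ; sound = λ { (here refl) → sound-prev b p le ; (there (here refl)) → sound-next b d }
      ; complete = [ (λ e → listed (forth d (link e))) , (λ e → listed (back d (link e))) ]′
      ; harmonic = refl
      ; parent = [ inj₁ , (λ h → inj₂ (prev b p , here refl , prev<label b p h , λ { (here refl) _ → inj₁ refl ; (there (here refl)) lt → next-below b d lt })) ]′ (parent-or b p) }

  code : ∀ i → 1 ℕ.≤ i → i ℕ.≤ 2 ℕ.* n → Σ Bool λ b → ∃ λ p → p ℕ.≤ ℓ × i ≡ label b p
  code (suc i) _ hi with i ℕₚ.≤? ℓ
  ... | yes le = false , i , le , ℕₚ.+-comm 1 i
  ... | no gt = true , i ℕ.∸ n , ℕₚ.+-cancelʳ-≤ (suc n) _ _ (subst₂ ℕ._≤_ eq (sym 2n≡) hi) , eq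
    where
    eq : suc i ≡ label true (i ℕ.∸ n)
    eq = sym (trans (ℕₚ.+-suc (i ℕ.∸ n) n) (cong suc (ℕₚ.m∸n+n≡m (ℕₚ.≰⇒> gt))))

  row : ∀ i → 1 ℕ.≤ i → i ℕ.≤ 2 ℕ.* n → R i
  row i lo hi with code i lo hi
  ... | b , p , le , refl = At.row b p le (p ℕₚ.<? ℓ)

-- Levels around the cycle from the balance of orientations.

pairs : List ℕ → List (ℕ × ℕ)
pairs (x ∷ y ∷ ys) = (x , y) ∷ pairs (y ∷ ys)
pairs _            = []

zip-pairs : ∀ x xs z → zip (x ∷ xs) (xs ++ (z ∷ [])) ≡ pairs ((x ∷ xs) ++ (z ∷ []))
zip-pairs x []       z = refl
zip-pairs x (y ∷ ys) z = cong ((x , y) ∷_) (zip-pairs y ys z)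

run-all : ∀ {P : ℕ × ℕ → Set} f n y ys → (∀ i → i ℕ.< n → P (f i , f (suc i))) → P (f n , y) → All P (pairs (y ∷ ys)) → All P (pairs (applyUpTo f (suc n) ++ (y ∷ ys)))
run-all f zero    y ys h e r = e All.∷ r
run-all f (suc n) y ys h e r = h 0 (ℕ.s≤s ℕ.z≤n) All.∷ run-all (f ∘ suc) n y ys (λ i lt → h (suc i) (ℕ.s≤s lt)) e r

run-∈ : ∀ f n y ys → (f n , y) ∈ pairs (applyUpTo f (suc n) ++ (y ∷ ys))
run-∈ f zero    y ys = here refl
run-∈ f (suc n) y ys = there (run-∈ (f ∘ suc) n y ys)

total₂ : (ℕ × ℕ → ℤ) → List (ℕ × ℕ) → ℤ
total₂ φ []      = 0ℤ
total₂ φ (p ∷ L) = φ p + total₂ φ L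

telescope : ∀ (g : ℕ → ℤ) x xs z → total₂ (λ p → g (proj₁ p) - g (proj₂ p)) (pairs ((x ∷ xs) ++ (z ∷ []))) ≡ g x - g z
telescope g x []       z = +-identityʳ _
telescope g x (y ∷ ys) z = trans (cong (λ w → (g x - g y) + w) (telescope g y ys z)) (lem (g x) (g y) (g z))
  where
  lem : ∀ a b c → (a - b) + (b - c) ≡ a - c
  lem = solve-∀

total₂-- : ∀ φ ψ L → total₂ (λ p → φ p - ψ p) L ≡ total₂ φ L - total₂ ψ L
total₂-- φ ψ []      = refl
total₂-- φ ψ (p ∷ L) = trans (cong (λ z → (φ p - ψ p) + z) (total₂-- φ ψ L)) (lem (φ p) (ψ p) (total₂ φ L) (total₂ ψ L))
  where
  lem : ∀ a b c d → (a - b) + (c - d) ≡ (a + c) - (b + d)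
  lem = solve-∀

count-signs : ∀ (φ : ℕ × ℕ → ℤ) → (∀ p → (φ p ≡ 0ℤ) ⊎ (φ p ≡ 1ℤ) ⊎ (φ p ≡ -1ℤ)) → (pos? : ∀ p → Dec (0ℤ < φ p)) (neg? : ∀ p → Dec (φ p < 0ℤ)) →
              ∀ L → total₂ φ L ≡ + length (filter pos? L) - + length (filter neg? L)
count-signs φ h pos? neg? [] = refl
count-signs φ h pos? neg? (p ∷ L) with pos? p | neg? p | h p | count-signs φ h pos? neg? L
... | yes a | yes b | _ | _ = ⊥-elim (<-asym a b)
... | yes a | no b | inj₁ z | _ = ⊥-elim (<-irrefl (sym z) a)
... | yes a | no b | inj₂ (inj₁ z) | IH = trans (cong₂ _+_ z IH) (sym (+-assoc 1ℤ (+ length (filter pos? L)) (- + length (filter neg? L))))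
... | yes a | no b | inj₂ (inj₂ z) | _ = ⊥-elim (b (subst (_< 0ℤ) (sym z) -<+))
... | no a | yes b | inj₁ z | _ = ⊥-elim (<-irrefl z b)
... | no a | yes b | inj₂ (inj₁ z) | _ = ⊥-elim (a (subst (0ℤ <_) (sym z) (+<+ (ℕ.s≤s ℕ.z≤n))))
... | no a | yes b | inj₂ (inj₂ z) | IH = trans (cong₂ _+_ z IH) (lem (+ length (filter pos? L)) (+ length (filter neg? L)))
  where
  lem : ∀ a b → -1ℤ + (a - b) ≡ a - (1ℤ + b)
  lem = solve-∀
... | no a | no b | inj₁ z | IH = trans (cong₂ _+_ z IH) (+-identityˡ _)
... | no a | no b | inj₂ (inj₁ z) | _ = ⊥-elim (a (subst (0ℤ <_) (sym z) (+<+ (ℕ.s≤s ℕ.z≤n))))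
... | no a | no b | inj₂ (inj₂ z) | _ = ⊥-elim (b (subst (_< 0ℤ) (sym z) -<+))

total-orientation : ∀ {N} (B : Matrix N) → (∀ p → let b = entry B (proj₁ p) (proj₂ p) in (b ≡ 0ℤ) ⊎ (b ≡ 1ℤ) ⊎ (b ≡ -1ℤ)) →
                    ∀ c → total₂ (λ p → entry B (proj₁ p) (proj₂ p)) (cyclicPairs c) ≡ + forwardCount B c - + backwardCount B c
total-orientation B h c = count-signs (λ p → entry B (proj₁ p) (proj₂ p)) h _ _ (cyclicPairs c)

-- Every entry other than `x` contributes zero, so the total is a positive multiple of `ψ x` unless
-- that value has already been seen to vanish.
sole : ∀ ψ x L → All (λ p → (ψ p ≡ 0ℤ) ⊎ (p ≡ x)) L → x ∈ L → total₂ ψ L ≡ 0ℤ → ψ x ≡ 0ℤ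
sole ψ x L all x∈L z = go (multiple L all) (occurs L all x∈L)
  where
  hits : ∀ L → All (λ p → (ψ p ≡ 0ℤ) ⊎ (p ≡ x)) L → ℕ
  hits [] _ = 0
  hits (p ∷ L) (inj₁ _ All.∷ a) = hits L a
  hits (p ∷ L) (inj₂ _ All.∷ a) = suc (hits L a)
  multiple : ∀ L a → total₂ ψ L ≡ + hits L a * ψ x
  multiple [] All.[] = refl
  multiple (p ∷ L) (inj₁ e All.∷ a) = trans (cong₂ _+_ e (multiple L a)) (+-identityˡ _)
  multiple (p ∷ L) (inj₂ e All.∷ a) = trans (cong₂ _+_ (cong ψ e) (multiple L a)) (sym (suc-* (+ hits L a) (ψ x)))
  occurs : ∀ L a → x ∈ L → (ψ x ≡ 0ℤ) ⊎ (∃ λ j → hits L a ≡ suc j)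
  occurs (p ∷ L) (inj₁ e All.∷ a) (here refl) = inj₁ e
  occurs (p ∷ L) (inj₁ e All.∷ a) (there q) = occurs L a q
  occurs (p ∷ L) (inj₂ e All.∷ a) _ = inj₂ (hits L a , refl)
  go : total₂ ψ L ≡ + hits L all * ψ x → (ψ x ≡ 0ℤ) ⊎ (∃ λ j → hits L all ≡ suc j) → ψ x ≡ 0ℤ
  go m (inj₁ e) = e
  go m (inj₂ (j , e)) = *≡0 {+ hits L all} (trans (sym m) z) λ h → absurd (trans (sym e) (+-injective h))
    where
    absurd : suc j ≢ 0
    absurd ()

vert-lab : ∀ {N} (t : Fin N) → vert N (lab t) ≡ just t
vert-lab {N} t with toℕ t ℕₚ.<? N
... | yes p = cong just (fromℕ<-toℕ t p)
... | no q = ⊥-elim (q (toℕ<n t))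

entry-lab : ∀ {N} (B : Matrix N) t u → entry B (lab t) (lab u) ≡ B t u
entry-lab B t u rewrite vert-lab t | vert-lab u = refl

module Cycle (k : ℕ) (B₀ : Matrix (2 ℕ.* (2 ℕ.+ k))) (skew₀ : ∀ i j → B₀ j i ≡ - B₀ i j)
             (under : ∀ i j → (Symmetric (EdgeAnn (2 ℕ.+ k)) (lab i) (lab j) → ∣ B₀ i j ∣ ≡ 1) × (¬ Symmetric (EdgeAnn (2 ℕ.+ k)) (lab i) (lab j) → B₀ i j ≡ 0ℤ))
             (forward : forwardCount B₀ (cycleAnn (2 ℕ.+ k)) ≡ 2 ℕ.+ k) (backward : backwardCount B₀ (cycleAnn (2 ℕ.+ k)) ≡ 2 ℕ.+ k) where
  open ATilde k

  open Diagram {N = 2 ℕ.* n} {Symmetric (EdgeAnn n)} {X} [ inj₂ , inj₁ ]′ {δ} {λ _ → comark one} (λ _ → mark≥1 one) (λ _ → comark≥1 one) (λ _ → comark-mark one)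
               (λ t → row (lab t) (ℕ.s≤s ℕ.z≤n) (lab≤ t)) zero refl B₀ skew₀ under

  levℓ : ℕ → ℤ
  levℓ i with vert (2 ℕ.* n) i
  ... | just t  = lev t
  ... | nothing = 0ℤ

  levℓ-lab : ∀ t → levℓ (lab t) ≡ lev t
  levℓ-lab t rewrite vert-lab t = refl

  -- `ψ` measures how far an arrow is from agreeing with the drop in level. Around the cycle level
  -- differences telescope to zero, and the arrows sum to forward minus backward count.
  φ ψ : ℕ × ℕ → ℤ
  φ p = entry B₀ (proj₁ p) (proj₂ p)
  ψ p = φ p - (levℓ (proj₁ p) - levℓ (proj₂ p))

  L : List (ℕ × ℕ)
  L = pairs (applyUpTo suc n ++ (applyUpTo (λ j → 2 ℕ.* n ℕ.∸ j) n ++ (1 ∷ [])))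

  xs : List ℕ
  xs = applyUpTo (λ j → suc (suc j)) (suc k) ++ applyUpTo (λ j → 2 ℕ.* n ℕ.∸ j) n

  cyclic≡ : cyclicPairs (cycleAnn n) ≡ pairs ((1 ∷ xs) ++ (1 ∷ []))
  cyclic≡ = trans (cong cyclicPairs (cong₂ _++_ (map-upTo suc n) (map-upTo (λ j → 2 ℕ.* n ℕ.∸ j) n))) (zip-pairs 1 xs 1)

  L≡ : pairs ((1 ∷ xs) ++ (1 ∷ [])) ≡ L
  L≡ = cong pairs (++-assoc (applyUpTo suc n) (applyUpTo (λ j → 2 ℕ.* n ℕ.∸ j) n) (1 ∷ []))

  φ-sign : ∀ p → (φ p ≡ 0ℤ) ⊎ (φ p ≡ 1ℤ) ⊎ (φ p ≡ -1ℤ)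
  φ-sign (i , j) with vert (2 ℕ.* n) i | vert (2 ℕ.* n) j
  ... | just t  | just u  = entries t u
  ... | just t  | nothing = inj₁ refl
  ... | nothing | just u  = inj₁ refl
  ... | nothing | nothing = inj₁ refl

  φ-total : total₂ φ L ≡ 0ℤ
  φ-total = trans (cong (total₂ φ) (sym (trans cyclic≡ L≡))) (trans (total-orientation B₀ φ-sign (cycleAnn n)) (trans (cong₂ (λ x y → + x - + y) forward backward) (+-inverseʳ (+ n))))

  ψ-total : total₂ ψ L ≡ 0ℤ
  ψ-total = trans (total₂-- φ (λ p → levℓ (proj₁ p) - levℓ (proj₂ p)) L) (cong₂ _-_ φ-total
    (trans (cong (total₂ (λ p → levℓ (proj₁ p) - levℓ (proj₂ p))) (sym L≡)) (trans (telescope levℓ 1 xs 1) (+-inverseʳ (levℓ 1)))))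

  ψ-level : ∀ t u → Level t u → ψ (lab t , lab u) ≡ 0ℤ
  ψ-level t u h = trans (cong₂ _-_ (entry-lab B₀ t u) (cong₂ _-_ (levℓ-lab t) (levℓ-lab u))) (trans (cong (λ z → B₀ t u - (z - lev u)) h) (lem (B₀ t u) (lev u)))
    where
    lem : ∀ b l → b - (l + b - l) ≡ 0ℤ
    lem = solve-∀

  level-ψ : ∀ t u → ψ (lab u , lab t) ≡ 0ℤ → Level t u
  level-ψ t u h = level-sym (trans (lem (B₀ u t) (lev u) (lev t)) (trans (cong (λ z → lev t + B₀ u t - z) (trans (sym (cong₂ _-_ (entry-lab B₀ u t) (cong₂ _-_ (levℓ-lab u) (levℓ-lab t)))) h)) (+-identityʳ _)))
    where
    lem : ∀ b l l' → l ≡ l' + b - (b - (l - l'))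
    lem = solve-∀

  on-edge : ∀ {i j} → (1 ℕ.≤ i × i ℕ.≤ 2 ℕ.* n) → (1 ℕ.≤ j × j ℕ.≤ 2 ℕ.* n) → j ℕ.< i → Symmetric (EdgeAnn n) i j → ¬ X i j → ψ (i , j) ≡ 0ℤ × ψ (j , i) ≡ 0ℤ
  on-edge {i} {j} ri rj lt e nx = subst₂ (λ i j → ψ (i , j) ≡ 0ℤ × ψ (j , i) ≡ 0ℤ) ti uj (ψ-level t u h , ψ-level u t (level-sym h))
    where
    t u : Fin (2 ℕ.* n)
    t = vertex (proj₁ ri) (proj₂ ri)
    u = vertex (proj₁ rj) (proj₂ rj)
    ti : lab t ≡ i
    ti = lab-vertex (proj₁ ri) (proj₂ ri)
    uj : lab u ≡ j
    uj = lab-vertex (proj₁ rj) (proj₂ rj)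
    h : Level t u
    h = [ (λ q → q) , (λ x → ⊥-elim (nx (subst₂ X ti uj x))) ]′ (tree-level (Row.complete (row (lab t) (ℕ.s≤s ℕ.z≤n) (lab≤ t)) (subst₂ (Symmetric (EdgeAnn n)) (sym ti) (sym uj) e)) (ℕₚ.≤-pred (subst₂ ℕ._<_ (sym uj) (sym ti) lt)))

  ψ-along : ∀ b p → p ℕ.< ℓ → ψ (label b (suc p) , label b p) ≡ 0ℤ × ψ (label b p , label b (suc p)) ≡ 0ℤ
  ψ-along b p lt = on-edge (1≤label b (suc p) , label≤ b lt) (1≤label b p , label≤ b (ℕₚ.<⇒≤ lt)) ℕₚ.≤-refl (inj₂ (unlink (along b p lt refl refl)))
    λ { (e , f) → absurd (proj₁ (label-inj true b ℕₚ.≤-refl lt (sym e))) (proj₁ (label-inj false b ℕₚ.≤-refl (ℕₚ.<⇒≤ lt) (sym f))) }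
    where
    absurd : ∀ {b} → true ≡ b → false ≡ b → ⊥
    absurd refl ()

  ψ-bottom : ψ (suc n , 1) ≡ 0ℤ
  ψ-bottom = proj₁ (on-edge (ℕ.s≤s ℕ.z≤n , label≤ true {0} ℕ.z≤n) (ℕ.s≤s ℕ.z≤n , label≤ false {0} ℕ.z≤n) (ℕ.s≤s (ℕ.s≤s ℕ.z≤n)) (inj₂ (unlink (bottom refl refl))) λ { (e , _) → absurd (proj₂ (label-inj true true {0} ℕ.z≤n ℕₚ.≤-refl e)) })
    where
    absurd : 0 ≢ ℓ
    absurd ()

  descending : ∀ j → j ℕ.≤ ℓ → 2 ℕ.* n ℕ.∸ j ≡ label true (ℓ ℕ.∸ j)
  descending j le = trans (cong (ℕ._∸ j) (sym 2n≡)) (ℕₚ.+-∸-comm (suc n) le)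

  last-descending : 2 ℕ.* n ℕ.∸ ℓ ≡ suc n
  last-descending = trans (descending ℓ ℕₚ.≤-refl) (cong (label true) (ℕₚ.n∸n≡0 ℓ))

  ends : ℕ × ℕ
  ends = suc (suc k) , 2 ℕ.* n

  L-all : All (λ p → (ψ p ≡ 0ℤ) ⊎ (p ≡ ends)) L
  L-all = run-all suc (suc k) (2 ℕ.* n) (applyUpTo (λ j → 2 ℕ.* n ℕ.∸ suc j) (suc k) ++ (1 ∷ []))
    (λ i lt → inj₁ (subst₂ (λ x y → ψ (x , y) ≡ 0ℤ) (ℕₚ.+-comm i 1) (cong suc (ℕₚ.+-comm i 1)) (proj₂ (ψ-along false i lt)))) (inj₂ refl)
    (run-all (λ j → 2 ℕ.* n ℕ.∸ j) (suc k) 1 [] (λ j lt → inj₁ (down j lt)) (inj₁ (subst (λ x → ψ (x , 1) ≡ 0ℤ) (sym last-descending) ψ-bottom)) All.[])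
    where
    down : ∀ j → j ℕ.< ℓ → ψ (2 ℕ.* n ℕ.∸ j , 2 ℕ.* n ℕ.∸ suc j) ≡ 0ℤ
    down j lt = subst₂ (λ x y → ψ (x , y) ≡ 0ℤ) (trans (cong (label true) step) (sym (descending j (ℕₚ.<⇒≤ lt)))) (sym (descending (suc j) lt)) (proj₁ (ψ-along true (ℓ ℕ.∸ suc j) (ℕₚ.∸-monoʳ-< {ℓ} {suc j} {0} (ℕ.s≤s ℕ.z≤n) lt)))
      where
      step : suc (ℓ ℕ.∸ suc j) ≡ ℓ ℕ.∸ j
      step = sym (ℕₚ.+-∸-assoc 1 {ℓ} {suc j} lt)

  -- All tree edges have zero discrepancy and the total discrepancy is zero, so the closing edge has
  -- none either. Here the equality of the two orientation counts is used.
  exceptional : ∀ t u → X (lab t) (lab u) → Level t u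
  exceptional t u (e , f) = level-ψ t u (subst₂ (λ x y → ψ (x , y) ≡ 0ℤ) (sym (trans f n≡)) (sym (trans e 2n≡))
    (sole ψ ends L L-all (run-∈ suc (suc k) (2 ℕ.* n) (applyUpTo (λ j → 2 ℕ.* n ℕ.∸ suc j) (suc k) ++ (1 ∷ []))) ψ-total))

  cycle-foldable : ∀ ks B → (∀ i j → mutateSeq ks B i j ≡ B₀ i j) → Foldable B
  cycle-foldable = Levelled.foldable exceptional

-- The listed label permutations are involutions.

==-refl : ∀ i → (i == i) ≡ true
==-refl zero    = refl
==-refl (suc i) = ==-refl i

==-≢ : ∀ {i j} → i ≢ j → (i == j) ≡ false
==-≢ {zero}  {zero}  n = ⊥-elim (n refl)
==-≢ {zero}  {suc j} n = refl
==-≢ {suc i} {zero}  n = refl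
==-≢ {suc i} {suc j} n = ==-≢ (n ∘ cong suc)

<ᵇ-true : ∀ {i j} → i ℕ.< j → (i ℕ.<ᵇ j) ≡ true
<ᵇ-true {zero}  {suc j} _           = refl
<ᵇ-true {suc i} {suc j} (ℕ.s≤s lt) = <ᵇ-true lt

<ᵇ-false : ∀ {i j} → j ℕ.≤ i → (i ℕ.<ᵇ j) ≡ false
<ᵇ-false {i}     {zero}  _           = refl
<ᵇ-false {suc i} {suc j} (ℕ.s≤s le) = <ᵇ-false le

Within : ℕ → ℕ → Set
Within N i = 1 ℕ.≤ i × i ℕ.≤ N

LabelInvolution : ℕ → (ℕ → ℕ) → Set
LabelInvolution N g = ∀ i → Within N i → Within N (g i) × g (g i) ≡ i

vert-vertex : ∀ {N i} (p : 1 ℕ.≤ i) (q : i ℕ.≤ N) → vert N i ≡ just (vertex p q)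
vert-vertex {N} {suc i} _ q with i ℕₚ.<? N
... | yes p = refl
... | no n  = ⊥-elim (n q)

lab-act : ∀ {N} g (t : Fin N) → Within N (g (lab t)) → lab (act g t) ≡ g (lab t)
lab-act g t (p , q) rewrite vert-vertex p q = lab-vertex p q

act-involutive : ∀ {N} g → LabelInvolution N g → (t : Fin N) → act g (act g t) ≡ t
act-involutive {N} g inv t = lab-injective (trans (lab-act g (act g t) (subst (λ z → Within N (g z)) (sym once) (proj₁ (inv (g (lab t)) within)))) (trans (cong g once) (proj₂ (inv (lab t) (ℕ.s≤s ℕ.z≤n , lab≤ t)))))
  where
  within : Within N (g (lab t))
  within = proj₁ (inv (lab t) (ℕ.s≤s ℕ.z≤n , lab≤ t))
  once : lab (act g t) ≡ g (lab t)
  once = lab-act g t within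

id-involution : ∀ N → LabelInvolution N idL
id-involution N i w = w , refl

∘-involution : ∀ {N f g} → LabelInvolution N f → LabelInvolution N g → (∀ i → Within N i → f (g i) ≡ g (f i)) → LabelInvolution N (f ∘L g)
∘-involution {f = f} {g} F G comm i w = proj₁ (F (g i) (proj₁ (G i w))) , trans (cong f (sym (comm (g i) (proj₁ (G i w))))) (trans (cong (f ∘ f) (proj₂ (G i w))) (proj₂ (F i w)))

swap-fst : ∀ a b → swap a b a ≡ b
swap-fst a b = cong (λ x → if x then b else if a == b then a else a) (==-refl a)

swap-snd : ∀ a b → swap a b b ≡ a
swap-snd a b with b ℕₚ.≟ a
... | yes refl = swap-fst a a
... | no n = trans (cong (λ x → if x then b else if b == b then a else b) (==-≢ n)) (cong (λ x → if x then a else b) (==-refl b))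

swap-other : ∀ {a b i} → i ≢ a → i ≢ b → swap a b i ≡ i
swap-other {a} {b} {i} p q = trans (cong (λ x → if x then b else if i == b then a else i) (==-≢ p)) (cong (λ x → if x then a else i) (==-≢ q))

swap-involution : ∀ {N a b} → Within N a → Within N b → LabelInvolution N (swap a b)
swap-involution {N} {a} {b} wa wb i w with i ℕₚ.≟ a | i ℕₚ.≟ b
... | yes refl | _ = subst (Within N) (sym (swap-fst a b)) wb , trans (cong (swap a b) (swap-fst a b)) (swap-snd a b)
... | no _ | yes refl = subst (Within N) (sym (swap-snd a b)) wa , trans (cong (swap a b) (swap-snd a b)) (swap-fst a b)
... | no p | no q = subst (Within N) (sym (swap-other p q)) w , trans (cong (swap a b) (swap-other p q)) (swap-other p q)

swaps-commute : ∀ {a b c d} → a ≢ c → a ≢ d → b ≢ c → b ≢ d → ∀ i → swap a b (swap c d i) ≡ swap c d (swap a b i)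
swaps-commute {a} {b} {c} {d} ac ad bc bd i with i ℕₚ.≟ c | i ℕₚ.≟ d
... | yes refl | _ = trans (cong (swap a b) (swap-fst c d)) (trans (swap-other (ad ∘ sym) (bd ∘ sym)) (sym (trans (cong (swap c d) (swap-other (ac ∘ sym) (bc ∘ sym))) (swap-fst c d))))
... | no _ | yes refl = trans (cong (swap a b) (swap-snd c d)) (trans (swap-other (ac ∘ sym) (bc ∘ sym)) (sym (trans (cong (swap c d) (swap-other (ad ∘ sym) (bd ∘ sym))) (swap-snd c d))))
... | no p | no q with i ℕₚ.≟ a | i ℕₚ.≟ b
...   | yes refl | _ = trans (cong (swap a b) (swap-other p q)) (trans (swap-fst a b) (sym (trans (cong (swap c d) (swap-fst a b)) (swap-other bc bd))))
...   | no _ | yes refl = trans (cong (swap a b) (swap-other p q)) (trans (swap-snd a b) (sym (trans (cong (swap c d) (swap-snd a b)) (swap-other ac ad))))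
...   | no r | no s = trans (cong (swap a b) (swap-other p q)) (trans (swap-other r s) (sym (trans (cong (swap c d) (swap-other r s)) (swap-other p q))))

end-swap-involution : ∀ m → 5 ℕ.≤ m → LabelInvolution (suc m) (swap m (suc m))
end-swap-involution m h = swap-involution (ℕₚ.≤-trans (ℕ.s≤s ℕ.z≤n) h , ℕₚ.n≤1+n m) (ℕ.s≤s ℕ.z≤n , ℕₚ.≤-refl)

both-swaps-involution : ∀ m → 5 ℕ.≤ m → LabelInvolution (suc m) (swap 2 3 ∘L swap m (suc m))
both-swaps-involution m h = ∘-involution (swap-involution (ℕ.s≤s ℕ.z≤n , ℕₚ.≤-trans (below 2 (ℕ.s≤s (ℕ.s≤s ℕ.z≤n))) (ℕₚ.n≤1+n m)) (ℕ.s≤s ℕ.z≤n , ℕₚ.≤-trans (below 3 (ℕ.s≤s (ℕ.s≤s (ℕ.s≤s ℕ.z≤n)))) (ℕₚ.n≤1+n m))) (end-swap-involution m h)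
    (λ i _ → swaps-commute (small 2 (ℕ.s≤s (ℕ.s≤s (ℕ.s≤s ℕ.z≤n)))) (small' 2 (ℕ.s≤s (ℕ.s≤s (ℕ.s≤s ℕ.z≤n)))) (small 3 ℕₚ.≤-refl) (small' 3 ℕₚ.≤-refl) i)
  where
  below : ∀ j → j ℕ.≤ 3 → j ℕ.≤ m
  below j le = ℕₚ.≤-trans le (ℕₚ.≤-trans (ℕ.s≤s (ℕ.s≤s (ℕ.s≤s ℕ.z≤n))) h)
  small : ∀ j → j ℕ.< 4 → j ≢ m
  small j lt = ℕₚ.<⇒≢ (ℕₚ.<-≤-trans lt (ℕₚ.≤-trans (ℕₚ.n≤1+n 4) h))
  small' : ∀ j → j ℕ.< 4 → j ≢ suc m
  small' j lt = ℕₚ.<⇒≢ (ℕₚ.<-≤-trans lt (ℕₚ.≤-trans (ℕₚ.n≤1+n 4) (ℕₚ.m≤n⇒m≤1+n h)))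

-- `sigmaG n` is `flip` at twice `n`. A free argument `M` can be written as `6 + w` by matching on
-- its bound, after which the case distinctions compute.
flip : ℕ → ℕ → ℕ
flip M i =
  if i == 1 then M ℕ.∸ 1
  else if i == M ℕ.∸ 1 then 1
  else if i == 2 then suc M
  else if i == suc M then 2
  else if i == 3 then M
  else if i == M then 3
  else M ℕ.+ 2 ℕ.∸ i

module Flip (w : ℕ) where
  T : ℕ
  T = 6 ℕ.+ w

  data Place : ℕ → Set where
    p₁ : Place 1
    p₂ : Place 2
    p₃ : Place 3
    mid : ∀ j → j ℕ.≤ w → Place (4 ℕ.+ j)
    p₅ : Place (5 ℕ.+ w)
    p₆ : Place (6 ℕ.+ w)
    p₇ : Place (7 ℕ.+ w)

  place : ∀ i → Within (suc T) i → Place i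
  place 1 _ = p₁
  place 2 _ = p₂
  place 3 _ = p₃
  place (suc (suc (suc (suc j)))) (_ , ℕ.s≤s (ℕ.s≤s (ℕ.s≤s (ℕ.s≤s le)))) with ℕₚ.m≤n⇒m<n∨m≡n le
  ... | inj₂ refl = p₇
  ... | inj₁ (ℕ.s≤s le₁) with ℕₚ.m≤n⇒m<n∨m≡n le₁
  ...   | inj₂ refl = p₆
  ...   | inj₁ (ℕ.s≤s le₂) with ℕₚ.m≤n⇒m<n∨m≡n le₂
  ...     | inj₂ refl = p₅
  ...     | inj₁ (ℕ.s≤s le₃) = mid j le₃

  n≢ : ∀ {i} d → i ≢ suc d ℕ.+ i
  n≢ d = ℕₚ.m≢1+n+m _

  chain : ∀ {a b c x y z} {u : ℕ} → a ≡ x → b ≡ y → c ≡ z → (if a then 1 else if b then 2 else if c then 3 else u) ≡ (if x then 1 else if y then 2 else if z then 3 else u)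
  chain refl refl refl = refl

  flip-mid : ∀ {j} → j ℕ.≤ w → flip T (4 ℕ.+ j) ≡ 4 ℕ.+ (w ℕ.∸ j)
  flip-mid {j} le = trans (chain {u = (2 ℕ.+ (w ℕ.+ 2)) ℕ.∸ j} (==-≢ (ℕₚ.<⇒≢ (ℕ.s≤s le))) (==-≢ (ℕₚ.<⇒≢ (ℕ.s≤s (ℕₚ.≤-trans le (ℕₚ.m≤n+m w 2))))) (==-≢ (ℕₚ.<⇒≢ (ℕ.s≤s (ℕₚ.≤-trans le (ℕₚ.n≤1+n w))))))
    (trans (cong (ℕ._∸ j) (cong (2 ℕ.+_) (ℕₚ.+-comm w 2))) (ℕₚ.+-∸-assoc 4 le))

  flip-5 : flip T (5 ℕ.+ w) ≡ 1
  flip-5 = cong (λ x → if x then 1 else if suc w == 3 ℕ.+ w then 2 else if suc w == 2 ℕ.+ w then 3 else (2 ℕ.+ (w ℕ.+ 2)) ℕ.∸ suc w) (==-refl w)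

  flip-6 : flip T (6 ℕ.+ w) ≡ 3
  flip-6 = chain {u = (2 ℕ.+ (w ℕ.+ 2)) ℕ.∸ (2 ℕ.+ w)} (==-≢ {suc w} {w} (n≢ 0 ∘ sym)) (==-≢ {w} {suc w} (n≢ 0)) (==-refl w)

  flip-7 : flip T (7 ℕ.+ w) ≡ 2
  flip-7 = chain {c = suc w == w} {z = false} {u = (2 ℕ.+ (w ℕ.+ 2)) ℕ.∸ (3 ℕ.+ w)} (==-≢ {2 ℕ.+ w} {w} (n≢ 1 ∘ sym)) (==-refl w) (==-≢ {suc w} {w} (n≢ 0 ∘ sym))

  flip-within : ∀ {i} → Place i → Within (suc T) (flip T i)
  flip-within p₁ = ℕ.s≤s ℕ.z≤n , ℕₚ.m≤n+m (5 ℕ.+ w) 2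
  flip-within p₂ = ℕ.s≤s ℕ.z≤n , ℕₚ.≤-refl
  flip-within p₃ = ℕ.s≤s ℕ.z≤n , ℕₚ.n≤1+n T
  flip-within (mid j le) = subst (Within (suc T)) (sym (flip-mid le)) (ℕ.s≤s ℕ.z≤n , ℕ.s≤s (ℕ.s≤s (ℕ.s≤s (ℕ.s≤s (ℕₚ.≤-trans (ℕₚ.m∸n≤m w j) (ℕₚ.m≤n+m w 3))))))
  flip-within p₅ = subst (Within (suc T)) (sym flip-5) (ℕ.s≤s ℕ.z≤n , ℕ.s≤s ℕ.z≤n)
  flip-within p₆ = subst (Within (suc T)) (sym flip-6) (ℕ.s≤s ℕ.z≤n , ℕ.s≤s (ℕ.s≤s (ℕ.s≤s ℕ.z≤n)))
  flip-within p₇ = subst (Within (suc T)) (sym flip-7) (ℕ.s≤s ℕ.z≤n , ℕ.s≤s (ℕ.s≤s ℕ.z≤n))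

  flip-flip : ∀ {i} → Place i → flip T (flip T i) ≡ i
  flip-flip p₁ = flip-5
  flip-flip p₂ = flip-7
  flip-flip p₃ = flip-6
  flip-flip (mid j le) = trans (cong (flip T) (flip-mid le)) (trans (flip-mid (ℕₚ.m∸n≤m w j)) (cong (4 ℕ.+_) (ℕₚ.m∸[m∸n]≡n le)))
  flip-flip p₅ = cong (flip T) flip-5
  flip-flip p₆ = cong (flip T) flip-6
  flip-flip p₇ = cong (flip T) flip-7

  flip-involution : LabelInvolution (suc T) (flip T)
  flip-involution i wi = flip-within (place i wi) , flip-flip (place i wi)

  ρ : ℕ → ℕ
  ρ = swap 2 3 ∘L swap T (suc T)

  ρ-6 : ρ T ≡ suc T
  ρ-6 = cong (swap 2 3) (swap-fst T (suc T))

  ρ-7 : ρ (suc T) ≡ T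
  ρ-7 = cong (swap 2 3) (swap-snd T (suc T))

  ρ-low : ∀ {j} → j ℕ.≤ suc w → ρ (4 ℕ.+ j) ≡ 4 ℕ.+ j
  ρ-low {j} le = cong (swap 2 3) (swap-other {T} {suc T} (ℕₚ.<⇒≢ (ℕ.s≤s (ℕ.s≤s (ℕ.s≤s (ℕ.s≤s (ℕ.s≤s le)))))) (ℕₚ.<⇒≢ (ℕ.s≤s (ℕ.s≤s (ℕ.s≤s (ℕ.s≤s (ℕ.s≤s (ℕₚ.m≤n⇒m≤1+n le))))))))

  commute : ∀ {i} → Place i → flip T (ρ i) ≡ ρ (flip T i)
  commute p₁ = sym (ρ-low ℕₚ.≤-refl)
  commute p₂ = sym ρ-7
  commute p₃ = sym ρ-6
  commute (mid j le) = trans (cong (flip T) (ρ-low (ℕₚ.m≤n⇒m≤1+n le))) (trans (flip-mid le) (sym (trans (cong ρ (flip-mid le)) (ρ-low (ℕₚ.≤-trans (ℕₚ.m∸n≤m w j) (ℕₚ.n≤1+n w))))))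
  commute p₅ = trans (cong (flip T) (ρ-low ℕₚ.≤-refl)) (trans flip-5 (sym (cong ρ flip-5)))
  commute p₆ = trans (cong (flip T) ρ-6) (trans flip-7 (sym (cong ρ flip-6)))
  commute p₇ = trans (cong (flip T) ρ-7) (trans flip-6 (sym (cong ρ flip-7)))

flip-involution : ∀ M → 6 ℕ.≤ M → LabelInvolution (suc M) (flip M)
flip-involution _ (ℕ.s≤s (ℕ.s≤s (ℕ.s≤s (ℕ.s≤s (ℕ.s≤s (ℕ.s≤s (ℕ.z≤n {w}))))))) = Flip.flip-involution w

flip-swaps-involution : ∀ M → 6 ℕ.≤ M → LabelInvolution (suc M) (flip M ∘L (swap 2 3 ∘L swap M (suc M)))
flip-swaps-involution M h@(ℕ.s≤s (ℕ.s≤s (ℕ.s≤s (ℕ.s≤s (ℕ.s≤s (ℕ.s≤s (ℕ.z≤n {w}))))))) = ∘-involution (flip-involution M h) (both-swaps-involution M (ℕₚ.≤-trans (ℕₚ.n≤1+n 5) h)) (λ i wi → Flip.commute w (Flip.place w i wi))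

module Tau (k : ℕ) where
  n : ℕ
  n = 2 ℕ.+ k

  2n≡ : 2 ℕ.* n ≡ suc n ℕ.+ suc k
  2n≡ = trans (cong (n ℕ.+_) (ℕₚ.+-identityʳ n)) (ℕₚ.+-suc n (suc k))

  data Place : ℕ → Set where
    first : Place 1
    low   : ∀ j → j ℕ.≤ k → Place (2 ℕ.+ j)
    high  : ∀ j → j ℕ.≤ k → Place (suc n ℕ.+ j)
    last  : Place (2 ℕ.* n)

  place : ∀ i → Within (2 ℕ.* n) i → Place i
  place 1 _ = first
  place (suc (suc j)) (_ , hi) with j ℕₚ.≤? k
  ... | yes le = low j le
  ... | no gt = go (ℕₚ.m≤n⇒∃[o]m+o≡n (ℕₚ.≰⇒> gt))
    where
    go : (∃ λ o → suc k ℕ.+ o ≡ j) → Place (2 ℕ.+ j)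
    go (o , refl) with ℕₚ.m≤n⇒m<n∨m≡n (ℕₚ.+-cancelˡ-≤ (suc n) _ _ (subst (suc n ℕ.+ o ℕ.≤_) 2n≡ hi))
    ... | inj₁ (ℕ.s≤s le) = high o le
    ... | inj₂ refl = subst Place 2n≡ last

  tau-low : ∀ {j} → j ℕ.≤ k → tauB n (2 ℕ.+ j) ≡ suc n ℕ.+ j
  tau-low {j} le = trans (cong (λ x → if x then n ℕ.+ (2 ℕ.+ j) ℕ.∸ 1 else if (1 ℕ.+ j) ℕ.<ᵇ (2 ℕ.* n ℕ.∸ 1) then suc (2 ℕ.+ j) ℕ.∸ n else (2 ℕ.+ j)) (<ᵇ-true {suc j} {n} (ℕ.s≤s (ℕ.s≤s le))))
    (cong (ℕ._∸ 1) (trans (ℕₚ.+-suc n (suc j)) (cong suc (ℕₚ.+-suc n j))))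

  tau-high : ∀ {j} → j ℕ.≤ k → tauB n (suc n ℕ.+ j) ≡ 2 ℕ.+ j
  tau-high {j} le = trans (cong₂ (λ x y → if x then n ℕ.+ (suc n ℕ.+ j) ℕ.∸ 1 else if y then suc (suc n ℕ.+ j) ℕ.∸ n else (suc n ℕ.+ j)) (<ᵇ-false {n ℕ.+ j} {n} (ℕₚ.m≤m+n n j)) (<ᵇ-true bound))
    (trans (cong (ℕ._∸ n) (sym (trans (ℕₚ.+-suc n (suc j)) (cong suc (ℕₚ.+-suc n j))))) (ℕₚ.m+n∸m≡n n (2 ℕ.+ j)))
    where
    bound : n ℕ.+ j ℕ.< 2 ℕ.* n ℕ.∸ 1
    bound = subst (n ℕ.+ j ℕ.<_) (cong (ℕ._∸ 1) (sym 2n≡)) (ℕₚ.+-monoʳ-< n (ℕ.s≤s le))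

  tau-last : tauB n (2 ℕ.* n) ≡ 2 ℕ.* n
  tau-last = cong₂ (λ x y → if x then n ℕ.+ 2 ℕ.* n ℕ.∸ 1 else if y then suc (2 ℕ.* n) ℕ.∸ n else 2 ℕ.* n) (<ᵇ-false {2 ℕ.* n ℕ.∸ 1} {n} above) (<ᵇ-false {2 ℕ.* n ℕ.∸ 1} ℕₚ.≤-refl)
    where
    above : n ℕ.≤ 2 ℕ.* n ℕ.∸ 1
    above = subst (n ℕ.≤_) (cong (ℕ._∸ 1) (sym 2n≡)) (ℕₚ.m≤m+n n (suc k))

  high-within : ∀ {j} → j ℕ.≤ k → Within (2 ℕ.* n) (suc n ℕ.+ j)
  high-within {j} le = ℕ.s≤s ℕ.z≤n , subst (suc n ℕ.+ j ℕ.≤_) (sym 2n≡) (ℕₚ.+-monoʳ-≤ (suc n) (ℕₚ.m≤n⇒m≤1+n le))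

  low-within : ∀ {j} → j ℕ.≤ k → Within (2 ℕ.* n) (2 ℕ.+ j)
  low-within {j} le = ℕ.s≤s ℕ.z≤n , ℕₚ.≤-trans (ℕ.s≤s (ℕ.s≤s le)) (ℕₚ.m≤m+n n (n ℕ.+ 0))

  tau-place : ∀ {i} → Place i → Within (2 ℕ.* n) (tauB n i) × tauB n (tauB n i) ≡ i
  tau-place first = (ℕ.s≤s ℕ.z≤n , ℕ.s≤s ℕ.z≤n) , refl
  tau-place (low j le) = subst (Within (2 ℕ.* n)) (sym (tau-low le)) (high-within le) , trans (cong (tauB n) (tau-low le)) (tau-high le)
  tau-place (high j le) = subst (Within (2 ℕ.* n)) (sym (tau-high le)) (low-within le) , trans (cong (tauB n) (tau-high le)) (tau-low le)
  tau-place last = subst (Within (2 ℕ.* n)) (sym tau-last) (ℕ.s≤s ℕ.z≤n , ℕₚ.≤-refl) , trans (cong (tauB n) tau-last) tau-last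

  involution : LabelInvolution (2 ℕ.* n) (tauB n)
  involution i w = tau-place (place i w)

-- Assembling the listed cases.

GoodAction : ∀ {N} → Matrix N → (ℕ → ℕ) → Set
GoodAction B g = Preserves B (act g) → Admits B (act g)

Equivalence : ∀ S → Matrix (N S) → Set
Equivalence S B = (Invariant S B → Admissible S B) × (Admissible S B → Invariant S B)

conclude : ∀ S (B : Matrix (N S)) → All (GoodAction B) (group S) → Equivalence S B
conclude S B good = (λ inv → inv , λ g∈ → All.lookup good g∈ (inv g∈)) , proj₁

tree-foldable : ∀ {N} (E : ℕ → ℕ → Set) (weight : ℕ → Weight) → ((t : Fin (suc N)) → Row (suc N) (Symmetric E) NoEdge (λ i → mark (weight i)) (lab t)) →
                (B₀ : Matrix (suc N)) → (∀ i j → B₀ j i ≡ - B₀ i j) → (∀ i j → (Symmetric E (lab i) (lab j) → ∣ B₀ i j ∣ ≡ 1) × (¬ Symmetric E (lab i) (lab j) → B₀ i j ≡ 0ℤ)) →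
                ∀ ks B → (∀ i j → mutateSeq ks B i j ≡ B₀ i j) → Foldable B
tree-foldable {N} E weight rows B₀ skew₀ under = Diagram.Levelled.foldable {suc N} {Symmetric E} {NoEdge} [ inj₂ , inj₁ ]′ {λ i → mark (weight i)} {λ i → comark (weight i)}
  (λ i → mark≥1 (weight i)) (λ i → comark≥1 (weight i)) (λ i → comark-mark (weight i)) rows zero refl B₀ skew₀ under (λ _ _ ())

module _ {N : ℕ} {B : Matrix N} (F : Foldable B) where
  open Foldable F

  involution : ∀ g → (∀ t → act {N} g (act g t) ≡ t) → GoodAction B g
  involution g gg = involution-good (act g) gg

  label-involution : ∀ g → LabelInvolution N g → GoodAction B g
  label-involution g h = involution g (act-involutive g h)

edgesD₄ edgesE₆ edgesE₇ : List (ℕ × ℕ)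
edgesD₄ = (1 , 2) ∷ (1 , 3) ∷ (1 , 4) ∷ (1 , 5) ∷ []

edgesE₆ = (1 , 2) ∷ (1 , 4) ∷ (1 , 6) ∷ (2 , 3) ∷ (4 , 5) ∷ (6 , 7) ∷ []

edgesE₇ = (1 , 2) ∷ (1 , 3) ∷ (1 , 6) ∷ (3 , 4) ∷ (4 , 5) ∷ (6 , 7) ∷ (7 , 8) ∷ []

weightsD₄ weightsE₆ weightsE₇ : List Weight
weightsD₄ = two ∷ []

weightsE₆ = three ∷ two ∷ one ∷ two ∷ one ∷ two ∷ one ∷ []

weightsE₇ = four ∷ two ∷ three ∷ two ∷ one ∷ three ∷ two ∷ one ∷ []

opaque
  rowsD₄ : (t : Fin 5) → Row 5 (Symmetric (EdgeList edgesD₄)) NoEdge (λ i → mark (nth weightsD₄ i)) (lab t)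
  rowsD₄ t = Finite.row 5 edgesD₄ weightsD₄ (from-yes (all? λ (t : Fin 5) → Finite.check? 5 edgesD₄ weightsD₄ (lab t)) t)

  rowsE₆ : (t : Fin 7) → Row 7 (Symmetric (EdgeList edgesE₆)) NoEdge (λ i → mark (nth weightsE₆ i)) (lab t)
  rowsE₆ t = Finite.row 7 edgesE₆ weightsE₆ (from-yes (all? λ (t : Fin 7) → Finite.check? 7 edgesE₆ weightsE₆ (lab t)) t)

  rowsE₇ : (t : Fin 8) → Row 8 (Symmetric (EdgeList edgesE₇)) NoEdge (λ i → mark (nth weightsE₇ i)) (lab t)
  rowsE₇ t = Finite.row 8 edgesE₇ weightsE₇ (from-yes (all? λ (t : Fin 8) → Finite.check? 8 edgesE₇ weightsE₇ (lab t)) t)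

involutive? : ∀ N g → Dec ((t : Fin N) → act g (act g t) ≡ t)
involutive? N g = all? λ t → act g (act g t) ≟ t

cubic? : ∀ N g → Dec ((t : Fin N) → act g (act g (act g t)) ≡ t)
cubic? N g = all? λ t → act g (act g (act g t)) ≟ t

one-orbit? : ∀ {N} (g : Fin N → Fin N) (a : Fin N) → Dec (∀ i → (g i ≡ i) ⊎ (i ≡ a) ⊎ (i ≡ g a) ⊎ (i ≡ g (g a)))
one-orbit? g a = all? λ i → (g i ≟ i) ⊎-dec ((i ≟ a) ⊎-dec ((i ≟ g a) ⊎-dec (i ≟ g (g a))))

two-orbits? : ∀ {N} (g : Fin N → Fin N) (f a x : Fin N) → Dec (∀ i → (i ≡ f) ⊎ ((i ≡ a) ⊎ (i ≡ g a) ⊎ (i ≡ g (g a))) ⊎ ((i ≡ x) ⊎ (i ≡ g x) ⊎ (i ≡ g (g x))))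
two-orbits? g f a x = all? λ i → (i ≟ f) ⊎-dec (((i ≟ a) ⊎-dec ((i ≟ g a) ⊎-dec (i ≟ g (g a)))) ⊎-dec ((i ≟ x) ⊎-dec ((i ≟ g x) ⊎-dec (i ≟ g (g x)))))

disjoint? : ∀ {N} (g : Fin N → Fin N) (a x : Fin N) → Dec (¬ ((a ≡ x) ⊎ (a ≡ g x) ⊎ (a ≡ g (g x))))
disjoint? g a x = ¬? ((a ≟ x) ⊎-dec ((a ≟ g x) ⊎-dec (a ≟ g (g x))))

-- Positions along the two orbits starting from labels 2 and 3, with the centre at position zero;
-- the gauge for the rotation is built from them.
positionE₆ : Fin 7 → Fin 3
positionE₆ zero = zero
positionE₆ (suc zero) = zero
positionE₆ (suc (suc zero)) = zero
positionE₆ (suc (suc (suc zero))) = suc zero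
positionE₆ (suc (suc (suc (suc zero)))) = suc zero
positionE₆ (suc (suc (suc (suc (suc zero))))) = suc (suc zero)
positionE₆ (suc (suc (suc (suc (suc (suc zero)))))) = suc (suc zero)

position? : ∀ {N} (g : Fin N → Fin N) (pos : Fin N → Fin 3) → Dec (∀ i → (g i ≡ i × pos i ≡ zero) ⊎ (pos (g i) ≡ succ₃ (pos i)))
position? g pos = all? λ i → ((g i ≟ i) ×-dec (pos i ≟ zero)) ⊎-dec (pos (g i) ≟ succ₃ (pos i))

-- The square of case (a) is the labelled cycle of case (b) for `n = 2`, with edges listed in other
-- orientations, so the cycle argument covers both.
square-edges : ∀ {i j} → EdgeAnn 2 i j → Adj settingA i j
square-edges {1} (inj₁ (_ , _ , refl)) = inj₁ (here refl)
square-edges {suc (suc i)} (inj₁ (_ , ℕ.s≤s () , _))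
square-edges (inj₂ (inj₁ (refl , refl))) = inj₁ (there (here refl))
square-edges (inj₂ (inj₂ (inj₁ (refl , refl)))) = inj₂ (there (there (there (here refl))))
square-edges {1} (inj₂ (inj₂ (inj₂ (ℕ.s≤s () , _ , _))))
square-edges {2} (inj₂ (inj₂ (inj₂ (ℕ.s≤s (ℕ.s≤s ()) , _ , _))))
square-edges {3} (inj₂ (inj₂ (inj₂ (_ , _ , refl)))) = inj₂ (there (there (here refl)))
square-edges {suc (suc (suc (suc i)))} (inj₂ (inj₂ (inj₂ (_ , ℕ.s≤s (ℕ.s≤s (ℕ.s≤s ())) , _))))

square-edges⁻ : ∀ {i j} → Edge settingA i j → Symmetric (EdgeAnn 2) i j
square-edges⁻ (here refl) = inj₁ (inj₁ (ℕ.s≤s ℕ.z≤n , ℕ.s≤s ℕ.z≤n , refl))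
square-edges⁻ (there (here refl)) = inj₁ (inj₂ (inj₁ (refl , refl)))
square-edges⁻ (there (there (here refl))) = inj₂ (inj₂ (inj₂ (inj₂ (ℕₚ.≤-refl , ℕₚ.≤-refl , refl))))
square-edges⁻ (there (there (there (here refl)))) = inj₂ (inj₂ (inj₂ (inj₁ (refl , refl))))

square-adj : ∀ i j → Symmetric (EdgeAnn 2) i j → Adj settingA i j
square-adj i j (inj₁ e) = square-edges e
square-adj i j (inj₂ e) = [ inj₂ , inj₁ ]′ (square-edges e)

square-adj⁻ : ∀ i j → Adj settingA i j → Symmetric (EdgeAnn 2) i j
square-adj⁻ i j (inj₁ e) = square-edges⁻ e
square-adj⁻ i j (inj₂ e) = [ inj₂ , inj₁ ]′ (square-edges⁻ e)

6≤2n : ∀ {n} → 3 ℕ.≤ n → 6 ℕ.≤ 2 ℕ.* n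
6≤2n h = ℕₚ.*-monoʳ-≤ 2 h

rowsD : ∀ m → 5 ℕ.≤ m → Σ (ℕ → Weight) λ weight → (t : Fin (suc m)) → Row (suc m) (Symmetric (EdgeD m)) NoEdge (λ i → mark (weight i)) (lab t)
rowsD _ (ℕ.s≤s (ℕ.s≤s (ℕ.s≤s (ℕ.s≤s (ℕ.s≤s (ℕ.z≤n {k})))))) = DTilde.weight k , λ t → DTilde.row k (lab t) (ℕ.s≤s ℕ.z≤n) (lab≤ t)

-- Here `p = q`, so the two alternatives for the direction around the cycle say the same.
same-counts : ∀ {a b n : ℕ} → ((a ≡ n) × (b ≡ n)) ⊎ ((a ≡ n) × (b ≡ n)) → (a ≡ n) × (b ≡ n)
same-counts = [ (λ h → h) , (λ h → h) ]′

foldA : ∀ B → OfType settingA B → Equivalence settingA B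
foldA B (B₀ , skew₀ , _ , under , orient , ks , path) = conclude settingA B
  (involution F idL (from-yes (involutive? 4 idL)) All.∷ involution F (swap 1 4 ∘L swap 2 3) (from-yes (involutive? 4 (swap 1 4 ∘L swap 2 3))) All.∷ All.[])
  where
  F : Foldable B
  F = Cycle.cycle-foldable 0 B₀ skew₀ (λ i j → (λ e → proj₁ (under i j) (square-adj (lab i) (lab j) e)) , (λ n → proj₂ (under i j) (λ e → n (square-adj⁻ (lab i) (lab j) e)))) (proj₁ (same-counts orient)) (proj₂ (same-counts orient)) ks B path

foldB : ∀ n → 2 ℕ.≤ n → ∀ B → OfType (settingB n) B → Equivalence (settingB n) B
foldB _ (ℕ.s≤s (ℕ.s≤s (ℕ.z≤n {k}))) B (B₀ , skew₀ , _ , under , orient , ks , path) = conclude (settingB (2 ℕ.+ k)) B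
  (label-involution F idL (id-involution (2 ℕ.* (2 ℕ.+ k))) All.∷ label-involution F (tauB (2 ℕ.+ k)) (Tau.involution k) All.∷ All.[])
  where
  F : Foldable B
  F = Cycle.cycle-foldable k B₀ skew₀ under (proj₁ (same-counts orient)) (proj₂ (same-counts orient)) ks B path

foldC : ∀ B → OfType settingC B → Equivalence settingC B
foldC B (B₀ , skew₀ , _ , under , _ , ks , path) = conclude settingC B
  (involution F idL (from-yes (involutive? 5 idL)) All.∷ involution F (swap 2 3 ∘L swap 4 5) (from-yes (involutive? 5 (swap 2 3 ∘L swap 4 5)))
    All.∷ involution F (swap 2 4 ∘L swap 3 5) (from-yes (involutive? 5 (swap 2 4 ∘L swap 3 5))) All.∷ involution F (swap 2 5 ∘L swap 3 4) (from-yes (involutive? 5 (swap 2 5 ∘L swap 3 4))) All.∷ All.[])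
  where
  F : Foldable B
  F = tree-foldable (EdgeList edgesD₄) (nth weightsD₄) rowsD₄ B₀ skew₀ under ks B path

foldD : ∀ B → OfType settingD B → Equivalence settingD B
foldD B (B₀ , skew₀ , _ , under , _ , ks , path) = conclude settingD B
  (involution F idL (from-yes (involutive? 5 idL))
    All.∷ (λ inv → Foldable.one-orbit-good F (act g) (from-yes (cubic? 5 g)) inv {zero} {v} (refl , from-yes (one-orbit? (act {5} g) v)))
    All.∷ (λ inv → Foldable.one-orbit-good F (act (g ∘L g)) (from-yes (cubic? 5 (g ∘L g))) inv {zero} {v} (refl , from-yes (one-orbit? (act {5} (g ∘L g)) v))) All.∷ All.[])
  where
  F : Foldable B
  F = tree-foldable (EdgeList edgesD₄) (nth weightsD₄) rowsD₄ B₀ skew₀ under ks B path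
  g : ℕ → ℕ
  g = cyc3 3 4 5
  v : Fin 5
  v = suc (suc zero)

foldE : ∀ n → 5 ℕ.≤ n → ∀ B → OfType (settingE n) B → Equivalence (settingE n) B
foldE n h B (B₀ , skew₀ , _ , under , _ , ks , path) = conclude (settingE n) B
  (label-involution F idL (id-involution (suc n)) All.∷ label-involution F (swap 2 3 ∘L swap n (suc n)) (both-swaps-involution n h) All.∷ All.[])
  where
  F : Foldable B
  F = tree-foldable (EdgeD n) (proj₁ (rowsD n h)) (proj₂ (rowsD n h)) B₀ skew₀ under ks B path

foldF : ∀ n → 5 ℕ.≤ n → ∀ B → OfType (settingF n) B → Equivalence (settingF n) B
foldF n h B (B₀ , skew₀ , _ , under , _ , ks , path) = conclude (settingF n) B
  (label-involution F idL (id-involution (suc n)) All.∷ label-involution F (swap n (suc n)) (end-swap-involution n h) All.∷ All.[])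
  where
  F : Foldable B
  F = tree-foldable (EdgeD n) (proj₁ (rowsD n h)) (proj₂ (rowsD n h)) B₀ skew₀ under ks B path

foldG : ∀ n → 3 ℕ.≤ n → ∀ B → OfType (settingG n) B → Equivalence (settingG n) B
foldG n h B (B₀ , skew₀ , _ , under , _ , ks , path) = conclude (settingG n) B
  (label-involution F idL (id-involution (suc (2 ℕ.* n))) All.∷ label-involution F (sigmaG n) (flip-involution (2 ℕ.* n) (6≤2n h)) All.∷ All.[])
  where
  5≤2n : 5 ℕ.≤ 2 ℕ.* n
  5≤2n = ℕₚ.≤-trans (ℕₚ.n≤1+n 5) (6≤2n h)
  F : Foldable B
  F = tree-foldable (EdgeD (2 ℕ.* n)) (proj₁ (rowsD (2 ℕ.* n) 5≤2n)) (proj₂ (rowsD (2 ℕ.* n) 5≤2n)) B₀ skew₀ under ks B path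

foldH : ∀ n → 3 ℕ.≤ n → ∀ B → OfType (settingH n) B → Equivalence (settingH n) B
foldH n h B (B₀ , skew₀ , _ , under , _ , ks , path) = conclude (settingH n) B
  (label-involution F idL (id-involution (suc (2 ℕ.* n))) All.∷ label-involution F (sigmaG n) (flip-involution (2 ℕ.* n) (6≤2n h))
    All.∷ label-involution F (rhoH n) (both-swaps-involution (2 ℕ.* n) 5≤2n) All.∷ label-involution F (sigmaG n ∘L rhoH n) (flip-swaps-involution (2 ℕ.* n) (6≤2n h)) All.∷ All.[])
  where
  5≤2n : 5 ℕ.≤ 2 ℕ.* n
  5≤2n = ℕₚ.≤-trans (ℕₚ.n≤1+n 5) (6≤2n h)
  F : Foldable B
  F = tree-foldable (EdgeD (2 ℕ.* n)) (proj₁ (rowsD (2 ℕ.* n) 5≤2n)) (proj₂ (rowsD (2 ℕ.* n) 5≤2n)) B₀ skew₀ under ks B path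

-- A table for the rotation of the three arms. Unlike `act gI` it reduces by pattern matching alone,
-- which the orbit data relies on.
rotate rotate² : Fin 7 → Fin 7
rotate zero = # 0
rotate (suc zero) = # 3
rotate (suc (suc zero)) = # 4
rotate (suc (suc (suc zero))) = # 5
rotate (suc (suc (suc (suc zero)))) = # 6
rotate (suc (suc (suc (suc (suc zero))))) = # 1
rotate (suc (suc (suc (suc (suc (suc zero)))))) = # 2

rotate² i = rotate (rotate i)

opaque
  act-gI : ∀ i → act {7} gI i ≡ rotate i
  act-gI = from-yes (all? λ i → act {7} gI i ≟ rotate i)

  act-gI² : ∀ i → act {7} (gI ∘L gI) i ≡ rotate² i
  act-gI² = from-yes (all? λ i → act {7} (gI ∘L gI) i ≟ rotate² i)

  rotate-cubic : ∀ i → rotate (rotate (rotate i)) ≡ i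
  rotate-cubic = from-yes (all? λ i → rotate (rotate (rotate i)) ≟ i)

  rotate²-cubic : ∀ i → rotate² (rotate² (rotate² i)) ≡ i
  rotate²-cubic = from-yes (all? λ i → rotate² (rotate² (rotate² i)) ≟ i)

  rotate-position : ∀ i → (rotate i ≡ i × positionE₆ i ≡ zero) ⊎ (positionE₆ (rotate i) ≡ succ₃ (positionE₆ i))
  rotate-position = from-yes (position? rotate positionE₆)

  rotate²-position : ∀ i → (rotate² i ≡ i × reverse (positionE₆ i) ≡ zero) ⊎ (reverse (positionE₆ (rotate² i)) ≡ succ₃ (reverse (positionE₆ i)))
  rotate²-position = from-yes (position? rotate² (reverse ∘ positionE₆))

foldI : ∀ B → OfType settingI B → Equivalence settingI B
foldI B (B₀ , skew₀ , _ , under , _ , ks , path) = conclude settingI B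
  (involution F idL (from-yes (involutive? 7 idL))
    All.∷ good-≗ act-gI (λ inv → Foldable.two-orbit-good F rotate rotate-cubic inv positionE₆ rotate-position orbits)
    All.∷ good-≗ act-gI² (λ inv → Foldable.two-orbit-good F rotate² rotate²-cubic inv (reverse ∘ positionE₆) rotate²-position orbits²) All.∷ All.[])
  where
  F : Foldable B
  F = tree-foldable (EdgeList edgesE₆) (nth weightsE₆) rowsE₆ B₀ skew₀ under ks B path
  enum₁ : ∀ f a x a' x' a″ x″ → f + (a + (x + (a' + (x' + (a″ + (x″ + 0ℤ)))))) ≡ f + ((a + (a' + a″)) + (x + (x' + x″)))
  enum₁ = solve-∀
  enum₂ : ∀ f a x a' x' a″ x″ → f + (a + (x + (a' + (x' + (a″ + (x″ + 0ℤ)))))) ≡ f + ((a + (a″ + a')) + (x + (x″ + x')))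
  enum₂ = solve-∀
  orbits : Orbit.TwoOrbits rotate (# 0) (# 1) (# 2)
  orbits = record
    { fixed = refl ; enum = λ h → enum₁ (h (# 0)) (h (# 1)) (h (# 2)) (h (# 3)) (h (# 4)) (h (# 5)) (h (# 6)) ; a≢ga = λ () ; x≢gx = λ ()
    ; a∉x = from-yes (disjoint? rotate (# 1) (# 2)) ; cover = from-yes (two-orbits? rotate (# 0) (# 1) (# 2)) }
  orbits² : Orbit.TwoOrbits rotate² (# 0) (# 1) (# 2)
  orbits² = record
    { fixed = refl ; enum = λ h → enum₂ (h (# 0)) (h (# 1)) (h (# 2)) (h (# 3)) (h (# 4)) (h (# 5)) (h (# 6)) ; a≢ga = λ () ; x≢gx = λ ()
    ; a∉x = from-yes (disjoint? rotate² (# 1) (# 2)) ; cover = from-yes (two-orbits? rotate² (# 0) (# 1) (# 2)) }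

foldJ : ∀ B → OfType settingJ B → Equivalence settingJ B
foldJ B (B₀ , skew₀ , _ , under , _ , ks , path) = conclude settingJ B
  (involution F idL (from-yes (involutive? 7 idL)) All.∷ involution F (swap 4 6 ∘L swap 5 7) (from-yes (involutive? 7 (swap 4 6 ∘L swap 5 7))) All.∷ All.[])
  where
  F : Foldable B
  F = tree-foldable (EdgeList edgesE₆) (nth weightsE₆) rowsE₆ B₀ skew₀ under ks B path

foldK : ∀ B → OfType settingK B → Equivalence settingK B
foldK B (B₀ , skew₀ , _ , under , _ , ks , path) = conclude settingK B
  (involution F idL (from-yes (involutive? 8 idL)) All.∷ involution F (swap 3 6 ∘L (swap 4 7 ∘L swap 5 8)) (from-yes (involutive? 8 (swap 3 6 ∘L (swap 4 7 ∘L swap 5 8)))) All.∷ All.[])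
  where
  F : Foldable B
  F = tree-foldable (EdgeList edgesE₇) (nth weightsE₇) rowsE₇ B₀ skew₀ under ks B path

theorem3p7 : ∀ {S} → Listed S → (B : Matrix (N S)) → Skew B → OfType S B →
  (Invariant S B → Admissible S B) × (Admissible S B → Invariant S B)
theorem3p7 case-a B _ = foldA B
theorem3p7 (case-b n h) B _ = foldB n h B
theorem3p7 case-c B _ = foldC B
theorem3p7 case-d B _ = foldD B
theorem3p7 (case-e n h) B _ = foldE n h B
theorem3p7 (case-f n h) B _ = foldF n h B
theorem3p7 (case-g n h) B _ = foldG n h B
theorem3p7 (case-h n h) B _ = foldH n h B
theorem3p7 case-i B _ = foldI B
theorem3p7 case-j B _ = foldJ B
theorem3p7 case-k B _ = foldK B
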